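{- There are absolute constants $C_3 > 0$ and $C > 0$ such that the following holds. Let $m,n$ be positive integers, let $K$ be a real number, and let $f : \mathbf{F}_2^m \to \mathbf{F}_2^n$ be a function such that the set $\{ f(x)+f(y)-f(x+y) : x,y \in \mathbf{F}_2^m\}$ has cardinality at most $K$. Then $f$ may be written as $f = g+h$, where $g : \mathbf{F}_2^m \to \mathbf{F}_2^n$ is linear and the range of $h : \mathbf{F}_2^m \to \mathbf{F}_2^n$ is a set of cardinality at most $C K^{C_3}$.
   Context: $\mathbf{F}_2$ is the field with two elements. The constants $C, C_3$ do not depend on $m,n,K,f$. -}

module Defs where

open import Algebra.Bundles using (CommutativeRing)
open import Algebra.Module.Bundles.Raw using (RawLeftModule)
open import Algebra.Module.Morphism.Structures using (IsLeftModuleHomomorphism)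
import Algebra.Properties.Semiring.Exp as Exp
open import Data.Integer.Base as ℤ using (ℤ; +_)
import Data.Integer.Properties as ℤ
open import Data.List.Base using (List; length)
open import Data.List.Membership.Propositional using (_∈_)
open import Data.List.Relation.Unary.Unique.Propositional using (Unique)
open import Data.Nat.Base as ℕ using (ℕ; zero; suc)
import Data.Nat.Properties as ℕ
open import Data.Parity.Properties using (+-*-commutativeRing)
open import Data.Product.Base using (∃; ∃₂; ∃-syntax; _×_; _,_; proj₁; proj₂)
open import Data.Rational.Base as ℚ using (ℚ; mkℚ; 0ℚ; 1ℚ; _<_; _≤_; *≤*; *<*; nonNegative)
open import Data.Rational.Properties as ℚ
  hiding (+-*-commutativeRing; _≟_)
open import Data.Rational.Unnormalised.Base using (mkℚᵘ)
import Data.Rational.Unnormalised.Base as ℚᵘ using (*≤*)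
import Data.Rational.Unnormalised.Properties as ℚᵘ
open import Data.Sum.Base using (_⊎_; inj₁; inj₂)
open import Data.Vec.Base using (Vec; map; zipWith; replicate)
open import Function.Bundles using (_⇔_)
open import Level using (0ℓ)
open import Relation.Binary.PropositionalEquality using (_≡_; refl; sym; subst; subst₂)
open import Relation.Nullary using (¬_; yes; no; contradiction)

open Exp (CommutativeRing.semiring ℚ.+-*-commutativeRing) using (_^_; ^-assocʳ)

------------------------------------------------------------------------
-- Real numbers

-- A real number is a Dedekind cut, given by its lower set: a nonempty,
-- bounded above, downward closed set of rationals without a greatest element.
record ℝ : Set₁ where
  field
    lower     : ℚ → Set
    inhabited : ∃[ q ] lower q
    bounded   : ∃[ b ] (∀ q → lower q → q ≤ b)
    downward  : ∀ {p q} → p < q → lower q → lower p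
    rounded   : ∀ {q} → lower q → ∃[ r ] q < r × lower r

open ℝ

infix 4 _<ᴿ_ _≤ᴿ_

_<ᴿ_ : ℚ → ℝ → Set
q <ᴿ x = lower x q

_≤ᴿ_ : ℝ → ℝ → Set
x ≤ᴿ y = ∀ q → q <ᴿ x → q <ᴿ y

Positive : ℝ → Set
Positive x = 0ℚ <ᴿ x

private
  below : ∀ q → ∃[ p ] p < q
  below q = q ℚ.- 1ℚ , subst (q ℚ.- 1ℚ <_) (+-identityʳ q) (+-monoʳ-< q (*<* ℤ.-<+))

fromℚ : ℚ → ℝ
fromℚ q = record
  { lower     = _< q
  ; inhabited = below q
  ; bounded   = q , λ _ → <⇒≤
  ; downward  = <-trans
  ; rounded   = λ p<q → let r , p<r , r<q = <-dense p<q in r , p<r , r<q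
  }

fromℕ : ℕ → ℝ
fromℕ n = fromℚ (+ n ℚ./ 1)

private
  ≤*≤ : ∀ {p q r s} → 0ℚ ≤ p → 0ℚ ≤ s → p ≤ q → r ≤ s → p ℚ.* r ≤ q ℚ.* s
  ≤*≤ {p} {q} {r} {s} 0≤p 0≤s p≤q r≤s = ≤-trans
    (*-monoˡ-≤-nonNeg p {{nonNegative 0≤p}} r≤s)
    (*-monoʳ-≤-nonNeg s {{nonNegative 0≤s}} p≤q)

  0≤1 : 0ℚ ≤ 1ℚ
  0≤1 = *≤* (ℤ.+≤+ ℕ.z≤n)

  0≤^ : ∀ {p} n → 0ℚ ≤ p → 0ℚ ≤ p ^ n
  0≤^ zero    0≤p = 0≤1
  0≤^ (suc n) 0≤p = ≤*≤ ≤-refl (0≤^ n 0≤p) 0≤p (0≤^ n 0≤p)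

  ^-mono-≤ : ∀ {p q} n → 0ℚ ≤ p → p ≤ q → p ^ n ≤ q ^ n
  ^-mono-≤ zero    0≤p p≤q = ≤-refl
  ^-mono-≤ (suc n) 0≤p p≤q =
    ≤*≤ 0≤p (0≤^ n (≤-trans 0≤p p≤q)) p≤q (^-mono-≤ n 0≤p p≤q)

  ^-mono-< : ∀ {p q} n → 0ℚ ≤ p → p < q → p ^ suc n < q ^ suc n
  ^-mono-< {p} {q} zero 0≤p p<q =
    subst₂ _<_ (sym (*-identityʳ p)) (sym (*-identityʳ q)) p<q
  ^-mono-< {p} {q} (suc n) 0≤p p<q = ≤-<-trans
    (*-monoˡ-≤-nonNeg p {{nonNegative 0≤p}} (<⇒≤ ih))
    (*-monoˡ-<-pos (q ^ suc n) {{ℚ.positive (≤-<-trans (0≤^ (suc n) 0≤p) ih)}} p<q)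
    where ih = ^-mono-< n 0≤p p<q

  1≤^ : ∀ {p} n → 1ℚ ≤ p → 1ℚ ≤ p ^ n
  1≤^ zero    1≤p = ≤-refl
  1≤^ (suc n) 1≤p = ≤*≤ 0≤1 (≤-trans 0≤1 (1≤^ n 1≤p)) 1≤p (1≤^ n 1≤p)

  ^-monoʳ-≤ : ∀ {p} → 1ℚ ≤ p → ∀ {m n} → m ℕ.≤ n → p ^ m ≤ p ^ n
  ^-monoʳ-≤ 1≤p {n = n} ℕ.z≤n = 1≤^ n 1≤p
  ^-monoʳ-≤ {p} 1≤p (ℕ.s≤s m≤n) =
    *-monoˡ-≤-nonNeg p {{nonNegative (≤-trans 0≤1 1≤p)}} (^-monoʳ-≤ 1≤p m≤n)

  ≤-natural : ∀ q → ∃[ n ] q ≤ + n ℚ./ 1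
  ≤-natural q@(mkℚ i d _) = ℤ.∣ i ∣ , toℚᵘ-cancel-≤ (ℚᵘ.≤-respʳ-≃
    (ℚᵘ.≃-sym (toℚᵘ-fromℚᵘ (mkℚᵘ (+ ℤ.∣ i ∣) 0))) (ℚᵘ.*≤* (lemma i)))
    where
    lemma : ∀ i → i ℤ.* + 1 ℤ.≤ + ℤ.∣ i ∣ ℤ.* + suc d
    lemma (+ n) = subst₂ ℤ._≤_ (ℤ.pos-* n 1) (ℤ.pos-* n (suc d))
      (ℤ.+≤+ (ℕ.*-monoʳ-≤ n (ℕ.s≤s ℕ.z≤n)))
    lemma ℤ.-[1+ n ] = subst (ℤ.-[1+ n ] ℤ.* + 1 ℤ.≤_) (ℤ.pos-* (suc n) (suc d)) ℤ.-≤+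

  clear-denominator : ∀ a b n → + a ℚ./ suc b ≤ + n ℚ./ 1 → a ℕ.≤ n ℕ.* suc b
  clear-denominator a b n a/b≤n = subst (ℕ._≤ n ℕ.* suc b) (ℕ.*-identityʳ a)
    (ℤ.drop‿+≤+ (subst₂ ℤ._≤_ (sym (ℤ.pos-* a 1)) (sym (ℤ.pos-* n (suc b)))
      (ℚᵘ.drop-*≤* (ℚᵘ.≤-respˡ-≃ (toℚᵘ-fromℚᵘ (mkℚᵘ (+ a) b))
        (ℚᵘ.≤-respʳ-≃ (toℚᵘ-fromℚᵘ (mkℚᵘ (+ n) 0)) (toℚᵘ-mono-≤ a/b≤n))))))

-- The product of nonnegative reals x and y (for a negative factor the value is
-- a meaningless 0).
infixl 7 _*ᴿ_

_*ᴿ_ : ℝ → ℝ → ℝ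
x *ᴿ y = record
  { lower     = λ q → q < 0ℚ ⊎ Below q
  ; inhabited = let q , q<0 = below 0ℚ in q , inj₁ q<0
  ; bounded   = X ℚ.* Y ℚ.⊔ 0ℚ , λ where
      q (inj₁ q<0) → ≤-trans (<⇒≤ q<0) (p≤q⊔p (X ℚ.* Y) 0ℚ)
      q (inj₂ (a , b , a<x , b<y , 0<a , 0<b , q<ab)) → ≤-trans
        (≤-trans (<⇒≤ q<ab)
          (≤*≤ (<⇒≤ 0<a) (≤-trans (<⇒≤ 0<b) (≤Y b b<y)) (≤X a a<x) (≤Y b b<y)))
        (p≤p⊔q (X ℚ.* Y) 0ℚ)
  ; downward  = λ where
      p<q (inj₁ q<0) → inj₁ (<-trans p<q q<0)
      p<q (inj₂ (a , b , a<x , b<y , 0<a , 0<b , q<ab)) →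
        inj₂ (a , b , a<x , b<y , 0<a , 0<b , <-trans p<q q<ab)
  ; rounded   = λ where
      (inj₁ q<0) → let r , q<r , r<0 = <-dense q<0 in r , q<r , inj₁ r<0
      (inj₂ (a , b , a<x , b<y , 0<a , 0<b , q<ab)) →
        let r , q<r , r<ab = <-dense q<ab in
        r , q<r , inj₂ (a , b , a<x , b<y , 0<a , 0<b , r<ab)
  }
  where
  Below : ℚ → Set
  Below q = ∃₂ λ a b → a <ᴿ x × b <ᴿ y × 0ℚ < a × 0ℚ < b × q < a ℚ.* b
  X  = proj₁ (bounded x)
  ≤X = proj₂ (bounded x)
  Y  = proj₁ (bounded y)
  ≤Y = proj₂ (bounded y)

-- The real power x ^ᴿ c for x ≥ 0 and c > 0 (otherwise the value is a
-- meaningless 0). It is the supremum of min (kʳ , kˢ) over rationals k, r, s with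
-- 0 < k < x and 0 ≤ r < c ≤ s, where r and s are written with a common
-- denominator d, r = a / d and s = a′ / d, and t ≤ k^(a/d) is expressed by
-- t ^ d ≤ k ^ a. Both exponents are needed because k ^_ is increasing for k ≥ 1
-- and decreasing for k ≤ 1.
infixr 8 _^ᴿ_

_^ᴿ_ : ℝ → ℝ → ℝ
x ^ᴿ c = record
  { lower     = λ q → q < 0ℚ ⊎ (∃[ t ] q < t × Below t)
  ; inhabited = let q , q<0 = below 0ℚ in q , inj₁ q<0
  ; bounded   = B ^ M , λ where
      q (inj₁ q<0)                → ≤-trans (<⇒≤ q<0) (0≤^ M 0≤B)
      q (inj₂ (t , q<t , below)) → ≤-trans (<⇒≤ q<t) (Below-bounded t below)
  ; downward  = λ where
      p<q (inj₁ q<0)               → inj₁ (<-trans p<q q<0)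
      p<q (inj₂ (t , q<t , below)) → inj₂ (t , <-trans p<q q<t , below)
  ; rounded   = λ where
      (inj₁ q<0)               → let r , q<r , r<0 = <-dense q<0 in r , q<r , inj₁ r<0
      (inj₂ (t , q<t , below)) →
        let r , q<r , r<t = <-dense q<t in r , q<r , inj₂ (t , r<t , below)
  }
  where
  Below : ℚ → Set
  Below t = ∃[ k ] 0ℚ < k × k <ᴿ x × 0ℚ ≤ t ×
            ∃[ d-1 ] ∃[ a ] ∃[ a′ ] let d = suc d-1 in
              (+ a ℚ./ d <ᴿ c) × ¬ (+ a′ ℚ./ d <ᴿ c) ×
              t ^ d ≤ k ^ a × t ^ d ≤ k ^ a′

  X  = proj₁ (bounded x)
  ≤X = proj₂ (bounded x)
  ≤Y = proj₂ (bounded c)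
  M  = proj₁ (≤-natural (proj₁ (bounded c)))
  ≤M = proj₂ (≤-natural (proj₁ (bounded c)))
  B  = X ℚ.⊔ 1ℚ

  1≤B : 1ℚ ≤ B
  1≤B = p≤q⊔p X 1ℚ

  0≤B : 0ℚ ≤ B
  0≤B = ≤-trans 0≤1 1≤B

  Below-bounded : ∀ t → Below t → t ≤ B ^ M
  Below-bounded t (k , 0<k , k<x , 0≤t , d-1 , a , a′ , a/d<c , _ , t^d≤k^a , _)
    with t ≤? B ^ M
  ... | yes t≤B^M = t≤B^M
  ... | no  t≰B^M = contradiction
    (<-≤-trans (^-mono-< d-1 (0≤^ M 0≤B) (≰⇒> t≰B^M)) t^d≤[B^M]^d) (<-irrefl refl)
    where
    t^d≤[B^M]^d : t ^ suc d-1 ≤ (B ^ M) ^ suc d-1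
    t^d≤[B^M]^d = begin
      t ^ suc d-1          ≤⟨ t^d≤k^a ⟩
      k ^ a                ≤⟨ ^-mono-≤ a (<⇒≤ 0<k) (≤-trans (≤X k k<x) (p≤p⊔q X 1ℚ)) ⟩
      B ^ a                ≤⟨ ^-monoʳ-≤ 1≤B (clear-denominator a d-1 M (≤-trans (≤Y _ a/d<c) ≤M)) ⟩
      B ^ (M ℕ.* suc d-1)  ≡⟨ ^-assocʳ B M (suc d-1) ⟨
      (B ^ M) ^ suc d-1    ∎
      where open ≤-Reasoning

------------------------------------------------------------------------
-- Cardinality of finite sets

HasCardinality : {A : Set} → (A → Set) → ℕ → Set
HasCardinality P n = ∃[ xs ] Unique xs × (∀ z → z ∈ xs ⇔ P z) × length xs ≡ n

infix 4 Card_≤ᴿ_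

Card_≤ᴿ_ : {A : Set} → (A → Set) → ℝ → Set
Card P ≤ᴿ x = ∃[ n ] HasCardinality P n × fromℕ n ≤ᴿ x

------------------------------------------------------------------------
-- Vector spaces over the field with two elements

module F₂ = CommutativeRing +-*-commutativeRing

F₂^ : ℕ → Set
F₂^ n = Vec F₂.Carrier n

infixl 6 _+ᵛ_ _-ᵛ_

_+ᵛ_ _-ᵛ_ : ∀ {n} → F₂^ n → F₂^ n → F₂^ n
_+ᵛ_ = zipWith F₂._+_
_-ᵛ_ = zipWith F₂._-_

F₂^-rawLeftModule : ℕ → RawLeftModule F₂.Carrier 0ℓ 0ℓ
F₂^-rawLeftModule n = record
  { Carrierᴹ = F₂^ n
  ; _≈ᴹ_     = _≡_
  ; _+ᴹ_     = _+ᵛ_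
  ; _*ₗ_     = λ a → map (a F₂.*_)
  ; 0ᴹ       = replicate n F₂.0#
  ; -ᴹ_      = map (F₂.-_)
  }

IsLinear : ∀ {m n} → (F₂^ m → F₂^ n) → Set
IsLinear {m} {n} = IsLeftModuleHomomorphism (F₂^-rawLeftModule m) (F₂^-rawLeftModule n)

module Submission where

-- The proof is a quantitative form of the entropy method of Gowers, Green, Manners
-- and Tao. Let A be the graph of f; the sum of two independent uniform points of A
-- has entropy at most log |A| + log K. For independent X₁ and X₂ with Ruzsa distance
-- k, one of five pairs of sums and conditionings of copies of X₁ and X₂ has distance
-- at most 47 k / 48 and lies at distance O(k) from (X₁ , X₂): the first four would
-- otherwise make X₁ + X₂, X₁′ + X₂ and X₁ + X₁′, which sum to 0, nearly independent
-- in pairs given X₁ + X₂ + X₁′ + X₂′, and then conditioning on the third decreases the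
-- distance of the first two. Iterating, one reaches an X at distance O(log K) from A
-- whose sum with an independent copy has almost no additional entropy, compared even
-- to the size of the group. Such an X is nearly uniform on a coset of a subgroup H,
-- so a translate of H of size K^O(1) |A| contains a proportion K^-O(1) of A. A linear
-- g whose graph follows H then has the desired property, by double counting.
--
-- Logarithms of rationals are only ever added, compared and multiplied by rationals,
-- so they are taken in the ordered vector space of formal roots, not in the reals.

-- The classical argument takes a pair minimising the distance by compactness and gets exact
-- structure from it. Formal roots admit no limits, so the iteration stops at a positive defect log
-- (1 / (1 - θ)), and the last step has to tolerate that defect. It does so only for θ small in
-- terms of the size of the group. This costs nothing in the final bound: the displacement of the
-- limiting variable from the starting one is bounded independently of the number of rounds. To that
-- end each round pays for its own displacement: 48 times the new distance plus the two
-- displacements is at most 47 times the old distance. The number 48 is large enough for the failure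
-- inequalities of the five candidates to force the distance to vanish. Choosing between success and
-- failure of a candidate takes a total order. Formal roots inherit one from the rationals, whereas
-- the order of Dedekind cuts is not total constructively. Nearly all steps between entropies are
-- linear inequalities, so they are discharged by explicit multipliers, checked by computation.

open import Data.List.Base using (List)

-- Certified linear inequalities over totally ordered abelian groups.

module LinearInequalities where

  open import Algebra.Bundles using (AbelianGroup)
  open import Data.Bool.Base using (Bool; true)
  open import Data.Fin.Base using (Fin; zero; suc)
  open import Data.List.Base using (List; []; _∷_)
  open import Data.List.Relation.Unary.All using (All; []; _∷_)
  open import Data.Nat.Base as ℕ using (ℕ; zero; suc)
  import Data.Nat.Properties as ℕ
  open import Data.Product.Base using (_,_; proj₂) renaming (_×_ to _∧_)
  open import Data.Sum.Base using (_⊎_; inj₁; inj₂)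
  open import Data.Vec.Base using (Vec; []; _∷_; lookup; zipWith; replicate; map)
  open import Data.Vec.Properties using (≡-dec)
  open import Level using (0ℓ)
  open import Relation.Binary.PropositionalEquality as ≡ using (_≡_; refl)
  open import Relation.Nullary using (yes; no; does)

  record OrderedGroup : Set₁ where
    field
      abelianGroup : AbelianGroup 0ℓ 0ℓ
    open AbelianGroup abelianGroup public
      using (Carrier; _≈_)
      renaming (_∙_ to infixl 6 _+_; ε to 0#; _⁻¹ to -_)
    infix 4 _≤_
    field
      _≤_        : Carrier → Carrier → Set
      ≤-reflexive : ∀ {x y} → x ≈ y → x ≤ y
      ≤-antisym  : ∀ {x y} → x ≤ y → y ≤ x → x ≈ y
      ≤-trans    : ∀ {x y z} → x ≤ y → y ≤ z → x ≤ z
      +-monoˡ-≤  : ∀ z {x y} → x ≤ y → x + z ≤ y + z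
      ≤-total    : ∀ x y → x ≤ y ⊎ y ≤ x
    infixl 6 _-_
    _-_ : Carrier → Carrier → Carrier
    x - y = x + - y

  infixl 6 _:+_ _:-_
  infixr 7 _:*_
  infix  5 _:≤_

  data Expr (n : ℕ) : Set where
    var       : Fin n → Expr n
    :0        : Expr n
    _:+_ _:-_ : Expr n → Expr n → Expr n
    :-_       : Expr n → Expr n
    _:*_      : ℕ → Expr n → Expr n

  record Inequality (n : ℕ) : Set where
    constructor _:≤_
    field
      lhs rhs : Expr n

  pattern v₀ = var zero
  pattern v₁ = var (suc zero)
  pattern v₂ = var (suc (suc zero))
  pattern v₃ = var (suc (suc (suc zero)))
  pattern v₄ = var (suc (suc (suc (suc zero))))
  pattern v₅ = var (suc (suc (suc (suc (suc zero)))))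
  pattern v₆ = var (suc (suc (suc (suc (suc (suc zero))))))
  pattern v₇ = var (suc (suc (suc (suc (suc (suc (suc zero)))))))
  pattern v₈ = var (suc (suc (suc (suc (suc (suc (suc (suc zero))))))))
  pattern v₉ = var (suc (suc (suc (suc (suc (suc (suc (suc (suc zero)))))))))
  pattern v₁₀ = var (suc (suc (suc (suc (suc (suc (suc (suc (suc (suc zero))))))))))
  pattern v₁₁ = var (suc (suc (suc (suc (suc (suc (suc (suc (suc (suc (suc zero)))))))))))
  pattern v₁₂ = var (suc (suc (suc (suc (suc (suc (suc (suc (suc (suc (suc (suc zero))))))))))))
  pattern v₁₃ = var (suc (suc (suc (suc (suc (suc (suc (suc (suc (suc (suc (suc (suc zero)))))))))))))
  pattern v₁₄ = var (suc (suc (suc (suc (suc (suc (suc (suc (suc (suc (suc (suc (suc (suc zero))))))))))))))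
  pattern v₁₅ = var (suc (suc (suc (suc (suc (suc (suc (suc (suc (suc (suc (suc (suc (suc (suc zero)))))))))))))))

  single : ∀ {n} → Fin n → Vec ℕ n
  single zero    = 1 ∷ replicate _ 0
  single (suc i) = 0 ∷ single i

  -- The coefficients of an expression, as a difference of two vectors.
  pos neg : ∀ {n} → Expr n → Vec ℕ n
  pos (var i)  = single i
  pos :0       = replicate _ 0
  pos (e :+ f) = zipWith ℕ._+_ (pos e) (pos f)
  pos (e :- f) = zipWith ℕ._+_ (pos e) (neg f)
  pos (:- e)   = neg e
  pos (k :* e) = map (k ℕ.*_) (pos e)
  neg (var i)  = replicate _ 0
  neg :0       = replicate _ 0
  neg (e :+ f) = zipWith ℕ._+_ (neg e) (neg f)
  neg (e :- f) = zipWith ℕ._+_ (neg e) (pos f)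
  neg (:- e)   = pos e
  neg (k :* e) = map (k ℕ.*_) (neg e)

  combine : ∀ {n} → (Inequality n → Expr n) → List (ℕ ∧ Inequality n) → Expr n
  combine side []             = :0
  combine side ((c , h) ∷ hs) = c :* side h :+ combine side hs

  equal : ∀ {n} → Expr n → Expr n → Bool
  equal e f = does (≡-dec ℕ._≟_ (zipWith ℕ._+_ (pos e) (neg f)) (zipWith ℕ._+_ (pos f) (neg e)))

  -- The hypotheses, multiplied by their coefficients and added up, give suc k times the goal.
  certifies : ∀ {n} → ℕ → Inequality n → List (ℕ ∧ Inequality n) → Bool
  certifies k (l :≤ r) hs =
    equal (suc k :* r :+ combine Inequality.lhs hs) (suc k :* l :+ combine Inequality.rhs hs)

  module LinearSolver (𝔾 : OrderedGroup) where
    open OrderedGroup 𝔾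
    open AbelianGroup abelianGroup using (setoid; ∙-cong; ⁻¹-cong; assoc; comm; identityˡ; identityʳ; inverseʳ; inverseˡ; group; commutativeMonoid)
    module A = AbelianGroup abelianGroup
    open import Algebra.Properties.Monoid.Mult A.monoid using (_×_; ×-homo-+; ×-congʳ; ×-assocˡ)
    open import Algebra.Properties.CommutativeMonoid.Mult commutativeMonoid using (×-distrib-+)
    open import Algebra.Properties.AbelianGroup abelianGroup using (⁻¹-∙-comm; ⁻¹-involutive; ε⁻¹≈ε)
    open import Algebra.Properties.CommutativeSemigroup A.commutativeSemigroup using (interchange)
    open import Relation.Binary.Reasoning.Setoid setoid

    infixr 7 _⊗_
    abstract
      -- Abstract, so that multiples such as `2257 ⊗ x` never unfold into long sums.
      _⊗_ : ℕ → Carrier → Carrier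
      _⊗_ = _×_

      zero-⊗ : ∀ x → 0 ⊗ x ≈ 0#
      zero-⊗ x = A.refl

      suc-⊗ : ∀ k x → suc k ⊗ x ≈ x + k ⊗ x
      suc-⊗ k x = A.refl

      ⊗-+ : ∀ x k l → (k ℕ.+ l) ⊗ x ≈ k ⊗ x + l ⊗ x
      ⊗-+ = ×-homo-+

      ⊗-assoc : ∀ x k l → k ⊗ (l ⊗ x) ≈ (k ℕ.* l) ⊗ x
      ⊗-assoc = ×-assocˡ

      ⊗-cong : ∀ k {x y} → x ≈ y → k ⊗ x ≈ k ⊗ y
      ⊗-cong = ×-congʳ

      ⊗-distrib-+ : ∀ x y k → k ⊗ (x + y) ≈ k ⊗ x + k ⊗ y
      ⊗-distrib-+ = ×-distrib-+

    ⟦_⟧ : ∀ {n} → Expr n → Vec Carrier n → Carrier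
    ⟦ var i ⟧  ρ = lookup ρ i
    ⟦ :0 ⟧     ρ = 0#
    ⟦ e :+ f ⟧ ρ = ⟦ e ⟧ ρ + ⟦ f ⟧ ρ
    ⟦ e :- f ⟧ ρ = ⟦ e ⟧ ρ - ⟦ f ⟧ ρ
    ⟦ :- e ⟧   ρ = - ⟦ e ⟧ ρ
    ⟦ k :* e ⟧ ρ = k ⊗ ⟦ e ⟧ ρ

    ⟦_⟧≤ : ∀ {n} → Inequality n → Vec Carrier n → Set
    ⟦ l :≤ r ⟧≤ ρ = ⟦ l ⟧ ρ ≤ ⟦ r ⟧ ρ

    private
      value : ∀ {n} → Vec ℕ n → Vec Carrier n → Carrier
      value []       []      = 0#
      value (k ∷ ks) (x ∷ ρ) = k ⊗ x + value ks ρ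

      value-zero : ∀ {n} (ρ : Vec Carrier n) → value (replicate n 0) ρ ≈ 0#
      value-zero []      = A.refl
      value-zero (x ∷ ρ) = A.trans (∙-cong (zero-⊗ x) A.refl) (A.trans (identityˡ _) (value-zero ρ))

      value-single : ∀ {n} (i : Fin n) ρ → value (single i) ρ ≈ lookup ρ i
      value-single zero    (x ∷ ρ) =
        A.trans (∙-cong (A.trans (suc-⊗ 0 x) (∙-cong A.refl (zero-⊗ x))) (value-zero ρ)) (A.trans (identityʳ _) (identityʳ x))
      value-single (suc i) (x ∷ ρ) = A.trans (∙-cong (zero-⊗ x) A.refl) (A.trans (identityˡ _) (value-single i ρ))

      value-+ : ∀ {n} (ks ls : Vec ℕ n) ρ → value (zipWith ℕ._+_ ks ls) ρ ≈ value ks ρ + value ls ρ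
      value-+ []       []       []      = A.sym (identityˡ _)
      value-+ (k ∷ ks) (l ∷ ls) (x ∷ ρ) =
        A.trans (∙-cong (⊗-+ x k l) (value-+ ks ls ρ)) (interchange _ _ _ _)

      ⊗-zeroʳ : ∀ k → k ⊗ 0# ≈ 0#
      ⊗-zeroʳ zero    = zero-⊗ 0#
      ⊗-zeroʳ (suc k) = A.trans (suc-⊗ k 0#) (A.trans (identityˡ _) (⊗-zeroʳ k))

      value-* : ∀ {n} k (ls : Vec ℕ n) ρ → value (map (k ℕ.*_) ls) ρ ≈ k ⊗ value ls ρ
      value-* k []       []      = A.sym (⊗-zeroʳ k)
      value-* k (l ∷ ls) (x ∷ ρ) =
        A.trans (∙-cong (A.sym (⊗-assoc x k l)) (value-* k ls ρ)) (A.sym (⊗-distrib-+ _ _ k))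

      ⊗-neg : ∀ k x → k ⊗ (- x) ≈ - (k ⊗ x)
      ⊗-neg zero    x = A.trans (zero-⊗ _) (A.trans (A.sym ε⁻¹≈ε) (⁻¹-cong (A.sym (zero-⊗ x))))
      ⊗-neg (suc k) x = A.trans (suc-⊗ k _) (A.trans (∙-cong A.refl (⊗-neg k x))
        (A.trans (⁻¹-∙-comm _ _) (⁻¹-cong (A.sym (suc-⊗ k x)))))

      neg-diff : ∀ a b → - (a - b) ≈ b - a
      neg-diff a b = begin
        - (a - b)     ≈⟨ ⁻¹-∙-comm a (- b) ⟨
        - a + - - b   ≈⟨ ∙-cong A.refl (⁻¹-involutive b) ⟩
        - a + b       ≈⟨ comm _ _ ⟩
        b - a         ∎

      add-diff : ∀ a b c d → (a - b) + (c - d) ≈ (a + c) - (b + d)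
      add-diff a b c d = A.trans (interchange _ _ _ _) (∙-cong A.refl (⁻¹-∙-comm b d))

      correct : ∀ {n} (e : Expr n) ρ → ⟦ e ⟧ ρ ≈ value (pos e) ρ - value (neg e) ρ
      correct (var i) ρ = A.sym (begin
        value (single i) ρ - value (replicate _ 0) ρ ≈⟨ ∙-cong (value-single i ρ) (⁻¹-cong (value-zero ρ)) ⟩
        lookup ρ i - 0#  ≈⟨ ∙-cong A.refl ε⁻¹≈ε ⟩
        lookup ρ i + 0#  ≈⟨ identityʳ _ ⟩
        lookup ρ i       ∎)
      correct :0 ρ = A.sym (inverseʳ _)
      correct (e :+ f) ρ = begin
        ⟦ e ⟧ ρ + ⟦ f ⟧ ρ ≈⟨ ∙-cong (correct e ρ) (correct f ρ) ⟩
        _                 ≈⟨ add-diff _ _ _ _ ⟩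
        _                 ≈⟨ ∙-cong (value-+ (pos e) (pos f) ρ) (⁻¹-cong (value-+ (neg e) (neg f) ρ)) ⟨
        _                 ∎
      correct (e :- f) ρ = begin
        ⟦ e ⟧ ρ - ⟦ f ⟧ ρ ≈⟨ ∙-cong (correct e ρ) (A.trans (⁻¹-cong (correct f ρ)) (neg-diff _ _)) ⟩
        _                 ≈⟨ add-diff _ _ _ _ ⟩
        _                 ≈⟨ ∙-cong (value-+ (pos e) (neg f) ρ) (⁻¹-cong (value-+ (neg e) (pos f) ρ)) ⟨
        _                 ∎
      correct (:- e) ρ = A.trans (⁻¹-cong (correct e ρ)) (neg-diff _ _)
      correct (k :* e) ρ = begin
        k ⊗ ⟦ e ⟧ ρ                      ≈⟨ ⊗-cong k (correct e ρ) ⟩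
        k ⊗ (value (pos e) ρ - value (neg e) ρ) ≈⟨ ⊗-distrib-+ _ _ k ⟩
        _                                ≈⟨ ∙-cong A.refl (⊗-neg k _) ⟩
        _                                ≈⟨ ∙-cong (value-* k (pos e) ρ) (⁻¹-cong (value-* k (neg e) ρ)) ⟨
        _                                ∎

      diff-eq : ∀ a b c d → a + d ≈ c + b → a - b ≈ c - d
      diff-eq a b c d eq = begin
        a - b                 ≈⟨ identityʳ _ ⟨
        (a - b) + 0#          ≈⟨ ∙-cong A.refl (inverseʳ d) ⟨
        (a - b) + (d - d)     ≈⟨ interchange _ _ _ _ ⟩
        (a + d) + (- b - d)   ≈⟨ ∙-cong eq (comm _ _) ⟩
        (c + b) + (- d - b)   ≈⟨ interchange _ _ _ _ ⟩
        (c - d) + (b - b)     ≈⟨ ∙-cong A.refl (inverseʳ b) ⟩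
        (c - d) + 0#          ≈⟨ identityʳ _ ⟩
        c - d                 ∎

    +-cancelʳ-≤ : ∀ z {x y} → x + z ≤ y + z → x ≤ y
    +-cancelʳ-≤ z p = ≤-trans (≤-reflexive (A.sym (lemma _)))
      (≤-trans (+-monoˡ-≤ (- z) p) (≤-reflexive (lemma _)))
      where
      lemma : ∀ x → (x + z) - z ≈ x
      lemma x = A.trans (assoc _ _ _) (A.trans (∙-cong A.refl (inverseʳ z)) (identityʳ x))

    +-mono-≤ : ∀ {x y u v} → x ≤ y → u ≤ v → x + u ≤ y + v
    +-mono-≤ x≤y u≤v = ≤-trans (+-monoˡ-≤ _ x≤y)
      (≤-trans (≤-reflexive (comm _ _)) (≤-trans (+-monoˡ-≤ _ u≤v) (≤-reflexive (comm _ _))))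

    ⊗-mono-≤ : ∀ k {x y} → x ≤ y → k ⊗ x ≤ k ⊗ y
    ⊗-mono-≤ zero    x≤y = ≤-reflexive (A.trans (zero-⊗ _) (A.sym (zero-⊗ _)))
    ⊗-mono-≤ (suc k) x≤y = ≤-trans (≤-reflexive (suc-⊗ k _))
      (≤-trans (+-mono-≤ x≤y (⊗-mono-≤ k x≤y)) (≤-reflexive (A.sym (suc-⊗ k _))))

    -- Totality replaces division: if y ≤ x, then x + k x ≤ y + k y ≤ y + k x, and k x cancels.
    ⊗-cancel-≤ : ∀ k {x y} → suc k ⊗ x ≤ suc k ⊗ y → x ≤ y
    ⊗-cancel-≤ k {x} {y} h with ≤-total x y
    ... | inj₁ x≤y = x≤y
    ... | inj₂ y≤x = +-cancelʳ-≤ (k ⊗ x) (≤-trans (≤-reflexive (A.sym (suc-⊗ k x)))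
      (≤-trans h (≤-trans (≤-reflexive (suc-⊗ k y)) (+-mono-≤ (≤-reflexive A.refl) (⊗-mono-≤ k y≤x)))))

    equal-sound : ∀ {n} (e f : Expr n) (ρ : Vec Carrier n) → equal e f ≡ true → ⟦ e ⟧ ρ ≈ ⟦ f ⟧ ρ
    equal-sound e f ρ eq with ≡-dec ℕ._≟_ (zipWith ℕ._+_ (pos e) (neg f)) (zipWith ℕ._+_ (pos f) (neg e))
    equal-sound e f ρ eq | yes p = begin
      ⟦ e ⟧ ρ                             ≈⟨ correct e ρ ⟩
      value (pos e) ρ - value (neg e) ρ   ≈⟨ diff-eq _ _ _ _ same ⟩
      value (pos f) ρ - value (neg f) ρ   ≈⟨ correct f ρ ⟨
      ⟦ f ⟧ ρ                             ∎
      where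
      same : value (pos e) ρ + value (neg f) ρ ≈ value (pos f) ρ + value (neg e) ρ
      same = begin
        _ ≈⟨ value-+ (pos e) (neg f) ρ ⟨
        _ ≈⟨ A.reflexive (≡.cong (λ ks → value ks ρ) p) ⟩
        _ ≈⟨ value-+ (pos f) (neg e) ρ ⟩
        _ ∎
    equal-sound e f ρ () | no _

    combine-≤ : ∀ {n} (ρ : Vec Carrier n) hs → All (λ h → ⟦ proj₂ h ⟧≤ ρ) hs →
                ⟦ combine Inequality.lhs hs ⟧ ρ ≤ ⟦ combine Inequality.rhs hs ⟧ ρ
    combine-≤ ρ []             []       = ≤-reflexive A.refl
    combine-≤ ρ ((c , h) ∷ hs) (p ∷ ps) = +-mono-≤ (⊗-mono-≤ c p) (combine-≤ ρ hs ps)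

    -- A Farkas certificate: the multipliers in `hs` and the factor `suc k` of the goal are supplied
    -- by hand, and `ok` is `refl` because comparing coefficient vectors is mere evaluation.
    linear : ∀ {n} (ρ : Vec Carrier n) k goal hs → certifies k goal hs ≡ true →
             All (λ h → ⟦ proj₂ h ⟧≤ ρ) hs → ⟦ goal ⟧≤ ρ
    linear ρ k (l :≤ r) hs ok ps = ⊗-cancel-≤ k (+-cancelʳ-≤ (⟦ L ⟧ ρ)
      (≤-trans (≤-trans (≤-reflexive (comm _ _)) (+-monoˡ-≤ _ (combine-≤ ρ hs ps)))
        (≤-trans (≤-reflexive (comm _ _))
          (≤-reflexive (A.sym (equal-sound (suc k :* r :+ L) (suc k :* l :+ R) ρ ok))))))
      where
      L = combine Inequality.lhs hs
      R = combine Inequality.rhs hs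

-- Inverses, powers and convexity over the rationals.

module RationalLemmas where

  open import Algebra.Bundles using (CommutativeRing)
  import Algebra.Properties.Semiring.Exp as Exp
  import Algebra.Properties.CommutativeSemiring.Exp as CExp
  import Data.Integer.Base as ℤ
  open import Data.Nat.Base as ℕ using (ℕ; zero; suc)
  import Data.Nat.Properties as ℕ
  open import Data.Product.Base using (∃-syntax; _,_)
  open import Data.Rational.Base
  open import Data.Rational.Properties
  open import Data.Rational.Solver
  open import Data.Sum.Base using (inj₁; inj₂)
  open import Relation.Binary.PropositionalEquality using (_≡_; _≢_; refl; sym; trans; cong; cong₂; subst; subst₂)
  open import Relation.Nullary using (¬_; yes; no; contradiction; Dec)
  open LinearInequalities using (OrderedGroup)

  open Exp (CommutativeRing.semiring +-*-commutativeRing) using (_^_; ^-homo-*; ^-assocʳ) public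
  open CExp (CommutativeRing.commutativeSemiring +-*-commutativeRing) using (^-distrib-*) public
  open +-*-Solver

  0<1 : 0ℚ < 1ℚ
  0<1 = *<* (ℤ.+<+ (ℕ.s≤s ℕ.z≤n))

  0≤1 : 0ℚ ≤ 1ℚ
  0≤1 = <⇒≤ 0<1

  *-mono-≤ : ∀ {p q r s} → 0ℚ ≤ p → 0ℚ ≤ s → p ≤ q → r ≤ s → p * r ≤ q * s
  *-mono-≤ {p} {q} {r} {s} 0≤p 0≤s p≤q r≤s = ≤-trans
    (*-monoˡ-≤-nonNeg p {{nonNegative 0≤p}} r≤s)
    (*-monoʳ-≤-nonNeg s {{nonNegative 0≤s}} p≤q)

  *-monoˡ : ∀ r {p q} → 0ℚ ≤ r → p ≤ q → r * p ≤ r * q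
  *-monoˡ r 0≤r = *-monoˡ-≤-nonNeg r {{nonNegative 0≤r}}

  *-monoʳ : ∀ r {p q} → 0ℚ ≤ r → p ≤ q → p * r ≤ q * r
  *-monoʳ r 0≤r = *-monoʳ-≤-nonNeg r {{nonNegative 0≤r}}

  0≤* : ∀ {p q} → 0ℚ ≤ p → 0ℚ ≤ q → 0ℚ ≤ p * q
  0≤* {p} {q} 0≤p 0≤q = subst (_≤ p * q) (*-zeroʳ p) (*-monoˡ p 0≤p 0≤q)

  0<* : ∀ {p q} → 0ℚ < p → 0ℚ < q → 0ℚ < p * q
  0<* {p} {q} 0<p 0<q = subst (_< p * q) (*-zeroʳ p) (*-monoʳ-<-pos p {{positive 0<p}} 0<q)

  0≤+ : ∀ {p q} → 0ℚ ≤ p → 0ℚ ≤ q → 0ℚ ≤ p + q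
  0≤+ {p} {q} 0≤p 0≤q = subst (_≤ p + q) (+-identityˡ 0ℚ) (+-mono-≤ 0≤p 0≤q)

  p≤p+q : ∀ p {q} → 0ℚ ≤ q → p ≤ p + q
  p≤p+q p {q} 0≤q = subst (_≤ p + q) (+-identityʳ p) (+-monoʳ-≤ p 0≤q)

  q≤p+q : ∀ {p} q → 0ℚ ≤ p → q ≤ p + q
  q≤p+q {p} q 0≤p = subst (_≤ p + q) (+-identityˡ q) (+-monoˡ-≤ q 0≤p)

  0≤square : ∀ p → 0ℚ ≤ p * p
  0≤square p with ≤-total 0ℚ p
  ... | inj₁ 0≤p = 0≤* 0≤p 0≤p
  ... | inj₂ p≤0 = subst (0ℚ ≤_) (solve 1 (λ p → (:- p) :* (:- p) := p :* p) refl p)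
    (0≤* (neg-antimono-≤ p≤0) (neg-antimono-≤ p≤0))

  *-cancelˡ : ∀ r {p q} → 0ℚ < r → r * p ≤ r * q → p ≤ q
  *-cancelˡ r 0<r = *-cancelˡ-≤-pos r {{positive 0<r}}

  ≤-from-diff : ∀ {p q} → 0ℚ ≤ q - p → p ≤ q
  ≤-from-diff {p} {q} h = subst₂ _≤_ (+-identityʳ p)
    (solve 2 (λ p q → p :+ (q :- p) := q) refl p q) (+-monoʳ-≤ p h)

  ≤-to-diff : ∀ {p q} → p ≤ q → 0ℚ ≤ q - p
  ≤-to-diff {p} {q} h = subst₂ _≤_ (+-inverseʳ p) refl (+-monoˡ-≤ (- p) h)

  ≤⇒≯ : ∀ {p q} → p ≤ q → ¬ q < p
  ≤⇒≯ p≤q q<p = <-irrefl refl (<-≤-trans q<p p≤q)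

  0≤∧≢0⇒0< : ∀ {p} → 0ℚ ≤ p → p ≢ 0ℚ → 0ℚ < p
  0≤∧≢0⇒0< {p} 0≤p p≢0 with 0ℚ <? p
  ... | yes 0<p = 0<p
  ... | no  0≮p = contradiction (≤-antisym (≮⇒≥ 0≮p) 0≤p) p≢0

  0≤^ : ∀ {p} n → 0ℚ ≤ p → 0ℚ ≤ p ^ n
  0≤^ zero    0≤p = 0≤1
  0≤^ (suc n) 0≤p = 0≤* 0≤p (0≤^ n 0≤p)

  0<^ : ∀ {p} n → 0ℚ < p → 0ℚ < p ^ n
  0<^ zero    0<p = 0<1
  0<^ (suc n) 0<p = 0<* 0<p (0<^ n 0<p)

  1^ : ∀ n → 1ℚ ^ n ≡ 1ℚ
  1^ zero    = refl
  1^ (suc n) = trans (*-identityˡ _) (1^ n)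

  ^-mono-≤ : ∀ {p q} n → 0ℚ ≤ p → p ≤ q → p ^ n ≤ q ^ n
  ^-mono-≤ zero    0≤p p≤q = ≤-refl
  ^-mono-≤ (suc n) 0≤p p≤q = *-mono-≤ 0≤p (0≤^ n (≤-trans 0≤p p≤q)) p≤q (^-mono-≤ n 0≤p p≤q)

  ^-mono-< : ∀ {p q} n → 0ℚ ≤ p → p < q → p ^ suc n < q ^ suc n
  ^-mono-< {p} {q} n 0≤p p<q = ≤-<-trans
    (*-monoˡ p 0≤p (^-mono-≤ n 0≤p (<⇒≤ p<q)))
    (*-monoˡ-<-pos (q ^ n) {{positive (0<^ n (≤-<-trans 0≤p p<q))}} p<q)

  ^-cancel-≤ : ∀ {p q} n → 0ℚ ≤ q → p ^ suc n ≤ q ^ suc n → p ≤ q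
  ^-cancel-≤ {p} {q} n 0≤q h with p ≤? q
  ... | yes p≤q = p≤q
  ... | no  p≰q = contradiction (<-≤-trans (^-mono-< n 0≤q (≰⇒> p≰q)) h) (<-irrefl refl)

  -- The inverse, extended by inv 0 = 0.
  inv : ℚ → ℚ
  inv p with p ≟ 0ℚ
  ... | yes _   = 0ℚ
  ... | no  p≢0 = (1/ p) {{≢-nonZero p≢0}}

  *-inv : ∀ {p} → p ≢ 0ℚ → p * inv p ≡ 1ℚ
  *-inv {p} p≢0 with p ≟ 0ℚ
  ... | yes p≡0  = contradiction p≡0 p≢0
  ... | no  p≢0′ = *-inverseʳ p {{≢-nonZero p≢0′}}

  0≤inv : ∀ {p} → 0ℚ ≤ p → 0ℚ ≤ inv p
  0≤inv {p} 0≤p with p ≟ 0ℚ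
  ... | yes _    = ≤-refl
  ... | no  p≢0 = <⇒≤ (positive⁻¹ _ {{1/pos⇒pos p {{positive (0≤∧≢0⇒0< 0≤p p≢0)}}}})

  <⇒≢0 : ∀ {p} → 0ℚ < p → p ≢ 0ℚ
  <⇒≢0 0<p p≡0 = <-irrefl (sym p≡0) 0<p

  0<inv : ∀ {p} → 0ℚ < p → 0ℚ < inv p
  0<inv {p} 0<p = 0≤∧≢0⇒0< (0≤inv (<⇒≤ 0<p)) λ inv≡0 →
    <-irrefl (trans (sym (*-zeroʳ p)) (trans (cong (p *_) (sym inv≡0)) (*-inv (<⇒≢0 0<p)))) 0<1

  inv-unique : ∀ {p q} → p * q ≡ 1ℚ → q ≡ inv p
  inv-unique {p} {q} pq≡1 = begin-equality
    q               ≡⟨ *-identityʳ q ⟨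
    q * 1ℚ          ≡⟨ cong (q *_) (*-inv p≢0) ⟨
    q * (p * inv p) ≡⟨ solve 3 (λ p q i → q :* (p :* i) := (p :* q) :* i) refl p q (inv p) ⟩
    (p * q) * inv p ≡⟨ cong (_* inv p) pq≡1 ⟩
    1ℚ * inv p      ≡⟨ *-identityˡ _ ⟩
    inv p           ∎
    where
    open ≤-Reasoning
    p≢0 : p ≢ 0ℚ
    p≢0 refl = <-irrefl (trans (sym (*-zeroˡ q)) pq≡1) 0<1

  inv-* : ∀ p q → inv (p * q) ≡ inv p * inv q
  inv-* p q = helper (p ≟ 0ℚ) (q ≟ 0ℚ)
    where
    open ≤-Reasoning
    helper : Dec (p ≡ 0ℚ) → Dec (q ≡ 0ℚ) → inv (p * q) ≡ inv p * inv q
    helper (yes refl) _          = trans (cong inv (*-zeroˡ q)) (sym (*-zeroˡ (inv q)))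
    helper (no _)     (yes refl) = trans (cong inv (*-zeroʳ p)) (sym (*-zeroʳ (inv p)))
    helper (no p≢0)   (no q≢0)   = sym (inv-unique {p * q} (begin-equality
      (p * q) * (inv p * inv q) ≡⟨ solve 4 (λ p q i j → (p :* q) :* (i :* j) := (p :* i) :* (q :* j)) refl p q (inv p) (inv q) ⟩
      (p * inv p) * (q * inv q) ≡⟨ cong₂ _*_ (*-inv p≢0) (*-inv q≢0) ⟩
      1ℚ                        ∎))

  p*inv-p≤1 : ∀ p → p * inv p ≤ 1ℚ
  p*inv-p≤1 p with p ≟ 0ℚ
  ... | yes refl = subst (_≤ 1ℚ) (sym (*-zeroˡ 0ℚ)) 0≤1
  ... | no p≢0   = ≤-reflexive (*-inverseʳ p {{≢-nonZero p≢0}})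

  nat : ℕ → ℚ
  nat zero    = 0ℚ
  nat (suc n) = 1ℚ + nat n

  0≤nat : ∀ n → 0ℚ ≤ nat n
  0≤nat zero    = ≤-refl
  0≤nat (suc n) = 0≤+ 0≤1 (0≤nat n)

  0<nat : ∀ n → 0ℚ < nat (suc n)
  0<nat n = <-≤-trans 0<1 (subst (_≤ nat (suc n)) (+-identityʳ 1ℚ) (+-monoʳ-≤ 1ℚ (0≤nat n)))

  nat-+ : ∀ m n → nat (m ℕ.+ n) ≡ nat m + nat n
  nat-+ zero    n = sym (+-identityˡ _)
  nat-+ (suc m) n = trans (cong (1ℚ +_) (nat-+ m n)) (sym (+-assoc 1ℚ (nat m) (nat n)))

  nat-* : ∀ m n → nat (m ℕ.* n) ≡ nat m * nat n
  nat-* zero    n = sym (*-zeroˡ (nat n))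
  nat-* (suc m) n = trans (nat-+ n (m ℕ.* n)) (trans (cong (nat n +_) (nat-* m n))
    (solve 2 (λ m n → n :+ m :* n := (con 1ℚ :+ m) :* n) refl (nat m) (nat n)))

  nat-mono : ∀ {m n} → m ℕ.≤ n → nat m ≤ nat n
  nat-mono {n = n} ℕ.z≤n = 0≤nat n
  nat-mono (ℕ.s≤s m≤n)  = +-monoʳ-≤ 1ℚ (nat-mono m≤n)

  nat-cancel : ∀ {m n} → nat m ≤ nat n → m ℕ.≤ n
  nat-cancel {m} {n} h with m ℕ.≤? n
  ... | yes m≤n = m≤n
  ... | no  m≰n = contradiction (<-≤-trans (subst (_< nat (suc n)) (+-identityˡ _) (+-monoˡ-< (nat n) 0<1))
    (≤-trans (nat-mono (ℕ.≰⇒> m≰n)) h)) (<-irrefl refl)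

  nat-^ : ∀ m n → nat (m ℕ.^ n) ≡ nat m ^ n
  nat-^ m zero    = +-identityʳ 1ℚ
  nat-^ m (suc n) = trans (nat-* m (m ℕ.^ n)) (cong (nat m *_) (nat-^ m n))

  -- Convexity of the power, without derivatives: multiplying the case n by y leaves exactly (n + 1)
  -- xⁿ (y - x)² to spare.
  tangent : ∀ n {x y} → 0ℚ ≤ x → 0ℚ ≤ y → (1ℚ + nat n) * (x ^ n * y) ≤ y ^ suc n + nat n * x ^ suc n
  tangent zero {x} {y} 0≤x 0≤y = ≤-reflexive
    (solve 2 (λ x y → (con 1ℚ :+ con 0ℚ) :* (con 1ℚ :* y) := y :* con 1ℚ :+ con 0ℚ :* (x :* con 1ℚ)) refl x y)
  tangent (suc n) {x} {y} 0≤x 0≤y = ≤-trans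
    (≤-from-diff {(1ℚ + nat (suc n)) * (x * X * y)} {(y * ((1ℚ + nat n) * (X * y)) - y * (nat n * (x * X))) + nat (suc n) * (x * (x * X))}
      (subst (0ℚ ≤_) identity (0≤* (0≤* (0≤nat (suc n)) (0≤^ n 0≤x)) (0≤square (y - x)))))
    (+-monoˡ-≤ (nat (suc n) * x ^ suc (suc n))
      {y * ((1ℚ + nat n) * (X * y)) - y * (nat n * (x * X))} {y * (y * Y)}
      (≤-from-diff {y * ((1ℚ + nat n) * (X * y)) - y * (nat n * (x * X))} {y * (y * Y)} (subst (0ℚ ≤_) step
      (0≤* 0≤y (≤-to-diff (tangent n 0≤x 0≤y))))))
    where
    X = x ^ n
    Y = y ^ n
    identity : (nat (suc n) * X) * ((y - x) * (y - x)) ≡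
      ((y * ((1ℚ + nat n) * (X * y)) - y * (nat n * (x * X))) + nat (suc n) * (x * (x * X))) - (1ℚ + nat (suc n)) * (x * X * y)
    identity = solve 4 (λ x y X n → ((con 1ℚ :+ n) :* X) :* ((y :- x) :* (y :- x)) :=
      ((y :* ((con 1ℚ :+ n) :* (X :* y)) :- y :* (n :* (x :* X))) :+ (con 1ℚ :+ n) :* (x :* (x :* X))) :- (con 1ℚ :+ (con 1ℚ :+ n)) :* (x :* X :* y))
      refl x y X (nat n)
    step : y * ((y * Y + nat n * (x * X)) - (1ℚ + nat n) * (X * y)) ≡
      y * (y * Y) - (y * ((1ℚ + nat n) * (X * y)) - y * (nat n * (x * X)))
    step = solve 5 (λ x y X Y n → y :* ((y :* Y :+ n :* (x :* X)) :- (con 1ℚ :+ n) :* (X :* y)) :=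
      y :* (y :* Y) :- (y :* ((con 1ℚ :+ n) :* (X :* y)) :- y :* (n :* (x :* X)))) refl x y X Y (nat n)

  -- In the form (N c)ᴺ, where N c = N - m + m a, the weighted inequality of the
  -- arithmetic and geometric means: by the tangent inequality (1 + z / N) ^ N
  -- increases with N.
  module _ {a : ℚ} (0<a : 0ℚ < a) (m : ℕ) where
    private
      z = nat m * (a - 1ℚ)
      c : ℕ → ℚ
      c N = inv (nat N) * (nat N + z)

    N*c : ∀ k → nat (suc k) * c (suc k) ≡ nat (suc k) + z
    N*c k = begin-equality
      n * (inv n * (n + z)) ≡⟨ *-assoc n (inv n) (n + z) ⟨
      n * inv n * (n + z)   ≡⟨ cong (_* (n + z)) (*-inv (<⇒≢0 (0<nat k))) ⟩
      1ℚ * (n + z)          ≡⟨ *-identityˡ _ ⟩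
      n + z                 ∎
      where
      open ≤-Reasoning
      n = nat (suc k)

    private
      0≤N+z : ∀ k → 0ℚ ≤ nat (k ℕ.+ m) + z
      0≤N+z k = subst (0ℚ ≤_) eq (0≤+ (0≤nat k) (0≤* (0≤nat m) (<⇒≤ 0<a)))
        where
        eq : nat k + nat m * a ≡ nat (k ℕ.+ m) + z
        eq = trans (solve 3 (λ k m a → k :+ m :* a := (k :+ m) :+ m :* (a :- con 1ℚ)) refl (nat k) (nat m) a)
               (cong (_+ z) (sym (nat-+ k m)))

      0≤c : ∀ k → 0ℚ ≤ c (k ℕ.+ m)
      0≤c k = 0≤* (0≤inv (0≤nat (k ℕ.+ m))) (0≤N+z k)

      -- The products N c N grow by 1 with N, so the term linear in y of the tangent inequality at x
      -- = c (N + 1), y = c (N + 2) becomes X + (N + 1) x X, whose second summand cancels.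
      c-step : ∀ N → 0ℚ ≤ c (suc N) → 0ℚ ≤ c (suc (suc N)) → c (suc N) ^ suc N ≤ c (suc (suc N)) ^ suc (suc N)
      c-step N 0≤x 0≤y = +-cancel (subst (_≤ y ^ suc (suc N) + nat (suc N) * x ^ suc (suc N)) eq
        (tangent (suc N) 0≤x 0≤y))
        where
        open ≤-Reasoning
        x = c (suc N)
        y = c (suc (suc N))
        X = x ^ suc N
        eq : (1ℚ + nat (suc N)) * (X * y) ≡ X + nat (suc N) * x ^ suc (suc N)
        eq = begin-equality
          (1ℚ + nat (suc N)) * (X * y)     ≡⟨ solve 3 (λ n X y → n :* (X :* y) := X :* (n :* y)) refl (nat (suc (suc N))) X y ⟩
          X * (nat (suc (suc N)) * y)      ≡⟨ cong (X *_) (N*c (suc N)) ⟩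
          X * ((1ℚ + nat (suc N)) + z)     ≡⟨ solve 3 (λ X n z → X :* ((con 1ℚ :+ n) :+ z) := X :+ X :* (n :+ z)) refl X (nat (suc N)) z ⟩
          X + X * (nat (suc N) + z)        ≡⟨ cong (λ t → X + X * t) (N*c N) ⟨
          X + X * (nat (suc N) * x)        ≡⟨ cong (X +_) (solve 3 (λ X n x → X :* (n :* x) := n :* (x :* X)) refl X (nat (suc N)) x) ⟩
          X + nat (suc N) * (x * X)        ∎
        +-cancel : X + nat (suc N) * x ^ suc (suc N) ≤ y ^ suc (suc N) + nat (suc N) * x ^ suc (suc N) → X ≤ y ^ suc (suc N)
        +-cancel h = ≤-from-diff (subst (0ℚ ≤_) (solve 3 (λ X Y t → (Y :+ t) :- (X :+ t) := Y :- X) refl X (y ^ suc (suc N)) (nat (suc N) * x ^ suc (suc N))) (≤-to-diff h))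

    am-gm : ∀ k → a ^ m ≤ c (k ℕ.+ m) ^ (k ℕ.+ m)
    am-gm = go m refl
      where
      base : ∀ j → m ≡ suc j → c m ≡ a
      base j refl = begin-equality
        inv n * (n + n * (a - 1ℚ)) ≡⟨ solve 3 (λ i n a → i :* (n :+ n :* (a :- con 1ℚ)) := (n :* i) :* a) refl (inv n) n a ⟩
        (n * inv n) * a            ≡⟨ cong (_* a) (*-inv (<⇒≢0 (0<nat j))) ⟩
        1ℚ * a                     ≡⟨ *-identityˡ a ⟩
        a                          ∎
        where
        open ≤-Reasoning
        n = nat (suc j)
      go : ∀ j → m ≡ j → ∀ k → a ^ m ≤ c (k ℕ.+ m) ^ (k ℕ.+ m)
      -- The case m = 0 stands apart: `base` would divide by 0, and c 0 = 0 is harmless only because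
      -- its exponent is 0.
      go zero refl k = subst (1ℚ ≤_) (trans (sym (1^ (k ℕ.+ 0))) (one k)) ≤-refl
        where
        one : ∀ k → 1ℚ ^ (k ℕ.+ 0) ≡ c (k ℕ.+ 0) ^ (k ℕ.+ 0)
        one zero    = refl
        one (suc k) = cong (_^ (suc k ℕ.+ 0)) (sym (begin-equality
          inv n * (n + 0ℚ * (a - 1ℚ)) ≡⟨ solve 3 (λ i n a → i :* (n :+ con 0ℚ :* (a :- con 1ℚ)) := n :* i) refl (inv n) n a ⟩
          n * inv n                   ≡⟨ *-inv (<⇒≢0 (0<nat (k ℕ.+ 0))) ⟩
          1ℚ                          ∎))
          where
          open ≤-Reasoning
          n = nat (suc k ℕ.+ 0)
      go (suc j) m≡ zero    = ≤-reflexive (cong (_^ m) (sym (base j m≡)))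
      go (suc j) m≡ (suc k) = ≤-trans (go (suc j) m≡ k) (shift (k ℕ.+ m) (positive′ k m≡) (0≤c k) (0≤c (suc k)))
        where
        positive′ : ∀ k → m ≡ suc j → ∃[ N ] k ℕ.+ m ≡ suc N
        positive′ k refl = k ℕ.+ j , ℕ.+-suc k j
        shift : ∀ M → ∃[ N ] M ≡ suc N → 0ℚ ≤ c M → 0ℚ ≤ c (suc M) → c M ^ M ≤ c (suc M) ^ suc M
        shift M (N , refl) = c-step N

  bernoulli : ∀ n {x} → 0ℚ ≤ x → 1ℚ + nat n * x ≤ (1ℚ + x) ^ n
  bernoulli zero    {x} 0≤x = ≤-reflexive (solve 1 (λ x → con 1ℚ :+ con 0ℚ :* x := con 1ℚ) refl x)
  bernoulli (suc n) {x} 0≤x = ≤-trans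
    (≤-from-diff (subst (0ℚ ≤_) (solve 2 (λ n x → n :* (x :* x) :=
       ((con 1ℚ :+ x) :* (con 1ℚ :+ n :* x)) :- (con 1ℚ :+ (con 1ℚ :+ n) :* x)) refl (nat n) x)
      (0≤* (0≤nat n) (0≤square x))))
    (*-monoˡ (1ℚ + x) (0≤+ 0≤1 0≤x) (bernoulli n 0≤x))

  ℚ-orderedGroup : OrderedGroup
  ℚ-orderedGroup = record
    { abelianGroup = +-0-abelianGroup
    ; _≤_          = _≤_
    ; ≤-reflexive  = ≤-reflexive
    ; ≤-antisym    = ≤-antisym
    ; ≤-trans      = ≤-trans
    ; +-monoˡ-≤    = λ z → +-monoˡ-≤ z
    ; ≤-total      = ≤-total
    }

-- Formal roots as a model of logarithms.

module LogarithmModel where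

  import Data.Integer.Base as ℤ
  import Data.Integer.Properties as ℤ
  open import Data.Nat.Base as ℕ using (ℕ; zero; suc)
  import Data.Nat.Properties as ℕ
  open import Data.Nat.Solver using (module +-*-Solver)
  open import Data.Product.Base using (∃-syntax; _×_; _,_; proj₁; proj₂)
  open import Data.Rational.Base as ℚ using (ℚ; 0ℚ; 1ℚ; mkℚ; ↥_; ↧ₙ_; toℚᵘ; _*_; _<_)
  import Data.Rational.Properties as ℚ
  import Data.Rational.Solver as ℚ
  open import Data.Rational.Unnormalised.Base as ℚᵘ using (mkℚᵘ; _≃_; *≡*)
  import Data.Rational.Unnormalised.Properties as ℚᵘ
  open import Data.Sum.Base using (_⊎_; inj₁; inj₂)
  open import Relation.Binary.PropositionalEquality using (_≡_; refl; sym; trans; cong; cong₂; subst; subst₂; module ≡-Reasoning)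
  open import Relation.Nullary using (yes; no; contradiction)
  open LinearInequalities using (OrderedGroup)
  open RationalLemmas

  toℚᵘ-nat : ∀ n → toℚᵘ (nat n) ≃ mkℚᵘ (ℤ.+ n) 0
  toℚᵘ-nat zero    = ℚᵘ.≃-refl
  toℚᵘ-nat (suc n) = ℚᵘ.≃-trans (ℚ.toℚᵘ-homo-+ 1ℚ (nat n)) (ℚᵘ.≃-trans
    (ℚᵘ.+-congʳ (toℚᵘ 1ℚ) (toℚᵘ-nat n))
    (*≡* (cong (λ k → (ℤ.1ℤ ℤ.* ℤ.1ℤ ℤ.+ k) ℤ.* ℤ.1ℤ) (ℤ.*-identityʳ (ℤ.+ n)))))

  denominator* : ∀ {q} → 0ℚ ℚ.≤ q → nat (↧ₙ q) * q ≡ nat ℤ.∣ ↥ q ∣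
  denominator* {mkℚ (ℤ.+ k) d c} 0≤q = ℚ.toℚᵘ-injective (ℚᵘ.≃-trans (ℚ.toℚᵘ-homo-* (nat (suc d)) (mkℚ (ℤ.+ k) d c))
    (ℚᵘ.≃-trans (ℚᵘ.*-congʳ (toℚᵘ-nat (suc d))) (ℚᵘ.≃-trans (*≡* eq) (ℚᵘ.≃-sym (toℚᵘ-nat k)))))
    where
    eq : (ℤ.+ suc d) ℤ.* (ℤ.+ k) ℤ.* ℤ.1ℤ ≡ ℤ.+ k ℤ.* (ℤ.+ (1 ℕ.* suc d))
    eq = trans (ℤ.*-identityʳ _) (trans (ℤ.*-comm (ℤ.+ suc d) (ℤ.+ k)) (cong (λ e → ℤ.+ k ℤ.* (ℤ.+ e)) (sym (ℕ.*-identityˡ (suc d)))))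
  denominator* {mkℚ (ℤ.-[1+ k ]) d c} 0≤q with ℚ.nonNegative 0≤q
  ... | ()

  nat-injective : ∀ {m n} → nat m ≡ nat n → m ≡ n
  nat-injective eq = ℕ.≤-antisym (nat-cancel (ℚ.≤-reflexive eq)) (nat-cancel (ℚ.≤-reflexive (sym eq)))

  -- The fields of a sum or product of rationals are in lowest terms and do not compute; this trades
  -- them for the naive numerator r and denominator s.
  cross : ∀ {q} → 0ℚ ℚ.≤ q → ∀ r s → nat s * q ≡ nat r → ℤ.∣ ↥ q ∣ ℕ.* s ≡ r ℕ.* ↧ₙ q
  cross {q} 0≤q r s eq = nat-injective (begin
    nat (p ℕ.* s)             ≡⟨ nat-* p s ⟩
    nat p * nat s           ≡⟨ cong (_* nat s) (denominator* 0≤q) ⟨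
    nat d * q * nat s     ≡⟨ ℚ.+-*-Solver.solve 3 (λ d q s → d ℚ.+-*-Solver.:* q ℚ.+-*-Solver.:* s ℚ.+-*-Solver.:= (s ℚ.+-*-Solver.:* q) ℚ.+-*-Solver.:* d) refl (nat d) q (nat s) ⟩
    nat s * q * nat d     ≡⟨ cong (_* nat d) eq ⟩
    nat r * nat d           ≡⟨ nat-* r d ⟨
    nat (r ℕ.* d)             ∎)
    where
    open ≡-Reasoning
    p = ℤ.∣ ↥ q ∣
    d = ↧ₙ q

  -- The numerator of a / x serves as t, since a denominator is at least 1.
  archimedean-ℚ : ∀ {x} a → 0ℚ < x → ∃[ t ] a ℚ.≤ nat t * x
  archimedean-ℚ {x} a 0<x with ℚ.≤-total 0ℚ a
  ... | inj₂ a≤0 = 0 , ℚ.≤-trans a≤0 (ℚ.≤-reflexive (sym (ℚ.*-zeroˡ x)))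
  ... | inj₁ 0≤a = ℤ.∣ ↥ q ∣ , ℚ.≤-trans (ℚ.≤-reflexive a≡qx) (*-monoʳ x (ℚ.<⇒≤ 0<x) q≤)
    where
    q = a * inv x
    0≤q : 0ℚ ℚ.≤ q
    0≤q = 0≤* 0≤a (0≤inv (ℚ.<⇒≤ 0<x))
    a≡qx : a ≡ q * x
    a≡qx = sym (trans (ℚ.*-assoc a (inv x) x) (trans (cong (a *_) (trans (ℚ.*-comm (inv x) x) (*-inv (<⇒≢0 0<x)))) (ℚ.*-identityʳ a)))
    q≤ : q ℚ.≤ nat ℤ.∣ ↥ q ∣
    q≤ = subst₂ ℚ._≤_ (ℚ.*-identityˡ q) (denominator* 0≤q)
      (*-monoʳ q {1ℚ} {nat (↧ₙ q)} 0≤q (subst (ℚ._≤ nat (↧ₙ q)) (ℚ.+-identityʳ 1ℚ) (nat-mono {1} {↧ₙ q} (ℕ.s≤s ℕ.z≤n))))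

  -- root a d-1 stands for (log a) / suc d-1.
  record Root : Set where
    constructor root
    field
      base     : ℚ
      degree-1 : ℕ
      0<base   : 0ℚ < base
    degree = suc degree-1

  open Root

  infix  4 _≤_ _≈_
  infixl 6 _+_
  infixr 7 _·_

  _≤_ _≈_ : Root → Root → Set
  x ≤ y = base x ^ degree y ℚ.≤ base y ^ degree x
  x ≈ y = x ≤ y × y ≤ x

  _+_ : Root → Root → Root
  x + y = root (base x ^ degree y * base y ^ degree x) (degree-1 y ℕ.+ degree-1 x ℕ.* degree y)
    (0<* (0<^ (degree y) (0<base x)) (0<^ (degree x) (0<base y)))

  0ᴿ : Root
  0ᴿ = root 1ℚ 0 0<1

  -_ : Root → Root
  - x = root (inv (base x)) (degree-1 x) (0<inv (0<base x))

  -- A negative q acts as its absolute value, which is junk; hence the sign conditions in some of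
  -- the laws below.
  _·_ : ℚ → Root → Root
  q · x = root (base x ^ ℤ.∣ ↥ q ∣) (ℚ.denominator-1 q ℕ.+ degree-1 x ℕ.* ↧ₙ q) (0<^ ℤ.∣ ↥ q ∣ (0<base x))

  0≤base : ∀ x → 0ℚ ℚ.≤ base x
  0≤base x = ℚ.<⇒≤ (0<base x)

  ≈-intro : ∀ {x y} → base x ^ degree y ≡ base y ^ degree x → x ≈ y
  ≈-intro eq = ℚ.≤-reflexive eq , ℚ.≤-reflexive (sym eq)

  ^-comm : ∀ a m n → (a ^ m) ^ n ≡ (a ^ n) ^ m
  ^-comm a m n = trans (^-assocʳ a m n) (trans (cong (a ^_) (ℕ.*-comm m n)) (sym (^-assocʳ a n m)))

  ^-pair : ∀ a b i j k → (a ^ i * b ^ j) ^ k ≡ a ^ (i ℕ.* k) * b ^ (j ℕ.* k)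
  ^-pair a b i j k = trans (^-distrib-* (a ^ i) (b ^ j) k) (cong₂ _*_ (^-assocʳ a i k) (^-assocʳ b j k))

  ≤-trans : ∀ {x y z} → x ≤ y → y ≤ z → x ≤ z
  ≤-trans {x} {y} {z} x≤y y≤z = ^-cancel-≤ (degree-1 y) (0≤^ n (0≤base z)) (begin
    (a ^ l) ^ m ≡⟨ ^-comm a l m ⟩
    (a ^ m) ^ l ≤⟨ ^-mono-≤ l (0≤^ m (0≤base x)) x≤y ⟩
    (b ^ n) ^ l ≡⟨ ^-comm b n l ⟩
    (b ^ l) ^ n ≤⟨ ^-mono-≤ n (0≤^ l (0≤base y)) y≤z ⟩
    (c ^ m) ^ n ≡⟨ ^-comm c m n ⟩
    (c ^ n) ^ m ∎)
    where
    open ℚ.≤-Reasoning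
    a = base x ; b = base y ; c = base z
    n = degree x ; m = degree y ; l = degree z

  ≤-refl : ∀ {x} → x ≤ x
  ≤-refl = ℚ.≤-refl

  ≤-total : ∀ x y → x ≤ y ⊎ y ≤ x
  ≤-total x y = ℚ.≤-total _ _

  ≈-refl : ∀ {x} → x ≈ x
  ≈-refl = ℚ.≤-refl , ℚ.≤-refl

  ≈-sym : ∀ {x y} → x ≈ y → y ≈ x
  ≈-sym (p , q) = q , p

  ≈-trans : ∀ {x y z} → x ≈ y → y ≈ z → x ≈ z
  ≈-trans {x} {y} {z} (p , q) (r , s) = ≤-trans {x} {y} {z} p r , ≤-trans {z} {y} {x} s q

  open +-*-Solver

  +-comm : ∀ x y → x + y ≈ y + x
  +-comm x y = ≈-intro {x + y} {y + x} (cong₂ _^_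
    (ℚ.*-comm (base x ^ degree y) (base y ^ degree x)) (ℕ.*-comm (degree y) (degree x)))

  +-assoc : ∀ x y z → (x + y) + z ≈ x + (y + z)
  +-assoc x y z = ≈-intro {(x + y) + z} {x + (y + z)} (cong₂ _^_ eq (sym (ℕ.*-assoc n m l)))
    where
    open ≡-Reasoning
    a = base x ; b = base y ; c = base z
    n = degree x ; m = degree y ; l = degree z
    eq : (a ^ m * b ^ n) ^ l * c ^ (n ℕ.* m) ≡ a ^ (m ℕ.* l) * (b ^ l * c ^ m) ^ n
    eq = begin
      (a ^ m * b ^ n) ^ l * c ^ (n ℕ.* m)                    ≡⟨ cong (_* c ^ (n ℕ.* m)) (^-pair a b m n l) ⟩
      a ^ (m ℕ.* l) * b ^ (n ℕ.* l) * c ^ (n ℕ.* m)          ≡⟨ ℚ.*-assoc (a ^ (m ℕ.* l)) (b ^ (n ℕ.* l)) (c ^ (n ℕ.* m)) ⟩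
      a ^ (m ℕ.* l) * (b ^ (n ℕ.* l) * c ^ (n ℕ.* m))        ≡⟨ cong (a ^ (m ℕ.* l) *_) (cong₂ (λ i j → b ^ i * c ^ j) (ℕ.*-comm n l) (ℕ.*-comm n m)) ⟩
      a ^ (m ℕ.* l) * (b ^ (l ℕ.* n) * c ^ (m ℕ.* n))        ≡⟨ cong (a ^ (m ℕ.* l) *_) (^-pair b c l m n) ⟨
      a ^ (m ℕ.* l) * (b ^ l * c ^ m) ^ n                    ∎

  +-identityʳ : ∀ x → x + 0ᴿ ≈ x
  +-identityʳ x = ≈-intro {x + 0ᴿ} {x} (cong₂ _^_
    (trans (cong₂ _*_ (ℚ.*-identityʳ (base x)) (1^ (degree x))) (ℚ.*-identityʳ (base x)))
    (sym (ℕ.*-identityʳ (degree x))))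

  +-inverseʳ : ∀ x → x + (- x) ≈ 0ᴿ
  +-inverseʳ x = ≈-intro {x + (- x)} {0ᴿ} (trans (ℚ.*-identityʳ _) (begin
    a ^ n * inv a ^ n ≡⟨ ^-distrib-* a (inv a) n ⟨
    (a * inv a) ^ n   ≡⟨ cong (_^ n) (*-inv (<⇒≢0 (0<base x))) ⟩
    1ℚ ^ n              ≡⟨ 1^ n ⟩
    1ℚ                  ≡⟨ 1^ (n ℕ.* n) ⟨
    1ℚ ^ (n ℕ.* n)      ∎))
    where
    open ≡-Reasoning
    a = base x
    n = degree x

  +-monoˡ-≤ : ∀ z {x y} → x ≤ y → x + z ≤ y + z
  +-monoˡ-≤ z {x} {y} x≤y = begin
    (a ^ l * c ^ n) ^ (m ℕ.* l)                        ≡⟨ ^-pair a c l n (m ℕ.* l) ⟩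
    a ^ (l ℕ.* (m ℕ.* l)) * c ^ (n ℕ.* (m ℕ.* l))      ≡⟨ cong₂ (λ i j → a ^ i * c ^ j) (rearrange l m) (solve 3 (λ n m l → n :* (m :* l) := m :* (n :* l)) refl n m l) ⟩
    a ^ (m ℕ.* (l ℕ.* l)) * c ^ (m ℕ.* (n ℕ.* l))      ≡⟨ cong (_* c ^ (m ℕ.* (n ℕ.* l))) (^-assocʳ a m (l ℕ.* l)) ⟨
    (a ^ m) ^ (l ℕ.* l) * c ^ (m ℕ.* (n ℕ.* l))        ≤⟨ *-monoʳ (c ^ (m ℕ.* (n ℕ.* l))) (0≤^ (m ℕ.* (n ℕ.* l)) (0≤base z)) (^-mono-≤ (l ℕ.* l) (0≤^ m (0≤base x)) x≤y) ⟩
    (b ^ n) ^ (l ℕ.* l) * c ^ (m ℕ.* (n ℕ.* l))        ≡⟨ cong (_* c ^ (m ℕ.* (n ℕ.* l))) (^-assocʳ b n (l ℕ.* l)) ⟩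
    b ^ (n ℕ.* (l ℕ.* l)) * c ^ (m ℕ.* (n ℕ.* l))      ≡⟨ cong (λ i → b ^ i * c ^ (m ℕ.* (n ℕ.* l))) (rearrange l n) ⟨
    b ^ (l ℕ.* (n ℕ.* l)) * c ^ (m ℕ.* (n ℕ.* l))      ≡⟨ ^-pair b c l m (n ℕ.* l) ⟨
    (b ^ l * c ^ m) ^ (n ℕ.* l)                        ∎
    where
    open ℚ.≤-Reasoning
    a = base x ; b = base y ; c = base z
    n = degree x ; m = degree y ; l = degree z
    rearrange : ∀ l m → l ℕ.* (m ℕ.* l) ≡ m ℕ.* (l ℕ.* l)
    rearrange = solve 2 (λ l m → l :* (m :* l) := m :* (l :* l)) refl

  +-mono-≤ : ∀ {x y u v} → x ≤ y → u ≤ v → x + u ≤ y + v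
  +-mono-≤ {x} {y} {u} {v} x≤y u≤v = ≤-trans {x + u} {y + u} {y + v} (+-monoˡ-≤ u {x} {y} x≤y)
    (≤-trans {y + u} {u + y} {y + v} (proj₁ (+-comm y u))
      (≤-trans {u + y} {v + y} {y + v} (+-monoˡ-≤ y {u} {v} u≤v) (proj₁ (+-comm v y))))

  +-cong : ∀ {x y u v} → x ≈ y → u ≈ v → x + u ≈ y + v
  +-cong {x} {y} {u} {v} (p , q) (r , s) = +-mono-≤ {x} {y} {u} {v} p r , +-mono-≤ {y} {x} {v} {u} q s

  neg-cong : ∀ {x y} → x ≈ y → - x ≈ - y
  neg-cong {x} {y} eq = ≈-intro { - x} { - y} (begin
    inv a ^ m                      ≡⟨ inv-^ a m (0<base x) ⟩
    inv (a ^ m)                    ≡⟨ cong inv (ℚ.≤-antisym (proj₁ eq) (proj₂ eq)) ⟩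
    inv (b ^ n)                    ≡⟨ inv-^ b n (0<base y) ⟨
    inv b ^ n                      ∎)
    where
    open ≡-Reasoning
    a = base x ; b = base y
    n = degree x ; m = degree y
    inv-^ : ∀ a m → 0ℚ < a → inv a ^ m ≡ inv (a ^ m)
    inv-^ a m 0<a = inv-unique {a ^ m} (trans (sym (^-distrib-* a (inv a) m)) (trans (cong (_^ m) (*-inv (<⇒≢0 0<a))) (1^ m)))

  ·-mono-≤ : ∀ q {x y} → x ≤ y → q · x ≤ q · y
  ·-mono-≤ q {x} {y} x≤y = begin
    (a ^ p) ^ (m ℕ.* d)   ≡⟨ swap a m ⟩
    (a ^ m) ^ (p ℕ.* d)   ≤⟨ ^-mono-≤ (p ℕ.* d) (0≤^ m (0≤base x)) x≤y ⟩
    (b ^ n) ^ (p ℕ.* d)   ≡⟨ swap b n ⟨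
    (b ^ p) ^ (n ℕ.* d)   ∎
    where
    open ℚ.≤-Reasoning
    a = base x ; b = base y
    n = degree x ; m = degree y
    p = ℤ.∣ ↥ q ∣
    d = ↧ₙ q
    swap : ∀ a m → (a ^ p) ^ (m ℕ.* d) ≡ (a ^ m) ^ (p ℕ.* d)
    swap a m = trans (^-assocʳ a p (m ℕ.* d)) (trans
      (cong (a ^_) (solve 3 (λ p m d → p :* (m :* d) := m :* (p :* d)) refl p m d)) (sym (^-assocʳ a m (p ℕ.* d))))

  ·-distribˡ-+ : ∀ q x y → q · (x + y) ≈ q · x + q · y
  ·-distribˡ-+ q x y = ≈-intro {q · (x + y)} {q · x + q · y} (begin
    ((a ^ m * b ^ n) ^ p) ^ (n ℕ.* d ℕ.* (m ℕ.* d))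
      ≡⟨ cong (_^ (n ℕ.* d ℕ.* (m ℕ.* d))) (^-pair a b m n p) ⟩
    (a ^ (m ℕ.* p) * b ^ (n ℕ.* p)) ^ (n ℕ.* d ℕ.* (m ℕ.* d))
      ≡⟨ ^-pair a b (m ℕ.* p) (n ℕ.* p) _ ⟩
    a ^ (m ℕ.* p ℕ.* (n ℕ.* d ℕ.* (m ℕ.* d))) * b ^ (n ℕ.* p ℕ.* (n ℕ.* d ℕ.* (m ℕ.* d)))
      ≡⟨ cong₂ (λ i j → a ^ i * b ^ j)
           (solve 4 (λ n m p d → m :* p :* (n :* d :* (m :* d)) := p :* (m :* d) :* (n :* m :* d)) refl n m p d)
           (solve 4 (λ n m p d → n :* p :* (n :* d :* (m :* d)) := p :* (n :* d) :* (n :* m :* d)) refl n m p d) ⟩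
    a ^ (p ℕ.* (m ℕ.* d) ℕ.* (n ℕ.* m ℕ.* d)) * b ^ (p ℕ.* (n ℕ.* d) ℕ.* (n ℕ.* m ℕ.* d))
      ≡⟨ ^-pair a b (p ℕ.* (m ℕ.* d)) (p ℕ.* (n ℕ.* d)) _ ⟨
    (a ^ (p ℕ.* (m ℕ.* d)) * b ^ (p ℕ.* (n ℕ.* d))) ^ (n ℕ.* m ℕ.* d)
      ≡⟨ cong (_^ (n ℕ.* m ℕ.* d)) (cong₂ _*_ (^-assocʳ a p (m ℕ.* d)) (^-assocʳ b p (n ℕ.* d))) ⟨
    ((a ^ p) ^ (m ℕ.* d) * (b ^ p) ^ (n ℕ.* d)) ^ (n ℕ.* m ℕ.* d) ∎)
    where
    open ≡-Reasoning
    a = base x ; b = base y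
    n = degree x ; m = degree y
    p = ℤ.∣ ↥ q ∣
    d = ↧ₙ q

  ·-distribʳ-+ : ∀ {q r} x → 0ℚ ℚ.≤ q → 0ℚ ℚ.≤ r → (q ℚ.+ r) · x ≈ q · x + r · x
  ·-distribʳ-+ {q} {r} x 0≤q 0≤r = ≈-intro {(q ℚ.+ r) · x} {q · x + r · x} (begin
    (a ^ P) ^ (n ℕ.* d ℕ.* (n ℕ.* e))
      ≡⟨ ^-assocʳ a P _ ⟩
    a ^ (P ℕ.* (n ℕ.* d ℕ.* (n ℕ.* e)))
      ≡⟨ cong (a ^_) (trans (solve 4 (λ P n d e → P :* (n :* d :* (n :* e)) := n :* n :* (P :* (d :* e))) refl P n d e)
          (trans (cong (n ℕ.* n ℕ.*_) key)
            (solve 6 (λ n p t d e D → n :* n :* ((p :* e :+ t :* d) :* D) := p :* (n :* e) :* (n :* D) :+ t :* (n :* d) :* (n :* D)) refl n p t d e D))) ⟩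
    a ^ (p ℕ.* (n ℕ.* e) ℕ.* (n ℕ.* D) ℕ.+ t ℕ.* (n ℕ.* d) ℕ.* (n ℕ.* D))
      ≡⟨ ^-homo-* a (p ℕ.* (n ℕ.* e) ℕ.* (n ℕ.* D)) (t ℕ.* (n ℕ.* d) ℕ.* (n ℕ.* D)) ⟩
    a ^ (p ℕ.* (n ℕ.* e) ℕ.* (n ℕ.* D)) * a ^ (t ℕ.* (n ℕ.* d) ℕ.* (n ℕ.* D))
      ≡⟨ ^-pair a a (p ℕ.* (n ℕ.* e)) (t ℕ.* (n ℕ.* d)) (n ℕ.* D) ⟨
    (a ^ (p ℕ.* (n ℕ.* e)) * a ^ (t ℕ.* (n ℕ.* d))) ^ (n ℕ.* D)
      ≡⟨ cong (_^ (n ℕ.* D)) (cong₂ _*_ (^-assocʳ a p (n ℕ.* e)) (^-assocʳ a t (n ℕ.* d))) ⟨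
    ((a ^ p) ^ (n ℕ.* e) * (a ^ t) ^ (n ℕ.* d)) ^ (n ℕ.* D) ∎)
    where
    open ≡-Reasoning
    a = base x
    n = degree x
    P = ℤ.∣ ↥ (q ℚ.+ r) ∣ ; p = ℤ.∣ ↥ q ∣ ; t = ℤ.∣ ↥ r ∣
    D = ↧ₙ (q ℚ.+ r) ; d = ↧ₙ q ; e = ↧ₙ r
    key : P ℕ.* (d ℕ.* e) ≡ (p ℕ.* e ℕ.+ t ℕ.* d) ℕ.* D
    key = cross (0≤+ 0≤q 0≤r) (p ℕ.* e ℕ.+ t ℕ.* d) (d ℕ.* e) (begin
      nat (d ℕ.* e) * (q ℚ.+ r)                   ≡⟨ cong (_* (q ℚ.+ r)) (nat-* d e) ⟩
      nat d * nat e * (q ℚ.+ r)                 ≡⟨ S.solve 4 (λ d e q r → d S.:* e S.:* (q S.:+ r) S.:= (d S.:* q) S.:* e S.:+ (e S.:* r) S.:* d) refl (nat d) (nat e) q r ⟩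
      nat d * q * nat e ℚ.+ nat e * r * nat d ≡⟨ cong₂ (λ u v → u * nat e ℚ.+ v * nat d) (denominator* 0≤q) (denominator* 0≤r) ⟩
      nat p * nat e ℚ.+ nat t * nat d           ≡⟨ cong₂ ℚ._+_ (nat-* p e) (nat-* t d) ⟨
      nat (p ℕ.* e) ℚ.+ nat (t ℕ.* d)               ≡⟨ nat-+ (p ℕ.* e) (t ℕ.* d) ⟨
      nat (p ℕ.* e ℕ.+ t ℕ.* d)                     ∎)
      where module S = ℚ.+-*-Solver

  ·-assoc : ∀ {q r} x → 0ℚ ℚ.≤ q → 0ℚ ℚ.≤ r → (q * r) · x ≈ q · (r · x)
  ·-assoc {q} {r} x 0≤q 0≤r = ≈-intro {(q * r) · x} {q · (r · x)} (begin
    (a ^ P) ^ (n ℕ.* e ℕ.* d)       ≡⟨ ^-assocʳ a P _ ⟩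
    a ^ (P ℕ.* (n ℕ.* e ℕ.* d))     ≡⟨ cong (a ^_) (trans (solve 4 (λ P n d e → P :* (n :* e :* d) := n :* (P :* (d :* e))) refl P n d e)
                                         (trans (cong (n ℕ.*_) key) (solve 4 (λ n p t D → n :* (p :* t :* D) := t :* (p :* (n :* D))) refl n p t D))) ⟩
    a ^ (t ℕ.* (p ℕ.* (n ℕ.* D)))   ≡⟨ ^-assocʳ a t _ ⟨
    (a ^ t) ^ (p ℕ.* (n ℕ.* D))     ≡⟨ ^-assocʳ (a ^ t) p _ ⟨
    ((a ^ t) ^ p) ^ (n ℕ.* D)       ∎)
    where
    open ≡-Reasoning
    a = base x
    n = degree x
    P = ℤ.∣ ↥ (q * r) ∣ ; p = ℤ.∣ ↥ q ∣ ; t = ℤ.∣ ↥ r ∣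
    D = ↧ₙ (q * r) ; d = ↧ₙ q ; e = ↧ₙ r
    key : P ℕ.* (d ℕ.* e) ≡ p ℕ.* t ℕ.* D
    key = cross (0≤* 0≤q 0≤r) (p ℕ.* t) (d ℕ.* e) (begin
      nat (d ℕ.* e) * (q * r)         ≡⟨ cong (_* (q * r)) (nat-* d e) ⟩
      nat d * nat e * (q * r)       ≡⟨ S.solve 4 (λ d e q r → d S.:* e S.:* (q S.:* r) S.:= (d S.:* q) S.:* (e S.:* r)) refl (nat d) (nat e) q r ⟩
      (nat d * q) * (nat e * r)     ≡⟨ cong₂ _*_ (denominator* 0≤q) (denominator* 0≤r) ⟩
      nat p * nat t                     ≡⟨ nat-* p t ⟨
      nat (p ℕ.* t)                       ∎)
      where module S = ℚ.+-*-Solver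

  ·-identity : ∀ x → 1ℚ · x ≈ x
  ·-identity x = ≈-intro {1ℚ · x} {x} (cong₂ _^_ (ℚ.*-identityʳ (base x)) (sym (ℕ.*-identityʳ (degree x))))

  ·-zero : ∀ x → 0ℚ · x ≈ 0ᴿ
  ·-zero x = ≈-intro {0ℚ · x} {0ᴿ} (trans (ℚ.*-identityʳ 1ℚ) (sym (1^ (degree x ℕ.* 1))))

  -- Outside of its domain log has the junk value 0.
  log : ℚ → Root
  log q with 0ℚ ℚ.<? q
  ... | yes 0<q = root q 0 0<q
  ... | no  _   = 0ᴿ

  log-view : ∀ {q} (0<q : 0ℚ < q) → ∃[ 0<q′ ] log q ≡ root q 0 0<q′
  log-view {q} 0<q with 0ℚ ℚ.<? q
  ... | yes 0<q′ = 0<q′ , refl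
  ... | no  0≮q  = contradiction 0<q 0≮q

  log-mono : ∀ {p q} → 0ℚ < p → p ℚ.≤ q → log p ≤ log q
  log-mono {p} {q} 0<p p≤q with log p | log-view 0<p | log q | log-view (ℚ.<-≤-trans 0<p p≤q)
  ... | _ | _ , refl | _ | _ , refl = subst₂ ℚ._≤_ (sym (ℚ.*-identityʳ p)) (sym (ℚ.*-identityʳ q)) p≤q

  log-cancel : ∀ {p q} → 0ℚ < p → 0ℚ < q → log p ≤ log q → p ℚ.≤ q
  log-cancel {p} {q} 0<p 0<q h with log p | log-view 0<p | log q | log-view 0<q
  ... | _ | _ , refl | _ | _ , refl = subst₂ ℚ._≤_ (ℚ.*-identityʳ p) (ℚ.*-identityʳ q) h

  log-* : ∀ {p q} → 0ℚ < p → 0ℚ < q → log (p * q) ≈ log p + log q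
  log-* {p} {q} 0<p 0<q with log p | log-view 0<p | log q | log-view 0<q | log (p * q) | log-view (0<* 0<p 0<q)
  ... | _ | 0<p′ , refl | _ | 0<q′ , refl | _ | 0<pq , refl =
    ≈-intro {root (p * q) 0 0<pq} {root p 0 0<p′ + root q 0 0<q′}
      (cong (_* 1ℚ) (cong₂ _*_ (sym (ℚ.*-identityʳ p)) (sym (ℚ.*-identityʳ q))))

  log-1 : log 1ℚ ≈ 0ᴿ
  log-1 = ≈-refl {0ᴿ}

  -- With w = m / N, clearing the degrees leaves a ^ m ≤ (1 + w (a - 1)) ^ N, which is `am-gm` for k
  -- = N - m.
  log-concave : ∀ {w a} → 0ℚ ℚ.≤ w → w ℚ.≤ 1ℚ → 0ℚ < a → 0ℚ < 1ℚ ℚ.+ w * (a ℚ.- 1ℚ) →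
                w · log a ≤ log (1ℚ ℚ.+ w * (a ℚ.- 1ℚ))
  log-concave {w} {a} 0≤w w≤1 0<a 0<c with log a | log-view 0<a | log (1ℚ ℚ.+ w * (a ℚ.- 1ℚ)) | log-view 0<c
  ... | _ | _ , refl | _ | _ , refl = subst₂ ℚ._≤_ (sym (ℚ.*-identityʳ (a ^ m)))
        (cong₂ _^_ eq (trans k+m≡N (sym (ℕ.*-identityˡ N)))) (am-gm 0<a m k)
    where
    open ≡-Reasoning
    module S = ℚ.+-*-Solver
    m = ℤ.∣ ↥ w ∣
    N = ↧ₙ w
    m≤N : m ℕ.≤ N
    m≤N = nat-cancel (subst₂ ℚ._≤_ (denominator* 0≤w) (ℚ.*-identityʳ (nat N)) (*-monoˡ (nat N) (0≤nat N) w≤1))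
    k = N ℕ.∸ m
    k+m≡N : k ℕ.+ m ≡ N
    k+m≡N = ℕ.m∸n+n≡m m≤N
    eq : inv (nat (k ℕ.+ m)) * (nat (k ℕ.+ m) ℚ.+ nat m * (a ℚ.- 1ℚ)) ≡ 1ℚ ℚ.+ w * (a ℚ.- 1ℚ)
    eq = begin
      inv (nat (k ℕ.+ m)) * (nat (k ℕ.+ m) ℚ.+ nat m * (a ℚ.- 1ℚ))
        ≡⟨ cong₂ (λ N m → inv (nat N) * (nat N ℚ.+ m * (a ℚ.- 1ℚ))) k+m≡N (sym (denominator* 0≤w)) ⟩
      inv (nat N) * (nat N ℚ.+ (nat N * w) * (a ℚ.- 1ℚ))
        ≡⟨ S.solve 4 (λ i n w a → i S.:* (n S.:+ (n S.:* w) S.:* a) S.:= (n S.:* i) S.:* (S.con 1ℚ S.:+ w S.:* a)) refl (inv (nat N)) (nat N) w (a ℚ.- 1ℚ) ⟩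
      (nat N * inv (nat N)) * (1ℚ ℚ.+ w * (a ℚ.- 1ℚ))
        ≡⟨ cong (_* (1ℚ ℚ.+ w * (a ℚ.- 1ℚ))) (*-inv (<⇒≢0 (0<nat (ℚ.denominator-1 w)))) ⟩
      1ℚ * (1ℚ ℚ.+ w * (a ℚ.- 1ℚ))
        ≡⟨ ℚ.*-identityˡ _ ⟩
      1ℚ ℚ.+ w * (a ℚ.- 1ℚ) ∎

  -- By Bernoulli's inequality some power of b exceeds the base of x; raising it further to the
  -- degree of x only helps, as it is at least 1.
  archimedean : ∀ x {b} → 1ℚ < b → ∃[ t ] x ≤ log (b ^ t)
  archimedean x {b} 1<b with archimedean-ℚ {b ℚ.- 1ℚ} (base x) (subst (_< b ℚ.- 1ℚ) (ℚ.+-inverseʳ 1ℚ) (ℚ.+-monoˡ-< (ℚ.- 1ℚ) 1<b))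
  ... | t , a≤ = t , subst (x ≤_) (sym (proj₂ (log-view (0<^ t (ℚ.<-trans 0<1 1<b))))) (begin
      base x ^ 1           ≡⟨ ℚ.*-identityʳ (base x) ⟩
      base x               ≤⟨ a≤b^t ⟩
      b ^ t                ≡⟨ ℚ.*-identityʳ _ ⟨
      b ^ t * 1ℚ          ≤⟨ *-monoˡ (b ^ t) (0≤^ t (ℚ.<⇒≤ 0<b)) (1≤^ (degree-1 x) (1≤^ t (ℚ.<⇒≤ 1<b))) ⟩
      (b ^ t) ^ degree x   ∎)
    where
    open ℚ.≤-Reasoning
    0<b = ℚ.<-trans 0<1 1<b
    1≤^ : ∀ {b} t → 1ℚ ℚ.≤ b → 1ℚ ℚ.≤ b ^ t
    1≤^ {b} t 1≤b = subst (ℚ._≤ b ^ t) (1^ t) (^-mono-≤ t 0≤1 1≤b)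
    b-1 = b ℚ.- 1ℚ
    a≤b^t : base x ℚ.≤ b ^ t
    a≤b^t = begin
      base x                       ≤⟨ a≤ ⟩
      nat t * b-1                ≡⟨ ℚ.+-identityˡ _ ⟨
      0ℚ ℚ.+ nat t * b-1         ≤⟨ ℚ.+-monoˡ-≤ (nat t * b-1) 0≤1 ⟩
      1ℚ ℚ.+ nat t * b-1         ≤⟨ bernoulli t (≤-to-diff (ℚ.<⇒≤ 1<b)) ⟩
      (1ℚ ℚ.+ b-1) ^ t             ≡⟨ cong (_^ t) (ℚ.+-*-Solver.solve 1 (λ b → ℚ.+-*-Solver.con 1ℚ ℚ.+-*-Solver.:+ (b ℚ.+-*-Solver.:- ℚ.+-*-Solver.con 1ℚ) ℚ.+-*-Solver.:= b) refl b) ⟩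
      b ^ t                        ∎

  orderedGroup : OrderedGroup
  orderedGroup = record
    { abelianGroup = record
      { Carrier = Root ; _≈_ = _≈_ ; _∙_ = _+_ ; ε = 0ᴿ ; _⁻¹ = -_
      ; isAbelianGroup = record
        { isGroup = record
          { isMonoid = record
            { isSemigroup = record
              { isMagma = record
                { isEquivalence = record
                  { refl = λ {x} → ≈-refl {x} ; sym = λ {x y} → ≈-sym {x} {y} ; trans = λ {x y z} → ≈-trans {x} {y} {z} }
                ; ∙-cong = λ {x y u v} → +-cong {x} {y} {u} {v} }
              ; assoc = +-assoc }
            ; identity = (λ x → ≈-trans {0ᴿ + x} {x + 0ᴿ} {x} (+-comm 0ᴿ x) (+-identityʳ x)) , +-identityʳ }
          ; inverse = (λ x → ≈-trans {(- x) + x} {x + (- x)} {0ᴿ} (+-comm (- x) x) (+-inverseʳ x)) , +-inverseʳ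
          ; ⁻¹-cong = λ {x y} → neg-cong {x} {y} }
        ; comm = +-comm } }
    ; _≤_ = _≤_
    ; ≤-reflexive = proj₁
    ; ≤-antisym = _,_
    ; ≤-trans = λ {x y z} → ≤-trans {x} {y} {z}
    ; +-monoˡ-≤ = λ z {x y} → +-monoˡ-≤ z {x} {y}
    ; ≤-total = ≤-total
    }

-- The logarithm behind an abstract interface.

module Logarithms where

  open import Data.Product.Base using (∃-syntax)
  open import Data.Rational.Base as ℚ using (ℚ; 0ℚ; 1ℚ)
  open LinearInequalities using (OrderedGroup)
  open RationalLemmas using (_^_)
  module Model = LogarithmModel

  record Logarithm : Set₁ where
    field
      orderedGroup : OrderedGroup
    open OrderedGroup orderedGroup
    infixr 7 _·_
    field
      _·_         : ℚ → Carrier → Carrier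
      ·-mono      : ∀ q {x y} → x ≤ y → q · x ≤ q · y
      ·-distribˡ  : ∀ q x y → q · (x + y) ≈ q · x + q · y
      ·-distribʳ  : ∀ {q r} x → 0ℚ ℚ.≤ q → 0ℚ ℚ.≤ r → (q ℚ.+ r) · x ≈ q · x + r · x
      ·-assoc     : ∀ {q r} x → 0ℚ ℚ.≤ q → 0ℚ ℚ.≤ r → (q ℚ.* r) · x ≈ q · (r · x)
      1·          : ∀ x → 1ℚ · x ≈ x
      0·          : ∀ x → 0ℚ · x ≈ 0#
      log         : ℚ → Carrier
      log-mono    : ∀ {p q} → 0ℚ ℚ.< p → p ℚ.≤ q → log p ≤ log q
      log-cancel  : ∀ {p q} → 0ℚ ℚ.< p → 0ℚ ℚ.< q → log p ≤ log q → p ℚ.≤ q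
      log-*       : ∀ {p q} → 0ℚ ℚ.< p → 0ℚ ℚ.< q → log (p ℚ.* q) ≈ log p + log q
      log-1       : log 1ℚ ≈ 0#
      -- Concavity for the two points 1 and a only; the general case follows by homogeneity and
      -- induction.
      log-concave : ∀ {w a} → 0ℚ ℚ.≤ w → w ℚ.≤ 1ℚ → 0ℚ ℚ.< a → 0ℚ ℚ.< 1ℚ ℚ.+ w ℚ.* (a ℚ.- 1ℚ) →
                    w · log a ≤ log (1ℚ ℚ.+ w ℚ.* (a ℚ.- 1ℚ))
      archimedean : ∀ x {b} → 1ℚ ℚ.< b → ∃[ t ] x ≤ log (b ^ t)

  abstract
    -- Sealed, so that entropies are never unfolded into powers of rationals.
    logarithm : Logarithm
    logarithm = record
      { orderedGroup = Model.orderedGroup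
      ; _·_          = Model._·_
      ; ·-mono       = λ q {x y} → Model.·-mono-≤ q {x} {y}
      ; ·-distribˡ   = Model.·-distribˡ-+
      ; ·-distribʳ   = Model.·-distribʳ-+
      ; ·-assoc      = Model.·-assoc
      ; 1·           = Model.·-identity
      ; 0·           = Model.·-zero
      ; log          = Model.log
      ; log-mono     = Model.log-mono
      ; log-cancel   = Model.log-cancel
      ; log-*        = Model.log-*
      ; log-1        = Model.log-1
      ; log-concave  = Model.log-concave
      ; archimedean  = Model.archimedean
      }

-- Finite measures, expectations and Jensen's inequality.

module Expectations where

  open import Algebra.Bundles using (CommutativeMonoid)
  import Algebra.Properties.CommutativeSemigroup as CommutativeSemigroupProperties
  open import Data.List.Base using (List; []; _∷_; cartesianProduct; map; _++_)
  open import Data.List.Membership.Propositional using (_∈_)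
  open import Data.List.Relation.Unary.Any using (here; there)
  open import Data.Product.Base using (_×_; _,_; proj₂)
  open import Data.Rational.Base as ℚ using (ℚ; 0ℚ; 1ℚ; _*_; _<_)
  import Data.Rational.Properties as ℚ
  import Data.Rational.Solver as ℚ
  open import Data.Sum.Base using (_⊎_; inj₁; inj₂)
  open import Level using (0ℓ)
  open import Relation.Binary.PropositionalEquality as ≡ using (_≡_; refl; cong; cong₂; subst)
  import Relation.Binary.Reasoning.Setoid as SetoidReasoning
  open import Relation.Nullary using (yes; no; contradiction)
  open LinearInequalities using (OrderedGroup; module LinearSolver)
  open Logarithms using (Logarithm; logarithm)
  open RationalLemmas

  -- Scaling by a negative number is junk.
  record Semimodule : Set₁ where
    field
      commutativeMonoid : CommutativeMonoid 0ℓ 0ℓ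
    open CommutativeMonoid commutativeMonoid public
      using (Carrier; _≈_; setoid)
      renaming (_∙_ to infixl 6 _+_; ε to 0#; refl to ≈-refl; sym to ≈-sym; trans to ≈-trans; ∙-cong to +-cong;
        assoc to +-assoc; comm to +-comm; identityˡ to +-identityˡ; identityʳ to +-identityʳ; commutativeSemigroup to +-commutativeSemigroup)
    infixr 7 _·_
    field
      _·_        : ℚ → Carrier → Carrier
      ·-congʳ    : ∀ q {x y} → x ≈ y → q · x ≈ q · y
      ·-distribˡ : ∀ q x y → q · (x + y) ≈ q · x + q · y
      ·-distribʳ : ∀ {q r} x → 0ℚ ℚ.≤ q → 0ℚ ℚ.≤ r → (q ℚ.+ r) · x ≈ q · x + r · x
      ·-assoc    : ∀ {q r} x → 0ℚ ℚ.≤ q → 0ℚ ℚ.≤ r → (q * r) · x ≈ q · (r · x)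
      1·         : ∀ x → 1ℚ · x ≈ x
      0·         : ∀ x → 0ℚ · x ≈ 0#
    ·-congˡ : ∀ {q r} x → q ≡ r → q · x ≈ r · x
    ·-congˡ x refl = ≈-refl

    ·-zeroʳ : ∀ {q} → 0ℚ ℚ.≤ q → q · 0# ≈ 0#
    ·-zeroʳ {q} 0≤q = ≈-trans (·-congʳ q (≈-sym (0· 0#)))
      (≈-trans (≈-sym (·-assoc 0# 0≤q ℚ.≤-refl)) (≈-trans (·-congˡ 0# (ℚ.*-zeroʳ q)) (0· 0#)))

  ℚ-semimodule : Semimodule
  ℚ-semimodule = record
    { commutativeMonoid = ℚ.+-0-commutativeMonoid
    ; _·_        = _*_
    ; ·-congʳ    = λ q → cong (q *_)
    ; ·-distribˡ = ℚ.*-distribˡ-+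
    ; ·-distribʳ = λ {q} {r} x _ _ → ℚ.*-distribʳ-+ x q r
    ; ·-assoc    = λ {q} {r} x _ _ → ℚ.*-assoc q r x
    ; 1·         = ℚ.*-identityˡ
    ; 0·         = ℚ.*-zeroˡ
    }

  -- A point may be listed several times; its weight then counts each time.
  record Measure : Set₁ where
    field
      Ω        : Set
      points   : List Ω
      weight   : Ω → ℚ
      0≤weight : ∀ ω → 0ℚ ℚ.≤ weight ω

  open Measure public

  Support : (μ : Measure) → Ω μ → Set
  Support μ ω = ω ∈ points μ × 0ℚ < weight μ ω

  module Expectation (M : Semimodule) where
    open Semimodule M
    open SetoidReasoning setoid
    open CommutativeSemigroupProperties +-commutativeSemigroup using (interchange)

    sum : ∀ {I : Set} → List I → (I → Carrier) → Carrier
    sum []       f = 0#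
    sum (i ∷ is) f = f i + sum is f

    sum-cong : ∀ {I : Set} (is : List I) {f g : I → Carrier} → (∀ i → i ∈ is → f i ≈ g i) → sum is f ≈ sum is g
    sum-cong []       f≈g = ≈-refl
    sum-cong (i ∷ is) f≈g = +-cong (f≈g i (here refl)) (sum-cong is λ j j∈is → f≈g j (there j∈is))

    sum-zero : ∀ {I : Set} (is : List I) → sum is (λ _ → 0#) ≈ 0#
    sum-zero []       = ≈-refl
    sum-zero (i ∷ is) = ≈-trans (+-identityˡ _) (sum-zero is)

    sum-+ : ∀ {I : Set} (is : List I) (f g : I → Carrier) → sum is (λ i → f i + g i) ≈ sum is f + sum is g
    sum-+ []       f g = ≈-sym (+-identityˡ 0#)
    sum-+ (i ∷ is) f g = ≈-trans (+-cong ≈-refl (sum-+ is f g)) (interchange _ _ _ _)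

    sum-· : ∀ {I : Set} (is : List I) {q} → 0ℚ ℚ.≤ q → (f : I → Carrier) → sum is (λ i → q · f i) ≈ q · sum is f
    sum-· []       0≤q f = ≈-sym (·-zeroʳ 0≤q)
    sum-· (i ∷ is) 0≤q f = ≈-trans (+-cong ≈-refl (sum-· is 0≤q f)) (≈-sym (·-distribˡ _ _ _))

    sum-swap : ∀ {I J : Set} (is : List I) (js : List J) (f : I → J → Carrier) →
               sum is (λ i → sum js (f i)) ≈ sum js (λ j → sum is (λ i → f i j))
    sum-swap []       js f = ≈-sym (sum-zero js)
    sum-swap (i ∷ is) js f = ≈-trans (+-cong ≈-refl (sum-swap is js f)) (≈-sym (sum-+ js _ _))

    sum-++ : ∀ {I : Set} (is js : List I) f → sum (is ++ js) f ≈ sum is f + sum js f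
    sum-++ []       js f = ≈-sym (+-identityˡ _)
    sum-++ (i ∷ is) js f = ≈-trans (+-cong ≈-refl (sum-++ is js f)) (≈-sym (+-assoc _ _ _))

    sum-map : ∀ {I J : Set} (h : I → J) is f → sum (map h is) f ≈ sum is (λ i → f (h i))
    sum-map h []       f = ≈-refl
    sum-map h (i ∷ is) f = +-cong ≈-refl (sum-map h is f)

    sum-product : ∀ {I J : Set} (is : List I) (js : List J) f →
                  sum (cartesianProduct is js) f ≈ sum is (λ i → sum js (λ j → f (i , j)))
    sum-product []       js f = ≈-refl
    sum-product (i ∷ is) js f = ≈-trans (sum-++ (map (i ,_) js) (cartesianProduct is js) f)
      (+-cong (sum-map (i ,_) js f) (sum-product is js f))

    E : (μ : Measure) → (Ω μ → Carrier) → Carrier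
    E μ f = sum (points μ) (λ ω → weight μ ω · f ω)

    -- Points of weight 0 contribute 0 whatever the values are. Logarithms of probabilities can
    -- therefore be treated on the support, where the probabilities are positive.
    E-cong : ∀ μ {f g : Ω μ → Carrier} → (∀ ω → Support μ ω → f ω ≈ g ω) → E μ f ≈ E μ g
    E-cong μ {f} {g} f≈g = sum-cong (points μ) lemma
      where
      lemma : ∀ ω → ω ∈ points μ → weight μ ω · f ω ≈ weight μ ω · g ω
      lemma ω ω∈ with weight μ ω ℚ.≟ 0ℚ
      ... | yes w≡0 = ≈-trans (·-congˡ _ w≡0) (≈-trans (0· _) (≈-sym (≈-trans (·-congˡ _ w≡0) (0· _))))
      ... | no  w≢0 = ·-congʳ _ (f≈g ω (ω∈ , 0≤∧≢0⇒0< (0≤weight μ ω) w≢0))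

    E-+ : ∀ μ (f g : Ω μ → Carrier) → E μ (λ ω → f ω + g ω) ≈ E μ f + E μ g
    E-+ μ f g = ≈-trans (sum-cong (points μ) (λ ω _ → ·-distribˡ _ _ _)) (sum-+ (points μ) _ _)

    ·-comm : ∀ {q r} x → 0ℚ ℚ.≤ q → 0ℚ ℚ.≤ r → q · (r · x) ≈ r · (q · x)
    ·-comm {q} {r} x 0≤q 0≤r = ≈-trans (≈-sym (·-assoc x 0≤q 0≤r)) (≈-trans (·-congˡ x (ℚ.*-comm q r)) (·-assoc x 0≤r 0≤q))

    E-· : ∀ μ {q} → 0ℚ ℚ.≤ q → (f : Ω μ → Carrier) → E μ (λ ω → q · f ω) ≈ q · E μ f
    E-· μ 0≤q f = ≈-trans (sum-cong (points μ) (λ ω _ → ·-comm (f ω) (0≤weight μ ω) 0≤q)) (sum-· (points μ) 0≤q _)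

    E-swap : ∀ μ ν (f : Ω μ → Ω ν → Carrier) →
             E μ (λ ω → E ν (f ω)) ≈ E ν (λ ψ → E μ (λ ω → f ω ψ))
    E-swap μ ν f = begin
      sum (points μ) (λ ω → weight μ ω · sum (points ν) (λ ψ → weight ν ψ · f ω ψ))
        ≈⟨ sum-cong (points μ) (λ ω _ → sum-· (points ν) (0≤weight μ ω) _) ⟨
      sum (points μ) (λ ω → sum (points ν) (λ ψ → weight μ ω · (weight ν ψ · f ω ψ)))
        ≈⟨ sum-swap (points μ) (points ν) _ ⟩
      sum (points ν) (λ ψ → sum (points μ) (λ ω → weight μ ω · (weight ν ψ · f ω ψ)))
        ≈⟨ sum-cong (points ν) (λ ψ _ → sum-cong (points μ) (λ ω _ → ·-comm (f ω ψ) (0≤weight μ ω) (0≤weight ν ψ))) ⟩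
      sum (points ν) (λ ψ → sum (points μ) (λ ω → weight ν ψ · (weight μ ω · f ω ψ)))
        ≈⟨ sum-cong (points ν) (λ ψ _ → sum-· (points μ) (0≤weight ν ψ) _) ⟩
      sum (points ν) (λ ψ → weight ν ψ · sum (points μ) (λ ω → weight μ ω · f ω ψ)) ∎

    E-zero : ∀ μ → E μ (λ _ → 0#) ≈ 0#
    E-zero μ = ≈-trans (sum-cong (points μ) (λ ω _ → ·-zeroʳ (0≤weight μ ω))) (sum-zero (points μ))

  module 𝔼 = Expectation ℚ-semimodule
  open 𝔼 public using (E)

  total : Measure → ℚ
  total μ = E μ (λ _ → 1ℚ)

  IsProbability : Measure → Set
  IsProbability μ = total μ ≡ 1ℚ

  module ScalarExpectation (M : Semimodule) where
    open Semimodule M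
    module F = Expectation M

    -- The sign of the partial sum is carried along because `·-distribʳ` asks for it.
    sum-·ʳ : ∀ {I : Set} (is : List I) (h : I → ℚ) → (∀ i → 0ℚ ℚ.≤ h i) → ∀ x →
             0ℚ ℚ.≤ 𝔼.sum is h × F.sum is (λ i → h i · x) ≈ 𝔼.sum is h · x
    sum-·ʳ []       h 0≤h x = ℚ.≤-refl , ≈-sym (0· x)
    sum-·ʳ (i ∷ is) h 0≤h x with sum-·ʳ is h 0≤h x
    ... | 0≤s , eq = 0≤+ (0≤h i) 0≤s , ≈-trans (+-cong ≈-refl eq) (≈-sym (·-distribʳ x (0≤h i) 0≤s))

    E-·ʳ : ∀ μ (h : Ω μ → ℚ) → (∀ ω → 0ℚ ℚ.≤ h ω) → ∀ x → F.E μ (λ ω → h ω · x) ≈ E μ h · x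
    E-·ʳ μ h 0≤h x = ≈-trans (F.sum-cong (points μ) (λ ω _ → ≈-sym (·-assoc x (0≤weight μ ω) (0≤h ω))))
      (proj₂ (sum-·ʳ (points μ) (λ ω → weight μ ω * h ω) (λ ω → 0≤* (0≤weight μ ω) (0≤h ω)) x))

    E-const : ∀ μ → IsProbability μ → ∀ x → F.E μ (λ _ → x) ≈ x
    E-const μ total≡1 x = ≈-trans (F.E-cong μ (λ ω _ → ≈-sym (1· x)))
      (≈-trans (E-·ʳ μ (λ _ → 1ℚ) (λ _ → 0≤1) x) (≈-trans (·-congˡ x total≡1) (1· x)))

  open Logarithm logarithm public
  open LinearSolver orderedGroup public
  open OrderedGroup orderedGroup public
    using (_≈_; _≤_; _+_; -_; _-_; 0#; ≤-reflexive; ≤-trans; ≤-antisym; +-monoˡ-≤; ≤-total)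
    renaming (Carrier to 𝕃)

  open A using (∙-cong; assoc; comm; identityˡ; identityʳ)

  ≈⇒≤ : ∀ {x y} → x ≈ y → x ≤ y
  ≈⇒≤ = ≤-reflexive

  ≈⇒≥ : ∀ {x y} → x ≈ y → y ≤ x
  ≈⇒≥ x≈y = ≤-reflexive (A.sym x≈y)

  ≤-refl : ∀ {x} → x ≤ x
  ≤-refl = ≤-reflexive A.refl

  𝕃-semimodule : Semimodule
  𝕃-semimodule = record
    { commutativeMonoid = A.commutativeMonoid
    ; _·_        = _·_
    ; ·-congʳ    = λ q x≈y → ≤-antisym (·-mono q (≈⇒≤ x≈y)) (·-mono q (≈⇒≥ x≈y))
    ; ·-distribˡ = ·-distribˡ
    ; ·-distribʳ = ·-distribʳ
    ; ·-assoc    = ·-assoc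
    ; 1·         = 1·
    ; 0·         = 0·
    }

  0≤·  : ∀ {q x} → 0ℚ ℚ.≤ q → 0# ≤ x → 0# ≤ q · x
  0≤· {q} 0≤q 0≤x = ≤-trans (≈⇒≥ (Semimodule.·-zeroʳ 𝕃-semimodule 0≤q)) (·-mono q 0≤x)

  module 𝔼ᴸ = Expectation 𝕃-semimodule
  open 𝔼ᴸ public using () renaming (E to Eᴸ)

  sum-mono : ∀ {I : Set} (is : List I) {f g : I → ℚ} → (∀ i → i ∈ is → f i ℚ.≤ g i) → 𝔼.sum is f ℚ.≤ 𝔼.sum is g
  sum-mono []       f≤g = ℚ.≤-refl
  sum-mono (i ∷ is) f≤g = ℚ.+-mono-≤ (f≤g i (here refl)) (sum-mono is λ j j∈is → f≤g j (there j∈is))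

  E-mono : ∀ μ {f g : Ω μ → ℚ} → (∀ ω → Support μ ω → f ω ℚ.≤ g ω) → E μ f ℚ.≤ E μ g
  E-mono μ {f} {g} f≤g = sum-mono (points μ) lemma
    where
    lemma : ∀ ω → ω ∈ points μ → weight μ ω * f ω ℚ.≤ weight μ ω * g ω
    lemma ω ω∈ with weight μ ω ℚ.≟ 0ℚ
    ... | yes w≡0 = ℚ.≤-reflexive (≡.trans (≡.trans (cong (_* f ω) w≡0) (ℚ.*-zeroˡ (f ω)))
                      (≡.sym (≡.trans (cong (_* g ω) w≡0) (ℚ.*-zeroˡ (g ω)))))
    ... | no  w≢0 = *-monoˡ (weight μ ω) (0≤weight μ ω) (f≤g ω (ω∈ , 0≤∧≢0⇒0< (0≤weight μ ω) w≢0))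

  Eᴸ-mono : ∀ μ {f g : Ω μ → 𝕃} → (∀ ω → Support μ ω → f ω ≤ g ω) → Eᴸ μ f ≤ Eᴸ μ g
  Eᴸ-mono μ {f} {g} f≤g = sum-mono′ (points μ) lemma
    where
    sum-mono′ : ∀ is {f g : Ω μ → 𝕃} → (∀ i → i ∈ is → f i ≤ g i) → 𝔼ᴸ.sum is f ≤ 𝔼ᴸ.sum is g
    sum-mono′ []       f≤g = ≤-refl
    sum-mono′ (i ∷ is) f≤g = +-mono-≤ (f≤g i (here refl)) (sum-mono′ is λ j j∈is → f≤g j (there j∈is))
    lemma : ∀ ω → ω ∈ points μ → weight μ ω · f ω ≤ weight μ ω · g ω
    lemma ω ω∈ with weight μ ω ℚ.≟ 0ℚ
    ... | yes w≡0 rewrite w≡0 = ≤-trans (≈⇒≤ (0· (f ω))) (≈⇒≥ (0· (g ω)))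
    ... | no  w≢0 = ·-mono (weight μ ω) (f≤g ω (ω∈ , 0≤∧≢0⇒0< (0≤weight μ ω) w≢0))

  0≤E : ∀ μ {f : Ω μ → ℚ} → (∀ ω → Support μ ω → 0ℚ ℚ.≤ f ω) → 0ℚ ℚ.≤ E μ f
  0≤E μ {f} 0≤f = subst (ℚ._≤ E μ f) (𝔼.E-zero μ) (E-mono μ 0≤f)

  weight*≤E : ∀ μ {f : Ω μ → ℚ} → (∀ ω → 0ℚ ℚ.≤ f ω) → ∀ {ω} → ω ∈ points μ → weight μ ω * f ω ℚ.≤ E μ f
  weight*≤E μ {f} 0≤f ω∈ = go (points μ) ω∈
    where
    0≤term : ∀ ω → 0ℚ ℚ.≤ weight μ ω * f ω
    0≤term ω = 0≤* (0≤weight μ ω) (0≤f ω)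
    0≤sum : ∀ is → 0ℚ ℚ.≤ 𝔼.sum is (λ ω → weight μ ω * f ω)
    0≤sum []       = ℚ.≤-refl
    0≤sum (i ∷ is) = 0≤+ (0≤term i) (0≤sum is)
    go : ∀ is {ω} → ω ∈ is → weight μ ω * f ω ℚ.≤ 𝔼.sum is (λ ω → weight μ ω * f ω)
    go (i ∷ is) (here refl) = p≤p+q (weight μ i * f i) (0≤sum is)
    go (i ∷ is) (there ω∈)  = ℚ.≤-trans (go is ω∈) (q≤p+q (𝔼.sum is (λ ω → weight μ ω * f ω)) (0≤term i))

  -- `log-concave` for a / m in place of a, with log m added to both sides.
  jensen₂ : ∀ {s a m} → 0ℚ ℚ.≤ s → s ℚ.≤ 1ℚ → 0ℚ < a → 0ℚ < m → 0ℚ < m ℚ.+ s * (a ℚ.- m) →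
            s · log a + (1ℚ ℚ.- s) · log m ≤ log (m ℚ.+ s * (a ℚ.- m))
  jensen₂ {s} {a} {m} 0≤s s≤1 0<a 0<m 0<c = ≤-trans (≈⇒≤ eq₁) (≤-trans
    (+-monoˡ-≤ (log m) (log-concave 0≤s s≤1 0<b 0<d)) (≈⇒≤ eq₂))
    where
    open ≡.≡-Reasoning
    module S = ℚ.+-*-Solver
    module L = SetoidReasoning A.setoid
    b = a * inv m
    d = 1ℚ ℚ.+ s * (b ℚ.- 1ℚ)
    0<b : 0ℚ < b
    0<b = 0<* 0<a (0<inv 0<m)
    mb≡a : m * b ≡ a
    mb≡a = ≡.trans (S.solve 3 (λ m a i → m S.:* (a S.:* i) S.:= a S.:* (m S.:* i)) refl m a (inv m))
      (≡.trans (cong (a *_) (*-inv (<⇒≢0 0<m))) (ℚ.*-identityʳ a))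
    md≡c : d * m ≡ m ℚ.+ s * (a ℚ.- m)
    md≡c = ≡.trans (S.solve 3 (λ m s b → (S.con 1ℚ S.:+ s S.:* (b S.:- S.con 1ℚ)) S.:* m S.:= m S.:+ s S.:* (m S.:* b S.:- m)) refl m s b)
      (cong (λ t → m ℚ.+ s * (t ℚ.- m)) mb≡a)
    0<d : 0ℚ < d
    0<d = subst (0ℚ <_) (≡.trans (cong (_* inv m) (≡.sym md≡c))
        (≡.trans (ℚ.*-assoc d m (inv m)) (≡.trans (cong (d *_) (*-inv (<⇒≢0 0<m))) (ℚ.*-identityʳ d))))
      (0<* 0<c (0<inv 0<m))
    0≤1-s : 0ℚ ℚ.≤ 1ℚ ℚ.- s
    0≤1-s = ≤-to-diff s≤1
    module M = Semimodule 𝕃-semimodule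
    eq₁ : s · log a + (1ℚ ℚ.- s) · log m ≈ s · log b + log m
    eq₁ = L.begin
      s · log a + (1ℚ ℚ.- s) · log m                 L.≈⟨ ∙-cong (M.·-congʳ s (A.trans (A.reflexive (cong log (≡.sym mb≡a))) (log-* 0<m 0<b))) A.refl ⟩
      s · (log m + log b) + (1ℚ ℚ.- s) · log m       L.≈⟨ ∙-cong (A.trans (·-distribˡ s _ _) (comm _ _)) A.refl ⟩
      (s · log b + s · log m) + (1ℚ ℚ.- s) · log m   L.≈⟨ assoc _ _ _ ⟩
      s · log b + (s · log m + (1ℚ ℚ.- s) · log m)   L.≈⟨ ∙-cong A.refl (·-distribʳ (log m) 0≤s 0≤1-s) ⟨
      s · log b + (s ℚ.+ (1ℚ ℚ.- s)) · log m         L.≈⟨ ∙-cong A.refl (A.trans (A.reflexive (cong (_· log m)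
                                                            (S.solve 1 (λ s → s S.:+ (S.con 1ℚ S.:- s) S.:= S.con 1ℚ) refl s))) (1· _)) ⟩
      s · log b + log m                              L.∎
    eq₂ : log d + log m ≈ log (m ℚ.+ s * (a ℚ.- m))
    eq₂ = A.trans (A.sym (log-* 0<d 0<m)) (A.reflexive (cong log md≡c))

  -- An induction over the points meets weights that do not sum to 1, so their total is part of the
  -- statement, which degenerates when it is 0. In the main step `jensen₂` joins the new value, of
  -- relative weight s = w i / W′, to the mean m of the others.
  jensen-sum : ∀ {I : Set} (is : List I) (w f : I → ℚ) → (∀ i → 0ℚ ℚ.≤ w i) → (∀ i → i ∈ is → 0ℚ < w i → 0ℚ < f i) →
    (𝔼.sum is w ≡ 0ℚ × 𝔼.sum is (λ i → w i * f i) ≡ 0ℚ × 𝔼ᴸ.sum is (λ i → w i · log (f i)) ≈ 0#) ⊎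
    (0ℚ < 𝔼.sum is w × 0ℚ < 𝔼.sum is (λ i → w i * f i) ×
     𝔼ᴸ.sum is (λ i → w i · log (f i)) ≤ 𝔼.sum is w · log (𝔼.sum is (λ i → w i * f i) * inv (𝔼.sum is w)))
  jensen-sum []       w f 0≤w 0<f = inj₁ (refl , refl , A.refl)
  jensen-sum (i ∷ is) w f 0≤w 0<f with w i ℚ.≟ 0ℚ | jensen-sum is w f 0≤w (λ j j∈ → 0<f j (there j∈))
  ... | yes w≡0 | inj₁ (W≡0 , F≡0 , S≈0) rewrite w≡0 | W≡0 | F≡0 =
    inj₁ (refl , ≡.trans (ℚ.+-identityʳ _) (ℚ.*-zeroˡ (f i)) , A.trans (∙-cong (0· _) S≈0) (identityʳ _))
  ... | yes w≡0 | inj₂ (0<W , 0<F , S≤) rewrite w≡0 | ℚ.*-zeroˡ (f i) | ℚ.+-identityˡ (𝔼.sum is w) | ℚ.+-identityˡ (𝔼.sum is (λ i → w i * f i)) =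
    inj₂ (0<W , 0<F , ≤-trans (≈⇒≤ (A.trans (∙-cong (0· _) A.refl) (identityˡ _))) S≤)
  ... | no w≢0  | inj₁ (W≡0 , F≡0 , S≈0) rewrite W≡0 | F≡0 | ℚ.+-identityʳ (w i) | ℚ.+-identityʳ (w i * f i) =
    inj₂ (0<w , 0<* 0<w 0<fi , ≤-trans (≈⇒≤ (A.trans (∙-cong A.refl S≈0) (identityʳ _)))
      (≈⇒≤ (A.reflexive (cong (λ t → w i · log t) (≡.sym wf/w≡f)))))
    where
    module S = ℚ.+-*-Solver
    0<w = 0≤∧≢0⇒0< (0≤w i) w≢0
    0<fi = 0<f i (here refl) 0<w
    wf/w≡f : w i * f i * inv (w i) ≡ f i
    wf/w≡f = ≡.trans (S.solve 3 (λ w f i → w S.:* f S.:* i S.:= (w S.:* i) S.:* f) refl (w i) (f i) (inv (w i)))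
      (≡.trans (cong (_* f i) (*-inv w≢0)) (ℚ.*-identityˡ (f i)))
  ... | no w≢0  | inj₂ (0<W , 0<F , S≤) = inj₂ (0<W′ , 0<F′ ,
    ≤-trans (+-mono-≤ (≤-refl {w i · log (f i)}) S≤) (≤-trans (≈⇒≤ eq₁) (≤-trans (·-mono W′ (jensen₂ 0≤s s≤1 0<fi 0<m 0<c)) (≈⇒≤ eq₂))))
    where
    module S = ℚ.+-*-Solver
    open ≡.≡-Reasoning
    module L = SetoidReasoning A.setoid
    module M = Semimodule 𝕃-semimodule
    W = 𝔼.sum is w
    F = 𝔼.sum is (λ i → w i * f i)
    0<w : 0ℚ < w i
    0<w = 0≤∧≢0⇒0< (0≤w i) w≢0
    0<fi : 0ℚ < f i
    0<fi = 0<f i (here refl) 0<w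
    0<+ : ∀ {p q} → 0ℚ < p → 0ℚ < q → 0ℚ < p ℚ.+ q
    0<+ = ℚ.+-mono-<
    W′ = w i ℚ.+ W
    F′ = w i * f i ℚ.+ F
    0<W′ : 0ℚ < W′
    0<W′ = 0<+ 0<w 0<W
    0<F′ : 0ℚ < F′
    0<F′ = 0<+ (0<* 0<w 0<fi) 0<F
    m = F * inv W
    0<m : 0ℚ < m
    0<m = 0<* 0<F (0<inv 0<W)
    s = w i * inv W′
    0≤s : 0ℚ ℚ.≤ s
    0≤s = 0≤* (ℚ.<⇒≤ 0<w) (0≤inv (ℚ.<⇒≤ 0<W′))
    W′i : W′ * inv W′ ≡ 1ℚ
    W′i = *-inv (<⇒≢0 0<W′)
    W′s : W′ * s ≡ w i
    W′s = ≡.trans (S.solve 3 (λ W w i → W S.:* (w S.:* i) S.:= w S.:* (W S.:* i)) refl W′ (w i) (inv W′))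
      (≡.trans (cong (w i *_) W′i) (ℚ.*-identityʳ (w i)))
    1-s : 1ℚ ℚ.- s ≡ W * inv W′
    1-s = ≡.trans (cong (ℚ._- s) (≡.sym W′i))
      (S.solve 3 (λ w W i → (w S.:+ W) S.:* i S.:- w S.:* i S.:= W S.:* i) refl (w i) W (inv W′))
    W′[1-s] : W′ * (1ℚ ℚ.- s) ≡ W
    W′[1-s] = ≡.trans (cong (W′ *_) 1-s) (≡.trans (S.solve 3 (λ V W i → V S.:* (W S.:* i) S.:= W S.:* (V S.:* i)) refl W′ W (inv W′))
      (≡.trans (cong (W *_) W′i) (ℚ.*-identityʳ W)))
    s≤1 : s ℚ.≤ 1ℚ
    s≤1 = ≤-from-diff {s} {1ℚ} (subst (0ℚ ℚ.≤_) (≡.sym 1-s) (0≤* (ℚ.<⇒≤ 0<W) (0≤inv (ℚ.<⇒≤ 0<W′))))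
    Wm : W * m ≡ F
    Wm = ≡.trans (S.solve 3 (λ W F i → W S.:* (F S.:* i) S.:= F S.:* (W S.:* i)) refl W F (inv W))
      (≡.trans (cong (F *_) (*-inv (<⇒≢0 0<W))) (ℚ.*-identityʳ F))
    c≡ : m ℚ.+ s * (f i ℚ.- m) ≡ F′ * inv W′
    c≡ = begin
      m ℚ.+ s * (f i ℚ.- m)                  ≡⟨ S.solve 3 (λ m s f → m S.:+ s S.:* (f S.:- m) S.:= s S.:* f S.:+ (S.con 1ℚ S.:- s) S.:* m) refl m s (f i) ⟩
      s * f i ℚ.+ (1ℚ ℚ.- s) * m           ≡⟨ cong (λ t → s * f i ℚ.+ t * m) 1-s ⟩
      s * f i ℚ.+ (W * inv W′) * m       ≡⟨ S.solve 5 (λ w i f W m → (w S.:* i) S.:* f S.:+ (W S.:* i) S.:* m S.:= (w S.:* f S.:+ W S.:* m) S.:* i) refl (w i) (inv W′) (f i) W m ⟩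
      (w i * f i ℚ.+ W * m) * inv W′     ≡⟨ cong (λ t → (w i * f i ℚ.+ t) * inv W′) Wm ⟩
      F′ * inv W′                            ∎
    0<c : 0ℚ < m ℚ.+ s * (f i ℚ.- m)
    0<c = subst (0ℚ <_) (≡.sym c≡) (0<* 0<F′ (0<inv 0<W′))
    eq₁ : w i · log (f i) + W · log m ≈ W′ · (s · log (f i) + (1ℚ ℚ.- s) · log m)
    eq₁ = A.sym (L.begin
      W′ · (s · log (f i) + (1ℚ ℚ.- s) · log m)              L.≈⟨ ·-distribˡ W′ _ _ ⟩
      W′ · (s · log (f i)) + W′ · ((1ℚ ℚ.- s) · log m)       L.≈⟨ ∙-cong (·-assoc (log (f i)) (ℚ.<⇒≤ 0<W′) 0≤s) (·-assoc (log m) (ℚ.<⇒≤ 0<W′) (≤-to-diff s≤1)) ⟨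
      (W′ * s) · log (f i) + (W′ * (1ℚ ℚ.- s)) · log m   L.≈⟨ A.reflexive (cong₂ (λ p q → p · log (f i) + q · log m) W′s W′[1-s]) ⟩
      w i · log (f i) + W · log m                            L.∎)
    eq₂ : W′ · log (m ℚ.+ s * (f i ℚ.- m)) ≈ W′ · log (F′ * inv W′)
    eq₂ = A.reflexive (cong (λ t → W′ · log t) c≡)

  -- The positivity of the mean is returned as well, for use in `log-mono` and `log-cancel`.
  jensen : ∀ μ → IsProbability μ → (f : Ω μ → ℚ) → (∀ ω → Support μ ω → 0ℚ < f ω) →
           0ℚ < E μ f × Eᴸ μ (λ ω → log (f ω)) ≤ log (E μ f)
  jensen μ total≡1 f 0<f with jensen-sum (points μ) (weight μ) f (0≤weight μ) (λ ω ω∈ 0<w → 0<f ω (ω∈ , 0<w))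
  ... | inj₁ (W≡0 , _) = contradiction (≡.trans (≡.sym W≡0) sum≡1) λ ()
    where
    sum≡1 : 𝔼.sum (points μ) (weight μ) ≡ 1ℚ
    sum≡1 = ≡.trans (𝔼.sum-cong (points μ) (λ ω _ → ≡.sym (ℚ.*-identityʳ _))) total≡1
  ... | inj₂ (_ , 0<F , S≤) = 0<F , ≤-trans S≤ (≈⇒≤ (A.trans (A.reflexive (cong₂ (λ W F → W · log F) sum≡1
      (≡.trans (cong (λ W → E μ f * inv W) sum≡1) (ℚ.*-identityʳ (E μ f))))) (1· _)))
    where
    sum≡1 : 𝔼.sum (points μ) (weight μ) ≡ 1ℚ
    sum≡1 = ≡.trans (𝔼.sum-cong (points μ) (λ ω _ → ≡.sym (ℚ.*-identityʳ _))) total≡1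

-- Shannon entropy, couplings and conditioning.

module Entropy where

  open import Data.List.Base using ([]; _∷_; cartesianProduct)
  open import Data.List.Membership.Propositional using (_∈_)
  open import Data.List.Membership.Propositional.Properties using (∈-cartesianProduct⁻)
  open import Data.List.Relation.Unary.Any using (here; there)
  open import Data.Product.Base using (∃-syntax; _×_; _,_; proj₁; proj₂)
  import Data.Product.Base as Product
  open import Data.Product.Properties using (≡-dec; ,-injective)
  open import Data.Rational.Base as ℚ using (ℚ; 0ℚ; 1ℚ; _*_; _<_)
  import Data.Rational.Properties as ℚ
  import Data.Rational.Solver as ℚ
  open import Data.Sum.Base using (_⊎_; inj₁; inj₂)
  open import Data.Unit.Base using (⊤; tt)
  open import Data.Vec.Base using ([]; _∷_)
  open import Data.List.Relation.Unary.All using ([]; _∷_)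
  open import Function.Base using (_∘_; id)
  open import Relation.Binary.Definitions using (DecidableEquality)
  open import Relation.Binary.PropositionalEquality as ≡ using (_≡_; _≢_; refl; cong; cong₂; subst)
  import Relation.Binary.Reasoning.Setoid as SetoidReasoning
  open import Relation.Nullary using (¬_; Dec; yes; no; contradiction)
  open LinearInequalities
  open RationalLemmas
  open Expectations

  module S = ℚ.+-*-Solver
  module M = Semimodule 𝕃-semimodule
  module ≈-Reasoning = SetoidReasoning A.setoid

  record DecEq (V : Set) : Set where
    infix 4 _≟_
    field
      _≟_ : DecidableEquality V

  open DecEq {{...}} public

  instance
    ⊤-decEq : DecEq ⊤
    ⊤-decEq = record { _≟_ = λ _ _ → yes refl }

    ×-decEq : ∀ {V W} → {{DecEq V}} → {{DecEq W}} → DecEq (V × W)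
    ×-decEq = record { _≟_ = ≡-dec _≟_ _≟_ }

  indicator : ∀ {P : Set} → Dec P → ℚ
  indicator (yes _) = 1ℚ
  indicator (no _)  = 0ℚ

  0≤indicator : ∀ {P : Set} (d : Dec P) → 0ℚ ℚ.≤ indicator d
  0≤indicator (yes _) = 0≤1
  0≤indicator (no _)  = ℚ.≤-refl

  indicator≤1 : ∀ {P : Set} (d : Dec P) → indicator d ℚ.≤ 1ℚ
  indicator≤1 (yes _) = ℚ.≤-refl
  indicator≤1 (no _)  = 0≤1

  indicator-yes : ∀ {P : Set} (d : Dec P) → P → indicator d ≡ 1ℚ
  indicator-yes (yes _) p = refl
  indicator-yes (no ¬p) p = contradiction p ¬p

  indicator-no : ∀ {P : Set} (d : Dec P) → ¬ P → indicator d ≡ 0ℚ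
  indicator-no (yes p) ¬p = contradiction p ¬p
  indicator-no (no _)  ¬p = refl

  indicator-mono : ∀ {P Q : Set} (d : Dec P) (e : Dec Q) → (P → Q) → indicator d ℚ.≤ indicator e
  indicator-mono (yes p) e f = ℚ.≤-reflexive (≡.sym (indicator-yes e (f p)))
  indicator-mono (no _)  e f = 0≤indicator e

  indicator-cong : ∀ {P Q : Set} (d : Dec P) (e : Dec Q) → (P → Q) → (Q → P) → indicator d ≡ indicator e
  indicator-cong d e f g = ℚ.≤-antisym (indicator-mono d e f) (indicator-mono e d g)

  indicator-* : ∀ {P : Set} (d : Dec P) {x y} → (P → x ≡ y) → indicator d * x ≡ indicator d * y
  indicator-* (yes p) f = cong (1ℚ *_) (f p)
  indicator-* (no _) {x} {y} f = ≡.trans (ℚ.*-zeroˡ x) (≡.sym (ℚ.*-zeroˡ y))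

  module _ {V W : Set} {{_ : DecEq V}} {{_ : DecEq W}} where
    indicator-pair : ∀ (v v′ : V) (w w′ : W) → indicator ((v , w) ≟ (v′ , w′)) ≡ indicator (v ≟ v′) * indicator (w ≟ w′)
    indicator-pair v v′ w w′ = helper (v ≟ v′) (w ≟ w′)
      where
      helper : (d : Dec (v ≡ v′)) (e : Dec (w ≡ w′)) → indicator ((v , w) ≟ (v′ , w′)) ≡ indicator d * indicator e
      helper (yes v≡) (yes w≡) = indicator-yes ((v , w) ≟ (v′ , w′)) (cong₂ _,_ v≡ w≡)
      helper (yes _)  (no w≢)  = indicator-no ((v , w) ≟ (v′ , w′)) (λ eq → w≢ (proj₂ (,-injective eq)))
      helper (no v≢)  e        = ≡.trans (indicator-no ((v , w) ≟ (v′ , w′)) (λ eq → v≢ (proj₁ (,-injective eq)))) (≡.sym (ℚ.*-zeroˡ (indicator e)))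

  indicator-sym : ∀ {V : Set} {{_ : DecEq V}} (v w : V) → indicator (v ≟ w) ≡ indicator (w ≟ v)
  indicator-sym v w = indicator-cong (v ≟ w) (w ≟ v) ≡.sym ≡.sym

  -- That μ is the image of ν under π. Testing against functions into every `Semimodule` covers
  -- probabilities, valued in ℚ, and entropies, valued in 𝕃, at once.
  Preserves : (ν μ : Measure) → (Ω ν → Ω μ) → Set₁
  Preserves ν μ π = ∀ M (f : Ω μ → Semimodule.Carrier M) →
    Semimodule._≈_ M (Expectation.E M ν (f ∘ π)) (Expectation.E M μ f)

  preserves-id : ∀ {μ} → Preserves μ μ id
  preserves-id M f = Semimodule.≈-refl M

  preserves-weights : ∀ μ w 0≤w → (∀ ω → w ω ≡ weight μ ω) →
    Preserves (record { Ω = Ω μ ; points = points μ ; weight = w ; 0≤weight = 0≤w }) μ id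
  preserves-weights μ w 0≤w w≡ M f = Expectation.sum-cong M (points μ) (λ ω _ → Semimodule.·-congˡ M (f ω) (w≡ ω))

  preserves-total : ∀ {ν μ π} → Preserves ν μ π → IsProbability μ → IsProbability ν
  preserves-total p total≡1 = ≡.trans (p ℚ-semimodule (λ _ → 1ℚ)) total≡1

  reweight : (μ : Measure) (h : Ω μ → ℚ) → (∀ ω → 0ℚ ℚ.≤ h ω) → Measure
  reweight μ h 0≤h = record
    { Ω = Ω μ ; points = points μ ; weight = λ ω → weight μ ω * h ω ; 0≤weight = λ ω → 0≤* (0≤weight μ ω) (0≤h ω) }

  infixr 4 _⊗ᵐ_

  _⊗ᵐ_ : Measure → Measure → Measure
  μ ⊗ᵐ ν = record
    { Ω        = Ω μ × Ω ν
    ; points   = cartesianProduct (points μ) (points ν)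
    ; weight   = λ (ω , ψ) → weight μ ω * weight ν ψ
    ; 0≤weight = λ (ω , ψ) → 0≤* (0≤weight μ ω) (0≤weight ν ψ)
    }

  module _ (M : Semimodule) where
    open Semimodule M using (Carrier; ≈-sym; ≈-trans) renaming (_≈_ to _≈ᴹ_; _·_ to _·ᴹ_; ·-assoc to ·ᴹ-assoc)
    open Expectation M using (sum-cong; sum-·; sum-product) renaming (E to Eᴹ)

    E-reweight : ∀ μ h 0≤h (f : Ω μ → Carrier) → Eᴹ (reweight μ h 0≤h) f ≈ᴹ Eᴹ μ (λ ω → h ω ·ᴹ f ω)
    E-reweight μ h 0≤h f = sum-cong (points μ) (λ ω _ → ·ᴹ-assoc (f ω) (0≤weight μ ω) (0≤h ω))

    E-⊗ : ∀ μ ν (f : Ω μ × Ω ν → Carrier) → Eᴹ (μ ⊗ᵐ ν) f ≈ᴹ Eᴹ μ (λ ω → Eᴹ ν (λ ψ → f (ω , ψ)))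
    E-⊗ μ ν f = ≈-trans (sum-product (points μ) (points ν) _) (sum-cong (points μ) (λ ω _ →
      ≈-trans (sum-cong (points ν) (λ ψ _ → ·ᴹ-assoc _ (0≤weight μ ω) (0≤weight ν ψ))) (sum-· (points ν) (0≤weight μ ω) _)))

  support-⊗ : ∀ μ ν {ω ψ} → Support (μ ⊗ᵐ ν) (ω , ψ) → Support μ ω × Support ν ψ
  support-⊗ μ ν {ω} {ψ} (∈× , 0<) with ∈-cartesianProduct⁻ (points μ) (points ν) ∈×
  ... | ω∈ , ψ∈ =
    (ω∈ , 0≤∧≢0⇒0< (0≤weight μ ω) λ eq → <⇒≢0 0< (≡.trans (cong (_* weight ν ψ) eq) (ℚ.*-zeroˡ (weight ν ψ)))) ,
    (ψ∈ , 0≤∧≢0⇒0< (0≤weight ν ψ) λ eq → <⇒≢0 0< (≡.trans (cong (weight μ ω *_) eq) (ℚ.*-zeroʳ (weight μ ω))))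

  support-reweight : ∀ μ h 0≤h {ω} → Support (reweight μ h 0≤h) ω → Support μ ω × h ω ≢ 0ℚ
  support-reweight μ h 0≤h {ω} (ω∈ , 0<) =
    (ω∈ , 0≤∧≢0⇒0< (0≤weight μ ω) λ eq → <⇒≢0 0< (≡.trans (cong (_* h ω) eq) (ℚ.*-zeroˡ (h ω)))) ,
    λ eq → <⇒≢0 0< (≡.trans (cong (weight μ ω *_) eq) (ℚ.*-zeroʳ (weight μ ω)))

  preserves-fst : ∀ {μ ν} → IsProbability ν → Preserves (μ ⊗ᵐ ν) μ proj₁
  preserves-fst {μ} {ν} total≡1 M f = Semimodule.≈-trans M (E-⊗ M μ ν _)
    (Expectation.E-cong M μ (λ ω _ → ScalarExpectation.E-const M ν total≡1 (f ω)))

  preserves-snd : ∀ {μ ν} → IsProbability μ → Preserves (μ ⊗ᵐ ν) ν proj₂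
  preserves-snd {μ} {ν} total≡1 M f = Semimodule.≈-trans M (E-⊗ M μ ν _) (ScalarExpectation.E-const M μ total≡1 _)

  preserves-map : ∀ {μ ν μ′ ν′ π ρ} → Preserves μ μ′ π → Preserves ν ν′ ρ → Preserves (μ ⊗ᵐ ν) (μ′ ⊗ᵐ ν′) (Product.map π ρ)
  preserves-map {μ} {ν} {μ′} {ν′} {π} {ρ} p q M f = begin
    Eᴹ (μ ⊗ᵐ ν) (f ∘ Product.map π ρ)           ≈⟨ E-⊗ M μ ν _ ⟩
    Eᴹ μ (λ ω → Eᴹ ν (λ ψ → f (π ω , ρ ψ)))     ≈⟨ Expectation.E-cong M μ (λ ω _ → q M (λ ψ → f (π ω , ψ))) ⟩
    Eᴹ μ (λ ω → Eᴹ ν′ (λ ψ → f (π ω , ψ)))      ≈⟨ p M (λ ω → Eᴹ ν′ (λ ψ → f (ω , ψ))) ⟩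
    Eᴹ μ′ (λ ω → Eᴹ ν′ (λ ψ → f (ω , ψ)))       ≈⟨ E-⊗ M μ′ ν′ f ⟨
    Eᴹ (μ′ ⊗ᵐ ν′) f                             ∎
    where
    open SetoidReasoning (Semimodule.setoid M)
    open Expectation M using () renaming (E to Eᴹ)

  preserves-swap : ∀ {μ ν} → Preserves (μ ⊗ᵐ ν) (ν ⊗ᵐ μ) Product.swap
  preserves-swap {μ} {ν} M f = Semimodule.≈-trans M (E-⊗ M μ ν _)
    (Semimodule.≈-trans M (Expectation.E-swap M μ ν _) (Semimodule.≈-sym M (E-⊗ M ν μ f)))

  preserves-interchange : ∀ {μ ν ξ ο} → Preserves ((μ ⊗ᵐ ν) ⊗ᵐ (ξ ⊗ᵐ ο)) ((μ ⊗ᵐ ξ) ⊗ᵐ (ν ⊗ᵐ ο))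
    (λ ((a , b) , (c , d)) → ((a , c) , (b , d)))
  preserves-interchange {μ} {ν} {ξ} {ο} M f = ≈-trans (expand μ ν ξ ο _)
    (≈-trans (E-cong μ (λ a _ → E-swap ν ξ _)) (≈-sym (expand μ ξ ν ο f)))
    where
    open Semimodule M using (≈-sym; ≈-trans) renaming (_≈_ to _≈ᴹ_)
    open Expectation M using (E-cong; E-swap) renaming (E to Eᴹ)
    expand : ∀ μ ν ξ ο f → Eᴹ ((μ ⊗ᵐ ν) ⊗ᵐ (ξ ⊗ᵐ ο)) f ≈ᴹ Eᴹ μ (λ a → Eᴹ ν (λ b → Eᴹ ξ (λ c → Eᴹ ο (λ d → f ((a , b) , (c , d))))))
    expand μ ν ξ ο f = ≈-trans (E-⊗ M (μ ⊗ᵐ ν) (ξ ⊗ᵐ ο) f) (≈-trans (E-⊗ M μ ν _)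
      (E-cong μ (λ a _ → E-cong ν (λ b _ → E-⊗ M ξ ο _))))

  ⊗-isProbability : ∀ {μ ν} → IsProbability μ → IsProbability ν → IsProbability (μ ⊗ᵐ ν)
  ⊗-isProbability {μ} {ν} p q = preserves-total {μ ⊗ᵐ ν} {μ} (preserves-fst {μ} {ν} q) p

  module _ {V : Set} {{_ : DecEq V}} where

    prob : (μ : Measure) → (Ω μ → V) → V → ℚ
    prob μ X v = E μ (λ ω → indicator (X ω ≟ v))

    0≤prob : ∀ μ X v → 0ℚ ℚ.≤ prob μ X v
    0≤prob μ X v = 0≤E μ (λ ω _ → 0≤indicator (X ω ≟ v))

    prob≤1 : ∀ μ → IsProbability μ → ∀ X v → prob μ X v ℚ.≤ 1ℚ
    prob≤1 μ total≡1 X v = subst (prob μ X v ℚ.≤_) total≡1 (E-mono μ (λ ω _ → indicator≤1 (X ω ≟ v)))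

    weight≤prob : ∀ μ X {ω} → ω ∈ points μ → weight μ ω ℚ.≤ prob μ X (X ω)
    weight≤prob μ X {ω} ω∈ = subst (ℚ._≤ prob μ X (X ω))
      (≡.trans (cong (weight μ ω *_) (indicator-yes (X ω ≟ X ω) refl)) (ℚ.*-identityʳ (weight μ ω)))
      (weight*≤E μ (λ ψ → 0≤indicator (X ψ ≟ X ω)) ω∈)

    0<prob : ∀ μ X {ω} → Support μ ω → 0ℚ < prob μ X (X ω)
    0<prob μ X (ω∈ , 0<w) = ℚ.<-≤-trans 0<w (weight≤prob μ X ω∈)

    prob-preserves : ∀ {ν μ π} → Preserves ν μ π → ∀ X v → prob ν (X ∘ π) v ≡ prob μ X v
    prob-preserves p X v = p ℚ-semimodule (λ ω → indicator (X ω ≟ v))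

    localize : ∀ μ X v (g : V → ℚ) → E μ (λ ω → indicator (X ω ≟ v) * g (X ω)) ≡ prob μ X v * g v
    localize μ X v g = ≡.trans
      (𝔼.E-cong μ (λ ω _ → indicator-* (X ω ≟ v) (cong g)))
      (ScalarExpectation.E-·ʳ ℚ-semimodule μ _ (λ ω → 0≤indicator (X ω ≟ v)) (g v))

    localize-inv : ∀ μ X v → E μ (λ ω → indicator (v ≟ X ω) * inv (prob μ X (X ω))) ≡ prob μ X v * inv (prob μ X v)
    localize-inv μ X v = ≡.trans (𝔼.E-cong μ (λ ω _ → cong (_* inv (prob μ X (X ω))) (indicator-sym v (X ω))))
      (localize μ X v (λ v → inv (prob μ X v)))

    -- Swapping the expectations leaves p * inv p at each value of Y, where p is its probability
    -- under X: this is 1, or 0 if p vanishes. Combined with `jensen` it is Gibbs' inequality for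
    -- likelihood ratios.
    density≤total : ∀ μ X ν Y → E μ (λ ω → prob ν Y (X ω) * inv (prob μ X (X ω))) ℚ.≤ total ν
    density≤total μ X ν Y = begin
      E μ (λ ω → prob ν Y (X ω) * inv (prob μ X (X ω)))
        ≡⟨ 𝔼.E-cong μ (λ ω _ → ScalarExpectation.E-·ʳ ℚ-semimodule ν _ (λ ψ → 0≤indicator (Y ψ ≟ X ω)) _) ⟨
      E μ (λ ω → E ν (λ ψ → indicator (Y ψ ≟ X ω) * inv (prob μ X (X ω))))
        ≡⟨ 𝔼.E-swap μ ν _ ⟩
      E ν (λ ψ → E μ (λ ω → indicator (Y ψ ≟ X ω) * inv (prob μ X (X ω))))
        ≡⟨ 𝔼.E-cong ν (λ ψ _ → localize-inv μ X (Y ψ)) ⟩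
      E ν (λ ψ → prob μ X (Y ψ) * inv (prob μ X (Y ψ)))
        ≤⟨ E-mono ν (λ ψ _ → p*inv-p≤1 (prob μ X (Y ψ))) ⟩
      total ν ∎
      where open ℚ.≤-Reasoning

  E-neg : ∀ μ (f : Ω μ → 𝕃) → Eᴸ μ (λ ω → - f ω) ≈ - Eᴸ μ f
  E-neg μ f = inverseˡ-unique _ _ (A.trans (A.sym (𝔼ᴸ.E-+ μ _ f))
    (A.trans (𝔼ᴸ.E-cong μ (λ ω _ → A.inverseˡ (f ω))) (𝔼ᴸ.E-zero μ)))
    where open import Algebra.Properties.Group A.group using (inverseˡ-unique)

  E-- : ∀ μ (f g : Ω μ → 𝕃) → Eᴸ μ (λ ω → f ω - g ω) ≈ Eᴸ μ f - Eᴸ μ g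
  E-- μ f g = A.trans (𝔼ᴸ.E-+ μ f _) (A.∙-cong A.refl (E-neg μ g))

  log-inv : ∀ {p} → 0ℚ < p → log (inv p) ≈ - log p
  log-inv {p} 0<p = inverseʳ-unique _ _ (A.trans (A.sym (log-* 0<p (0<inv 0<p)))
    (A.trans (A.reflexive (cong log (*-inv (<⇒≢0 0<p)))) log-1))
    where open import Algebra.Properties.Group A.group using (inverseʳ-unique)

  module _ {V : Set} {{_ : DecEq V}} where

    H : (μ : Measure) → (Ω μ → V) → 𝕃
    H μ X = Eᴸ μ (λ ω → - log (prob μ X (X ω)))

    H-preserves : ∀ {ν μ π} → Preserves ν μ π → ∀ X → H ν (X ∘ π) ≈ H μ X
    H-preserves {ν} {μ} {π} p X = A.trans
      (𝔼ᴸ.E-cong ν (λ ω _ → A.reflexive (cong (λ q → - log q) (prob-preserves {ν = ν} {μ} p X (X (π ω))))))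
      (p 𝕃-semimodule (λ ω → - log (prob μ X (X ω))))

    0≤H : ∀ μ → IsProbability μ → ∀ X → 0# ≤ H μ X
    0≤H μ total≡1 X = ≤-trans (≈⇒≥ (𝔼ᴸ.E-zero μ)) (Eᴸ-mono μ (λ ω ω∈ →
      linear (log (prob μ X (X ω)) ∷ []) 0 (:0 :≤ :- v₀) ((1 , v₀ :≤ :0) ∷ []) refl
        (≤-trans (log-mono (0<prob μ X ω∈) (prob≤1 μ total≡1 X (X ω))) (≈⇒≤ log-1) ∷ [])))

  module _ {V W : Set} {{_ : DecEq V}} {{_ : DecEq W}} where

    -- On the support the event X = x lies within Y = φ x, so the comparison holds pointwise, before
    -- averaging.
    H-function : ∀ μ (X : Ω μ → V) (Y : Ω μ → W) (φ : V → W) → (∀ ω → Support μ ω → φ (X ω) ≡ Y ω) → H μ Y ≤ H μ X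
    H-function μ X Y φ φX≡Y = Eᴸ-mono μ (λ ω ω∈ →
      linear (log (prob μ X (X ω)) ∷ log (prob μ Y (Y ω)) ∷ []) 0 (:- v₁ :≤ :- v₀) ((1 , v₀ :≤ v₁) ∷ []) refl
        (log-mono (0<prob μ X ω∈) (E-mono μ (λ ψ ψ∈ → indicator-mono (X ψ ≟ X ω) (Y ψ ≟ Y ω)
          (λ eq → ≡.trans (≡.sym (φX≡Y ψ ψ∈)) (≡.trans (cong φ eq) (φX≡Y ω ω∈))))) ∷ []))

    module _ μ ν (X : Ω μ → V) (Y : Ω ν → W) where
      prob-⊗ : ∀ v w → prob (μ ⊗ᵐ ν) (Product.map X Y) (v , w) ≡ prob μ X v * prob ν Y w
      prob-⊗ v w = begin
        prob (μ ⊗ᵐ ν) (Product.map X Y) (v , w)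
          ≡⟨ E-⊗ ℚ-semimodule μ ν _ ⟩
        E μ (λ ω → E ν (λ ψ → indicator ((X ω , Y ψ) ≟ (v , w))))
          ≡⟨ 𝔼.E-cong μ (λ ω _ → ≡.trans (𝔼.E-cong ν (λ ψ _ → indicator-pair (X ω) v (Y ψ) w)) (𝔼.E-· ν (0≤indicator (X ω ≟ v)) _)) ⟩
        E μ (λ ω → indicator (X ω ≟ v) * prob ν Y w)
          ≡⟨ ScalarExpectation.E-·ʳ ℚ-semimodule μ _ (λ ω → 0≤indicator (X ω ≟ v)) _ ⟩
        prob μ X v * prob ν Y w ∎
        where open ≡.≡-Reasoning

      H-⊗ : IsProbability μ → IsProbability ν → H (μ ⊗ᵐ ν) (Product.map X Y) ≈ H μ X + H ν Y
      H-⊗ p q = A.trans (𝔼ᴸ.E-cong (μ ⊗ᵐ ν) pointwise) (A.trans (𝔼ᴸ.E-+ (μ ⊗ᵐ ν) _ _)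
        (A.∙-cong (preserves-fst {μ} {ν} q 𝕃-semimodule _) (preserves-snd {μ} {ν} p 𝕃-semimodule _)))
        where
        pointwise : ∀ ω → Support (μ ⊗ᵐ ν) ω → - log (prob (μ ⊗ᵐ ν) (Product.map X Y) (Product.map X Y ω)) ≈
                    - log (prob μ X (X (proj₁ ω))) + - log (prob ν Y (Y (proj₂ ω)))
        pointwise (ω , ψ) ∈× with support-⊗ μ ν ∈×
        ... | ω∈ , ψ∈ = A.trans (A.⁻¹-cong (A.trans (A.reflexive (cong log (prob-⊗ (X ω) (Y ψ))))
              (log-* (0<prob μ X ω∈) (0<prob ν Y ψ∈)))) (equal-sound (:- (v₀ :+ v₁)) (:- v₀ :+ :- v₁) (log (prob μ X (X ω)) ∷ log (prob ν Y (Y ψ)) ∷ []) refl)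

  inv-≢0 : ∀ {p} → 0ℚ < p → p * inv p ≡ 1ℚ
  inv-≢0 0<p = *-inv (<⇒≢0 0<p)

  -- Given the common value of Z and W the two coordinates are independent.
  module Coupling {V : Set} {{_ : DecEq V}} (μ : Measure) (Z : Ω μ → V) (ν : Measure) (W : Ω ν → V)
    (same-law : ∀ z → prob μ Z z ≡ prob ν W z) where

    density : Ω (μ ⊗ᵐ ν) → ℚ
    density (ω , ψ) = indicator (Z ω ≟ W ψ) * inv (prob μ Z (Z ω))

    0≤density : ∀ ω → 0ℚ ℚ.≤ density ω
    0≤density (ω , ψ) = 0≤* (0≤indicator (Z ω ≟ W ψ)) (0≤inv (0≤prob μ Z (Z ω)))

    coupling : Measure
    coupling = reweight (μ ⊗ᵐ ν) density 0≤density

    support-coupling : ∀ {ω ψ} → Support coupling (ω , ψ) → Support μ ω × Support ν ψ × Z ω ≡ W ψ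
    support-coupling {ω} {ψ} s with support-reweight (μ ⊗ᵐ ν) density 0≤density s
    ... | s′ , d≢0 with support-⊗ μ ν s′ | Z ω ≟ W ψ
    ...   | ω∈ , ψ∈ | yes eq = ω∈ , ψ∈ , eq
    ...   | _       | no  _  = contradiction (ℚ.*-zeroˡ (inv (prob μ Z (Z ω)))) d≢0

    E-coupling : ∀ M f → Semimodule._≈_ M (Expectation.E M coupling f)
      (Expectation.E M μ (λ ω → Expectation.E M ν (λ ψ → Semimodule._·_ M (density (ω , ψ)) (f (ω , ψ)))))
    E-coupling M f = Semimodule.≈-trans M (E-reweight M (μ ⊗ᵐ ν) density 0≤density f) (E-⊗ M μ ν _)

    coupling-fst : Preserves coupling μ proj₁
    coupling-fst M f = Semimodule.≈-trans M (E-coupling M _) (Expectation.E-cong M μ λ ω ω∈ →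
      Semimodule.≈-trans M (ScalarExpectation.E-·ʳ M ν _ (λ ψ → 0≤density (ω , ψ)) (f ω))
        (Semimodule.≈-trans M (Semimodule.·-congˡ M (f ω) (mass ω ω∈)) (Semimodule.1· M (f ω))))
      where
      mass : ∀ ω → Support μ ω → E ν (λ ψ → density (ω , ψ)) ≡ 1ℚ
      mass ω ω∈ = begin
        E ν (λ ψ → indicator (Z ω ≟ W ψ) * inv (prob μ Z (Z ω)))
          ≡⟨ 𝔼.E-cong ν (λ ψ _ → cong (_* inv (prob μ Z (Z ω))) (indicator-sym (Z ω) (W ψ))) ⟩
        E ν (λ ψ → indicator (W ψ ≟ Z ω) * inv (prob μ Z (Z ω)))
          ≡⟨ ScalarExpectation.E-·ʳ ℚ-semimodule ν _ (λ ψ → 0≤indicator (W ψ ≟ Z ω)) _ ⟩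
        prob ν W (Z ω) * inv (prob μ Z (Z ω))
          ≡⟨ cong (_* inv (prob μ Z (Z ω))) (same-law (Z ω)) ⟨
        prob μ Z (Z ω) * inv (prob μ Z (Z ω))
          ≡⟨ inv-≢0 (0<prob μ Z ω∈) ⟩
        1ℚ ∎
        where open ≡.≡-Reasoning

    coupling-snd : Preserves coupling ν proj₂
    coupling-snd M f = Semimodule.≈-trans M (E-coupling M _) (Semimodule.≈-trans M (Expectation.E-swap M μ ν _)
      (Expectation.E-cong M ν λ ψ ψ∈ →
        Semimodule.≈-trans M (ScalarExpectation.E-·ʳ M μ _ (λ ω → 0≤density (ω , ψ)) (f ψ))
          (Semimodule.≈-trans M (Semimodule.·-congˡ M (f ψ) (mass ψ ψ∈)) (Semimodule.1· M (f ψ)))))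
      where
      mass : ∀ ψ → Support ν ψ → E μ (λ ω → density (ω , ψ)) ≡ 1ℚ
      mass ψ ψ∈ = ≡.trans (localize μ Z (W ψ) (λ z → inv (prob μ Z z)))
        (inv-≢0 (subst (0ℚ <_) (≡.sym (same-law (W ψ))) (0<prob ν W ψ∈)))

    coupling-isProbability : IsProbability μ → IsProbability coupling
    coupling-isProbability = preserves-total {coupling} {μ} coupling-fst

    module _ {A B : Set} {{_ : DecEq A}} {{_ : DecEq B}} (X : Ω μ → A) (Y : Ω ν → B) where

      joint : Ω coupling → (A × B) × V
      joint (ω , ψ) = (X ω , Y ψ) , Z ω

      prob-coupling : ∀ a b z → prob coupling joint ((a , b) , z) ≡
        prob μ (λ ω → X ω , Z ω) (a , z) * prob ν (λ ψ → Y ψ , W ψ) (b , z) * inv (prob μ Z z)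
      prob-coupling a b z = begin
        prob coupling joint ((a , b) , z)
          ≡⟨ E-coupling ℚ-semimodule _ ⟩
        E μ (λ ω → E ν (λ ψ → density (ω , ψ) * indicator (((X ω , Y ψ) , Z ω) ≟ ((a , b) , z))))
          ≡⟨ 𝔼.E-cong μ (λ ω _ → 𝔼.E-cong ν (λ ψ _ → pointwise ω ψ)) ⟩
        E μ (λ ω → E ν (λ ψ → indicator ((X ω , Z ω) ≟ (a , z)) * (indicator ((Y ψ , W ψ) ≟ (b , z)) * inv (prob μ Z z))))
          ≡⟨ 𝔼.E-cong μ (λ ω _ → 𝔼.E-· ν (0≤indicator ((X ω , Z ω) ≟ (a , z))) _) ⟩
        E μ (λ ω → indicator ((X ω , Z ω) ≟ (a , z)) * E ν (λ ψ → indicator ((Y ψ , W ψ) ≟ (b , z)) * inv (prob μ Z z)))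
          ≡⟨ ScalarExpectation.E-·ʳ ℚ-semimodule μ _ (λ ω → 0≤indicator ((X ω , Z ω) ≟ (a , z))) _ ⟩
        prob μ (λ ω → X ω , Z ω) (a , z) * E ν (λ ψ → indicator ((Y ψ , W ψ) ≟ (b , z)) * inv (prob μ Z z))
          ≡⟨ cong (prob μ (λ ω → X ω , Z ω) (a , z) *_)
               (ScalarExpectation.E-·ʳ ℚ-semimodule ν _ (λ ψ → 0≤indicator ((Y ψ , W ψ) ≟ (b , z))) _) ⟩
        prob μ (λ ω → X ω , Z ω) (a , z) * (prob ν (λ ψ → Y ψ , W ψ) (b , z) * inv (prob μ Z z))
          ≡⟨ ℚ.*-assoc (prob μ (λ ω → X ω , Z ω) (a , z)) (prob ν (λ ψ → Y ψ , W ψ) (b , z)) (inv (prob μ Z z)) ⟨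
        _ ∎
        where
        open ≡.≡-Reasoning
        pointwise : ∀ ω ψ → density (ω , ψ) * indicator (((X ω , Y ψ) , Z ω) ≟ ((a , b) , z)) ≡
          indicator ((X ω , Z ω) ≟ (a , z)) * (indicator ((Y ψ , W ψ) ≟ (b , z)) * inv (prob μ Z z))
        pointwise ω ψ = begin
          density (ω , ψ) * indicator (((X ω , Y ψ) , Z ω) ≟ ((a , b) , z))
            ≡⟨ cong (density (ω , ψ) *_) (≡.trans (indicator-pair (X ω , Y ψ) (a , b) (Z ω) z) (cong (_* iz) (indicator-pair (X ω) a (Y ψ) b))) ⟩
          density (ω , ψ) * ((ia * ib) * iz)
            ≡⟨ S.solve 4 (λ d a b z → d S.:* ((a S.:* b) S.:* z) S.:= (a S.:* b) S.:* (z S.:* d)) refl (density (ω , ψ)) ia ib iz ⟩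
          (ia * ib) * (iz * density (ω , ψ))
            ≡⟨ cong ((ia * ib) *_) (indicator-* (Z ω ≟ z) (λ eq → cong (λ t → indicator (t ≟ W ψ) * inv (prob μ Z t)) eq)) ⟩
          (ia * ib) * (iz * (indicator (z ≟ W ψ) * i))
            ≡⟨ cong (λ t → (ia * ib) * (iz * (t * i))) (indicator-sym z (W ψ)) ⟩
          (ia * ib) * (iz * (iw * i))
            ≡⟨ S.solve 5 (λ a b z w i → (a S.:* b) S.:* (z S.:* (w S.:* i)) S.:= (a S.:* z) S.:* ((b S.:* w) S.:* i)) refl ia ib iz iw i ⟩
          (ia * iz) * ((ib * iw) * i)
            ≡⟨ cong₂ (λ s t → s * (t * i)) (indicator-pair (X ω) a (Z ω) z) (indicator-pair (Y ψ) b (W ψ) z) ⟨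
          indicator ((X ω , Z ω) ≟ (a , z)) * (indicator ((Y ψ , W ψ) ≟ (b , z)) * i) ∎
          where
          ia = indicator (X ω ≟ a)
          ib = indicator (Y ψ ≟ b)
          iz = indicator (Z ω ≟ z)
          iw = indicator (W ψ ≟ z)
          i  = inv (prob μ Z z)

      -- The logarithm of `prob-coupling`, averaged; the marginals of the coupling identify the
      -- three terms.
      H-coupling : H coupling joint ≈ H μ (λ ω → X ω , Z ω) + H ν (λ ψ → Y ψ , W ψ) - H μ Z
      H-coupling = A.trans (𝔼ᴸ.E-cong coupling pointwise) (A.trans (E-- coupling _ _)
        (A.∙-cong (A.trans (𝔼ᴸ.E-+ coupling _ _) (A.∙-cong (coupling-fst 𝕃-semimodule _) (coupling-snd 𝕃-semimodule _)))
          (A.⁻¹-cong (coupling-fst 𝕃-semimodule _))))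
        where
        p : Ω μ → ℚ
        p ω = prob μ (λ ω → X ω , Z ω) (X ω , Z ω)
        q : Ω ν → ℚ
        q ψ = prob ν (λ ψ → Y ψ , W ψ) (Y ψ , W ψ)
        pointwise : ∀ ω → Support coupling ω → - log (prob coupling joint (joint ω)) ≈
          (- log (p (proj₁ ω)) + - log (q (proj₂ ω))) - - log (prob μ Z (Z (proj₁ ω)))
        pointwise (ω , ψ) s with support-coupling s
        ... | ω∈ , ψ∈ , eq = A.trans (A.⁻¹-cong (begin
          log (prob coupling joint (joint (ω , ψ)))             ≈⟨ A.reflexive (cong log (≡.trans (prob-coupling (X ω) (Y ψ) (Z ω)) (cong (λ t → p ω * prob ν (λ ψ → Y ψ , W ψ) (Y ψ , t) * inv r) eq))) ⟩
          log (p ω * q ψ * inv r)                           ≈⟨ log-* (0<* 0<p 0<q) (0<inv 0<r) ⟩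
          log (p ω * q ψ) + log (inv r)                       ≈⟨ A.∙-cong (log-* 0<p 0<q) (log-inv 0<r) ⟩
          log (p ω) + log (q ψ) - log r                         ∎))
          (equal-sound (:- (v₀ :+ v₁ :- v₂)) ((:- v₀ :+ :- v₁) :- :- v₂) (log (p ω) ∷ log (q ψ) ∷ log r ∷ []) refl)
          where
          open ≈-Reasoning
          r = prob μ Z (Z ω)
          0<p = 0<prob μ (λ ω → X ω , Z ω) ω∈
          0<q = 0<prob ν (λ ψ → Y ψ , W ψ) ψ∈
          0<r = 0<prob μ Z ω∈

  -- By Gibbs' inequality, comparing the law of (X , Y , Z) with the one in which X
  -- and Y are made independent given Z.
  module _ {A B V : Set} {{_ : DecEq A}} {{_ : DecEq B}} {{_ : DecEq V}} where

    submodular′ : ∀ μ → IsProbability μ → (X : Ω μ → A) (Y : Ω μ → B) (Z : Ω μ → V) →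
      H μ (λ ω → (X ω , Y ω) , Z ω) + H μ Z ≤ H μ (λ ω → X ω , Z ω) + H μ (λ ω → Y ω , Z ω)
    submodular′ μ total≡1 X Y Z = linear (h ∷ H μ Z ∷ H μ XZ ∷ H μ YZ ∷ [])
        0 (v₀ :+ v₁ :≤ v₂ :+ v₃) ((1 , ((v₀ :+ v₁) :- v₂) :- v₃ :≤ :0) ∷ []) refl
        (≤-trans (≈⇒≥ expand) gibbs ∷ [])
      where
      open Coupling μ Z μ Z (λ _ → refl)
      XZ = λ ω → X ω , Z ω
      YZ = λ ω → Y ω , Z ω
      T : Ω μ → (A × B) × V
      T ω = (X ω , Y ω) , Z ω
      h = H μ T
      f : Ω μ → ℚ
      f ω = prob coupling (joint X Y) (T ω) * inv (prob μ T (T ω))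
      log-product : ∀ {x y z t} → 0ℚ < x → 0ℚ < y → 0ℚ < z → 0ℚ < t →
        log (x * y * inv z * inv t) ≈ ((- log t - log z) - - log x) - - log y
      log-product {x} {y} {z} {t} 0<x 0<y 0<z 0<t = begin
        log (x * y * inv z * inv t)       ≈⟨ log-* (0<* (0<* 0<x 0<y) (0<inv 0<z)) (0<inv 0<t) ⟩
        log (x * y * inv z) + log (inv t)   ≈⟨ A.∙-cong (log-* (0<* 0<x 0<y) (0<inv 0<z)) (log-inv 0<t) ⟩
        log (x * y) + log (inv z) - log t     ≈⟨ A.∙-cong (A.∙-cong (log-* 0<x 0<y) (log-inv 0<z)) A.refl ⟩
        log x + log y - log z - log t           ≈⟨ equal-sound (v₀ :+ v₁ :- v₂ :- v₃) (((:- v₃ :- v₂) :- :- v₀) :- :- v₁)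
                                                     (log x ∷ log y ∷ log z ∷ log t ∷ []) refl ⟩
        ((- log t - log z) - - log x) - - log y ∎
        where open ≈-Reasoning
      f≡ : ∀ ω → f ω ≡ prob μ XZ (XZ ω) * prob μ YZ (YZ ω) * inv (prob μ Z (Z ω)) * inv (prob μ T (T ω))
      f≡ ω = cong (_* inv (prob μ T (T ω))) (prob-coupling X Y (X ω) (Y ω) (Z ω))
      0<f : ∀ ω → Support μ ω → 0ℚ < f ω
      0<f ω ω∈ = subst (0ℚ <_) (≡.sym (f≡ ω))
        (0<* (0<* (0<* (0<prob μ XZ ω∈) (0<prob μ YZ ω∈)) (0<inv (0<prob μ Z ω∈))) (0<inv (0<prob μ T ω∈)))
      log-f : ∀ ω → Support μ ω → log (f ω) ≈
        ((- log (prob μ T (T ω)) - log (prob μ Z (Z ω))) - - log (prob μ XZ (XZ ω))) - - log (prob μ YZ (YZ ω))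
      log-f ω ω∈ = A.trans (A.reflexive (cong log (f≡ ω)))
        (log-product (0<prob μ XZ ω∈) (0<prob μ YZ ω∈) (0<prob μ Z ω∈) (0<prob μ T ω∈))
      gibbs : Eᴸ μ (λ ω → log (f ω)) ≤ 0#
      gibbs = ≤-trans (proj₂ J) (≤-trans
        (log-mono (proj₁ J) (ℚ.≤-trans (density≤total μ T coupling (joint X Y)) (ℚ.≤-reflexive (coupling-isProbability total≡1))))
        (≈⇒≤ log-1))
        where J = jensen μ total≡1 f 0<f
      expand : Eᴸ μ (λ ω → log (f ω)) ≈ ((h + H μ Z) - H μ XZ) - H μ YZ
      expand = A.trans (𝔼ᴸ.E-cong μ log-f) (A.trans (E-- μ _ _) (A.∙-cong (A.trans (E-- μ _ _) (A.∙-cong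
        (A.trans (𝔼ᴸ.E-+ μ _ _) A.refl) A.refl)) A.refl))

  module _ {A B V Q : Set} {{_ : DecEq A}} {{_ : DecEq B}} {{_ : DecEq V}} {{_ : DecEq Q}} where

    -- The working form: monotonicity of entropy replaces (X , Z) and (Y , Z) by X and Y, and the
    -- triple by T. The functional relations are asked for on the support only, as those between the
    -- two halves of a coupling fail elsewhere.
    submodular : ∀ μ → IsProbability μ → (X : Ω μ → A) (Y : Ω μ → B) (Z : Ω μ → V) (T : Ω μ → Q)
      (φ : A → V) → (∀ ω → Support μ ω → φ (X ω) ≡ Z ω) →
      (χ : B → V) → (∀ ω → Support μ ω → χ (Y ω) ≡ Z ω) →
      (τ : A × B → Q) → (∀ ω → Support μ ω → τ (X ω , Y ω) ≡ T ω) →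
      H μ T + H μ Z ≤ H μ X + H μ Y
    submodular μ total≡1 X Y Z T φ φX≡Z χ χY≡Z τ τXY≡T =
      ≤-trans (+-monoˡ-≤ _ (H-function μ (λ ω → (X ω , Y ω) , Z ω) T (λ (xy , _) → τ xy) τXY≡T))
        (≤-trans (submodular′ μ total≡1 X Y Z) (+-mono-≤
          (H-function μ X (λ ω → X ω , Z ω) (λ x → x , φ x) (λ ω ω∈ → cong (X ω ,_) (φX≡Z ω ω∈)))
          (H-function μ Y (λ ω → Y ω , Z ω) (λ y → y , χ y) (λ ω ω∈ → cong (Y ω ,_) (χY≡Z ω ω∈)))))

  module _ {A B : Set} {{_ : DecEq A}} {{_ : DecEq B}} where

    subadditive : ∀ μ → IsProbability μ → (X : Ω μ → A) (Y : Ω μ → B) → H μ (λ ω → X ω , Y ω) ≤ H μ X + H μ Y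
    subadditive μ total≡1 X Y = linear (H μ (λ ω → X ω , Y ω) ∷ H μ (λ _ → tt) ∷ H μ X + H μ Y ∷ [])
      0 (v₀ :≤ v₂) ((1 , v₀ :+ v₁ :≤ v₂) ∷ (1 , :0 :≤ v₁) ∷ []) refl
      (submodular μ total≡1 X Y (λ _ → tt) (λ ω → X ω , Y ω) (λ _ → tt) (λ _ _ → refl) (λ _ → tt) (λ _ _ → refl) id (λ _ _ → refl)
        ∷ 0≤H μ total≡1 (λ _ → tt) ∷ [])

  module _ {V : Set} {{_ : DecEq V}} (μ : Measure) (Z : Ω μ → V) where

    0≤conditional : ∀ z ω → 0ℚ ℚ.≤ indicator (Z ω ≟ z) * inv (prob μ Z z)
    0≤conditional z ω = 0≤* (0≤indicator (Z ω ≟ z)) (0≤inv (0≤prob μ Z z))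

    -- At a value of probability 0 all weights vanish, because inv 0 = 0; it is a probability
    -- measure only at values attained on the support.
    conditional : V → Measure
    conditional z = reweight μ (λ ω → indicator (Z ω ≟ z) * inv (prob μ Z z)) (0≤conditional z)

    conditional-isProbability : ∀ {ω} → Support μ ω → IsProbability (conditional (Z ω))
    conditional-isProbability {ω} ω∈ = ≡.trans (E-reweight ℚ-semimodule μ _ (0≤conditional (Z ω)) (λ _ → 1ℚ))
      (≡.trans (𝔼.E-cong μ (λ ψ _ → ℚ.*-identityʳ (indicator (Z ψ ≟ Z ω) * inv (prob μ Z (Z ω)))))
        (≡.trans (localize μ Z (Z ω) (λ _ → inv (prob μ Z (Z ω)))) (inv-≢0 (0<prob μ Z ω∈))))

    module _ {A : Set} {{_ : DecEq A}} (X : Ω μ → A) where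

      prob-conditional : ∀ z a → prob (conditional z) X a ≡ prob μ (λ ω → X ω , Z ω) (a , z) * inv (prob μ Z z)
      prob-conditional z a = ≡.trans (E-reweight ℚ-semimodule μ _ (0≤conditional z) (λ ω → indicator (X ω ≟ a)))
        (≡.trans (𝔼.E-cong μ (λ ω _ → ≡.trans
            (S.solve 3 (λ z i a → (z S.:* i) S.:* a S.:= (a S.:* z) S.:* i) refl (indicator (Z ω ≟ z)) (inv (prob μ Z z)) (indicator (X ω ≟ a)))
            (cong (_* inv (prob μ Z z)) (≡.sym (indicator-pair (X ω) a (Z ω) z)))))
          (ScalarExpectation.E-·ʳ ℚ-semimodule μ _ (λ ω → 0≤indicator ((X ω , Z ω) ≟ (a , z))) _))

      -- The chain rule: once the expectations are swapped, the outer sample merely selects the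
      -- fibre of Z, and its density integrates to 1.
      H-conditional : Eᴸ μ (λ ω → H (conditional (Z ω)) X) ≈ H μ (λ ω → X ω , Z ω) - H μ Z
      H-conditional = begin
        Eᴸ μ (λ ω → H (conditional (Z ω)) X)
          ≈⟨ 𝔼ᴸ.E-cong μ (λ ω ω∈ → A.trans (E-reweight 𝕃-semimodule μ _ (0≤conditional (Z ω)) _) (𝔼ᴸ.E-cong μ (pointwise ω ω∈))) ⟩
        Eᴸ μ (λ ω → Eᴸ μ (λ ψ → (indicator (Z ω ≟ Z ψ) * inv (prob μ Z (Z ω))) · φ ψ))
          ≈⟨ 𝔼ᴸ.E-swap μ μ _ ⟩
        Eᴸ μ (λ ψ → Eᴸ μ (λ ω → (indicator (Z ω ≟ Z ψ) * inv (prob μ Z (Z ω))) · φ ψ))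
          ≈⟨ 𝔼ᴸ.E-cong μ (λ ψ ψ∈ → A.trans (ScalarExpectation.E-·ʳ 𝕃-semimodule μ _ (λ ω → 0≤* (0≤indicator (Z ω ≟ Z ψ)) (0≤inv (0≤prob μ Z (Z ω)))) (φ ψ))
               (A.trans (A.reflexive (cong (_· φ ψ) (≡.trans (localize μ Z (Z ψ) (λ z → inv (prob μ Z z))) (inv-≢0 (0<prob μ Z ψ∈))))) (1· (φ ψ)))) ⟩
        Eᴸ μ φ
          ≈⟨ E-- μ _ _ ⟩
        H μ (λ ω → X ω , Z ω) - H μ Z ∎
        where
        open ≈-Reasoning
        φ : Ω μ → 𝕃
        φ ψ = - log (prob μ (λ ω → X ω , Z ω) (X ψ , Z ψ)) - - log (prob μ Z (Z ψ))
        vanish : ∀ p x → (0ℚ * p) · x ≈ 0#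
        vanish p x = A.trans (A.reflexive (cong (_· x) (ℚ.*-zeroˡ p))) (0· x)
        pointwise : ∀ ω → Support μ ω → ∀ ψ → Support μ ψ →
          (indicator (Z ψ ≟ Z ω) * inv (prob μ Z (Z ω))) · (- log (prob (conditional (Z ω)) X (X ψ))) ≈
          (indicator (Z ω ≟ Z ψ) * inv (prob μ Z (Z ω))) · φ ψ
        pointwise ω ω∈ ψ ψ∈ with Z ψ ≟ Z ω | Z ω ≟ Z ψ
        ... | no _   | no _   = A.trans (vanish (inv (prob μ Z (Z ω))) _) (A.sym (vanish (inv (prob μ Z (Z ω))) (φ ψ)))
        ... | no ≢   | yes ≡  = contradiction (≡.sym ≡) ≢
        ... | yes ≡  | no ≢   = contradiction (≡.sym ≡) ≢
        ... | yes eq | yes _  = M.·-congʳ _ (A.trans (A.⁻¹-cong (begin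
          log (prob (conditional (Z ω)) X (X ψ))
            ≈⟨ A.reflexive (cong log (≡.trans (prob-conditional (Z ω) (X ψ)) (cong (λ z → prob μ (λ ω → X ω , Z ω) (X ψ , z) * inv (prob μ Z z)) (≡.sym eq)))) ⟩
          log (prob μ (λ ω → X ω , Z ω) (X ψ , Z ψ) * inv (prob μ Z (Z ψ)))
            ≈⟨ log-* (0<prob μ (λ ω → X ω , Z ω) ψ∈) (0<inv (0<prob μ Z ψ∈)) ⟩
          _ ≈⟨ A.∙-cong A.refl (log-inv (0<prob μ Z ψ∈)) ⟩
          log (prob μ (λ ω → X ω , Z ω) (X ψ , Z ψ)) - log (prob μ Z (Z ψ)) ∎))
          (equal-sound (:- (v₀ :- v₁)) (:- v₀ :- :- v₁) (log (prob μ (λ ω → X ω , Z ω) (X ψ , Z ψ)) ∷ log (prob μ Z (Z ψ)) ∷ []) refl))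

  -- The first moment method. Membership in the support makes conditioning on the chosen sample
  -- legitimate.
  minimum≤E : ∀ μ → IsProbability μ → (f : Ω μ → 𝕃) → ∃[ ω ] Support μ ω × f ω ≤ Eᴸ μ f
  minimum≤E μ total≡1 f with minimum (points μ)
    where
    minimum : ∀ is → (∀ i → i ∈ is → ¬ 0ℚ < weight μ i) ⊎
                     (∃[ i ] i ∈ is × 0ℚ < weight μ i × (∀ j → j ∈ is → 0ℚ < weight μ j → f i ≤ f j))
    minimum [] = inj₁ λ _ ()
    minimum (i ∷ is) with minimum is | 0ℚ ℚ.<? weight μ i
    ... | inj₁ none | no ≮ = inj₁ λ { j (here refl) → ≮ ; j (there j∈) → none j j∈ }
    ... | inj₁ none | yes 0<w = inj₂ (i , here refl , 0<w , λ { j (here refl) _ → ≤-refl ; j (there j∈) 0<wj → contradiction 0<wj (none j j∈) })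
    ... | inj₂ (m , m∈ , 0<m , m≤) | no ≮ = inj₂ (m , there m∈ , 0<m , λ { j (here refl) 0<wj → contradiction 0<wj ≮ ; j (there j∈) → m≤ j j∈ })
    ... | inj₂ (m , m∈ , 0<m , m≤) | yes 0<w with ≤-total (f m) (f i)
    ...   | inj₁ fm≤fi = inj₂ (m , there m∈ , 0<m , λ { j (here refl) _ → fm≤fi ; j (there j∈) → m≤ j j∈ })
    ...   | inj₂ fi≤fm = inj₂ (i , here refl , 0<w , λ { j (here refl) _ → ≤-refl ; j (there j∈) 0<wj → ≤-trans fi≤fm (m≤ j j∈ 0<wj) })
  ... | inj₁ none = contradiction (≡.trans (≡.sym total≡1) zero) λ ()
    where
    zero : total μ ≡ 0ℚ
    zero = ≡.trans (𝔼.E-cong μ (λ ω (ω∈ , 0<w) → contradiction 0<w (none ω ω∈))) (𝔼.E-zero μ)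
  ... | inj₂ (ω , ω∈ , 0<w , min) = ω , (ω∈ , 0<w) , ≤-trans (≈⇒≥ (ScalarExpectation.E-const 𝕃-semimodule μ total≡1 (f ω)))
    (Eᴸ-mono μ (λ ψ (ψ∈ , 0<wψ) → min ψ ψ∈ 0<wψ))

-- Abelian groups of exponent 2.

module BooleanGroups where

  open import Data.Bool.Base using (Bool; true; false; _xor_)
  open import Data.Bool.Properties using () renaming (_≟_ to _≟ᵇ_)
  open import Data.Fin.Base using (Fin; zero; suc)
  open import Data.Nat.Base using (ℕ; zero; suc)
  open import Data.Vec.Base using (Vec; []; _∷_; lookup; zipWith; replicate)
  open import Data.Vec.Properties using (≡-dec)
  open import Relation.Binary.PropositionalEquality using (_≡_; refl; sym; trans; cong; cong₂)
  open import Relation.Nullary using (yes; no; does)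
  open import Data.List.Base using (List)
  open import Data.Rational.Base using (1ℚ)
  open Expectations using (module 𝔼)
  open Entropy using (DecEq; _≟_; indicator)

  record BooleanGroup : Set₁ where
    infixl 6 _⊕_
    field
      G         : Set
      decEq     : DecEq G
      _⊕_       : G → G → G
      𝟎         : G
      ⊕-assoc   : ∀ x y z → (x ⊕ y) ⊕ z ≡ x ⊕ (y ⊕ z)
      ⊕-comm    : ∀ x y → x ⊕ y ≡ y ⊕ x
      ⊕-identity : ∀ x → 𝟎 ⊕ x ≡ x
      ⊕-self    : ∀ x → x ⊕ x ≡ 𝟎

  -- Being listed exactly once, phrased as a sum of indicators so that it fits into the calculus of
  -- expectations.
  Enumerates : (𝔾 : BooleanGroup) → List (BooleanGroup.G 𝔾) → Set
  Enumerates 𝔾 elements = ∀ v → 𝔼.sum elements (λ g → indicator (v ≟ g)) ≡ 1ℚ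
    where instance _ = BooleanGroup.decEq 𝔾

  infixl 6 _:⊕_

  data XorExpr (n : ℕ) : Set where
    atom : Fin n → XorExpr n
    _:⊕_ : XorExpr n → XorExpr n → XorExpr n
    :𝟎   : XorExpr n

  pattern x₀ = atom zero
  pattern x₁ = atom (suc zero)
  pattern x₂ = atom (suc (suc zero))
  pattern x₃ = atom (suc (suc (suc zero)))
  pattern x₄ = atom (suc (suc (suc (suc zero))))
  pattern x₅ = atom (suc (suc (suc (suc (suc zero)))))
  pattern x₆ = atom (suc (suc (suc (suc (suc (suc zero))))))
  pattern x₇ = atom (suc (suc (suc (suc (suc (suc (suc zero)))))))

  parity : ∀ {n} → XorExpr n → Vec Bool n
  parity (atom i)  = unit i
    where
    unit : ∀ {n} → Fin n → Vec Bool n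
    unit zero    = true ∷ replicate _ false
    unit (suc i) = false ∷ unit i
  parity (e :⊕ f) = zipWith _xor_ (parity e) (parity f)
  parity :𝟎       = replicate _ false

  module XorSolver (𝔾 : BooleanGroup) where
    open BooleanGroup 𝔾

    ⟦_⟧⊕ : ∀ {n} → XorExpr n → Vec G n → G
    ⟦ atom i ⟧⊕ ρ = lookup ρ i
    ⟦ e :⊕ f ⟧⊕ ρ = ⟦ e ⟧⊕ ρ ⊕ ⟦ f ⟧⊕ ρ
    ⟦ :𝟎 ⟧⊕     ρ = 𝟎

    ⊕-identityʳ : ∀ x → x ⊕ 𝟎 ≡ x
    ⊕-identityʳ x = trans (⊕-comm x 𝟎) (⊕-identity x)

    private
      choose : Bool → G → G
      choose true  x = x
      choose false x = 𝟎

      value : ∀ {n} → Vec Bool n → Vec G n → G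
      value []       []      = 𝟎
      value (b ∷ bs) (x ∷ ρ) = choose b x ⊕ value bs ρ

      value-zero : ∀ {n} (ρ : Vec G n) → value (replicate n false) ρ ≡ 𝟎
      value-zero []      = refl
      value-zero (x ∷ ρ) = trans (⊕-identity _) (value-zero ρ)

      interchange : ∀ a b c d → (a ⊕ b) ⊕ (c ⊕ d) ≡ (a ⊕ c) ⊕ (b ⊕ d)
      interchange a b c d = trans (⊕-assoc a b (c ⊕ d)) (trans (cong (a ⊕_)
        (trans (sym (⊕-assoc b c d)) (trans (cong (_⊕ d) (⊕-comm b c)) (⊕-assoc c b d)))) (sym (⊕-assoc a c (b ⊕ d))))

      choose-xor : ∀ b c x → choose (b xor c) x ≡ choose b x ⊕ choose c x
      choose-xor true  true  x = sym (⊕-self x)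
      choose-xor true  false x = sym (⊕-identityʳ x)
      choose-xor false c     x = sym (⊕-identity _)

      value-xor : ∀ {n} (bs cs : Vec Bool n) ρ → value (zipWith _xor_ bs cs) ρ ≡ value bs ρ ⊕ value cs ρ
      value-xor []       []       []      = sym (⊕-identity 𝟎)
      value-xor (b ∷ bs) (c ∷ cs) (x ∷ ρ) = trans (cong₂ _⊕_ (choose-xor b c x) (value-xor bs cs ρ)) (interchange _ _ _ _)

      correct : ∀ {n} (e : XorExpr n) ρ → ⟦ e ⟧⊕ ρ ≡ value (parity e) ρ
      correct (atom zero)    (x ∷ ρ) = sym (trans (cong (x ⊕_) (value-zero ρ)) (⊕-identityʳ x))
      correct (atom (suc i)) (x ∷ ρ) = trans (correct (atom i) ρ) (sym (⊕-identity _))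
      correct (e :⊕ f)       ρ = trans (cong₂ _⊕_ (correct e ρ) (correct f ρ)) (sym (value-xor (parity e) (parity f) ρ))
      correct :𝟎             ρ = sym (value-zero ρ)

    xor-solve : ∀ {n} (e f : XorExpr n) (ρ : Vec G n) → does (≡-dec _≟ᵇ_ (parity e) (parity f)) ≡ true → ⟦ e ⟧⊕ ρ ≡ ⟦ f ⟧⊕ ρ
    xor-solve e f ρ ok with ≡-dec _≟ᵇ_ (parity e) (parity f)
    xor-solve e f ρ ok | yes eq = trans (correct e ρ) (trans (cong (λ bs → value bs ρ) eq) (sym (correct f ρ)))
    xor-solve e f ρ () | no _

-- Entropic Ruzsa calculus.

module RuzsaDistance (𝔾 : BooleanGroups.BooleanGroup) where

  open BooleanGroups
  open import Data.List.Relation.Unary.All using ([]; _∷_)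
  open import Data.Nat.Base using (zero; suc)
  open import Data.Product.Base using (_×_; _,_; proj₁; proj₂)
  import Data.Product.Base as Product
  open import Data.Rational.Base as ℚ using (ℚ; _*_)
  import Data.Rational.Properties as ℚ
  open import Data.Vec.Base as Vec using (Vec; []; _∷_)
  open import Data.Vec.Properties using (lookup-map)
  open import Data.List.Base using ([]; _∷_)
  open import Function.Base using (_∘_; id)
  open import Relation.Binary.PropositionalEquality as ≡ using (_≡_; refl; cong; cong₂)
  open LinearInequalities
  open RationalLemmas
  open Expectations
  open Entropy

  open BooleanGroup 𝔾 public
  open XorSolver 𝔾 public

  instance
    G-decEq : DecEq G
    G-decEq = decEq

  add : ∀ {A B : Set} → (A → G) → (B → G) → A × B → G
  add X Y p = X (proj₁ p) ⊕ Y (proj₂ p)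

  -- Twice the entropic Ruzsa distance, to avoid fractions.
  D : (μ : Measure) → (Ω μ → G) → (ν : Measure) → (Ω ν → G) → 𝕃
  D μ X ν Y = H (μ ⊗ᵐ ν) (add X Y) + H (μ ⊗ᵐ ν) (add X Y) - H μ X - H ν Y

  H-≤ : ∀ {V : Set} {{_ : DecEq V}} μ (X Y : Ω μ → V) → (∀ ω → X ω ≡ Y ω) → H μ Y ≤ H μ X
  H-≤ μ X Y X≡Y = H-function μ X Y id (λ ω _ → X≡Y ω)

  -- Independence is assumed in the form of an entropy inequality, the only form in which the linear
  -- certificates can consume it.
  module Independent (μ : Measure) (p : IsProbability μ) (A B C : Ω μ → G)
    (independent : H μ A + (H μ B + H μ C) ≤ H μ (λ ω → A ω , (B ω , C ω))) where

    -- Submodularity for (A + C , B + C) and (A , B): each determines A + B, since C + C = 0, and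
    -- together they determine A, B and C. This is Ruzsa's triangle inequality.
    triangle′ : H μ (λ ω → A ω ⊕ B ω) + H μ C ≤ H μ (λ ω → A ω ⊕ C ω) + H μ (λ ω → B ω ⊕ C ω)
    triangle′ = linear (H μ A ∷ H μ B ∷ H μ C ∷ H μ (λ ω → A ω , (B ω , C ω)) ∷ H μ (λ ω → A ω ⊕ B ω) ∷ H μ (λ ω → A ω ⊕ C ω , B ω ⊕ C ω) ∷
        H μ (λ ω → A ω , B ω) ∷ H μ (λ ω → A ω ⊕ C ω) ∷ H μ (λ ω → B ω ⊕ C ω) ∷ [])
      0 (v₄ :+ v₂ :≤ v₇ :+ v₈)
      ((1 , v₀ :+ (v₁ :+ v₂) :≤ v₃) ∷ (1 , v₃ :+ v₄ :≤ v₅ :+ v₆) ∷ (1 , v₅ :≤ v₇ :+ v₈) ∷ (1 , v₆ :≤ v₀ :+ v₁) ∷ []) refl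
      (independent
      ∷ submodular μ p (λ ω → A ω ⊕ C ω , B ω ⊕ C ω) (λ ω → A ω , B ω) (λ ω → A ω ⊕ B ω) (λ ω → A ω , (B ω , C ω))
          (λ (a , b) → a ⊕ b) (λ ω _ → xor-solve ((x₀ :⊕ x₂) :⊕ (x₁ :⊕ x₂)) (x₀ :⊕ x₁) (A ω ∷ B ω ∷ C ω ∷ []) refl)
          (λ (a , b) → a ⊕ b) (λ _ _ → refl)
          (λ ((d , e) , (a , b)) → a , (b , d ⊕ a)) (λ ω _ → cong (λ t → A ω , (B ω , t)) (xor-solve ((x₀ :⊕ x₁) :⊕ x₀) x₁ (A ω ∷ C ω ∷ []) refl))
      ∷ subadditive μ p (λ ω → A ω ⊕ C ω) (λ ω → B ω ⊕ C ω)
      ∷ subadditive μ p A B ∷ [])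

    -- Submodularity for (A , B + C) and (A + B + C , C), which share the total sum and together
    -- determine the three variables. This is the Kaimanovich-Vershik-Madiman inequality.
    sum′ : H μ (λ ω → A ω ⊕ (B ω ⊕ C ω)) + H μ B ≤ H μ (λ ω → A ω ⊕ B ω) + H μ (λ ω → B ω ⊕ C ω)
    sum′ = linear (H μ A ∷ H μ B ∷ H μ C ∷ H μ (λ ω → A ω , (B ω , C ω)) ∷ H μ Z ∷ H μ (λ ω → A ω , B ω ⊕ C ω) ∷
        H μ (λ ω → Z ω , C ω) ∷ H μ (λ ω → A ω ⊕ B ω , C ω) ∷ H μ (λ ω → A ω ⊕ B ω) ∷ H μ (λ ω → B ω ⊕ C ω) ∷ [])
      0 (v₄ :+ v₁ :≤ v₈ :+ v₉)
      ((1 , v₀ :+ (v₁ :+ v₂) :≤ v₃) ∷ (1 , v₃ :+ v₄ :≤ v₅ :+ v₆) ∷ (1 , v₅ :≤ v₀ :+ v₉) ∷ (1 , v₆ :≤ v₇) ∷ (1 , v₇ :≤ v₈ :+ v₂) ∷ []) refl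
      (independent
      ∷ submodular μ p (λ ω → A ω , B ω ⊕ C ω) (λ ω → Z ω , C ω) Z (λ ω → A ω , (B ω , C ω))
          (λ (a , d) → a ⊕ d) (λ _ _ → refl) proj₁ (λ _ _ → refl)
          (λ ((a , d) , (_ , c)) → a , (d ⊕ c , c)) (λ ω _ → cong (λ t → A ω , (t , C ω)) (xor-solve ((x₀ :⊕ x₁) :⊕ x₁) x₀ (B ω ∷ C ω ∷ []) refl))
      ∷ subadditive μ p A (λ ω → B ω ⊕ C ω)
      ∷ H-function μ (λ ω → A ω ⊕ B ω , C ω) (λ ω → Z ω , C ω) (λ (d , c) → d ⊕ c , c) (λ ω _ → cong (_, C ω) (⊕-assoc (A ω) (B ω) (C ω)))
      ∷ subadditive μ p (λ ω → A ω ⊕ B ω) C ∷ [])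
      where
      Z : Ω μ → G
      Z ω = A ω ⊕ (B ω ⊕ C ω)

  add-comm : ∀ {μ ν} X Y → H (ν ⊗ᵐ μ) (add Y X) ≤ H (μ ⊗ᵐ ν) (add X Y)
  add-comm {μ} {ν} X Y = ≤-trans (H-≤ (ν ⊗ᵐ μ) (add X Y ∘ Product.swap) (add Y X) (λ (ψ , ω) → ⊕-comm (X ω) (Y ψ)))
    (≈⇒≤ (H-preserves {ν = ν ⊗ᵐ μ} {μ ⊗ᵐ ν} (preserves-swap {ν} {μ}) (add X Y)))

  -- The pair (X + Y , Y) determines (X , Y), of entropy H X + H Y, and H Y cancels.
  H≤add : ∀ {μ ν} → IsProbability μ → IsProbability ν → ∀ X Y → H μ X ≤ H (μ ⊗ᵐ ν) (add X Y)
  H≤add {μ} {ν} p q X Y = linear (H μ X ∷ H ν Y ∷ H (μ ⊗ᵐ ν) (Product.map X Y) ∷ H (μ ⊗ᵐ ν) (λ ω → add X Y ω , Y (proj₂ ω)) ∷ H (μ ⊗ᵐ ν) (add X Y) ∷ H (μ ⊗ᵐ ν) (Y ∘ proj₂) ∷ [])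
    0 (v₀ :≤ v₄) ((1 , v₀ :+ v₁ :≤ v₂) ∷ (1 , v₂ :≤ v₃) ∷ (1 , v₃ :≤ v₄ :+ v₅) ∷ (1 , v₅ :≤ v₁) ∷ []) refl
    (≈⇒≥ (H-⊗ μ ν X Y p q)
    ∷ H-function (μ ⊗ᵐ ν) (λ ω → add X Y ω , Y (proj₂ ω)) (Product.map X Y) (λ (z , y) → z ⊕ y , y)
        (λ (ω , ψ) _ → cong (_, Y ψ) (xor-solve ((x₀ :⊕ x₁) :⊕ x₁) x₀ (X ω ∷ Y ψ ∷ []) refl))
    ∷ subadditive (μ ⊗ᵐ ν) (⊗-isProbability {μ} {ν} p q) (add X Y) (Y ∘ proj₂)
    ∷ ≈⇒≤ (H-preserves {ν = μ ⊗ᵐ ν} {ν} (preserves-snd {μ} {ν} p) Y) ∷ [])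

  H≤add′ : ∀ {μ ν} → IsProbability μ → IsProbability ν → ∀ X Y → H ν Y ≤ H (μ ⊗ᵐ ν) (add X Y)
  H≤add′ {μ} {ν} p q X Y = ≤-trans (H≤add {ν} {μ} q p Y X) (add-comm {μ} {ν} X Y)

  module Three {μ ν ξ : Measure} (p : IsProbability μ) (q : IsProbability ν) (r : IsProbability ξ)
    (X : Ω μ → G) (Y : Ω ν → G) (Z : Ω ξ → G) where

    private
      σ : Measure
      σ = μ ⊗ᵐ (ν ⊗ᵐ ξ)
      νξ : IsProbability (ν ⊗ᵐ ξ)
      νξ = ⊗-isProbability {ν} {ξ} q r
      A B C : Ω σ → G
      A (ω , _) = X ω
      B (_ , (ψ , _)) = Y ψ
      C (_ , (_ , χ)) = Z χ
      total-σ : IsProbability σ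
      total-σ = ⊗-isProbability {μ} {ν ⊗ᵐ ξ} p νξ
      fst : Preserves σ μ proj₁
      fst = preserves-fst {μ} {ν ⊗ᵐ ξ} νξ
      snd : Preserves σ (ν ⊗ᵐ ξ) proj₂
      snd = preserves-snd {μ} {ν ⊗ᵐ ξ} p
      HA : H σ A ≤ H μ X
      HA = ≈⇒≤ (H-preserves {ν = σ} {μ} fst X)
      HB : H σ B ≈ H ν Y
      HB = A.trans (H-preserves {ν = σ} {ν ⊗ᵐ ξ} snd (Y ∘ proj₁)) (H-preserves {ν = ν ⊗ᵐ ξ} {ν} (preserves-fst {ν} {ξ} r) Y)
      HC : H σ C ≈ H ξ Z
      HC = A.trans (H-preserves {ν = σ} {ν ⊗ᵐ ξ} snd (Z ∘ proj₂)) (H-preserves {ν = ν ⊗ᵐ ξ} {ξ} (preserves-snd {ν} {ξ} q) Z)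
      HABC : H σ (λ ω → A ω , (B ω , C ω)) ≈ H μ X + (H ν Y + H ξ Z)
      HABC = A.trans (H-⊗ μ (ν ⊗ᵐ ξ) X (Product.map Y Z) p νξ) (A.∙-cong A.refl (H-⊗ ν ξ Y Z q r))
      independent : H σ A + (H σ B + H σ C) ≤ H σ (λ ω → A ω , (B ω , C ω))
      independent = ≤-trans (+-mono-≤ HA (+-mono-≤ (≈⇒≤ HB) (≈⇒≤ HC))) (≈⇒≥ HABC)
      independent′ : H σ A + (H σ C + H σ B) ≤ H σ (λ ω → A ω , (C ω , B ω))
      independent′ = ≤-trans (≤-trans (+-mono-≤ (≤-refl {H σ A}) (≈⇒≤ (A.comm (H σ C) (H σ B)))) independent)
        (H-function σ (λ ω → A ω , (C ω , B ω)) (λ ω → A ω , (B ω , C ω)) (λ (a , (c , b)) → a , (b , c)) (λ _ _ → refl))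
      AB : H σ (λ ω → A ω ⊕ B ω) ≈ H (μ ⊗ᵐ ν) (add X Y)
      AB = H-preserves {ν = σ} {μ ⊗ᵐ ν} (preserves-map {μ} {ν ⊗ᵐ ξ} {μ} {ν} (preserves-id {μ}) (preserves-fst {ν} {ξ} r)) (add X Y)
      AC : H σ (λ ω → A ω ⊕ C ω) ≈ H (μ ⊗ᵐ ξ) (add X Z)
      AC = H-preserves {ν = σ} {μ ⊗ᵐ ξ} (preserves-map {μ} {ν ⊗ᵐ ξ} {μ} {ξ} (preserves-id {μ}) (preserves-snd {ν} {ξ} q)) (add X Z)
      BC : H σ (λ ω → B ω ⊕ C ω) ≈ H (ν ⊗ᵐ ξ) (add Y Z)
      BC = H-preserves {ν = σ} {ν ⊗ᵐ ξ} snd (add Y Z)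

    triangle : H (μ ⊗ᵐ ν) (add X Y) + H ξ Z ≤ H (μ ⊗ᵐ ξ) (add X Z) + H (ν ⊗ᵐ ξ) (add Y Z)
    triangle = ≤-trans (+-mono-≤ (≈⇒≥ AB) (≈⇒≥ HC))
      (≤-trans (Independent.triangle′ σ total-σ A B C independent) (+-mono-≤ (≈⇒≤ AC) (≈⇒≤ BC)))

    sum-bound : H (μ ⊗ᵐ (ν ⊗ᵐ ξ)) (add X (add Y Z)) + H ν Y ≤ H (μ ⊗ᵐ ν) (add X Y) + H (ν ⊗ᵐ ξ) (add Y Z)
    sum-bound = ≤-trans (+-mono-≤ ≤-refl (≈⇒≥ HB))
      (≤-trans (Independent.sum′ σ total-σ A B C independent) (+-mono-≤ (≈⇒≤ AB) (≈⇒≤ BC)))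

    sum-bound′ : H (μ ⊗ᵐ (ν ⊗ᵐ ξ)) (add X (add Y Z)) + H ξ Z ≤ H (μ ⊗ᵐ ξ) (add X Z) + H (ν ⊗ᵐ ξ) (add Y Z)
    sum-bound′ = ≤-trans (+-mono-≤ (H-≤ σ (λ ω → A ω ⊕ (C ω ⊕ B ω)) (λ ω → A ω ⊕ (B ω ⊕ C ω)) (λ ω → cong (A ω ⊕_) (⊕-comm (C ω) (B ω)))) (≈⇒≥ HC))
      (≤-trans (Independent.sum′ σ total-σ A C B independent′) (+-mono-≤ (≈⇒≤ AC)
        (≤-trans (H-≤ σ (λ ω → B ω ⊕ C ω) (λ ω → C ω ⊕ B ω) (λ ω → ⊕-comm (B ω) (C ω))) (≈⇒≤ BC))))

  E-⊗ᴺ : ∀ μ k (f : Ω μ → 𝕃) → Eᴸ μ (λ ω → k ⊗ f ω) ≈ k ⊗ Eᴸ μ f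
  E-⊗ᴺ μ zero    f = A.trans (𝔼ᴸ.E-cong μ (λ ω _ → zero-⊗ (f ω))) (A.trans (𝔼ᴸ.E-zero μ) (A.sym (zero-⊗ _)))
  E-⊗ᴺ μ (suc k) f = A.trans (𝔼ᴸ.E-cong μ (λ ω _ → suc-⊗ k (f ω))) (A.trans (𝔼ᴸ.E-+ μ f _)
    (A.trans (A.∙-cong A.refl (E-⊗ᴺ μ k f)) (A.sym (suc-⊗ k _))))

  -- Allows the cost of a candidate, a linear expression in seven entropies, to be averaged in one
  -- step.
  E-linear : ∀ {n} μ (e : Expr n) (fs : Vec (Ω μ → 𝕃) n) →
    Eᴸ μ (λ ω → ⟦ e ⟧ (Vec.map (λ f → f ω) fs)) ≈ ⟦ e ⟧ (Vec.map (Eᴸ μ) fs)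
  E-linear μ (var i)  fs = A.trans (𝔼ᴸ.E-cong μ (λ ω _ → A.reflexive (lookup-map i _ fs))) (A.reflexive (≡.sym (lookup-map i _ fs)))
  E-linear μ :0       fs = 𝔼ᴸ.E-zero μ
  E-linear μ (e :+ f) fs = A.trans (𝔼ᴸ.E-+ μ _ _) (A.∙-cong (E-linear μ e fs) (E-linear μ f fs))
  E-linear μ (e :- f) fs = A.trans (E-- μ _ _) (A.∙-cong (E-linear μ e fs) (A.⁻¹-cong (E-linear μ f fs)))
  E-linear μ (:- e)   fs = A.trans (E-neg μ _) (A.⁻¹-cong (E-linear μ e fs))
  E-linear μ (k :* e) fs = A.trans (E-⊗ᴺ μ k _) (⊗-cong k (E-linear μ e fs))

  record RandomVariable : Set₁ where
    field
      measure       : Measure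
      isProbability : IsProbability measure
      value         : Ω measure → G

  -- The weights agree one by one; values of probability 0 are no exception, because `inv-*` holds
  -- at 0 too.
  conditional-⊗ : ∀ {V W : Set} {{_ : DecEq V}} {{_ : DecEq W}} μ (Z : Ω μ → V) ν (W : Ω ν → W) z w →
    Preserves (conditional (μ ⊗ᵐ ν) (Product.map Z W) (z , w)) (conditional μ Z z ⊗ᵐ conditional ν W w) id
  conditional-⊗ μ Z ν W z w = preserves-weights (conditional μ Z z ⊗ᵐ conditional ν W w) _
    (0≤weight (conditional (μ ⊗ᵐ ν) (Product.map Z W) (z , w))) (λ (ω , ψ) → begin
      (weight μ ω * weight ν ψ) * (indicator ((Z ω , W ψ) ≟ (z , w)) * inv (prob (μ ⊗ᵐ ν) (Product.map Z W) (z , w)))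
        ≡⟨ cong₂ (λ i p → (weight μ ω * weight ν ψ) * (i * p)) (indicator-pair (Z ω) z (W ψ) w)
             (≡.trans (cong inv (prob-⊗ μ ν Z W z w)) (inv-* (prob μ Z z) (prob ν W w))) ⟩
      (weight μ ω * weight ν ψ) * ((indicator (Z ω ≟ z) * indicator (W ψ ≟ w)) * (inv (prob μ Z z) * inv (prob ν W w)))
        ≡⟨ S.solve 6 (λ m n i j p q → (m S.:* n) S.:* ((i S.:* j) S.:* (p S.:* q)) S.:= (m S.:* (i S.:* p)) S.:* (n S.:* (j S.:* q))) refl
             (weight μ ω) (weight ν ψ) (indicator (Z ω ≟ z)) (indicator (W ψ ≟ w)) (inv (prob μ Z z)) (inv (prob ν W w)) ⟩
      weight (conditional μ Z z ⊗ᵐ conditional ν W w) (ω , ψ) ∎)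
    where open ≡.≡-Reasoning

  conditional-⊗ʳ : ∀ {V : Set} {{_ : DecEq V}} μ → IsProbability μ → ∀ ν (Z : Ω ν → V) z →
    Preserves (conditional (μ ⊗ᵐ ν) (Z ∘ proj₂) z) (μ ⊗ᵐ conditional ν Z z) id
  conditional-⊗ʳ μ p ν Z z = preserves-weights (μ ⊗ᵐ conditional ν Z z) _ (0≤weight (conditional (μ ⊗ᵐ ν) (Z ∘ proj₂) z)) (λ (ω , ψ) → begin
      (weight μ ω * weight ν ψ) * (indicator (Z ψ ≟ z) * inv (prob (μ ⊗ᵐ ν) (Z ∘ proj₂) z))
        ≡⟨ cong (λ q → (weight μ ω * weight ν ψ) * (indicator (Z ψ ≟ z) * inv q)) (prob-preserves {ν = μ ⊗ᵐ ν} {ν} (preserves-snd {μ} {ν} p) Z z) ⟩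
      (weight μ ω * weight ν ψ) * (indicator (Z ψ ≟ z) * inv (prob ν Z z))
        ≡⟨ ℚ.*-assoc (weight μ ω) (weight ν ψ) (indicator (Z ψ ≟ z) * inv (prob ν Z z)) ⟩
      weight (μ ⊗ᵐ conditional ν Z z) (ω , ψ) ∎)
    where open ≡.≡-Reasoning

  module _ {V : Set} {{_ : DecEq V}} (μ : Measure) (Z : Ω μ → V) (ν : Measure) (W : Ω ν → V)
    (same-law : ∀ z → prob μ Z z ≡ prob ν W z) where
    open Coupling μ Z ν W same-law

    -- On the event Z = z the density of the coupling is the indicator of W = z over the probability
    -- of z, which supplies the conditioning of the second factor.
    conditional-coupling : ∀ z → Preserves (conditional coupling (Z ∘ proj₁) z) (conditional μ Z z ⊗ᵐ conditional ν W z) id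
    conditional-coupling z = preserves-weights (conditional μ Z z ⊗ᵐ conditional ν W z) _
      (0≤weight (conditional coupling (Z ∘ proj₁) z)) (λ (ω , ψ) → begin
        ((weight μ ω * weight ν ψ) * (indicator (Z ω ≟ W ψ) * inv (prob μ Z (Z ω)))) * (indicator (Z ω ≟ z) * inv (prob coupling (Z ∘ proj₁) z))
          ≡⟨ cong (λ p → ((weight μ ω * weight ν ψ) * (indicator (Z ω ≟ W ψ) * inv (prob μ Z (Z ω)))) * (indicator (Z ω ≟ z) * inv p))
               (prob-preserves {ν = coupling} {μ} coupling-fst Z z) ⟩
        ((weight μ ω * weight ν ψ) * (indicator (Z ω ≟ W ψ) * inv (prob μ Z (Z ω)))) * (indicator (Z ω ≟ z) * inv (prob μ Z z))
          ≡⟨ S.solve 5 (λ m n d i p → ((m S.:* n) S.:* d) S.:* (i S.:* p) S.:= (m S.:* n) S.:* p S.:* (i S.:* d)) refl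
               (weight μ ω) (weight ν ψ) (indicator (Z ω ≟ W ψ) * inv (prob μ Z (Z ω))) (indicator (Z ω ≟ z)) (inv (prob μ Z z)) ⟩
        (weight μ ω * weight ν ψ) * inv (prob μ Z z) * (indicator (Z ω ≟ z) * (indicator (Z ω ≟ W ψ) * inv (prob μ Z (Z ω))))
          ≡⟨ cong ((weight μ ω * weight ν ψ) * inv (prob μ Z z) *_)
               (indicator-* (Z ω ≟ z) (λ eq → cong (λ t → indicator (t ≟ W ψ) * inv (prob μ Z t)) eq)) ⟩
        (weight μ ω * weight ν ψ) * inv (prob μ Z z) * (indicator (Z ω ≟ z) * (indicator (z ≟ W ψ) * inv (prob μ Z z)))
          ≡⟨ cong₂ (λ j p → (weight μ ω * weight ν ψ) * inv (prob μ Z z) * (indicator (Z ω ≟ z) * (j * inv p))) (indicator-sym z (W ψ)) (same-law z) ⟩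
        (weight μ ω * weight ν ψ) * inv (prob μ Z z) * (indicator (Z ω ≟ z) * (indicator (W ψ ≟ z) * inv (prob ν W z)))
          ≡⟨ S.solve 6 (λ m n p i j q → (m S.:* n) S.:* p S.:* (i S.:* (j S.:* q)) S.:= (m S.:* (i S.:* p)) S.:* (n S.:* (j S.:* q))) refl
               (weight μ ω) (weight ν ψ) (inv (prob μ Z z)) (indicator (Z ω ≟ z)) (indicator (W ψ ≟ z)) (inv (prob ν W z)) ⟩
        weight (conditional μ Z z ⊗ᵐ conditional ν W z) (ω , ψ) ∎)
      where open ≡.≡-Reasoning

-- Averaging the cost of a conditioned pair.

module ConditionalAverages (𝔾 : BooleanGroups.BooleanGroup) where

  open import Data.List.Base using ([]; _∷_; cartesianProduct)
  open import Data.List.Relation.Unary.All using ([]; _∷_)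
  open import Data.Product.Base using (Σ-syntax; _×_; _,_; proj₁; proj₂)
  import Data.Product.Base as Product
  open import Data.Rational.Base as ℚ using (ℚ; 0ℚ)
  open import Data.Sum.Base using (_⊎_; inj₁; inj₂)
  open import Data.Unit.Base using (tt)
  open import Data.Vec.Base using ([]; _∷_)
  open import Function.Base using (_∘_; id)
  open import Relation.Binary.PropositionalEquality using (refl; cong; subst)
  open LinearInequalities
  open Expectations
  open Entropy
  open RuzsaDistance 𝔾

  H-const : ∀ μ → IsProbability μ → H μ (λ _ → tt) ≤ 0#
  H-const μ p = ≤-trans (≈⇒≤ (A.trans (𝔼ᴸ.E-cong μ (λ ω _ → A.trans (A.⁻¹-cong (A.trans (A.reflexive (cong log p)) log-1))
    (equal-sound (:- :0) :0 [] refl))) (𝔼ᴸ.E-zero μ))) ≤-refl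

  on-product : (μ ν : Measure) (w : Ω μ × Ω ν → ℚ) → (∀ ω → 0ℚ ℚ.≤ w ω) → Measure
  on-product μ ν w 0≤w = record
    { Ω = Ω μ × Ω ν ; points = cartesianProduct (points μ) (points ν) ; weight = w ; 0≤weight = 0≤w }

  module Averaging (X₁ X₂ : RandomVariable) where
    open RandomVariable X₁ public renaming (measure to P₁; value to ξ₁; isProbability to π₁)
    open RandomVariable X₂ public renaming (measure to P₂; value to ξ₂; isProbability to π₂)

    k = D P₁ ξ₁ P₂ ξ₂

    cost : (ν₁ : Measure) → (Ω ν₁ → G) → (ν₂ : Measure) → (Ω ν₂ → G) → 𝕃
    cost ν₁ A ν₂ B = 48 ⊗ D ν₁ A ν₂ B + D P₁ ξ₁ ν₁ A + D P₂ ξ₂ ν₂ B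

    -- One inequality carries both demands: as distances are nonnegative, the new distance is at
    -- most 47 k / 48 and the displacements are at most 47 k in total.
    Improvement : Set₁
    Improvement = Σ[ Y₁ ∈ RandomVariable ] Σ[ Y₂ ∈ RandomVariable ]
      cost (RandomVariable.measure Y₁) (RandomVariable.value Y₁) (RandomVariable.measure Y₂) (RandomVariable.value Y₂) ≤ 47 ⊗ k

    cost-expr : ∀ {n} (a b c d e g h : Expr n) → Expr n
    cost-expr a b c d e g h = 48 :* (a :+ a :- b :- c) :+ (d :+ d :- g :- b) :+ (e :+ e :- h :- c)

    -- A bound for the average cost: hJ, c₁ and c₂ are conditional entropies of the sum and of its
    -- two terms, while e₁ and e₂ are entropies of sums with the old variables.
    bound : 𝕃 → 𝕃 → 𝕃 → 𝕃 → 𝕃 → 𝕃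
    bound hJ c₁ c₂ e₁ e₂ = 48 ⊗ (hJ + hJ - c₁ - c₂) + (e₁ + e₁ - H P₁ ξ₁ - c₁) + (e₂ + e₂ - H P₂ ξ₂ - c₂)

    -- Serves both for R₁ and R₂ independent, with T the pair of Z₁ and Z₂, and for two copies
    -- coupled over a common Z. By `split`, in either case the coordinates are independent given T,
    -- with the two conditioned laws.
    module _ {V₁ V₂ V : Set} {{_ : DecEq V₁}} {{_ : DecEq V₂}} {{_ : DecEq V}}
      (R₁ : Measure) (p₁ : IsProbability R₁) (A : Ω R₁ → G) (Z₁ : Ω R₁ → V₁)
      (R₂ : Measure) (p₂ : IsProbability R₂) (B : Ω R₂ → G) (Z₂ : Ω R₂ → V₂)
      (w : Ω R₁ × Ω R₂ → ℚ) (0≤w : ∀ ω → 0ℚ ℚ.≤ w ω) (T : Ω R₁ × Ω R₂ → V)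
      (fst : Preserves (on-product R₁ R₂ w 0≤w) R₁ proj₁) (snd : Preserves (on-product R₁ R₂ w 0≤w) R₂ proj₂)
      (supp : ∀ ω → Support (on-product R₁ R₂ w 0≤w) ω → Support R₁ (proj₁ ω) × Support R₂ (proj₂ ω))
      (split : ∀ ω → Support (on-product R₁ R₂ w 0≤w) ω → Preserves (conditional (on-product R₁ R₂ w 0≤w) T (T ω))
                 (conditional R₁ Z₁ (Z₁ (proj₁ ω)) ⊗ᵐ conditional R₂ Z₂ (Z₂ (proj₂ ω))) id)
      where

      private
        J = on-product R₁ R₂ w 0≤w
        pJ : IsProbability J
        pJ = preserves-total {J} {R₁} fst p₁
        C₁ : Ω J → Measure
        C₁ ω = conditional R₁ Z₁ (Z₁ (proj₁ ω))
        C₂ : Ω J → Measure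
        C₂ ω = conditional R₂ Z₂ (Z₂ (proj₂ ω))
        a b c d e g h : Ω J → 𝕃
        a ω = H (C₁ ω ⊗ᵐ C₂ ω) (add A B)
        b ω = H (C₁ ω) A
        c ω = H (C₂ ω) B
        d ω = H (P₁ ⊗ᵐ C₁ ω) (add ξ₁ A)
        e ω = H (P₂ ⊗ᵐ C₂ ω) (add ξ₂ B)
        g ω = H P₁ ξ₁
        h ω = H P₂ ξ₂
        f : Ω J → 𝕃
        f ω = cost (C₁ ω) A (C₂ ω) B
        hJ = H J (λ ω → add A B ω , T ω) - H J T
        c₁ = H R₁ (λ ω → A ω , Z₁ ω) - H R₁ Z₁
        c₂ = H R₂ (λ ω → B ω , Z₂ ω) - H R₂ Z₂
        e₁ = H (P₁ ⊗ᵐ R₁) (add ξ₁ A)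
        e₂ = H (P₂ ⊗ᵐ R₂) (add ξ₂ B)

        Ea : Eᴸ J a ≤ hJ
        Ea = ≤-trans (Eᴸ-mono J (λ ω ω∈ → ≈⇒≥ (H-preserves {ν = conditional J T (T ω)} {C₁ ω ⊗ᵐ C₂ ω} (split ω ω∈) (add A B))))
          (≈⇒≤ (H-conditional J T (add A B)))
        Eb : c₁ ≤ Eᴸ J b
        Eb = ≈⇒≥ (A.trans (fst 𝕃-semimodule (λ ω → H (conditional R₁ Z₁ (Z₁ ω)) A)) (H-conditional R₁ Z₁ A))
        Ec : c₂ ≤ Eᴸ J c
        Ec = ≈⇒≥ (A.trans (snd 𝕃-semimodule (λ ω → H (conditional R₂ Z₂ (Z₂ ω)) B)) (H-conditional R₂ Z₂ B))

        -- The left side is the entropy of ξ + A given Z, by the chain rule, and conditioning does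
        -- not raise entropy.
        smeared : ∀ {W : Set} {{_ : DecEq W}} P → IsProbability P → (ξ : Ω P → G) → ∀ R → IsProbability R → (A : Ω R → G) (Z : Ω R → W) →
          Eᴸ R (λ ω → H (P ⊗ᵐ conditional R Z (Z ω)) (add ξ A)) ≤ H (P ⊗ᵐ R) (add ξ A)
        smeared P pP ξ R pR A Z = ≤-trans (≈⇒≥ (preserves-snd {P} {R} pP 𝕃-semimodule (λ ω → H (P ⊗ᵐ conditional R Z (Z ω)) (add ξ A))))
          (≤-trans (Eᴸ-mono (P ⊗ᵐ R) (λ ω _ → ≈⇒≥ (H-preserves {ν = conditional (P ⊗ᵐ R) (Z ∘ proj₂) (Z (proj₂ ω))} {P ⊗ᵐ conditional R Z (Z (proj₂ ω))}
              (conditional-⊗ʳ P pP R Z (Z (proj₂ ω))) (add ξ A))))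
            (≤-trans (≈⇒≤ (H-conditional (P ⊗ᵐ R) (Z ∘ proj₂) (add ξ A)))
              (linear (H (P ⊗ᵐ R) (λ ω → add ξ A ω , Z (proj₂ ω)) ∷ H (P ⊗ᵐ R) (Z ∘ proj₂) ∷ H (P ⊗ᵐ R) (add ξ A) ∷ [])
                0 (v₀ :- v₁ :≤ v₂) ((1 , v₀ :≤ v₂ :+ v₁) ∷ []) refl
                (subadditive (P ⊗ᵐ R) (⊗-isProbability {P} {R} pP pR) (add ξ A) (Z ∘ proj₂) ∷ []))))

        Ed : Eᴸ J d ≤ e₁
        Ed = ≤-trans (≈⇒≤ (fst 𝕃-semimodule (λ ω → H (P₁ ⊗ᵐ conditional R₁ Z₁ (Z₁ ω)) (add ξ₁ A)))) (smeared P₁ π₁ ξ₁ R₁ p₁ A Z₁)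
        Ee : Eᴸ J e ≤ e₂
        Ee = ≤-trans (≈⇒≤ (snd 𝕃-semimodule (λ ω → H (P₂ ⊗ᵐ conditional R₂ Z₂ (Z₂ ω)) (add ξ₂ B)))) (smeared P₂ π₂ ξ₂ R₂ p₂ B Z₂)

        Ef : Eᴸ J f ≤ bound hJ c₁ c₂ e₁ e₂
        Ef = ≤-trans (≈⇒≤ (E-linear J (cost-expr v₀ v₁ v₂ v₃ v₄ v₅ v₆) (a ∷ b ∷ c ∷ d ∷ e ∷ g ∷ h ∷ [])))
          (linear (Eᴸ J a ∷ Eᴸ J b ∷ Eᴸ J c ∷ Eᴸ J d ∷ Eᴸ J e ∷ Eᴸ J g ∷ Eᴸ J h ∷ hJ ∷ c₁ ∷ c₂ ∷ e₁ ∷ e₂ ∷ H P₁ ξ₁ ∷ H P₂ ξ₂ ∷ [])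
            0 (cost-expr v₀ v₁ v₂ v₃ v₄ v₅ v₆ :≤ cost-expr v₇ v₈ v₉ v₁₀ v₁₁ v₁₂ v₁₃)
            -- 96 = 2 · 48, because `D` counts the sum twice; 49 = 48 + 1, because the entropy of
            -- each new variable is subtracted in its distance to the other one and to the old one.
            ((96 , v₀ :≤ v₇) ∷ (49 , v₈ :≤ v₁) ∷ (49 , v₉ :≤ v₂) ∷ (2 , v₃ :≤ v₁₀) ∷ (2 , v₄ :≤ v₁₁) ∷ (1 , v₁₂ :≤ v₅) ∷ (1 , v₁₃ :≤ v₆) ∷ []) refl
            (Ea ∷ Eb ∷ Ec ∷ Ed ∷ Ee
            ∷ ≈⇒≥ (ScalarExpectation.E-const 𝕃-semimodule J pJ (H P₁ ξ₁))
            ∷ ≈⇒≥ (ScalarExpectation.E-const 𝕃-semimodule J pJ (H P₂ ξ₂)) ∷ []))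

        decide : ∀ ω → Support J ω → f ω ≤ Eᴸ J f → f ω ≤ 47 ⊗ k ⊎ 47 ⊗ k ≤ f ω → Improvement ⊎ 47 ⊗ k ≤ bound hJ c₁ c₂ e₁ e₂
        decide ω ω∈ _ (inj₁ fω≤) = inj₁
          ( record { measure = C₁ ω ; isProbability = conditional-isProbability R₁ Z₁ (proj₁ (supp ω ω∈)) ; value = A }
          , record { measure = C₂ ω ; isProbability = conditional-isProbability R₂ Z₂ (proj₂ (supp ω ω∈)) ; value = B } , fω≤)
        decide ω ω∈ fω≤E (inj₂ ≤fω) = inj₂ (≤-trans ≤fω (≤-trans fω≤E Ef))

      -- The cheapest sample either is an improvement or shows that even the average cost is at
      -- least 47 k.
      average : Improvement ⊎ 47 ⊗ k ≤ bound hJ c₁ c₂ e₁ e₂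
      average = decide (proj₁ m) (proj₁ (proj₂ m)) (proj₂ (proj₂ m)) (≤-total (f (proj₁ m)) (47 ⊗ k))
        where m = minimum≤E J pJ f

    module _ {V₁ V₂ : Set} {{_ : DecEq V₁}} {{_ : DecEq V₂}}
      (R₁ : Measure) (p₁ : IsProbability R₁) (A : Ω R₁ → G) (Z₁ : Ω R₁ → V₁)
      (R₂ : Measure) (p₂ : IsProbability R₂) (B : Ω R₂ → G) (Z₂ : Ω R₂ → V₂) where

      average-⊗ : Improvement ⊎ 47 ⊗ k ≤ bound (H (R₁ ⊗ᵐ R₂) (λ ω → add A B ω , Product.map Z₁ Z₂ ω) - H (R₁ ⊗ᵐ R₂) (Product.map Z₁ Z₂))
        (H R₁ (λ ω → A ω , Z₁ ω) - H R₁ Z₁) (H R₂ (λ ω → B ω , Z₂ ω) - H R₂ Z₂)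
        (H (P₁ ⊗ᵐ R₁) (add ξ₁ A)) (H (P₂ ⊗ᵐ R₂) (add ξ₂ B))
      average-⊗ = average R₁ p₁ A Z₁ R₂ p₂ B Z₂ (weight (R₁ ⊗ᵐ R₂)) (0≤weight (R₁ ⊗ᵐ R₂)) (Product.map Z₁ Z₂)
        (preserves-fst {R₁} {R₂} p₂) (preserves-snd {R₁} {R₂} p₁) (λ _ → support-⊗ R₁ R₂)
        (λ ω _ → conditional-⊗ R₁ Z₁ R₂ Z₂ (Z₁ (proj₁ ω)) (Z₂ (proj₂ ω)))

    module _ {V : Set} {{_ : DecEq V}} (R : Measure) (p : IsProbability R) (Z : Ω R → V) (A B : Ω R → G) where
      open Coupling R Z R Z (λ _ → refl)

      average-coupling : Improvement ⊎ 47 ⊗ k ≤ bound (H coupling (λ ω → add A B ω , Z (proj₁ ω)) - H coupling (Z ∘ proj₁))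
        (H R (λ ω → A ω , Z ω) - H R Z) (H R (λ ω → B ω , Z ω) - H R Z)
        (H (P₁ ⊗ᵐ R) (add ξ₁ A)) (H (P₂ ⊗ᵐ R) (add ξ₂ B))
      average-coupling = average R p A Z R p B Z (weight coupling) (0≤weight coupling) (Z ∘ proj₁)
        coupling-fst coupling-snd (λ ω ω∈ → proj₁ (support-coupling ω∈) , proj₁ (proj₂ (support-coupling ω∈)))
        (λ (ω , ψ) ω∈ → subst (λ z → Preserves (conditional coupling (Z ∘ proj₁) (Z ω)) (conditional R Z (Z ω) ⊗ᵐ conditional R Z z) id)
          (proj₂ (proj₂ (support-coupling ω∈))) (conditional-coupling R Z R Z (λ _ → refl) (Z ω)))

-- The five candidates and the decrease of the distance.

module Improvements (𝔾 : BooleanGroups.BooleanGroup) where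

  open BooleanGroups
  open import Data.List.Base using ([]; _∷_)
  open import Data.List.Relation.Unary.All using ([]; _∷_)
  open import Data.Product.Base using (_×_; _,_; proj₁; proj₂)
  import Data.Product.Base as Product
  open import Data.Sum.Base using (_⊎_; inj₁; inj₂)
  open import Data.Unit.Base using (tt)
  open import Data.Vec.Base using ([]; _∷_)
  open import Function.Base using (_∘_)
  open import Relation.Binary.PropositionalEquality as ≡ using (_≡_; refl; cong; cong₂)
  open LinearInequalities
  open Expectations
  open Entropy
  open RuzsaDistance 𝔾
  open ConditionalAverages 𝔾

  module Candidates (X₁ X₂ : RandomVariable) where
    open Averaging X₁ X₂

    R R₁ R₂ J : Measure
    R  = P₁ ⊗ᵐ P₂
    R₁ = P₁ ⊗ᵐ P₁
    R₂ = P₂ ⊗ᵐ P₂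
    J  = R ⊗ᵐ R

    pR : IsProbability R
    pR = ⊗-isProbability {P₁} {P₂} π₁ π₂
    pR₁ : IsProbability R₁
    pR₁ = ⊗-isProbability {P₁} {P₁} π₁ π₁
    pR₂ : IsProbability R₂
    pR₂ = ⊗-isProbability {P₂} {P₂} π₂ π₂
    pJ : IsProbability J
    pJ = ⊗-isProbability {R} {R} pR pR

    -- A point of J is ((x , y′) , (x′ , y)) with independent x, x′ ∼ X₁ and y, y′ ∼ X₂.
    x y x′ y′ U V W S : Ω J → G
    x  ((a , _) , _) = ξ₁ a
    y′ ((_ , b) , _) = ξ₂ b
    x′ (_ , (a , _)) = ξ₁ a
    y  (_ , (_ , b)) = ξ₂ b
    U ω = x ω ⊕ y ω
    V ω = x′ ω ⊕ y ω
    W ω = x ω ⊕ x′ ω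
    S = add (add ξ₁ ξ₂) (add ξ₁ ξ₂)

    -- The conditioning of the fifth candidate. As U + V = W, it makes each of U and V a function of
    -- the other.
    Z : Ω J → G × G
    Z ω = W ω , S ω

    h₁ h₂ s w₁ w₂ σ j z t₁ t₂ t₃ t₄ : 𝕃
    h₁ = H P₁ ξ₁
    h₂ = H P₂ ξ₂
    s  = H R (add ξ₁ ξ₂)
    w₁ = H R₁ (add ξ₁ ξ₁)
    w₂ = H R₂ (add ξ₂ ξ₂)
    σ  = H J S
    j  = H J (λ ω → (U ω , V ω) , Z ω)
    z  = H J Z
    t₁ = H (P₁ ⊗ᵐ R) (add ξ₁ (add ξ₁ ξ₂))
    t₂ = H (P₂ ⊗ᵐ R) (add ξ₂ (add ξ₁ ξ₂))
    t₃ = H (P₁ ⊗ᵐ R₁) (add ξ₁ (add ξ₁ ξ₁))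
    t₄ = H (P₂ ⊗ᵐ R₂) (add ξ₂ (add ξ₂ ξ₂))

    swapped : H (P₂ ⊗ᵐ P₁) (add ξ₂ ξ₁) ≤ s
    swapped = add-comm {P₁} {P₂} ξ₁ ξ₂

    t₁-bound : t₁ + h₂ ≤ s + s
    t₁-bound = Three.sum-bound′ {P₁} {P₁} {P₂} π₁ π₁ π₂ ξ₁ ξ₁ ξ₂
    t₂-bound : t₂ + h₁ ≤ s + s
    t₂-bound = ≤-trans (Three.sum-bound {P₂} {P₁} {P₂} π₂ π₁ π₂ ξ₂ ξ₁ ξ₂) (+-monoˡ-≤ s swapped)
    t₃-bound : t₃ + h₁ ≤ w₁ + w₁
    t₃-bound = Three.sum-bound {P₁} {P₁} {P₁} π₁ π₁ π₁ ξ₁ ξ₁ ξ₁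
    t₄-bound : t₄ + h₂ ≤ w₂ + w₂
    t₄-bound = Three.sum-bound {P₂} {P₂} {P₂} π₂ π₂ π₂ ξ₂ ξ₂ ξ₂
    w₁-bound : w₁ + h₂ ≤ s + s
    w₁-bound = Three.triangle {P₁} {P₁} {P₂} π₁ π₁ π₂ ξ₁ ξ₁ ξ₂
    w₂-bound : w₂ + h₁ ≤ s + s
    w₂-bound = ≤-trans (Three.triangle {P₂} {P₂} {P₁} π₂ π₂ π₁ ξ₂ ξ₂ ξ₁) (+-mono-≤ swapped swapped)

    J-fst : Preserves J R proj₁
    J-fst = preserves-fst {R} {R} pR
    J-snd : Preserves J R proj₂
    J-snd = preserves-snd {R} {R} pR
    to-P₁ : Preserves R P₁ proj₁
    to-P₁ = preserves-fst {P₁} {P₂} π₂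
    to-P₂ : Preserves R P₂ proj₂
    to-P₂ = preserves-snd {P₁} {P₂} π₁
    J-U : Preserves J R (Product.map proj₁ proj₂)
    J-U = preserves-map {R} {R} {P₁} {P₂} to-P₁ to-P₂

    HU : H J U ≤ s
    HU = ≈⇒≤ (H-preserves {ν = J} {R} J-U (add ξ₁ ξ₂))
    HV : H J V ≤ s
    HV = ≈⇒≤ (H-preserves {ν = J} {R} J-snd (add ξ₁ ξ₂))
    HW : H J W ≤ w₁
    HW = ≈⇒≤ (H-preserves {ν = J} {R₁} (preserves-map {R} {R} {P₁} {P₁} to-P₁ to-P₁) (add ξ₁ ξ₁))
    Hxy′ : H J (λ ω → x ω ⊕ y′ ω) ≤ s
    Hxy′ = ≈⇒≤ (H-preserves {ν = J} {R} J-fst (add ξ₁ ξ₂))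
    Hy′x′ : H J (λ ω → y′ ω ⊕ x′ ω) ≤ s
    Hy′x′ = ≤-trans (≈⇒≤ (H-preserves {ν = J} {P₂ ⊗ᵐ P₁} (preserves-map {R} {R} {P₂} {P₁} to-P₂ to-P₁) (add ξ₂ ξ₁))) swapped
    Hy′y : H J (λ ω → y′ ω ⊕ y ω) ≤ w₂
    Hy′y = ≈⇒≤ (H-preserves {ν = J} {R₂} (preserves-map {R} {R} {P₂} {P₂} to-P₂ to-P₂) (add ξ₂ ξ₂))
    Hx : H J x ≤ h₁
    Hx = ≈⇒≤ (A.trans (H-preserves {ν = J} {R} J-fst (ξ₁ ∘ proj₁)) (H-preserves {ν = R} {P₁} to-P₁ ξ₁))
    Hy : H J y ≤ h₂
    Hy = ≈⇒≤ (A.trans (H-preserves {ν = J} {R} J-snd (ξ₂ ∘ proj₂)) (H-preserves {ν = R} {P₂} to-P₂ ξ₂))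

    HUS : H J (λ ω → U ω , S ω) ≤ s + s
    HUS = ≤-trans (H-function J (λ ω → U ω , y′ ω ⊕ x′ ω) (λ ω → U ω , S ω) (λ (u , v) → u , u ⊕ v)
        (λ ω _ → cong (U ω ,_) (xor-solve ((x₀ :⊕ x₁) :⊕ (x₂ :⊕ x₃)) ((x₀ :⊕ x₂) :⊕ (x₃ :⊕ x₁)) (x ω ∷ y ω ∷ y′ ω ∷ x′ ω ∷ []) refl)))
      (≤-trans (subadditive J pJ U (λ ω → y′ ω ⊕ x′ ω)) (+-mono-≤ HU Hy′x′))
    HVS : H J (λ ω → V ω , S ω) ≤ s + s
    HVS = ≤-trans (H-function J (λ ω → V ω , x ω ⊕ y′ ω) (λ ω → V ω , S ω) (λ (v , t) → v , t ⊕ v) (λ _ _ → refl))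
      (≤-trans (subadditive J pJ V (λ ω → x ω ⊕ y′ ω)) (+-mono-≤ HV Hxy′))
    z-bound : z ≤ w₁ + w₂
    z-bound = ≤-trans (H-function J (λ ω → W ω , y′ ω ⊕ y ω) Z (λ (v , t) → v , v ⊕ t)
        (λ ω _ → cong (W ω ,_) (xor-solve ((x₀ :⊕ x₃) :⊕ (x₂ :⊕ x₁)) ((x₀ :⊕ x₂) :⊕ (x₃ :⊕ x₁)) (x ω ∷ y ω ∷ y′ ω ∷ x′ ω ∷ []) refl)))
      (≤-trans (subadditive J pJ W (λ ω → y′ ω ⊕ y ω)) (+-mono-≤ HW Hy′y))

    full : h₁ + h₂ + (h₁ + h₂) ≤ H J (Product.map (Product.map ξ₁ ξ₂) (Product.map ξ₁ ξ₂))
    full = ≈⇒≥ (A.trans (H-⊗ R R (Product.map ξ₁ ξ₂) (Product.map ξ₁ ξ₂) pR pR)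
      (A.∙-cong (H-⊗ P₁ P₂ ξ₁ ξ₂ π₁ π₂) (H-⊗ P₁ P₂ ξ₁ ξ₂ π₁ π₂)))

    -- U, V and S are three independent relations between four variables, so knowing x as well
    -- reveals all of them.
    j-bound₁ : h₁ + h₂ + (h₁ + h₂) ≤ j + h₁
    j-bound₁ = ≤-trans full (≤-trans
      (H-function J (λ ω → ((U ω , V ω) , Z ω) , x ω) (Product.map (Product.map ξ₁ ξ₂) (Product.map ξ₁ ξ₂))
        (λ (((u , v) , (w , t)) , a) → (a , t ⊕ (a ⊕ v)) , (w ⊕ a , u ⊕ a))
        (λ ω _ → cong₂ (λ b c → (x ω , b) , c)
          (xor-solve (((x₀ :⊕ x₂) :⊕ (x₃ :⊕ x₁)) :⊕ (x₀ :⊕ (x₃ :⊕ x₁))) x₂ (x ω ∷ y ω ∷ y′ ω ∷ x′ ω ∷ []) refl)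
          (cong₂ _,_ (xor-solve ((x₀ :⊕ x₁) :⊕ x₀) x₁ (x ω ∷ x′ ω ∷ []) refl) (xor-solve ((x₀ :⊕ x₁) :⊕ x₀) x₁ (x ω ∷ y ω ∷ []) refl))))
      (≤-trans (subadditive J pJ (λ ω → (U ω , V ω) , Z ω) x) (+-mono-≤ (≤-refl {j}) Hx)))

    j-bound₂ : h₁ + h₂ + (h₁ + h₂) ≤ j + h₂
    j-bound₂ = ≤-trans full (≤-trans
      (H-function J (λ ω → ((U ω , V ω) , Z ω) , y ω) (Product.map (Product.map ξ₁ ξ₂) (Product.map ξ₁ ξ₂))
        (λ (((u , v) , (w , t)) , b) → (u ⊕ b , t ⊕ (u ⊕ (v ⊕ b))) , (v ⊕ b , b))
        (λ ω _ → cong₂ _,_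
          (cong₂ _,_ (xor-solve ((x₀ :⊕ x₁) :⊕ x₁) x₀ (x ω ∷ y ω ∷ []) refl)
            (xor-solve (((x₀ :⊕ x₂) :⊕ (x₃ :⊕ x₁)) :⊕ ((x₀ :⊕ x₁) :⊕ ((x₃ :⊕ x₁) :⊕ x₁))) x₂ (x ω ∷ y ω ∷ y′ ω ∷ x′ ω ∷ []) refl))
          (cong (_, y ω) (xor-solve ((x₀ :⊕ x₁) :⊕ x₁) x₀ (x′ ω ∷ y ω ∷ []) refl))))
      (≤-trans (subadditive J pJ (λ ω → (U ω , V ω) , Z ω) y) (+-mono-≤ (≤-refl {j}) Hy)))

    Failure : 𝕃 → 𝕃 → 𝕃 → 𝕃 → 𝕃 → Set
    Failure hJ c₁ c₂ e₁ e₂ = 47 ⊗ k ≤ bound hJ c₁ c₂ e₁ e₂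

    failure-mono : ∀ {hJ c₁ c₂ e₁ e₂ hJ′ c₁′ c₂′ e₁′ e₂′} → hJ ≤ hJ′ → c₁′ ≤ c₁ → c₂′ ≤ c₂ → e₁ ≤ e₁′ → e₂ ≤ e₂′ →
      Improvement ⊎ Failure hJ c₁ c₂ e₁ e₂ → Improvement ⊎ Failure hJ′ c₁′ c₂′ e₁′ e₂′
    failure-mono a b c d e (inj₁ i) = inj₁ i
    failure-mono {hJ} {c₁} {c₂} {e₁} {e₂} {hJ′} {c₁′} {c₂′} {e₁′} {e₂′} a b c d e (inj₂ h) = inj₂ (≤-trans h
      (linear (hJ ∷ c₁ ∷ c₂ ∷ e₁ ∷ e₂ ∷ hJ′ ∷ c₁′ ∷ c₂′ ∷ e₁′ ∷ e₂′ ∷ h₁ ∷ h₂ ∷ []) 0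
        (cost-expr v₀ v₁ v₂ v₃ v₄ v₁₀ v₁₁ :≤ cost-expr v₅ v₆ v₇ v₈ v₉ v₁₀ v₁₁)
        ((96 , v₀ :≤ v₅) ∷ (49 , v₆ :≤ v₁) ∷ (49 , v₇ :≤ v₂) ∷ (2 , v₃ :≤ v₈) ∷ (2 , v₄ :≤ v₉) ∷ []) refl
        (a ∷ b ∷ c ∷ d ∷ e ∷ [])))

    trivial-Z : ∀ {V : Set} {{_ : DecEq V}} μ → IsProbability μ → (X : Ω μ → V) →
      H μ X ≤ H μ (λ ω → X ω , tt) - H μ (λ _ → tt)
    trivial-Z μ p X = linear (H μ X ∷ H μ (λ ω → X ω , tt) ∷ H μ (λ _ → tt) ∷ []) 0 (v₀ :≤ v₁ :- v₂)
      ((1 , v₀ :≤ v₁) ∷ (1 , v₂ :≤ :0) ∷ []) refl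
      (H-function μ (λ ω → X ω , tt) X proj₁ (λ _ _ → refl) ∷ H-const μ p ∷ [])

    unconditioned : ∀ Q Q′ → IsProbability Q → IsProbability Q′ → (A : Ω Q → G) (B : Ω Q′ → G) →
      H (Q ⊗ᵐ Q′) (λ ω → add A B ω , (tt , tt)) - H (Q ⊗ᵐ Q′) (λ _ → tt , tt) ≤ H (Q ⊗ᵐ Q′) (add A B)
    unconditioned Q Q′ p p′ A B = linear (H (Q ⊗ᵐ Q′) (λ ω → add A B ω , (tt , tt)) ∷ H (Q ⊗ᵐ Q′) (λ _ → tt , tt) ∷ H (Q ⊗ᵐ Q′) (add A B) ∷ [])
      0 (v₀ :- v₁ :≤ v₂) ((1 , v₀ :≤ v₂) ∷ (1 , :0 :≤ v₁) ∷ []) refl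
      (H-function (Q ⊗ᵐ Q′) (add A B) (λ ω → add A B ω , (tt , tt)) (_, (tt , tt)) (λ _ _ → refl)
      ∷ 0≤H (Q ⊗ᵐ Q′) (⊗-isProbability {Q} {Q′} p p′) (λ _ → tt , tt) ∷ [])

    -- Two independent copies of X₁ + X₂, whose sum is S.
    candidate₁ : Improvement ⊎ Failure σ s s t₁ t₂
    candidate₁ = failure-mono (unconditioned R R pR pR (add ξ₁ ξ₂) (add ξ₁ ξ₂))
      (trivial-Z R pR (add ξ₁ ξ₂)) (trivial-Z R pR (add ξ₁ ξ₂)) ≤-refl ≤-refl
      (average-⊗ R pR (add ξ₁ ξ₂) (λ _ → tt) R pR (add ξ₁ ξ₂) (λ _ → tt))

    given-sum : ∀ Q Q′ → IsProbability Q → IsProbability Q′ → (X : Ω Q → G) (Y : Ω Q′ → G) →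
      (A : Ω Q × Ω Q′ → G) (φ : G × G → G × G) → (∀ ω → φ (A ω , add X Y ω) ≡ Product.map X Y ω) →
      H Q X + H Q′ Y - H (Q ⊗ᵐ Q′) (add X Y) ≤ H (Q ⊗ᵐ Q′) (λ ω → A ω , add X Y ω) - H (Q ⊗ᵐ Q′) (add X Y)
    given-sum Q Q′ p p′ X Y A φ eq = +-monoˡ-≤ _ (≤-trans (≈⇒≥ (H-⊗ Q Q′ X Y p p′))
      (H-function (Q ⊗ᵐ Q′) (λ ω → A ω , add X Y ω) (Product.map X Y) φ (λ ω _ → eq ω)))

    recover-fst : ∀ {A B : Set} (X : A → G) (Y : B → G) (ω : A × B) → (X (proj₁ ω) , X (proj₁ ω) ⊕ add X Y ω) ≡ Product.map X Y ω
    recover-fst X Y (a , b) = cong (X a ,_) (xor-solve (x₀ :⊕ (x₀ :⊕ x₁)) x₁ (X a ∷ Y b ∷ []) refl)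

    recover-snd : ∀ {A B : Set} (X : A → G) (Y : B → G) (ω : A × B) → (add X Y ω ⊕ Y (proj₂ ω) , Y (proj₂ ω)) ≡ Product.map X Y ω
    recover-snd X Y (a , b) = cong (_, Y b) (xor-solve ((x₀ :⊕ x₁) :⊕ x₁) x₀ (X a ∷ Y b ∷ []) refl)

    -- X₁ and X₂, each given its sum with an independent copy of the other. Failure here and in
    -- `candidate₁` bounds σ + j from below, hence the mutual information us + vs - j - σ of U and V
    -- given S from above.
    candidate₂ : Improvement ⊎ Failure (j - (s + s)) (h₁ + h₂ - s) (h₁ + h₂ - s) w₁ w₂
    candidate₂ = failure-mono
      (+-mono-≤ (H-function J (λ ω → (U ω , V ω) , Z ω) (λ ω → U ω , (x ω ⊕ y′ ω , V ω)) (λ ((u , v) , (w , t)) → u , (t ⊕ v , v))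
          (λ ω _ → cong (λ a → U ω , (a , V ω)) (xor-solve ((x₀ :⊕ x₁) :⊕ x₁) x₀ ((x ω ⊕ y′ ω) ∷ V ω ∷ []) refl)))
        (≈⇒≤ (A.⁻¹-cong (H-⊗ R R (add ξ₁ ξ₂) (add ξ₁ ξ₂) pR pR))))
      (given-sum P₁ P₂ π₁ π₂ ξ₁ ξ₂ (ξ₁ ∘ proj₁) (λ (a , t) → a , a ⊕ t) (recover-fst ξ₁ ξ₂))
      (given-sum P₁ P₂ π₁ π₂ ξ₁ ξ₂ (ξ₂ ∘ proj₂) (λ (b , t) → t ⊕ b , b) (recover-snd ξ₁ ξ₂))
      (≈⇒≤ (H-preserves {ν = P₁ ⊗ᵐ R} {R₁} (preserves-map {P₁} {R} {P₁} {P₁} (preserves-id {P₁}) to-P₁) (add ξ₁ ξ₁)))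
      (≈⇒≤ (H-preserves {ν = P₂ ⊗ᵐ R} {R₂} (preserves-map {P₂} {R} {P₂} {P₂} (preserves-id {P₂}) to-P₂) (add ξ₂ ξ₂)))
      (average-⊗ R pR (ξ₁ ∘ proj₁) (add ξ₁ ξ₂) R pR (ξ₂ ∘ proj₂) (add ξ₁ ξ₂))

    J′ : Measure
    J′ = R₁ ⊗ᵐ R₂
    J′→J : Ω J′ → Ω J
    J′→J ((a , a′) , (b′ , b)) = (a , b′) , (a′ , b)
    interchange : Preserves J′ J J′→J
    interchange = preserves-interchange {P₁} {P₁} {P₂} {P₂}

    -- The same total S, with its four terms grouped as X₁ + X₁′ and X₂ + X₂′.
    candidate₃ : Improvement ⊎ Failure σ w₁ w₂ t₃ t₄
    candidate₃ = failure-mono (≤-trans (unconditioned R₁ R₂ pR₁ pR₂ (add ξ₁ ξ₁) (add ξ₂ ξ₂))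
        (≤-trans (H-≤ J′ (S ∘ J′→J) (add (add ξ₁ ξ₁) (add ξ₂ ξ₂)) (λ ((a , a′) , (b′ , b)) →
            xor-solve ((x₀ :⊕ x₂) :⊕ (x₁ :⊕ x₃)) ((x₀ :⊕ x₁) :⊕ (x₂ :⊕ x₃)) (ξ₁ a ∷ ξ₁ a′ ∷ ξ₂ b′ ∷ ξ₂ b ∷ []) refl))
          (≈⇒≤ (H-preserves {ν = J′} {J} interchange S))))
      (trivial-Z R₁ pR₁ (add ξ₁ ξ₁)) (trivial-Z R₂ pR₂ (add ξ₂ ξ₂)) ≤-refl ≤-refl
      (average-⊗ R₁ pR₁ (add ξ₁ ξ₁) (λ _ → tt) R₂ pR₂ (add ξ₂ ξ₂) (λ _ → tt))

    -- The conditioned companion of `candidate₃`. The two failures again bound σ + j from below, now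
    -- against w₁ + w₂, which dominates the entropy z of (W , S).
    candidate₄ : Improvement ⊎ Failure (j - (w₁ + w₂)) (h₁ + h₁ - w₁) (h₂ + h₂ - w₂) w₁ w₂
    candidate₄ = failure-mono
      (+-mono-≤ (≤-trans (H-function J′ (λ ω → (U (J′→J ω) , V (J′→J ω)) , Z (J′→J ω))
            (λ ω → add (ξ₁ ∘ proj₁) (ξ₂ ∘ proj₂) ω , Product.map (add ξ₁ ξ₁) (add ξ₂ ξ₂) ω) (λ ((u , v) , (w , t)) → u , (w , t ⊕ w))
            (λ ((a , a′) , (b′ , b)) _ → cong (λ t → ξ₁ a ⊕ ξ₂ b , (ξ₁ a ⊕ ξ₁ a′ , t))
              (xor-solve (((x₀ :⊕ x₂) :⊕ (x₁ :⊕ x₃)) :⊕ (x₀ :⊕ x₁)) (x₂ :⊕ x₃) (ξ₁ a ∷ ξ₁ a′ ∷ ξ₂ b′ ∷ ξ₂ b ∷ []) refl)))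
          (≈⇒≤ (H-preserves {ν = J′} {J} interchange (λ ω → (U ω , V ω) , Z ω))))
        (≈⇒≤ (A.⁻¹-cong (H-⊗ R₁ R₂ (add ξ₁ ξ₁) (add ξ₂ ξ₂) pR₁ pR₂))))
      (given-sum P₁ P₁ π₁ π₁ ξ₁ ξ₁ (ξ₁ ∘ proj₁) (λ (a , t) → a , a ⊕ t) (recover-fst ξ₁ ξ₁))
      (given-sum P₂ P₂ π₂ π₂ ξ₂ ξ₂ (ξ₂ ∘ proj₂) (λ (b , t) → t ⊕ b , b) (recover-snd ξ₂ ξ₂))
      (≈⇒≤ (H-preserves {ν = P₁ ⊗ᵐ R₁} {R₁} (preserves-map {P₁} {R₁} {P₁} {P₁} (preserves-id {P₁}) (preserves-fst {P₁} {P₁} π₁)) (add ξ₁ ξ₁)))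
      (≈⇒≤ (H-preserves {ν = P₂ ⊗ᵐ R₂} {R₂} (preserves-map {P₂} {R₂} {P₂} {P₂} (preserves-id {P₂}) (preserves-snd {P₂} {P₂} π₂)) (add ξ₂ ξ₂)))
      (average-⊗ R₁ pR₁ (ξ₁ ∘ proj₁) (add ξ₁ ξ₁) R₂ pR₂ (ξ₂ ∘ proj₂) (add ξ₂ ξ₂))

    -- Two copies of J with the same W and S. As U, V, W sum to 0, the sum of the
    -- first U and the second V is also the sum of the first V and the second U.
    open Coupling J Z J Z (λ _ → refl)

    pC : IsProbability coupling
    pC = coupling-isProbability pJ

    U₁ V₁ U₂ V₂ S₁ S₂ Q : Ω coupling → G
    U₁ = U ∘ proj₁
    V₁ = V ∘ proj₁
    S₁ = S ∘ proj₁
    U₂ = U ∘ proj₂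
    V₂ = V ∘ proj₂
    S₂ = S ∘ proj₂
    Q  = add U V

    U₁⊕V₁ : ∀ ω → U₁ ω ⊕ V₁ ω ≡ W (proj₁ ω)
    U₁⊕V₁ (ω , _) = xor-solve ((x₀ :⊕ x₁) :⊕ (x₂ :⊕ x₁)) (x₀ :⊕ x₂) (x ω ∷ y ω ∷ x′ ω ∷ []) refl

    U₂⊕V₂ : ∀ ω → Support coupling ω → U₂ ω ⊕ V₂ ω ≡ U₁ ω ⊕ V₁ ω
    U₂⊕V₂ (ω , ψ) ω∈ = ≡.trans (U₁⊕V₁ (ψ , ω)) (≡.trans (cong proj₁ (≡.sym (proj₂ (proj₂ (support-coupling ω∈))))) (≡.sym (U₁⊕V₁ (ω , ψ))))

    S₁≡S₂ : ∀ ω → Support coupling ω → S₁ ω ≡ S₂ ω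
    S₁≡S₂ ω ω∈ = cong proj₂ (proj₂ (proj₂ (support-coupling ω∈)))

    V₁⊕U₂ : ∀ ω → Support coupling ω → V₁ ω ⊕ U₂ ω ≡ Q ω
    V₁⊕U₂ ω ω∈ = ≡.trans (xor-solve (x₁ :⊕ x₂) ((x₁ :⊕ (x₂ :⊕ x₃)) :⊕ x₃) (U₁ ω ∷ V₁ ω ∷ U₂ ω ∷ V₂ ω ∷ []) refl)
      (≡.trans (cong (λ t → (V₁ ω ⊕ t) ⊕ V₂ ω) (U₂⊕V₂ ω ω∈))
        (xor-solve ((x₁ :⊕ (x₀ :⊕ x₁)) :⊕ x₃) (x₀ :⊕ x₃) (U₁ ω ∷ V₁ ω ∷ U₂ ω ∷ V₂ ω ∷ []) refl))

    us vs q qs r₁ r₂ : 𝕃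
    us = H J (λ ω → U ω , S ω)
    vs = H J (λ ω → V ω , S ω)
    q  = H coupling (λ ω → Q ω , Z (proj₁ ω))
    qs = H coupling (λ ω → Q ω , S₁ ω)
    r₁ = H coupling (λ ω → U₁ ω , (Q ω , S₁ ω))
    r₂ = H coupling (λ ω → V₁ ω , (Q ω , S₁ ω))

    S-fst : H coupling S₁ ≈ σ
    S-fst = H-preserves {ν = coupling} {J} coupling-fst S
    Z-fst : H coupling (Z ∘ proj₁) ≈ z
    Z-fst = H-preserves {ν = coupling} {J} coupling-fst Z

    -- Knowing W besides S can only lower the entropy of Q.
    q-bound : q + σ ≤ qs + z
    q-bound = ≤-trans (+-mono-≤ (≤-refl {q}) (≈⇒≥ S-fst)) (≤-trans
      (submodular coupling pC (λ ω → Q ω , S₁ ω) (Z ∘ proj₁) S₁ (λ ω → Q ω , Z (proj₁ ω))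
        proj₂ (λ _ _ → refl) proj₂ (λ _ _ → refl) (λ ((a , _) , t) → a , t) (λ _ _ → refl))
      (+-mono-≤ (≤-refl {qs}) (≈⇒≤ Z-fst)))

    r₁-bound : r₁ + σ ≤ us + vs
    r₁-bound = ≤-trans (+-mono-≤ (≤-refl {r₁}) (≈⇒≥ S-fst)) (≤-trans
      (submodular coupling pC (λ ω → U₁ ω , S₁ ω) (λ ω → V₂ ω , S₂ ω) S₁ (λ ω → U₁ ω , (Q ω , S₁ ω))
        proj₂ (λ _ _ → refl) proj₂ (λ ω ω∈ → ≡.sym (S₁≡S₂ ω ω∈)) (λ ((u , t) , (v , _)) → u , (u ⊕ v , t)) (λ _ _ → refl))
      (+-mono-≤ (≈⇒≤ (H-preserves {ν = coupling} {J} coupling-fst (λ ω → U ω , S ω)))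
        (≈⇒≤ (H-preserves {ν = coupling} {J} coupling-snd (λ ω → V ω , S ω)))))

    r₂-bound : r₂ + σ ≤ us + vs
    r₂-bound = ≤-trans (+-mono-≤ (≤-refl {r₂}) (≈⇒≥ S-fst)) (≤-trans
      (submodular coupling pC (λ ω → U₂ ω , S₂ ω) (λ ω → V₁ ω , S₁ ω) S₁ (λ ω → V₁ ω , (Q ω , S₁ ω))
        proj₂ (λ ω ω∈ → ≡.sym (S₁≡S₂ ω ω∈)) proj₂ (λ _ _ → refl)
        (λ ((u , _) , (v , t)) → v , (v ⊕ u , t)) (λ ω ω∈ → cong (λ p → V₁ ω , (p , S₁ ω)) (V₁⊕U₂ ω ω∈)))
      (+-mono-≤ (≈⇒≤ (H-preserves {ν = coupling} {J} coupling-snd (λ ω → U ω , S ω)))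
        (≈⇒≤ (H-preserves {ν = coupling} {J} coupling-fst (λ ω → V ω , S ω)))))

    UV : Ω J → G × G
    UV ω = U ω , V ω

    -- The entropic Balog-Szemerédi-Gowers step. From Q = U₁ + V₂ = V₁ + U₂ the triples behind r₁
    -- and r₂ together recover both copies, whose joint entropy is 2 j - z, while they share Q and
    -- S.
    qs-bound : (j + j - z) + qs ≤ r₁ + r₂
    qs-bound = ≤-trans (+-monoˡ-≤ qs (≈⇒≥ (H-coupling UV UV)))
      (submodular coupling pC (λ ω → U₁ ω , (Q ω , S₁ ω)) (λ ω → V₁ ω , (Q ω , S₁ ω)) (λ ω → Q ω , S₁ ω) (joint UV UV)
        proj₂ (λ _ _ → refl) proj₂ (λ _ _ → refl)
        (λ ((u , (p , t)) , (v , _)) → ((u , v) , (v ⊕ p , u ⊕ p)) , (u ⊕ v , t))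
        (λ ω ω∈ → cong₂ (λ a b → ((U₁ ω , V₁ ω) , a) , (b , S₁ ω))
          (cong₂ _,_ (≡.trans (cong (V₁ ω ⊕_) (≡.sym (V₁⊕U₂ ω ω∈))) (xor-solve (x₀ :⊕ (x₀ :⊕ x₁)) x₁ (V₁ ω ∷ U₂ ω ∷ []) refl))
            (xor-solve (x₀ :⊕ (x₀ :⊕ x₁)) x₁ (U₁ ω ∷ V₂ ω ∷ []) refl))
          (U₁⊕V₁ ω)))

    -- U and V given Z. Either of them determines the other then, so that each retains the
    -- conditional entropy j - z.
    candidate₅ : Improvement ⊎ Failure (q - z) (j - z) (j - z) t₁ t₂
    candidate₅ = failure-mono (+-mono-≤ (≤-refl {q}) (≈⇒≤ (A.⁻¹-cong Z-fst)))
      (+-monoˡ-≤ _ (H-function J (λ ω → U ω , Z ω) (λ ω → (U ω , V ω) , Z ω) (λ (u , (w , t)) → (u , w ⊕ u) , (w , t))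
        (λ ω _ → cong (λ v → (U ω , v) , Z ω) (xor-solve ((x₀ :⊕ x₂) :⊕ (x₀ :⊕ x₁)) (x₂ :⊕ x₁) (x ω ∷ y ω ∷ x′ ω ∷ []) refl))))
      (+-monoˡ-≤ _ (H-function J (λ ω → V ω , Z ω) (λ ω → (U ω , V ω) , Z ω) (λ (v , (w , t)) → (w ⊕ v , v) , (w , t))
        (λ ω _ → cong (λ u → (u , V ω) , Z ω) (xor-solve ((x₀ :⊕ x₂) :⊕ (x₂ :⊕ x₁)) (x₀ :⊕ x₁) (x ω ∷ y ω ∷ x′ ω ∷ []) refl))))
      (≈⇒≤ (H-preserves {ν = P₁ ⊗ᵐ J} {P₁ ⊗ᵐ R} (preserves-map {P₁} {J} {P₁} {R} (preserves-id {P₁}) J-U) (add ξ₁ (add ξ₁ ξ₂))))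
      (≈⇒≤ (H-preserves {ν = P₂ ⊗ᵐ J} {P₂ ⊗ᵐ R} (preserves-map {P₂} {J} {P₂} {R} (preserves-id {P₂}) J-snd) (add ξ₂ (add ξ₁ ξ₂))))
      (average-coupling J pJ Z U V)

    -- (candidates 1 and 2) + 2 (candidates 3 and 4) + candidate 5 reads 329 k ≤ 328 k.
    contradictory : Failure σ s s t₁ t₂ → Failure (j - (s + s)) (h₁ + h₂ - s) (h₁ + h₂ - s) w₁ w₂ →
      Failure σ w₁ w₂ t₃ t₄ → Failure (j - (w₁ + w₂)) (h₁ + h₁ - w₁) (h₂ + h₂ - w₂) w₁ w₂ →
      47 ⊗ k ≤ bound (q - z) (j - z) (j - z) t₁ t₂ → k ≤ 0#
    contradictory f₁ f₂ f₃ f₄ f₅ = linear (h₁ ∷ h₂ ∷ s ∷ w₁ ∷ w₂ ∷ σ ∷ j ∷ z ∷ t₁ ∷ t₂ ∷ t₃ ∷ t₄ ∷ q ∷ []) 0 (K :≤ :0)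
      ((1 , 47 :* K :≤ cost-expr v₅ v₂ v₂ v₈ v₉ v₀ v₁)
      ∷ (1 , 47 :* K :≤ cost-expr (v₆ :- (v₂ :+ v₂)) (v₀ :+ v₁ :- v₂) (v₀ :+ v₁ :- v₂) v₃ v₄ v₀ v₁)
      ∷ (2 , 47 :* K :≤ cost-expr v₅ v₃ v₄ v₁₀ v₁₁ v₀ v₁)
      ∷ (2 , 47 :* K :≤ cost-expr (v₆ :- (v₃ :+ v₄)) (v₀ :+ v₀ :- v₃) (v₁ :+ v₁ :- v₄) v₃ v₄ v₀ v₁)
      ∷ (1 , 47 :* K :≤ cost-expr (v₁₂ :- v₇) (v₆ :- v₇) (v₆ :- v₇) v₈ v₉ v₀ v₁)
      ∷ (96 , (v₆ :+ v₆ :- v₇) :+ v₁₂ :+ 3 :* v₅ :≤ v₇ :+ 8 :* v₂)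
      ∷ (4 , v₈ :+ v₁ :≤ v₂ :+ v₂) ∷ (4 , v₉ :+ v₀ :≤ v₂ :+ v₂)
      ∷ (4 , v₁₀ :+ v₀ :≤ v₃ :+ v₃) ∷ (4 , v₁₁ :+ v₁ :≤ v₄ :+ v₄)
      ∷ (16 , v₃ :+ v₁ :≤ v₂ :+ v₂) ∷ (16 , v₄ :+ v₀ :≤ v₂ :+ v₂)
      -- 194 = -96 + 98 + 192: z enters the fifth failure through q - z and, 49 times each, through
      -- two terms j - z, and enters 96 copies of `combined` twice each.
      ∷ (194 , v₇ :≤ v₃ :+ v₄)
      ∷ (1 , v₀ :+ v₁ :+ (v₀ :+ v₁) :≤ v₆ :+ v₀) ∷ (1 , v₀ :+ v₁ :+ (v₀ :+ v₁) :≤ v₆ :+ v₁) ∷ []) refl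
      (f₁ ∷ f₂ ∷ f₃ ∷ f₄ ∷ f₅ ∷ combined ∷ t₁-bound ∷ t₂-bound ∷ t₃-bound ∷ t₄-bound ∷ w₁-bound ∷ w₂-bound ∷ z-bound ∷ j-bound₁ ∷ j-bound₂ ∷ [])
      where
      K : Expr 13
      K = v₂ :+ v₂ :- v₀ :- v₁
      combined : (j + j - z) + q + 3 ⊗ σ ≤ z + 8 ⊗ s
      combined = linear (j ∷ z ∷ q ∷ σ ∷ s ∷ qs ∷ r₁ ∷ r₂ ∷ us ∷ vs ∷ []) 0 ((v₀ :+ v₀ :- v₁) :+ v₂ :+ 3 :* v₃ :≤ v₁ :+ 8 :* v₄)
        ((1 , v₂ :+ v₃ :≤ v₅ :+ v₁) ∷ (1 , (v₀ :+ v₀ :- v₁) :+ v₅ :≤ v₆ :+ v₇) ∷ (1 , v₆ :+ v₃ :≤ v₈ :+ v₉) ∷ (1 , v₇ :+ v₃ :≤ v₈ :+ v₉)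
        ∷ (2 , v₈ :≤ v₄ :+ v₄) ∷ (2 , v₉ :≤ v₄ :+ v₄) ∷ []) refl
        (q-bound ∷ qs-bound ∷ r₁-bound ∷ r₂-bound ∷ HUS ∷ HVS ∷ [])

    -- The five failures exclude only k > 0. For k ≤ 0 the pair may stay: by the triangle inequality
    -- each variable is at distance at most 2 k from its own copy, so the cost is at most 52 k ≤ 47
    -- k.
    trivial : k ≤ 0# → Improvement
    trivial k≤0 = X₁ , X₂ , linear (h₁ ∷ h₂ ∷ s ∷ w₁ ∷ w₂ ∷ []) 0 (48 :* K :+ (v₃ :+ v₃ :- v₀ :- v₀) :+ (v₄ :+ v₄ :- v₁ :- v₁) :≤ 47 :* K)
      ((5 , K :≤ :0) ∷ (2 , v₃ :+ v₁ :≤ v₂ :+ v₂) ∷ (2 , v₄ :+ v₀ :≤ v₂ :+ v₂) ∷ []) refl (k≤0 ∷ w₁-bound ∷ w₂-bound ∷ [])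
      where
      K : Expr 5
      K = v₂ :+ v₂ :- v₀ :- v₁

    improvement : Improvement
    improvement = choose candidate₁ candidate₂ candidate₃ candidate₄ candidate₅
      where
      choose : Improvement ⊎ _ → Improvement ⊎ _ → Improvement ⊎ _ → Improvement ⊎ _ → Improvement ⊎ _ → Improvement
      choose (inj₁ i) _ _ _ _ = i
      choose _ (inj₁ i) _ _ _ = i
      choose _ _ (inj₁ i) _ _ = i
      choose _ _ _ (inj₁ i) _ = i
      choose _ _ _ _ (inj₁ i) = i
      choose (inj₂ f₁) (inj₂ f₂) (inj₂ f₃) (inj₂ f₄) (inj₂ f₅) = trivial (contradictory f₁ f₂ f₃ f₄ f₅)

-- Iterating the decrease with bounded displacement.

module Iteration (𝔾 : BooleanGroups.BooleanGroup) where

  open import Data.List.Base using ([]; _∷_)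
  open import Data.List.Relation.Unary.All using ([]; _∷_)
  open import Data.Nat.Base as ℕ using (ℕ; zero; suc)
  import Data.Nat.Properties as ℕ
  open import Data.Product.Base using (∃-syntax; Σ-syntax; _×_; _,_; proj₁; proj₂)
  open import Data.Rational.Base as ℚ using (ℚ; 0ℚ; 1ℚ)
  import Data.Rational.Properties as ℚ
  open import Data.Vec.Base using ([]; _∷_)
  open import Relation.Binary.PropositionalEquality using (refl; cong)
  open LinearInequalities
  open RationalLemmas
  open Expectations
  open Entropy
  open RuzsaDistance 𝔾
  open Improvements 𝔾

  open RandomVariable

  d : RandomVariable → RandomVariable → 𝕃
  d X Y = D (measure X) (value X) (measure Y) (value Y)

  0≤d : ∀ X Y → 0# ≤ d X Y
  0≤d X Y = linear (H (measure X) (value X) ∷ H (measure Y) (value Y) ∷ H (measure X ⊗ᵐ measure Y) (add (value X) (value Y)) ∷ [])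
    0 (:0 :≤ v₂ :+ v₂ :- v₀ :- v₁) ((1 , v₀ :≤ v₂) ∷ (1 , v₁ :≤ v₂) ∷ []) refl
    (H≤add {measure X} {measure Y} (isProbability X) (isProbability Y) (value X) (value Y)
    ∷ H≤add′ {measure X} {measure Y} (isProbability X) (isProbability Y) (value X) (value Y) ∷ [])

  d-triangle : ∀ X Y Z → d X Z ≤ d X Y + d Z Y
  d-triangle X Y Z = linear (H (measure X) (value X) ∷ H (measure Y) (value Y) ∷ H (measure Z) (value Z)
      ∷ H (measure X ⊗ᵐ measure Z) (add (value X) (value Z)) ∷ H (measure X ⊗ᵐ measure Y) (add (value X) (value Y)) ∷ H (measure Z ⊗ᵐ measure Y) (add (value Z) (value Y)) ∷ [])
    0 (v₃ :+ v₃ :- v₀ :- v₂ :≤ (v₄ :+ v₄ :- v₀ :- v₁) :+ (v₅ :+ v₅ :- v₂ :- v₁)) ((2 , v₃ :+ v₁ :≤ v₄ :+ v₅) ∷ []) refl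
    (Three.triangle {measure X} {measure Z} {measure Y} (isProbability X) (isProbability Z) (isProbability Y) (value X) (value Z) (value Y) ∷ [])

  d-comm : ∀ X Y → d X Y ≤ d Y X
  d-comm X Y = linear (H (measure X) (value X) ∷ H (measure Y) (value Y) ∷ H (measure X ⊗ᵐ measure Y) (add (value X) (value Y)) ∷ H (measure Y ⊗ᵐ measure X) (add (value Y) (value X)) ∷ [])
    0 (v₂ :+ v₂ :- v₀ :- v₁ :≤ v₃ :+ v₃ :- v₁ :- v₀) ((2 , v₂ :≤ v₃) ∷ []) refl
    (add-comm {measure Y} {measure X} (value Y) (value X) ∷ [])

  module _ (X₀ : RandomVariable) where

    -- The distance to X₀ stays bounded because the distances between the pairs decrease geometrically.
    Descent : ℕ → Set₁
    Descent t = Σ[ X ∈ RandomVariable ] Σ[ Y ∈ RandomVariable ]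
      d X₀ X + 2256 ⊗ d X Y ≤ 2257 ⊗ d X₀ X₀ × t ⊗ d X Y + 48 ⊗ d X Y ≤ 48 ⊗ d X₀ X₀

    ⊗-48 : ∀ t x → t ⊗ (48 ⊗ x) ≈ 48 ⊗ (t ⊗ x)
    ⊗-48 t x = A.trans (⊗-assoc x t 48) (A.trans (A.reflexive (cong (_⊗ x) (ℕ.*-comm t 48))) (A.sym (⊗-assoc x 48 t)))

    ⊗-47 : ∀ t x → t ⊗ (47 ⊗ x) ≈ 47 ⊗ (t ⊗ x)
    ⊗-47 t x = A.trans (⊗-assoc x t 47) (A.trans (A.reflexive (cong (_⊗ x) (ℕ.*-comm t 47))) (A.sym (⊗-assoc x 47 t)))

    0≤⊗ : ∀ t {x} → 0# ≤ x → 0# ≤ t ⊗ x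
    0≤⊗ zero    0≤x = ≈⇒≥ (zero-⊗ _)
    0≤⊗ (suc t) {x} 0≤x = ≤-trans (linear (x ∷ t ⊗ x ∷ []) 0 (:0 :≤ v₀ :+ v₁) ((1 , :0 :≤ v₀) ∷ (1 , :0 :≤ v₁) ∷ []) refl (0≤x ∷ 0≤⊗ t 0≤x ∷ [])) (≈⇒≥ (suc-⊗ t x))

    -- 2256 = 47 · 48: the cost inequality times 47 has 47² d X Y on the right, below 2256 d X Y,
    -- and pays for the move from X to X′. The decay is recorded as d X Y ≤ 48 / (48 + t) times the
    -- start, which avoids powers and survives a round because 47 (t + 49) ≤ 48 (t + 48).
    descend : ∀ t → Descent t
    descend zero = X₀ , X₀ ,
      linear (d X₀ X₀ ∷ []) 0 (v₀ :+ 2256 :* v₀ :≤ 2257 :* v₀) [] refl [] ,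
      ≤-trans (+-monoˡ-≤ _ (≈⇒≤ (zero-⊗ _))) (linear (d X₀ X₀ ∷ []) 0 (:0 :+ 48 :* v₀ :≤ 48 :* v₀) [] refl [])
    descend (suc t) = next (descend t)
      where
      next : Descent t → Descent (suc t)
      next (X , Y , near , small) = X′ , Y′ ,
        linear (d X₀ X ∷ d X Y ∷ d X₀ X₀ ∷ d X′ Y′ ∷ d X X′ ∷ d Y Y′ ∷ d X₀ X′ ∷ d X′ X ∷ []) 0 (v₆ :+ 2256 :* v₃ :≤ 2257 :* v₂)
          ((1 , v₀ :+ 2256 :* v₁ :≤ 2257 :* v₂) ∷ (47 , 48 :* v₃ :+ v₄ :+ v₅ :≤ 47 :* v₁) ∷ (1 , v₆ :≤ v₀ :+ v₇) ∷ (1 , v₇ :≤ v₄) ∷ (46 , :0 :≤ v₄) ∷ (47 , :0 :≤ v₅) ∷ (47 , :0 :≤ v₁) ∷ []) refl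
          (near ∷ cost ∷ d-triangle X₀ X X′ ∷ d-comm X′ X ∷ 0≤d X X′ ∷ 0≤d Y Y′ ∷ 0≤d X Y ∷ []) ,
        ≤-trans (+-monoˡ-≤ _ (≈⇒≤ (suc-⊗ t (d X′ Y′))))
          (linear (d X Y ∷ d X₀ X₀ ∷ d X′ Y′ ∷ t ⊗ d X′ Y′ ∷ t ⊗ d X Y ∷ []) 47 ((v₂ :+ v₃) :+ 48 :* v₂ :≤ 48 :* v₁)
            ((48 , v₄ :+ 48 :* v₀ :≤ 48 :* v₁) ∷ (49 , 48 :* v₂ :≤ 47 :* v₀) ∷ (1 , 48 :* v₃ :≤ 47 :* v₄) ∷ (1 , :0 :≤ v₄) ∷ (1 , :0 :≤ v₀) ∷ []) refl
            (small ∷ shrink ∷ ≤-trans (≈⇒≥ (⊗-48 t (d X′ Y′))) (≤-trans (⊗-mono-≤ t shrink) (≈⇒≤ (⊗-47 t (d X Y)))) ∷ 0≤⊗ t (0≤d X Y) ∷ 0≤d X Y ∷ []))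
        where
        I = Candidates.improvement X Y
        X′ = proj₁ I
        Y′ = proj₁ (proj₂ I)
        cost : 48 ⊗ d X′ Y′ + d X X′ + d Y Y′ ≤ 47 ⊗ d X Y
        cost = proj₂ (proj₂ I)
        shrink : 48 ⊗ d X′ Y′ ≤ 47 ⊗ d X Y
        shrink = linear (d X Y ∷ d X′ Y′ ∷ d X X′ ∷ d Y Y′ ∷ []) 0 (48 :* v₁ :≤ 47 :* v₀)
          ((1 , 48 :* v₁ :+ v₂ :+ v₃ :≤ 47 :* v₀) ∷ (1 , :0 :≤ v₂) ∷ (1 , :0 :≤ v₃) ∷ []) refl (cost ∷ 0≤d X X′ ∷ 0≤d Y Y′ ∷ [])

    log-^ : ∀ {b} → 0ℚ ℚ.< b → ∀ t → log (b ^ t) ≈ t ⊗ log b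
    log-^ 0<b zero    = A.trans log-1 (A.sym (zero-⊗ _))
    log-^ {b} 0<b (suc t) = A.trans (log-* 0<b (0<^ t 0<b)) (A.trans (A.∙-cong A.refl (log-^ 0<b t)) (A.sym (suc-⊗ t (log b))))

    -- Enough rounds are made for the distance of the pair to fall below log b; the triangle
    -- inequality through Y then bounds d X X. The displacement bound is the same for every b.
    limit : ∀ {b} → 1ℚ ℚ.< b → Σ[ X ∈ RandomVariable ] d X X ≤ log b + log b × d X₀ X ≤ 2257 ⊗ d X₀ X₀
    limit {b} 1<b = finish (archimedean (48 ⊗ d X₀ X₀) 1<b)
      where
      0<b : 0ℚ ℚ.< b
      0<b = ℚ.<-trans 0<1 1<b
      0≤logb : 0# ≤ log b
      0≤logb = ≤-trans (≈⇒≥ log-1) (log-mono 0<1 (ℚ.<⇒≤ 1<b))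
      finish : ∃[ t ] 48 ⊗ d X₀ X₀ ≤ log (b ^ t) → Σ[ X ∈ RandomVariable ] d X X ≤ log b + log b × d X₀ X ≤ 2257 ⊗ d X₀ X₀
      finish (t , ≤t) = X ,
        linear (d X X ∷ d X Y ∷ log b ∷ []) 0 (v₀ :≤ v₂ :+ v₂) ((1 , v₀ :≤ v₁ :+ v₁) ∷ (2 , v₁ :≤ v₂) ∷ []) refl (d-triangle X Y X ∷ δ≤ ∷ []) ,
        linear (d X₀ X ∷ d X Y ∷ d X₀ X₀ ∷ []) 0 (v₀ :≤ 2257 :* v₂) ((1 , v₀ :+ 2256 :* v₁ :≤ 2257 :* v₂) ∷ (2256 , :0 :≤ v₁) ∷ []) refl (proj₁ (proj₂ (proj₂ (descend t))) ∷ 0≤d X Y ∷ [])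
        where
        X = proj₁ (descend t)
        Y = proj₁ (proj₂ (descend t))
        δ≤ : d X Y ≤ log b
        δ≤ = ⊗-cancel-≤ (47 ℕ.+ t) (≤-trans (≈⇒≤ (A.trans (⊗-+ (d X Y) 48 t) (A.comm _ _)))
          (linear (t ⊗ d X Y ∷ d X Y ∷ d X₀ X₀ ∷ t ⊗ log b ∷ log b ∷ (48 ℕ.+ t) ⊗ log b ∷ []) 0 (v₀ :+ 48 :* v₁ :≤ v₅)
            ((1 , v₀ :+ 48 :* v₁ :≤ 48 :* v₂) ∷ (1 , 48 :* v₂ :≤ v₃) ∷ (1 , 48 :* v₄ :+ v₃ :≤ v₅) ∷ (48 , :0 :≤ v₄) ∷ []) refl
            (proj₂ (proj₂ (proj₂ (descend t))) ∷ ≤-trans ≤t (≈⇒≤ (log-^ 0<b t)) ∷ ≈⇒≥ (⊗-+ (log b) 48 t) ∷ 0≤logb ∷ [])))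

-- Stability of the inequality H (X) ≤ H (X + X′).

module SmallDefect (𝔾 : BooleanGroups.BooleanGroup) where

  open BooleanGroups
  open import Data.List.Base using ([]; _∷_)
  open import Data.List.Relation.Unary.All using ([]; _∷_)
  open import Data.Product.Base using (_×_; _,_; proj₁; proj₂)
  import Data.Product.Base as Product
  open import Data.Rational.Base as ℚ using (ℚ; 0ℚ; 1ℚ; ½; _*_; _<_)
  import Data.Rational.Properties as ℚ
  open import Data.Vec.Base using ([]; _∷_)
  open import Relation.Binary.PropositionalEquality as ≡ using (_≡_; refl; cong; cong₂; subst)
  open LinearInequalities
  open RationalLemmas
  open Expectations
  open Entropy
  open RuzsaDistance 𝔾

  module ℚL = LinearSolver ℚ-orderedGroup

  4ℚ : ℚ
  4ℚ = 1ℚ ℚ.+ 1ℚ ℚ.+ 1ℚ ℚ.+ 1ℚ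

  -- The arithmetic mean of 1 and Q / P, and the squared ratio of their geometric
  -- and arithmetic means.
  mean ratio : ℚ → ℚ → ℚ
  mean P Q  = (P ℚ.+ Q) * (½ * inv P)
  ratio P Q = (4ℚ * (P * Q)) * inv ((P ℚ.+ Q) * (P ℚ.+ Q))

  0<+ : ∀ {P Q} → 0ℚ < P → 0ℚ < Q → 0ℚ < P ℚ.+ Q
  0<+ = ℚ.+-mono-<

  0<½ : 0ℚ < ½
  0<½ = ℚ.positive⁻¹ ½

  0<4 : 0ℚ < 4ℚ
  0<4 = ℚ.positive⁻¹ 4ℚ

  0<mean : ∀ {P Q} → 0ℚ < P → 0ℚ < Q → 0ℚ < mean P Q
  0<mean 0<P 0<Q = 0<* (0<+ 0<P 0<Q) (0<* 0<½ (0<inv 0<P))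

  0<ratio : ∀ {P Q} → 0ℚ < P → 0ℚ < Q → 0ℚ < ratio P Q
  0<ratio 0<P 0<Q = 0<* (0<* 0<4 (0<* 0<P 0<Q)) (0<inv (0<* (0<+ 0<P 0<Q) (0<+ 0<P 0<Q)))

  ratio*mean² : ∀ {P Q} → 0ℚ < P → 0ℚ < Q → ratio P Q * (mean P Q * mean P Q) ≡ Q * inv P
  ratio*mean² {P} {Q} 0<P 0<Q = begin
    ratio P Q * (mean P Q * mean P Q)
      ≡⟨ S.solve 4 (λ p q i j → ((S.con 4ℚ S.:* (p S.:* q)) S.:* j) S.:* (((p S.:+ q) S.:* (S.con ½ S.:* i)) S.:* ((p S.:+ q) S.:* (S.con ½ S.:* i)))
           S.:= (((p S.:+ q) S.:* (p S.:+ q)) S.:* j) S.:* ((p S.:* i) S.:* (q S.:* i))) refl P Q (inv P) (inv ((P ℚ.+ Q) * (P ℚ.+ Q))) ⟩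
    (((P ℚ.+ Q) * (P ℚ.+ Q)) * inv ((P ℚ.+ Q) * (P ℚ.+ Q))) * ((P * inv P) * (Q * inv P))
      ≡⟨ cong₂ (λ s t → s * (t * (Q * inv P))) (*-inv (<⇒≢0 (0<* (0<+ 0<P 0<Q) (0<+ 0<P 0<Q)))) (*-inv (<⇒≢0 0<P)) ⟩
    1ℚ * (1ℚ * (Q * inv P))
      ≡⟨ S.solve 1 (λ t → S.con 1ℚ S.:* (S.con 1ℚ S.:* t) S.:= t) refl (Q * inv P) ⟩
    Q * inv P ∎
    where open ≡.≡-Reasoning

  -- 1 - ratio is (P - Q)² / (P + Q)², and P + Q ≤ 2.
  square+4ratio≤4 : ∀ {P Q} → 0ℚ < P → 0ℚ < Q → P ℚ.≤ 1ℚ → Q ℚ.≤ 1ℚ →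
    (Q ℚ.- P) * (Q ℚ.- P) ℚ.+ 4ℚ * ratio P Q ℚ.≤ 4ℚ
  square+4ratio≤4 {P} {Q} 0<P 0<Q P≤1 Q≤1 = ≤-from-diff {(Q ℚ.- P) * (Q ℚ.- P) ℚ.+ 4ℚ * ratio P Q} {4ℚ}
    (subst (0ℚ ℚ.≤_) eq (0≤* (0≤square (Q ℚ.- P)) (0≤* (0≤inv (ℚ.<⇒≤ 0<s²)) (≤-to-diff s²≤4))))
    where
    open ≡.≡-Reasoning
    s  = P ℚ.+ Q
    i  = inv (s * s)
    0<s = 0<+ 0<P 0<Q
    0<s² = 0<* 0<s 0<s
    s²≤4 : s * s ℚ.≤ 4ℚ
    s²≤4 = *-mono-≤ {s} {1ℚ ℚ.+ 1ℚ} {s} {1ℚ ℚ.+ 1ℚ} (ℚ.<⇒≤ 0<s) (0≤+ 0≤1 0≤1) (ℚ.+-mono-≤ P≤1 Q≤1) (ℚ.+-mono-≤ P≤1 Q≤1)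
    s²i : s * s * i ≡ 1ℚ
    s²i = *-inv (<⇒≢0 0<s²)
    eq : (Q ℚ.- P) * (Q ℚ.- P) * (i * (4ℚ ℚ.- s * s)) ≡ 4ℚ ℚ.- ((Q ℚ.- P) * (Q ℚ.- P) ℚ.+ 4ℚ * ratio P Q)
    eq = begin
      (Q ℚ.- P) * (Q ℚ.- P) * (i * (4ℚ ℚ.- s * s))
        ≡⟨ S.solve 3 (λ p q i → (q S.:- p) S.:* (q S.:- p) S.:* (i S.:* (S.con 4ℚ S.:- (p S.:+ q) S.:* (p S.:+ q)))
             S.:= S.con 4ℚ S.:* ((p S.:+ q) S.:* (p S.:+ q) S.:* i) S.:- ((q S.:- p) S.:* (q S.:- p) S.:* ((p S.:+ q) S.:* (p S.:+ q) S.:* i) S.:+ S.con 4ℚ S.:* ((S.con 4ℚ S.:* (p S.:* q)) S.:* i)))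
             refl P Q i ⟩
      4ℚ * (s * s * i) ℚ.- ((Q ℚ.- P) * (Q ℚ.- P) * (s * s * i) ℚ.+ 4ℚ * ratio P Q)
        ≡⟨ cong (λ t → 4ℚ * t ℚ.- ((Q ℚ.- P) * (Q ℚ.- P) * t ℚ.+ 4ℚ * ratio P Q)) s²i ⟩
      4ℚ * 1ℚ ℚ.- ((Q ℚ.- P) * (Q ℚ.- P) * 1ℚ ℚ.+ 4ℚ * ratio P Q)
        ≡⟨ cong₂ (λ x y → x ℚ.- (y ℚ.+ 4ℚ * ratio P Q)) (ℚ.*-identityʳ 4ℚ) (ℚ.*-identityʳ ((Q ℚ.- P) * (Q ℚ.- P))) ⟩
      4ℚ ℚ.- ((Q ℚ.- P) * (Q ℚ.- P) ℚ.+ 4ℚ * ratio P Q) ∎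

  -- Jensen's inequality for log r, where r = q (g ⊕ h) / p g, sharpened by the
  -- identity log r = 2 log ((1 + r) / 2) + log (4 r / (1 + r)²).
  module _ (μ : Measure) (total≡1 : IsProbability μ) (ξ : Ω μ → G) {θ : ℚ} (0<1-θ : 0ℚ < 1ℚ ℚ.- θ)
    (small-defect : H (μ ⊗ᵐ μ) (add ξ ξ) ≤ H μ ξ + log (inv (1ℚ ℚ.- θ))) where

    private
      σ : Measure
      σ = μ ⊗ᵐ μ
      total-σ : IsProbability σ
      total-σ = ⊗-isProbability {μ} {μ} total≡1 total≡1
      p q : G → ℚ
      p = prob μ ξ
      q = prob σ (add ξ ξ)
      P Q : Ω σ → ℚ
      P ω = p (ξ (proj₁ ω))
      Q ω = q (add ξ ξ ω)
      0<P : ∀ ω → Support σ ω → 0ℚ < P ω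
      0<P ω ω∈ = 0<prob μ ξ (proj₁ (support-⊗ μ μ ω∈))
      0<Q : ∀ ω → Support σ ω → 0ℚ < Q ω
      0<Q ω ω∈ = 0<prob σ (add ξ ξ) ω∈

      translate : ∀ c v → prob σ (λ χ → add ξ ξ χ ⊕ c) v ≡ q (v ⊕ c)
      translate c v = 𝔼.E-cong σ (λ χ _ → indicator-cong ((add ξ ξ χ ⊕ c) ≟ v) (add ξ ξ χ ≟ v ⊕ c)
        (λ { refl → xor-solve x₀ ((x₀ :⊕ x₁) :⊕ x₁) (add ξ ξ χ ∷ c ∷ []) refl })
        (λ eq → ≡.trans (cong (_⊕ c) eq) (xor-solve ((x₀ :⊕ x₁) :⊕ x₁) x₀ (v ∷ c ∷ []) refl)))

      -- With the second coordinate fixed this is `density≤total`, for the law of a translate of the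
      -- sum against the law of ξ.
      E[Q/P]≤1 : E σ (λ ω → Q ω * inv (P ω)) ℚ.≤ 1ℚ
      E[Q/P]≤1 = begin
        E σ (λ ω → Q ω * inv (P ω))
          ≡⟨ E-⊗ ℚ-semimodule μ μ (λ ω → Q ω * inv (P ω)) ⟩
        E μ (λ ω → E μ (λ ψ → q (ξ ω ⊕ ξ ψ) * inv (p (ξ ω))))
          ≡⟨ 𝔼.E-swap μ μ (λ ω ψ → q (ξ ω ⊕ ξ ψ) * inv (p (ξ ω))) ⟩
        E μ (λ ψ → E μ (λ ω → q (ξ ω ⊕ ξ ψ) * inv (p (ξ ω))))
          ≤⟨ E-mono μ (λ ψ _ → ℚ.≤-trans
               (ℚ.≤-reflexive (𝔼.E-cong μ (λ ω _ → cong (_* inv (p (ξ ω))) (≡.sym (translate (ξ ψ) (ξ ω))))))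
               (ℚ.≤-trans (density≤total μ ξ σ (λ χ → add ξ ξ χ ⊕ ξ ψ)) (ℚ.≤-reflexive total-σ))) ⟩
        E μ (λ ψ → 1ℚ)
          ≡⟨ total≡1 ⟩
        1ℚ ∎
        where open ℚ.≤-Reasoning

      E[mean]≤1 : E σ (λ ω → mean (P ω) (Q ω)) ℚ.≤ 1ℚ
      E[mean]≤1 = begin
        E σ (λ ω → mean (P ω) (Q ω))
          ≡⟨ 𝔼.E-cong σ (λ ω ω∈ → expand (0<P ω ω∈)) ⟩
        E σ (λ ω → ½ * (1ℚ ℚ.+ Q ω * inv (P ω)))
          ≡⟨ 𝔼.E-· σ {½} (ℚ.<⇒≤ 0<½) (λ ω → 1ℚ ℚ.+ Q ω * inv (P ω)) ⟩
        ½ * E σ (λ ω → 1ℚ ℚ.+ Q ω * inv (P ω))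
          ≡⟨ cong (½ *_) (𝔼.E-+ σ (λ _ → 1ℚ) (λ ω → Q ω * inv (P ω))) ⟩
        ½ * (total σ ℚ.+ E σ (λ ω → Q ω * inv (P ω)))
          ≤⟨ *-monoˡ ½ (ℚ.<⇒≤ 0<½) (ℚ.+-mono-≤ (ℚ.≤-reflexive total-σ) E[Q/P]≤1) ⟩
        1ℚ ∎
        where
        open ℚ.≤-Reasoning
        expand : ∀ {P Q} → 0ℚ < P → mean P Q ≡ ½ * (1ℚ ℚ.+ Q * inv P)
        expand {P} {Q} 0<P = ≡.trans (S.solve 3 (λ p q i → (p S.:+ q) S.:* (S.con ½ S.:* i) S.:= S.con ½ S.:* (p S.:* i S.:+ q S.:* i)) refl P Q (inv P))
          (cong (λ t → ½ * (t ℚ.+ Q * inv P)) (*-inv (<⇒≢0 0<P)))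

      log-identity : ∀ ω → Support σ ω → - log (P ω) - - log (Q ω) ≈ log (ratio (P ω) (Q ω)) + (log (mean (P ω) (Q ω)) + log (mean (P ω) (Q ω)))
      log-identity ω ω∈ = pure (0<P ω ω∈) (0<Q ω ω∈)
        where
        pure : ∀ {P Q} → 0ℚ < P → 0ℚ < Q → - log P - - log Q ≈ log (ratio P Q) + (log (mean P Q) + log (mean P Q))
        pure {P} {Q} 0<P 0<Q = begin
          - log P - - log Q
            ≈⟨ equal-sound (:- v₀ :- :- v₁) (v₁ :- v₀) (log P ∷ log Q ∷ []) refl ⟩
          log Q - log P
            ≈⟨ A.∙-cong A.refl (log-inv 0<P) ⟨
          log Q + log (inv P)
            ≈⟨ log-* 0<Q (0<inv 0<P) ⟨
          log (Q * inv P)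
            ≈⟨ A.reflexive (cong log (ratio*mean² 0<P 0<Q)) ⟨
          log (ratio P Q * (mean P Q * mean P Q))
            ≈⟨ log-* (0<ratio 0<P 0<Q) (0<* (0<mean 0<P 0<Q) (0<mean 0<P 0<Q)) ⟩
          log (ratio P Q) + log (mean P Q * mean P Q)
            ≈⟨ A.∙-cong A.refl (log-* (0<mean 0<P 0<Q) (0<mean 0<P 0<Q)) ⟩
          log (ratio P Q) + (log (mean P Q) + log (mean P Q)) ∎
          where open ≈-Reasoning

      mean-jensen : 0ℚ < E σ (λ ω → mean (P ω) (Q ω)) × Eᴸ σ (λ ω → log (mean (P ω) (Q ω))) ≤ log (E σ (λ ω → mean (P ω) (Q ω)))
      mean-jensen = jensen σ total-σ (λ ω → mean (P ω) (Q ω)) (λ ω ω∈ → 0<mean (0<P ω ω∈) (0<Q ω ω∈))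

      ratio-jensen : 0ℚ < E σ (λ ω → ratio (P ω) (Q ω)) × Eᴸ σ (λ ω → log (ratio (P ω) (Q ω))) ≤ log (E σ (λ ω → ratio (P ω) (Q ω)))
      ratio-jensen = jensen σ total-σ (λ ω → ratio (P ω) (Q ω)) (λ ω ω∈ → 0<ratio (0<P ω ω∈) (0<Q ω ω∈))

      -- The expectation of log (Q / P) is H (X) - H (X + X′), at least log (1 - θ). In
      -- `log-identity` the means contribute at most 0, so the ratio accounts for all of it, and
      -- Jensen's inequality moves the expectation inside the logarithm.
      1-θ≤E[ratio] : 1ℚ ℚ.- θ ℚ.≤ E σ (λ ω → ratio (P ω) (Q ω))
      1-θ≤E[ratio] = log-cancel 0<1-θ (proj₁ ratio-jensen)
        (linear (H σ (add ξ ξ) ∷ H μ ξ ∷ log (inv (1ℚ ℚ.- θ)) ∷ log (1ℚ ℚ.- θ) ∷ r ∷ m ∷ log (E σ (λ ω → ratio (P ω) (Q ω))) ∷ []) 0 (v₃ :≤ v₆)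
          ((1 , v₀ :≤ v₁ :+ v₂) ∷ (1 , v₂ :≤ :- v₃) ∷ (1 , v₁ :- v₀ :≤ v₄ :+ (v₅ :+ v₅)) ∷ (2 , v₅ :≤ :0) ∷ (1 , v₄ :≤ v₆) ∷ []) refl
          (small-defect ∷ ≈⇒≤ (log-inv 0<1-θ) ∷ split ∷ m≤0 ∷ proj₂ ratio-jensen ∷ []))
        where
        r = Eᴸ σ (λ ω → log (ratio (P ω) (Q ω)))
        m = Eᴸ σ (λ ω → log (mean (P ω) (Q ω)))
        m≤0 : m ≤ 0#
        m≤0 = ≤-trans (proj₂ mean-jensen) (≤-trans (log-mono (proj₁ mean-jensen) E[mean]≤1) (≈⇒≤ log-1))
        split : H μ ξ - H σ (add ξ ξ) ≤ r + (m + m)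
        split = ≤-trans (≈⇒≥ (A.trans (E-- σ (λ ω → - log (P ω)) (λ ω → - log (Q ω)))
            (A.∙-cong (preserves-fst {μ} {μ} total≡1 𝕃-semimodule (λ ω → - log (p (ξ ω)))) A.refl)))
          (≈⇒≤ (A.trans (𝔼ᴸ.E-cong σ log-identity) (A.trans (𝔼ᴸ.E-+ σ _ _) (A.∙-cong A.refl (𝔼ᴸ.E-+ σ _ _)))))

      φ : G × G → ℚ
      φ (g , h) = (q (g ⊕ h) ℚ.- p g) * (q (g ⊕ h) ℚ.- p g)

      E[φ]≤4θ : E σ (λ ω → φ (Product.map ξ ξ ω)) ℚ.≤ 4ℚ * θ
      E[φ]≤4θ = ℚ.≤-trans (ℚL.linear (a ∷ 4ℚ * t ∷ 4ℚ ∷ []) 0 (v₀ :≤ v₂ :- v₁) ((1 , v₀ :+ v₁ :≤ v₂) ∷ []) refl (sum≤4 ∷ []))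
        (≤-from-diff {4ℚ ℚ.- 4ℚ * t} {4ℚ * θ} (subst (0ℚ ℚ.≤_)
          (S.solve 2 (λ t θ → S.con 4ℚ S.:* (t S.:- (S.con 1ℚ S.:- θ)) S.:= S.con 4ℚ S.:* θ S.:- (S.con 4ℚ S.:- S.con 4ℚ S.:* t)) refl t θ)
          (0≤* (ℚ.<⇒≤ 0<4) (≤-to-diff 1-θ≤E[ratio]))))
        where
        a = E σ (λ ω → φ (Product.map ξ ξ ω))
        t = E σ (λ ω → ratio (P ω) (Q ω))
        sum≤4 : a ℚ.+ 4ℚ * t ℚ.≤ 4ℚ
        sum≤4 = begin
          a ℚ.+ 4ℚ * t
            ≡⟨ cong (a ℚ.+_) (𝔼.E-· σ {4ℚ} (ℚ.<⇒≤ 0<4) (λ ω → ratio (P ω) (Q ω))) ⟨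
          a ℚ.+ E σ (λ ω → 4ℚ * ratio (P ω) (Q ω))
            ≡⟨ 𝔼.E-+ σ (λ ω → φ (Product.map ξ ξ ω)) (λ ω → 4ℚ * ratio (P ω) (Q ω)) ⟨
          E σ (λ ω → φ (Product.map ξ ξ ω) ℚ.+ 4ℚ * ratio (P ω) (Q ω))
            ≤⟨ E-mono σ (λ ω ω∈ → square+4ratio≤4 (0<P ω ω∈) (0<Q ω ω∈) (prob≤1 μ total≡1 ξ _) (prob≤1 σ total-σ (add ξ ξ) _)) ⟩
          E σ (λ _ → 4ℚ)
            ≡⟨ ScalarExpectation.E-const ℚ-semimodule σ total-σ 4ℚ ⟩
          4ℚ ∎
          where open ℚ.≤-Reasoning

    -- A single atom of the bound for the mean square. It is useful only when θ is small against
    -- products of atoms, which makes θ depend on the size of the group.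
    defect-bound : ∀ g h → (prob μ ξ g * prob μ ξ h) ℚ.*
      ((prob (μ ⊗ᵐ μ) (add ξ ξ) (g ⊕ h) ℚ.- prob μ ξ g) * (prob (μ ⊗ᵐ μ) (add ξ ξ) (g ⊕ h) ℚ.- prob μ ξ g)) ℚ.≤ 4ℚ * θ
    defect-bound g h = begin
      (p g * p h) * φ (g , h)
        ≡⟨ cong (_* φ (g , h)) (prob-⊗ μ μ ξ ξ g h) ⟨
      prob σ (Product.map ξ ξ) (g , h) * φ (g , h)
        ≡⟨ localize σ (Product.map ξ ξ) (g , h) φ ⟨
      E σ (λ ω → indicator (Product.map ξ ξ ω ≟ (g , h)) * φ (Product.map ξ ξ ω))
        ≤⟨ E-mono σ (λ ω _ → ℚ.≤-trans (*-monoʳ (φ (Product.map ξ ξ ω)) (0≤φ (Product.map ξ ξ ω)) (indicator≤1 (Product.map ξ ξ ω ≟ (g , h))))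
             (ℚ.≤-reflexive (ℚ.*-identityˡ (φ (Product.map ξ ξ ω))))) ⟩
      E σ (λ ω → φ (Product.map ξ ξ ω))
        ≤⟨ E[φ]≤4θ ⟩
      4ℚ * θ ∎
      where
      open ℚ.≤-Reasoning
      0≤φ : ∀ gh → 0ℚ ℚ.≤ φ gh
      0≤φ (g , h) = 0≤square (q (g ⊕ h) ℚ.- p g)

-- Small defect forces near uniformity on a coset.

module NearlyUniform (𝔾 : BooleanGroups.BooleanGroup) (elements : List (BooleanGroups.BooleanGroup.G 𝔾)) (once : BooleanGroups.Enumerates 𝔾 elements) where

  open BooleanGroups
  open import Data.Rational.Base as ℚ using (ℚ; 0ℚ; 1ℚ; ½; _*_; _<_)
  open import Data.List.Base using ([]; _∷_)
  open import Data.List.Membership.Propositional using (_∈_)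
  open import Data.List.Relation.Unary.Any using (here; there)
  open import Data.List.Relation.Unary.All using ([]; _∷_)
  open import Data.Product.Base using (∃-syntax; _×_; _,_; proj₁; proj₂)
  import Data.Integer.Base as ℤ
  import Data.Nat.Base as ℕ
  import Data.Rational.Properties as ℚ
  open import Data.Sum.Base using (_⊎_; inj₁; inj₂)
  open import Data.Vec.Base using ([]; _∷_)
  open import Function.Base using (id)
  open import Relation.Binary.PropositionalEquality as ≡ using (_≡_; refl; cong; cong₂; subst)
  open import Relation.Nullary using (¬_; Dec; yes; no; contradiction)
  open LinearInequalities
  open RationalLemmas
  open Expectations
  open Entropy
  open RuzsaDistance 𝔾
  open SmallDefect 𝔾
  open ℚL using () renaming (linear to linearℚ)

  counting : Measure
  counting = record { Ω = G ; points = elements ; weight = λ _ → 1ℚ ; 0≤weight = λ _ → 0≤1 }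

  Σᴳ : (G → ℚ) → ℚ
  Σᴳ = E counting

  Σᴳ-once : ∀ v → Σᴳ (λ g → indicator (v ≟ g)) ≡ 1ℚ
  Σᴳ-once v = ≡.trans (𝔼.sum-cong elements (λ g _ → ℚ.*-identityˡ (indicator (v ≟ g)))) (once v)

  Σᴳ-pick : ∀ v (φ : G → ℚ) → Σᴳ (λ g → indicator (v ≟ g) * φ g) ≡ φ v
  Σᴳ-pick v φ = ≡.trans (𝔼.E-cong counting (λ g _ → indicator-* (v ≟ g) (λ { refl → refl })))
    (≡.trans (ScalarExpectation.E-·ʳ ℚ-semimodule counting (λ g → indicator (v ≟ g)) (λ g → 0≤indicator (v ≟ g)) (φ v))
      (≡.trans (cong (_* φ v) (Σᴳ-once v)) (ℚ.*-identityˡ (φ v))))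

  Σᴳ-shift : ∀ c (φ : G → ℚ) → Σᴳ (λ g → φ (c ⊕ g)) ≡ Σᴳ φ
  Σᴳ-shift c φ = begin
    Σᴳ (λ g → φ (c ⊕ g))
      ≡⟨ 𝔼.E-cong counting (λ g _ → Σᴳ-pick (c ⊕ g) φ) ⟨
    Σᴳ (λ g → Σᴳ (λ h → indicator ((c ⊕ g) ≟ h) * φ h))
      ≡⟨ 𝔼.E-swap counting counting (λ g h → indicator ((c ⊕ g) ≟ h) * φ h) ⟩
    Σᴳ (λ h → Σᴳ (λ g → indicator ((c ⊕ g) ≟ h) * φ h))
      ≡⟨ 𝔼.E-cong counting (λ h _ → ScalarExpectation.E-·ʳ ℚ-semimodule counting (λ g → indicator ((c ⊕ g) ≟ h)) (λ g → 0≤indicator ((c ⊕ g) ≟ h)) (φ h)) ⟩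
    Σᴳ (λ h → Σᴳ (λ g → indicator ((c ⊕ g) ≟ h)) * φ h)
      ≡⟨ 𝔼.E-cong counting (λ h _ → ≡.trans (cong (_* φ h) (≡.trans (𝔼.E-cong counting (λ g _ → move g h)) (Σᴳ-once (c ⊕ h)))) (ℚ.*-identityˡ (φ h))) ⟩
    Σᴳ φ ∎
    where
    open ≡.≡-Reasoning
    cancel : ∀ a b → a ⊕ (a ⊕ b) ≡ b
    cancel a b = xor-solve (x₀ :⊕ (x₀ :⊕ x₁)) x₁ (a ∷ b ∷ []) refl
    move : ∀ g h → indicator ((c ⊕ g) ≟ h) ≡ indicator ((c ⊕ h) ≟ g)
    move g h = indicator-cong ((c ⊕ g) ≟ h) ((c ⊕ h) ≟ g) (λ { refl → cancel c g }) (λ { refl → cancel c h })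

  Σᴳ-prob : ∀ μ → IsProbability μ → ∀ X → Σᴳ (prob μ X) ≡ 1ℚ
  Σᴳ-prob μ total≡1 X = ≡.trans (𝔼.E-swap counting μ (λ g ω → indicator (X ω ≟ g)))
    (≡.trans (𝔼.E-cong μ (λ ω _ → Σᴳ-once (X ω))) total≡1)

  E-law : ∀ μ X (φ : G → ℚ) → E μ (λ ω → φ (X ω)) ≡ Σᴳ (λ g → prob μ X g * φ g)
  E-law μ X φ = ≡.sym (begin
    Σᴳ (λ g → prob μ X g * φ g)
      ≡⟨ 𝔼.E-cong counting (λ g _ → ScalarExpectation.E-·ʳ ℚ-semimodule μ (λ ω → indicator (X ω ≟ g)) (λ ω → 0≤indicator (X ω ≟ g)) (φ g)) ⟨
    Σᴳ (λ g → E μ (λ ω → indicator (X ω ≟ g) * φ g))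
      ≡⟨ 𝔼.E-swap counting μ (λ g ω → indicator (X ω ≟ g) * φ g) ⟩
    E μ (λ ω → Σᴳ (λ g → indicator (X ω ≟ g) * φ g))
      ≡⟨ 𝔼.E-cong μ (λ ω _ → Σᴳ-pick (X ω) φ) ⟩
    E μ (λ ω → φ (X ω)) ∎)
    where open ≡.≡-Reasoning

  N : ℚ
  N = total counting

  Σᴳ-const : ∀ {c} → 0ℚ ℚ.≤ c → Σᴳ (λ _ → c) ≡ N * c
  Σᴳ-const {c} 0≤c = ≡.trans (𝔼.E-cong counting (λ _ _ → ≡.sym (ℚ.*-identityˡ c)))
    (ScalarExpectation.E-·ʳ ℚ-semimodule counting (λ _ → 1ℚ) (λ _ → 0≤1) c)

  2ℚ 8ℚ 16ℚ : ℚ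
  2ℚ  = 1ℚ ℚ.+ 1ℚ
  8ℚ  = 4ℚ ℚ.+ 4ℚ
  16ℚ = 8ℚ ℚ.+ 8ℚ

  0≤2 : 0ℚ ℚ.≤ 2ℚ
  0≤2 = 0≤+ 0≤1 0≤1

  1≤8 : 1ℚ ℚ.≤ 8ℚ
  1≤8 = ℚ.*≤* (ℤ.+≤+ (ℕ.s≤s ℕ.z≤n))

  0<2 : 0ℚ < 2ℚ
  0<2 = 0<+ 0<1 0<1

  square-cancel : ∀ {a b} → 0ℚ ℚ.≤ b → a * a ℚ.≤ b * b → a ℚ.≤ b
  square-cancel {a} {b} 0≤b h with a ℚ.≤? b
  ... | yes a≤b = a≤b
  ... | no  a≰b = contradiction (ℚ.<-≤-trans (ℚ.≤-<-trans (*-monoˡ b 0≤b (ℚ.<⇒≤ b<a)) (ℚ.*-monoˡ-<-pos a {{ℚ.positive 0<a}} b<a)) h) (ℚ.<-irrefl refl)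
    where
    b<a = ℚ.≰⇒> a≰b
    0<a = ℚ.≤-<-trans 0≤b b<a

  find : ∀ (gs : List G) (f : G → ℚ) → (∃[ g ] 1ℚ ℚ.≤ f g) ⊎ (∀ g → g ∈ gs → f g ℚ.≤ 1ℚ)
  find []       f = inj₂ λ _ ()
  find (g ∷ gs) f with ℚ.≤-total 1ℚ (f g) | find gs f
  ... | inj₁ 1≤ | _       = inj₁ (g , 1≤)
  ... | inj₂ _  | inj₁ r  = inj₁ r
  ... | inj₂ ≤1 | inj₂ r  = inj₂ λ { h (here refl) → ≤1 ; h (there h∈) → r h h∈ }

  -- As q (g ⊕ h) is close to p g and to p h for g, h ∈ B, the mass of q is almost
  -- exhausted by g₀ ⊕ B, so that no element of B ⊕ B lies outside of it.
  module Structure (μ : Measure) (total≡1 : IsProbability μ) (ξ : Ω μ → G) {T τ η θ : ℚ}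
    (0<η : 0ℚ < η) (2η≤τ : η ℚ.+ η ℚ.≤ τ) (Nη≤τ : N * η ℚ.≤ τ) (2≤T : 2ℚ ℚ.≤ T) (N≤T : N ℚ.≤ T) (8Tτ≡1 : 8ℚ * (T * τ) ≡ 1ℚ)
    (0<1-θ : 0ℚ < 1ℚ ℚ.- θ) (4θ≡ : 4ℚ * θ ≡ (η * η) * (η * η))
    (small-defect : H (μ ⊗ᵐ μ) (add ξ ξ) ≤ H μ ξ + log (inv (1ℚ ℚ.- θ))) where

    p q : G → ℚ
    p = prob μ ξ
    q = prob (μ ⊗ᵐ μ) (add ξ ξ)

    B : G → Set
    B g = η ℚ.≤ p g

    B? : ∀ g → Dec (B g)
    B? g = η ℚ.≤? p g

    private
      0≤η = ℚ.<⇒≤ 0<η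
      0<T : 0ℚ < T
      0<T = ℚ.<-≤-trans 0<2 2≤T
      0≤T = ℚ.<⇒≤ 0<T
      0≤τ : 0ℚ ℚ.≤ τ
      0≤τ = ℚ.≤-trans (0≤+ 0≤η 0≤η) 2η≤τ
      0≤p : ∀ g → 0ℚ ℚ.≤ p g
      0≤p = 0≤prob μ ξ
      0≤q : ∀ g → 0ℚ ℚ.≤ q g
      0≤q = 0≤prob (μ ⊗ᵐ μ) (add ξ ξ)
      2τ≤1/8 : 8ℚ * (2ℚ * τ) ℚ.≤ 1ℚ
      2τ≤1/8 = subst (8ℚ * (2ℚ * τ) ℚ.≤_) 8Tτ≡1 (*-monoˡ 8ℚ (ℚ.<⇒≤ (0<+ 0<4 0<4)) (*-monoʳ τ 0≤τ 2≤T))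

    -- The choice 4 θ = η⁴ is made for this: dividing by the two atoms, each at least η, leaves η².
    close² : ∀ {g h} → B g → B h → (q (g ⊕ h) ℚ.- p g) * (q (g ⊕ h) ℚ.- p g) ℚ.≤ η * η
    close² {g} {h} Bg Bh = *-cancelˡ (η * η) (0<* 0<η 0<η) (begin
      (η * η) * ((q (g ⊕ h) ℚ.- p g) * (q (g ⊕ h) ℚ.- p g))
        ≤⟨ *-monoʳ ((q (g ⊕ h) ℚ.- p g) * (q (g ⊕ h) ℚ.- p g)) (0≤square (q (g ⊕ h) ℚ.- p g)) (*-mono-≤ 0≤η (0≤p h) Bg Bh) ⟩
      (p g * p h) * ((q (g ⊕ h) ℚ.- p g) * (q (g ⊕ h) ℚ.- p g))
        ≤⟨ defect-bound μ total≡1 ξ {θ} 0<1-θ small-defect g h ⟩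
      4ℚ * θ
        ≡⟨ 4θ≡ ⟩
      (η * η) * (η * η) ∎)
      where open ℚ.≤-Reasoning

    q≤p+η : ∀ {g h} → B g → B h → q (g ⊕ h) ℚ.≤ p g ℚ.+ η
    q≤p+η {g} {h} Bg Bh = linearℚ (q (g ⊕ h) ∷ p g ∷ η ∷ []) 0 (v₀ :≤ v₁ :+ v₂) ((1 , v₀ :- v₁ :≤ v₂) ∷ []) refl
      (square-cancel 0≤η (close² Bg Bh) ∷ [])

    p≤q+η : ∀ {g h} → B g → B h → p g ℚ.≤ q (g ⊕ h) ℚ.+ η
    p≤q+η {g} {h} Bg Bh = linearℚ (q (g ⊕ h) ∷ p g ∷ η ∷ []) 0 (v₁ :≤ v₀ :+ v₂) ((1 , v₁ :- v₀ :≤ v₂) ∷ []) refl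
      (square-cancel 0≤η (subst (ℚ._≤ η * η) (S.solve 2 (λ q p → (q S.:- p) S.:* (q S.:- p) S.:= (p S.:- q) S.:* (p S.:- q)) refl (q (g ⊕ h)) (p g)) (close² Bg Bh)) ∷ [])

    q≤p+η′ : ∀ {g h} → B g → B h → q (g ⊕ h) ℚ.≤ p h ℚ.+ η
    q≤p+η′ {g} {h} Bg Bh = subst (λ t → q t ℚ.≤ p h ℚ.+ η) (⊕-comm h g) (q≤p+η Bh Bg)

    p≤p+2η : ∀ {g h} → B g → B h → p g ℚ.≤ p h ℚ.+ (η ℚ.+ η)
    p≤p+2η {g} {h} Bg Bh = linearℚ (p g ∷ p h ∷ η ∷ q (g ⊕ h) ∷ []) 0 (v₀ :≤ v₁ :+ (v₂ :+ v₂))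
      ((1 , v₀ :≤ v₃ :+ v₂) ∷ (1 , v₃ :≤ v₁ :+ v₂) ∷ []) refl (p≤q+η Bg Bh ∷ q≤p+η′ Bg Bh ∷ [])

    -- Otherwise summing 2 T p over the group would give 2 T ≤ N ≤ T.
    heavy : ∃[ g ] 1ℚ ℚ.≤ (2ℚ * T) * p g
    heavy = choose (find elements (λ g → (2ℚ * T) * p g))
      where
      open ℚ.≤-Reasoning
      0≤2T = 0≤* 0≤2 0≤T
      choose : (∃[ g ] 1ℚ ℚ.≤ (2ℚ * T) * p g) ⊎ (∀ g → g ∈ elements → (2ℚ * T) * p g ℚ.≤ 1ℚ) → ∃[ g ] 1ℚ ℚ.≤ (2ℚ * T) * p g
      choose (inj₁ r)  = r
      choose (inj₂ ≤1) = contradiction 0<T (≤⇒≯ (linearℚ (T ∷ 2ℚ * T ∷ []) 0 (v₀ :≤ :0) ((1 , v₀ :+ v₀ :≤ v₁) ∷ (1 , v₁ :≤ v₀) ∷ []) refl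
        (ℚ.≤-reflexive (S.solve 1 (λ t → t S.:+ t S.:= (S.con 1ℚ S.:+ S.con 1ℚ) S.:* t) refl T) ∷ 2T≤T ∷ [])))
        where
        2T≤T : 2ℚ * T ℚ.≤ T
        2T≤T = begin
          2ℚ * T                          ≡⟨ ℚ.*-identityʳ (2ℚ * T) ⟨
          (2ℚ * T) * 1ℚ                 ≡⟨ cong ((2ℚ * T) *_) (Σᴳ-prob μ total≡1 ξ) ⟨
          (2ℚ * T) * Σᴳ p               ≡⟨ 𝔼.E-· counting {2ℚ * T} 0≤2T p ⟨
          Σᴳ (λ g → (2ℚ * T) * p g)     ≤⟨ E-mono counting (λ g (g∈ , _) → ≤1 g g∈) ⟩
          N                                 ≤⟨ N≤T ⟩
          T                                 ∎

    g₀ : G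
    g₀ = proj₁ heavy

    4τ≤p[g₀] : 4ℚ * τ ℚ.≤ p g₀
    4τ≤p[g₀] = *-cancelˡ (2ℚ * T) (0<* 0<2 0<T) (subst (ℚ._≤ (2ℚ * T) * p g₀)
      (≡.trans (≡.sym 8Tτ≡1) (S.solve 2 (λ t u → (S.con 8ℚ) S.:* (t S.:* u) S.:= (S.con 2ℚ S.:* t) S.:* (S.con 4ℚ S.:* u)) refl T τ)) (proj₂ heavy))

    τ≤4τ : τ ℚ.≤ 4ℚ * τ
    τ≤4τ = linearℚ (τ ∷ 4ℚ * τ ∷ []) 0 (v₀ :≤ v₁) ((1 , 4 :* v₀ :≤ v₁) ∷ (3 , :0 :≤ v₀) ∷ []) refl (4⊗τ≤ ∷ 0≤τ ∷ [])
      where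
      4⊗τ≤ : 4 ℚL.⊗ τ ℚ.≤ 4ℚ * τ
      4⊗τ≤ = linearℚ (τ ∷ 4ℚ * τ ∷ []) 0 (4 :* v₀ :≤ v₁) ((1 , v₀ :+ v₀ :+ v₀ :+ v₀ :≤ v₁) ∷ []) refl
        (ℚ.≤-reflexive (S.solve 1 (λ t → t S.:+ t S.:+ t S.:+ t S.:= S.con 4ℚ S.:* t) refl τ) ∷ [])

    B-g₀ : B g₀
    B-g₀ = ℚ.≤-trans (q≤p+q η 0≤η) (ℚ.≤-trans 2η≤τ (ℚ.≤-trans τ≤4τ 4τ≤p[g₀]))

    B-closed : ∀ {g h} → B g → B h → B (g₀ ⊕ (g ⊕ h))
    B-closed {g} {h} Bg Bh with B? (g₀ ⊕ (g ⊕ h))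
    ... | yes Bz = Bz
    -- If z = g + h lies outside of g₀ + B, then q z ≤ N η ≤ τ by `masses`. But three comparisons
    -- along g₀, g₀ + g, g and z give q z ≥ p g₀ - 3 η ≥ 4 τ - 3 η; with 2 η ≤ τ this leaves 3 η ≤
    -- 0.
    ... | no ¬Bz = contradiction 0<η (≤⇒≯ (linearℚ (η ∷ τ ∷ 4ℚ * τ ∷ p g₀ ∷ q (g ⊕ h) ∷ N * η ∷ 1ℚ ∷ p g ∷ q (g₀ ⊕ g) ∷ []) 2 (v₀ :≤ :0)
        ((3 , v₀ :+ v₀ :≤ v₁) ∷ (1 , v₂ :≤ v₃) ∷ (1 , v₇ :≤ v₄ :+ v₀) ∷ (1 , v₈ :≤ v₇ :+ v₀) ∷ (1 , v₃ :≤ v₈ :+ v₀) ∷ (1 , v₄ :+ v₆ :≤ v₆ :+ v₅) ∷ (1 , v₅ :≤ v₁)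
          ∷ (1 , v₁ :+ v₁ :+ v₁ :+ v₁ :≤ v₂) ∷ []) refl
        (2η≤τ ∷ 4τ≤p[g₀] ∷ p≤q+η Bg Bh ∷ q≤p+η′ B-g₀ Bg ∷ p≤q+η B-g₀ Bg ∷ masses ∷ Nη≤τ ∷ ℚ.≤-reflexive (S.solve 1 (λ t → t S.:+ t S.:+ t S.:+ t S.:= S.con 4ℚ S.:* t) refl τ) ∷ [])))
      where
      open ℚ.≤-Reasoning
      z = g ⊕ h
      f : G → ℚ
      f t = indicator (B? t) * (p t ℚ.- η)
      masses : q z ℚ.+ 1ℚ ℚ.≤ 1ℚ ℚ.+ N * η
      masses = linearℚ (q z ∷ 1ℚ ∷ N * η ∷ Σᴳ f ∷ []) 0 (v₀ :+ v₁ :≤ v₁ :+ v₂) ((1 , v₁ :≤ v₃ :+ v₂) ∷ (1 , v₀ :+ v₃ :≤ v₁) ∷ []) refl (lower ∷ upper ∷ [])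
        where
        lower : 1ℚ ℚ.≤ Σᴳ f ℚ.+ N * η
        lower = begin
          1ℚ                            ≡⟨ Σᴳ-prob μ total≡1 ξ ⟨
          Σᴳ p                          ≤⟨ E-mono counting (λ t _ → pointwise t (B? t)) ⟩
          Σᴳ (λ t → f t ℚ.+ η)          ≡⟨ 𝔼.E-+ counting f (λ _ → η) ⟩
          Σᴳ f ℚ.+ Σᴳ (λ _ → η)         ≡⟨ cong (Σᴳ f ℚ.+_) (Σᴳ-const 0≤η) ⟩
          Σᴳ f ℚ.+ N * η              ∎
          where
          pointwise : ∀ t (d : Dec (B t)) → p t ℚ.≤ indicator d * (p t ℚ.- η) ℚ.+ η
          pointwise t (yes _) = ℚ.≤-reflexive (S.solve 2 (λ p e → p S.:= S.con 1ℚ S.:* (p S.:- e) S.:+ e) refl (p t) η)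
          pointwise t (no ¬B) = subst (p t ℚ.≤_) (S.solve 2 (λ p e → e S.:= S.con 0ℚ S.:* (p S.:- e) S.:+ e) refl (p t) η) (ℚ.<⇒≤ (ℚ.≰⇒> ¬B))
        upper : q z ℚ.+ Σᴳ f ℚ.≤ 1ℚ
        upper = begin
          q z ℚ.+ Σᴳ f
            ≡⟨ cong₂ ℚ._+_ (Σᴳ-pick z q) (Σᴳ-shift g₀ f) ⟨
          Σᴳ (λ t → indicator (z ≟ t) * q t) ℚ.+ Σᴳ (λ t → f (g₀ ⊕ t))
            ≡⟨ 𝔼.E-+ counting (λ t → indicator (z ≟ t) * q t) (λ t → f (g₀ ⊕ t)) ⟨
          Σᴳ (λ t → indicator (z ≟ t) * q t ℚ.+ f (g₀ ⊕ t))
            ≤⟨ E-mono counting (λ t _ → pointwise t (z ≟ t) (B? (g₀ ⊕ t))) ⟩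
          Σᴳ q
            ≡⟨ Σᴳ-prob (μ ⊗ᵐ μ) (⊗-isProbability {μ} {μ} total≡1 total≡1) (add ξ ξ) ⟩
          1ℚ ∎
          where
          pointwise : ∀ t (d : Dec (z ≡ t)) (e : Dec (B (g₀ ⊕ t))) → indicator d * q t ℚ.+ indicator e * (p (g₀ ⊕ t) ℚ.- η) ℚ.≤ q t
          pointwise t (yes refl) (yes Bz) = contradiction Bz ¬Bz
          pointwise t (yes refl) (no _) = ℚ.≤-reflexive (S.solve 2 (λ q r → S.con 1ℚ S.:* q S.:+ S.con 0ℚ S.:* r S.:= q) refl (q t) (p (g₀ ⊕ t) ℚ.- η))
          pointwise t (no _) (no _) = subst (ℚ._≤ q t) (S.solve 2 (λ q r → S.con 0ℚ S.:= S.con 0ℚ S.:* q S.:+ S.con 0ℚ S.:* r) refl (q t) (p (g₀ ⊕ t) ℚ.- η)) (0≤q t)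
          pointwise t (no _) (yes Bt) = subst (ℚ._≤ q t) (S.solve 2 (λ q r → r S.:= S.con 0ℚ S.:* q S.:+ S.con 1ℚ S.:* r) refl (q t) (p (g₀ ⊕ t) ℚ.- η))
            (linearℚ (p (g₀ ⊕ t) ∷ η ∷ q t ∷ []) 0 (v₀ :- v₁ :≤ v₂) ((1 , v₀ :≤ v₂ :+ v₁) ∷ []) refl
              (subst (λ u → p (g₀ ⊕ t) ℚ.≤ q u ℚ.+ η) (xor-solve ((x₀ :⊕ x₁) :⊕ x₀) x₁ (g₀ ∷ t ∷ []) refl) (p≤q+η Bt B-g₀) ∷ []))

    n : ℚ
    n = Σᴳ (λ g → indicator (B? g))

    1≤n : 1ℚ ℚ.≤ n
    1≤n = subst (ℚ._≤ n) (Σᴳ-once g₀) (E-mono counting (λ g _ → indicator-mono (g₀ ≟ g) (B? g) (λ { refl → B-g₀ })))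

    0<n : 0ℚ < n
    0<n = ℚ.<-≤-trans 0<1 1≤n

    n≤N : n ℚ.≤ N
    n≤N = E-mono counting (λ g _ → indicator≤1 (B? g))

    -- Values of p on B differ by at most 2 η, so n copies of p g exceed the total mass 1 by at most
    -- 2 N η ≤ 1.
    n*p≤2 : ∀ {g} → B g → n * p g ℚ.≤ 2ℚ
    n*p≤2 {g} Bg = begin
      n * p g
        ≡⟨ ScalarExpectation.E-·ʳ ℚ-semimodule counting (λ h → indicator (B? h)) (λ h → 0≤indicator (B? h)) (p g) ⟨
      Σᴳ (λ h → indicator (B? h) * p g)
        ≤⟨ E-mono counting (λ h _ → pointwise h (B? h)) ⟩
      Σᴳ (λ h → p h ℚ.+ (η ℚ.+ η))
        ≡⟨ 𝔼.E-+ counting p (λ _ → η ℚ.+ η) ⟩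
      Σᴳ p ℚ.+ Σᴳ (λ _ → η ℚ.+ η)
        ≡⟨ cong₂ ℚ._+_ (Σᴳ-prob μ total≡1 ξ) (Σᴳ-const (0≤+ 0≤η 0≤η)) ⟩
      1ℚ ℚ.+ N * (η ℚ.+ η)
        ≤⟨ ℚ.+-monoʳ-≤ 1ℚ 2Nη≤1 ⟩
      2ℚ ∎
      where
      open ℚ.≤-Reasoning
      pointwise : ∀ h (d : Dec (B h)) → indicator d * p g ℚ.≤ p h ℚ.+ (η ℚ.+ η)
      pointwise h (yes Bh) = subst (ℚ._≤ p h ℚ.+ (η ℚ.+ η)) (≡.sym (ℚ.*-identityˡ (p g))) (p≤p+2η Bg Bh)
      pointwise h (no _)   = subst (ℚ._≤ p h ℚ.+ (η ℚ.+ η)) (≡.sym (ℚ.*-zeroˡ (p g))) (0≤+ (0≤p h) (0≤+ 0≤η 0≤η))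
      2Nη≤1 : N * (η ℚ.+ η) ℚ.≤ 1ℚ
      2Nη≤1 = linearℚ (N * (η ℚ.+ η) ∷ N * η ∷ τ ∷ 8ℚ * (2ℚ * τ) ∷ 1ℚ ∷ []) 0 (v₀ :≤ v₄)
        ((1 , v₀ :≤ v₁ :+ v₁) ∷ (2 , v₁ :≤ v₂) ∷ (1 , 16 :* v₂ :≤ v₃) ∷ (1 , v₃ :≤ v₄) ∷ (14 , :0 :≤ v₂) ∷ []) refl
        (ℚ.≤-reflexive (ℚ.*-distribˡ-+ N η η) ∷ Nη≤τ ∷ 16τ ∷ 2τ≤1/8 ∷ 0≤τ ∷ [])
        where
        16τ : 16 ℚL.⊗ τ ℚ.≤ 8ℚ * (2ℚ * τ)
        16τ = linearℚ (τ ∷ 8ℚ * (2ℚ * τ) ∷ []) 0 (16 :* v₀ :≤ v₁) ((1 , ((v₀ :+ v₀ :+ v₀ :+ v₀) :+ (v₀ :+ v₀ :+ v₀ :+ v₀)) :+ ((v₀ :+ v₀ :+ v₀ :+ v₀) :+ (v₀ :+ v₀ :+ v₀ :+ v₀)) :≤ v₁) ∷ []) refl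
          (ℚ.≤-reflexive (S.solve 1 (λ t → ((t S.:+ t S.:+ t S.:+ t) S.:+ (t S.:+ t S.:+ t S.:+ t)) S.:+ ((t S.:+ t S.:+ t S.:+ t) S.:+ (t S.:+ t S.:+ t S.:+ t)) S.:= S.con 8ℚ S.:* (S.con 2ℚ S.:* t)) refl τ) ∷ [])

    n*p≤τ : ∀ {g} → ¬ B g → n * p g ℚ.≤ τ
    n*p≤τ {g} ¬Bg = ℚ.≤-trans (*-mono-≤ (ℚ.<⇒≤ 0<n) 0≤η n≤N (ℚ.<⇒≤ (ℚ.≰⇒> ¬Bg))) Nη≤τ

    τ≤2 : τ ℚ.≤ 2ℚ
    τ≤2 = ℚ.≤-trans (ℚ.≤-trans (q≤p+q τ 0≤τ) (ℚ.≤-reflexive (S.solve 1 (λ t → t S.:+ t S.:= S.con 2ℚ S.:* t) refl τ)))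
      (ℚ.≤-trans (ℚ.≤-trans (ℚ.≤-reflexive (≡.sym (ℚ.*-identityˡ (2ℚ * τ)))) (*-monoʳ (2ℚ * τ) {1ℚ} {8ℚ} (0≤* 0≤2 0≤τ) 1≤8))
        (ℚ.≤-trans 2τ≤1/8 (p≤p+q 1ℚ 0≤1)))

    -- No atom exceeds 2 / n, inside B or outside, so - log p is at least log n - log 2 throughout
    -- the support.
    log-n≤H : log n ≤ H μ ξ + log 2ℚ
    log-n≤H = ≤-trans (≈⇒≥ (ScalarExpectation.E-const 𝕃-semimodule μ total≡1 (log n)))
      (≤-trans (Eᴸ-mono μ (λ ω ω∈ → pointwise ω ω∈))
        (≈⇒≤ (A.trans (𝔼ᴸ.E-+ μ (λ ω → - log (p (ξ ω))) (λ _ → log 2ℚ)) (A.∙-cong A.refl (ScalarExpectation.E-const 𝕃-semimodule μ total≡1 (log 2ℚ))))))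
      where
      n*p≤2′ : ∀ g → Dec (B g) → n * p g ℚ.≤ 2ℚ
      n*p≤2′ g (yes Bg) = n*p≤2 Bg
      n*p≤2′ g (no ¬Bg) = ℚ.≤-trans (n*p≤τ ¬Bg) τ≤2
      pointwise : ∀ ω → Support μ ω → log n ≤ - log (p (ξ ω)) + log 2ℚ
      pointwise ω ω∈ = linear (log n ∷ log (p (ξ ω)) ∷ log 2ℚ ∷ log (n * p (ξ ω)) ∷ []) 0 (v₀ :≤ :- v₁ :+ v₂)
        ((1 , v₀ :+ v₁ :≤ v₃) ∷ (1 , v₃ :≤ v₂) ∷ []) refl
        (≈⇒≥ (log-* 0<n (0<prob μ ξ ω∈)) ∷ log-mono (0<* 0<n (0<prob μ ξ ω∈)) (n*p≤2′ (ξ ω) (B? (ξ ω))) ∷ [])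

    -- Up to a factor, 1 / u is the uniform distribution on B, mixed with the
    -- uniform distribution on the group.
    private
      u′ : ∀ {g} → Dec (B g) → ℚ
      u′ (yes _) = 2ℚ * n
      u′ (no _)  = 2ℚ * T
      u : G → ℚ
      u g = u′ (B? g)
      0<u : ∀ g → 0ℚ < u g
      0<u g = helper (B? g)
        where
        helper : (d : Dec (B g)) → 0ℚ < u′ d
        helper (yes _) = 0<* 0<2 0<n
        helper (no _)  = 0<* 0<2 0<T

      E[u]≤4n : E μ (λ ω → u (ξ ω)) ℚ.≤ 4ℚ * n
      E[u]≤4n = begin
        E μ (λ ω → u (ξ ω))
          ≡⟨ E-law μ ξ u ⟩
        Σᴳ (λ g → p g * u g)
          ≤⟨ E-mono counting (λ g _ → pointwise g (B? g)) ⟩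
        Σᴳ (λ g → p g * (2ℚ * n) ℚ.+ η * (2ℚ * T))
          ≡⟨ 𝔼.E-+ counting (λ g → p g * (2ℚ * n)) (λ _ → η * (2ℚ * T)) ⟩
        Σᴳ (λ g → p g * (2ℚ * n)) ℚ.+ Σᴳ (λ _ → η * (2ℚ * T))
          ≡⟨ cong₂ ℚ._+_ (≡.trans (ScalarExpectation.E-·ʳ ℚ-semimodule counting p 0≤p (2ℚ * n)) (≡.trans (cong (_* (2ℚ * n)) (Σᴳ-prob μ total≡1 ξ)) (ℚ.*-identityˡ (2ℚ * n))))
               (Σᴳ-const (0≤* 0≤η (0≤* 0≤2 0≤T))) ⟩
        2ℚ * n ℚ.+ N * (η * (2ℚ * T))
          ≡⟨ cong (2ℚ * n ℚ.+_) (S.solve 3 (λ n e t → n S.:* (e S.:* (S.con 2ℚ S.:* t)) S.:= S.con 2ℚ S.:* (t S.:* (n S.:* e))) refl N η T) ⟩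
        2ℚ * n ℚ.+ 2ℚ * (T * (N * η))
          ≤⟨ ℚ.+-monoʳ-≤ (2ℚ * n) (*-monoˡ 2ℚ 0≤2 (*-monoˡ T 0≤T Nη≤τ)) ⟩
        2ℚ * n ℚ.+ 2ℚ * (T * τ)
          ≤⟨ ℚ.+-monoʳ-≤ (2ℚ * n) (*-monoˡ 2ℚ 0≤2 Tτ≤n) ⟩
        2ℚ * n ℚ.+ 2ℚ * n
          ≡⟨ S.solve 1 (λ n → S.con 2ℚ S.:* n S.:+ S.con 2ℚ S.:* n S.:= S.con 4ℚ S.:* n) refl n ⟩
        4ℚ * n ∎
        where
        open ℚ.≤-Reasoning
        pointwise : ∀ g (d : Dec (B g)) → p g * u′ d ℚ.≤ p g * (2ℚ * n) ℚ.+ η * (2ℚ * T)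
        pointwise g (yes _) = p≤p+q (p g * (2ℚ * n)) (0≤* 0≤η (0≤* 0≤2 0≤T))
        pointwise g (no ¬B) = ℚ.≤-trans (*-monoʳ (2ℚ * T) (0≤* 0≤2 0≤T) (ℚ.<⇒≤ (ℚ.≰⇒> ¬B))) (q≤p+q (η * (2ℚ * T)) (0≤* (0≤p g) (0≤* 0≤2 (ℚ.<⇒≤ 0<n))))
        Tτ≤n : T * τ ℚ.≤ n
        Tτ≤n = ℚ.≤-trans (ℚ.≤-trans (ℚ.≤-reflexive (≡.sym (ℚ.*-identityˡ (T * τ))))
          (*-monoʳ (T * τ) {1ℚ} {8ℚ} (0≤* 0≤T 0≤τ) 1≤8))
          (subst (ℚ._≤ n) (≡.sym 8Tτ≡1) 1≤n)

      Σᴳ[1/u]≤1 : Σᴳ (λ g → inv (u g)) ℚ.≤ 1ℚ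
      Σᴳ[1/u]≤1 = begin
        Σᴳ (λ g → inv (u g))
          ≤⟨ E-mono counting (λ g _ → pointwise g (B? g)) ⟩
        Σᴳ (λ g → indicator (B? g) * i ℚ.+ j)
          ≡⟨ 𝔼.E-+ counting (λ g → indicator (B? g) * i) (λ _ → j) ⟩
        Σᴳ (λ g → indicator (B? g) * i) ℚ.+ Σᴳ (λ _ → j)
          ≡⟨ cong₂ ℚ._+_ (ScalarExpectation.E-·ʳ ℚ-semimodule counting (λ g → indicator (B? g)) (λ g → 0≤indicator (B? g)) i) (Σᴳ-const 0≤j) ⟩
        n * i ℚ.+ N * j
          ≤⟨ ℚ.+-monoʳ-≤ (n * i) (*-monoʳ j 0≤j N≤T) ⟩
        n * i ℚ.+ T * j
          ≡⟨ S.solve 4 (λ n i t j → n S.:* i S.:+ t S.:* j S.:= S.con ½ S.:* ((S.con 2ℚ S.:* n) S.:* i S.:+ (S.con 2ℚ S.:* t) S.:* j)) refl n i T j ⟩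
        ½ * ((2ℚ * n) * i ℚ.+ (2ℚ * T) * j)
          ≡⟨ cong₂ (λ x y → ½ * (x ℚ.+ y)) (*-inv (<⇒≢0 (0<* 0<2 0<n))) (*-inv (<⇒≢0 (0<* 0<2 0<T))) ⟩
        1ℚ ∎
        where
        open ℚ.≤-Reasoning
        i = inv (2ℚ * n)
        j = inv (2ℚ * T)
        0≤j = 0≤inv (0≤* 0≤2 0≤T)
        pointwise : ∀ g (d : Dec (B g)) → inv (u′ d) ℚ.≤ indicator d * i ℚ.+ j
        pointwise g (yes _) = subst (λ t → i ℚ.≤ t ℚ.+ j) (≡.sym (ℚ.*-identityˡ i)) (p≤p+q i 0≤j)
        pointwise g (no _)  = subst (λ t → j ℚ.≤ t ℚ.+ j) (≡.sym (ℚ.*-zeroˡ i)) (q≤p+q j ℚ.≤-refl)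

      ν : Measure
      ν = reweight counting (λ g → inv (u g)) (λ g → 0≤inv (ℚ.<⇒≤ (0<u g)))

      prob-ν : ∀ v → prob ν id v ≡ inv (u v)
      prob-ν v = ≡.trans (E-reweight ℚ-semimodule counting (λ g → inv (u g)) (λ g → 0≤inv (ℚ.<⇒≤ (0<u g))) (λ g → indicator (g ≟ v)))
        (≡.trans (𝔼.E-cong counting (λ g _ → ≡.trans (ℚ.*-comm (inv (u g)) (indicator (g ≟ v))) (cong (_* inv (u g)) (indicator-sym g v))))
          (Σᴳ-pick v (λ g → inv (u g))))

      total-ν : total ν ℚ.≤ 1ℚ
      total-ν = ℚ.≤-trans (ℚ.≤-reflexive (≡.trans (E-reweight ℚ-semimodule counting (λ g → inv (u g)) (λ g → 0≤inv (ℚ.<⇒≤ (0<u g))) (λ _ → 1ℚ))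
        (𝔼.E-cong counting (λ g _ → ℚ.*-identityʳ (inv (u g)))))) Σᴳ[1/u]≤1

      J₁ : 0ℚ < E μ (λ ω → u (ξ ω)) × Eᴸ μ (λ ω → log (u (ξ ω))) ≤ log (E μ (λ ω → u (ξ ω)))
      J₁ = jensen μ total≡1 (λ ω → u (ξ ω)) (λ ω _ → 0<u (ξ ω))
      J₂ : 0ℚ < E μ (λ ω → inv (u (ξ ω)) * inv (p (ξ ω))) × Eᴸ μ (λ ω → log (inv (u (ξ ω)) * inv (p (ξ ω)))) ≤ log (E μ (λ ω → inv (u (ξ ω)) * inv (p (ξ ω))))
      J₂ = jensen μ total≡1 (λ ω → inv (u (ξ ω)) * inv (p (ξ ω))) (λ ω ω∈ → 0<* (0<inv (0<u (ξ ω))) (0<inv (0<prob μ ξ ω∈)))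
      E₂≤1 : E μ (λ ω → inv (u (ξ ω)) * inv (p (ξ ω))) ℚ.≤ 1ℚ
      E₂≤1 = ℚ.≤-trans (ℚ.≤-reflexive (𝔼.E-cong μ (λ ω _ → cong (_* inv (p (ξ ω))) (≡.sym (prob-ν (ξ ω))))))
        (ℚ.≤-trans (density≤total μ ξ ν id) total-ν)

    -- Gibbs' inequality against 1 / u bounds the entropy by the mean of log u, and Jensen's
    -- inequality bounds that by log of the mean of u. Outside of B, u is as large as 2 T, but each
    -- atom is below η there, so these values add at most 2 T N η ≤ 2 n to the mean.
    H≤log-4n : H μ ξ ≤ log (4ℚ * n)
    H≤log-4n = linear (H μ ξ ∷ l₁ ∷ l₂ ∷ log (4ℚ * n) ∷ []) 0 (v₀ :≤ v₃) ((1 , v₀ :≤ v₂ :+ v₁) ∷ (1 , v₁ :≤ v₃) ∷ (1 , v₂ :≤ :0) ∷ []) refl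
      (≈⇒≤ (A.trans (𝔼ᴸ.E-cong μ pointwise) (𝔼ᴸ.E-+ μ (λ ω → log (inv (u (ξ ω)) * inv (p (ξ ω)))) (λ ω → log (u (ξ ω)))))
      ∷ ≤-trans (proj₂ J₁) (log-mono (proj₁ J₁) E[u]≤4n)
      ∷ ≤-trans (proj₂ J₂) (≤-trans (log-mono (proj₁ J₂) E₂≤1) (≈⇒≤ log-1)) ∷ [])
      where
      l₁ = Eᴸ μ (λ ω → log (u (ξ ω)))
      l₂ = Eᴸ μ (λ ω → log (inv (u (ξ ω)) * inv (p (ξ ω))))
      pure : ∀ {a b} → 0ℚ < a → 0ℚ < b → - log b ≈ log (inv a * inv b) + log a
      pure {a} {b} 0<a 0<b = A.trans (equal-sound (:- v₁) (:- v₀ :- v₁ :+ v₀) (log a ∷ log b ∷ []) refl)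
        (A.∙-cong (A.sym (A.trans (log-* (0<inv 0<a) (0<inv 0<b)) (A.∙-cong (log-inv 0<a) (log-inv 0<b)))) A.refl)
      pointwise : ∀ ω → Support μ ω → - log (p (ξ ω)) ≈ log (inv (u (ξ ω)) * inv (p (ξ ω))) + log (u (ξ ω))
      pointwise ω ω∈ = pure (0<u (ξ ω)) (0<prob μ ξ ω∈)

    module _ (μ₀ : Measure) (total₀≡1 : IsProbability μ₀) (ξ₀ : Ω μ₀ → G) {K : ℚ} (0<K : 0ℚ < K) (K≤T : K ℚ.≤ T)
      (close : H (μ₀ ⊗ᵐ μ) (add ξ₀ ξ) ≤ H μ ξ + log K) where

      private
        σ : Measure
        σ = μ₀ ⊗ᵐ μ
        r : G → ℚ
        r = prob σ (add ξ₀ ξ)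
        mass : G → ℚ
        mass v = E μ₀ (λ ω → indicator (B? (v ⊕ ξ₀ ω)))

        -- r v is the mean of p (v + ξ₀), and n p is at most 2 on B and at most τ elsewhere.
        n*r≤ : ∀ v → n * r v ℚ.≤ 2ℚ * mass v ℚ.+ τ
        n*r≤ v = begin
          n * r v
            ≡⟨ cong (n *_) (≡.trans (E-⊗ ℚ-semimodule μ₀ μ (λ χ → indicator (add ξ₀ ξ χ ≟ v)))
                 (𝔼.E-cong μ₀ (λ ω _ → 𝔼.E-cong μ (λ ψ _ → move ω ψ)))) ⟩
          n * E μ₀ (λ ω → p (v ⊕ ξ₀ ω))
            ≡⟨ 𝔼.E-· μ₀ {n} (ℚ.<⇒≤ 0<n) (λ ω → p (v ⊕ ξ₀ ω)) ⟨
          E μ₀ (λ ω → n * p (v ⊕ ξ₀ ω))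
            ≤⟨ E-mono μ₀ (λ ω _ → pointwise (v ⊕ ξ₀ ω) (B? (v ⊕ ξ₀ ω))) ⟩
          E μ₀ (λ ω → 2ℚ * indicator (B? (v ⊕ ξ₀ ω)) ℚ.+ τ)
            ≡⟨ 𝔼.E-+ μ₀ (λ ω → 2ℚ * indicator (B? (v ⊕ ξ₀ ω))) (λ _ → τ) ⟩
          E μ₀ (λ ω → 2ℚ * indicator (B? (v ⊕ ξ₀ ω))) ℚ.+ E μ₀ (λ _ → τ)
            ≡⟨ cong₂ ℚ._+_ (𝔼.E-· μ₀ {2ℚ} 0≤2 (λ ω → indicator (B? (v ⊕ ξ₀ ω)))) (ScalarExpectation.E-const ℚ-semimodule μ₀ total₀≡1 τ) ⟩
          2ℚ * mass v ℚ.+ τ ∎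
          where
          open ℚ.≤-Reasoning
          move : ∀ ω ψ → indicator (add ξ₀ ξ (ω , ψ) ≟ v) ≡ indicator (ξ ψ ≟ v ⊕ ξ₀ ω)
          move ω ψ = indicator-cong (add ξ₀ ξ (ω , ψ) ≟ v) (ξ ψ ≟ v ⊕ ξ₀ ω)
            (λ { refl → xor-solve x₁ ((x₀ :⊕ x₁) :⊕ x₀) (ξ₀ ω ∷ ξ ψ ∷ []) refl })
            (λ eq → ≡.trans (cong (ξ₀ ω ⊕_) eq) (xor-solve (x₀ :⊕ (x₁ :⊕ x₀)) x₁ (ξ₀ ω ∷ v ∷ []) refl))
          pointwise : ∀ g (d : Dec (B g)) → n * p g ℚ.≤ 2ℚ * indicator d ℚ.+ τ
          pointwise g (yes Bg) = ℚ.≤-trans (n*p≤2 Bg) (ℚ.≤-trans (p≤p+q 2ℚ 0≤τ) (ℚ.≤-reflexive (cong (ℚ._+ τ) (≡.sym (ℚ.*-identityʳ 2ℚ)))))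
          pointwise g (no ¬Bg) = ℚ.≤-trans (n*p≤τ ¬Bg) (q≤p+q τ (0≤* 0≤2 ℚ.≤-refl))

        some : ∃[ ω ] Support σ ω × - log (r (add ξ₀ ξ ω)) ≤ H σ (add ξ₀ ξ)
        some = minimum≤E σ (⊗-isProbability {μ₀} {μ} total₀≡1 total≡1) (λ ω → - log (r (add ξ₀ ξ ω)))

      -- Some value v of the sum has - log (r v) at most the entropy, so r v ≥ 1 / (4 n K). In
      -- `n*r≤` the share of τ is at most a half, since 8 K τ ≤ 8 T τ = 1, and the mass must supply
      -- the rest.
      heavy-coset : ∃[ v ] 1ℚ ℚ.≤ 16ℚ * (K * mass v)
      heavy-coset = v , (begin
        1ℚ
          ≡⟨ S.solve 1 (λ t → S.con 1ℚ S.:= S.con 2ℚ S.:* t S.:- (S.con 2ℚ S.:* t S.:- S.con 1ℚ)) refl 1ℚ ⟩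
        2ℚ ℚ.- 1ℚ
          ≤⟨ linearℚ (1ℚ ∷ 4ℚ * (K * τ) ∷ 4ℚ * (K * (2ℚ * mass v ℚ.+ τ)) ∷ 8ℚ * (K * mass v) ∷ []) 0 ((v₀ :+ v₀) :- v₀ :≤ v₃ :+ v₃)
               ((2 , v₀ :≤ v₂) ∷ (2 , v₂ :≤ v₃ :+ v₁) ∷ (1 , v₁ :+ v₁ :≤ v₀) ∷ []) refl (1≤ ∷ ℚ.≤-reflexive split ∷ half ∷ []) ⟩
        8ℚ * (K * mass v) ℚ.+ 8ℚ * (K * mass v)
          ≡⟨ S.solve 1 (λ x → S.con 8ℚ S.:* x S.:+ S.con 8ℚ S.:* x S.:= S.con 16ℚ S.:* x) refl (K * mass v) ⟩
        16ℚ * (K * mass v) ∎)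
        where
        open ℚ.≤-Reasoning
        v = add ξ₀ ξ (proj₁ some)
        0≤K = ℚ.<⇒≤ 0<K
        0<r : 0ℚ < r v
        0<r = 0<prob σ (add ξ₀ ξ) (proj₁ (proj₂ some))
        0<4nK : 0ℚ < (4ℚ * n) * K
        0<4nK = 0<* (0<* 0<4 0<n) 0<K
        1≤r4nK : 1ℚ ℚ.≤ r v * ((4ℚ * n) * K)
        1≤r4nK = log-cancel 0<1 (0<* 0<r 0<4nK)
          (linear (log 1ℚ ∷ log (r v) ∷ log (4ℚ * n) ∷ log K ∷ log ((4ℚ * n) * K) ∷ log (r v * ((4ℚ * n) * K)) ∷ H μ ξ ∷ H σ (add ξ₀ ξ) ∷ []) 0 (v₀ :≤ v₅)
            ((1 , v₀ :≤ :0) ∷ (1 , v₁ :+ v₄ :≤ v₅) ∷ (1 , v₂ :+ v₃ :≤ v₄) ∷ (1 , :- v₁ :≤ v₇) ∷ (1 , v₇ :≤ v₆ :+ v₃) ∷ (1 , v₆ :≤ v₂) ∷ []) refl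
            (≈⇒≤ log-1 ∷ ≈⇒≥ (log-* 0<r 0<4nK) ∷ ≈⇒≥ (log-* (0<* 0<4 0<n) 0<K) ∷ proj₂ (proj₂ some) ∷ close ∷ H≤log-4n ∷ []))
        1≤ : 1ℚ ℚ.≤ 4ℚ * (K * (2ℚ * mass v ℚ.+ τ))
        1≤ = begin
          1ℚ                                            ≤⟨ 1≤r4nK ⟩
          r v * ((4ℚ * n) * K)                    ≡⟨ S.solve 3 (λ r n k → r S.:* ((S.con 4ℚ S.:* n) S.:* k) S.:= S.con 4ℚ S.:* (k S.:* (n S.:* r))) refl (r v) n K ⟩
          4ℚ * (K * (n * r v))                    ≤⟨ *-monoˡ 4ℚ (ℚ.<⇒≤ 0<4) (*-monoˡ K 0≤K (n*r≤ v)) ⟩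
          4ℚ * (K * (2ℚ * mass v ℚ.+ τ))          ∎
        split : 4ℚ * (K * (2ℚ * mass v ℚ.+ τ)) ≡ 8ℚ * (K * mass v) ℚ.+ 4ℚ * (K * τ)
        split = S.solve 3 (λ k m t → S.con 4ℚ S.:* (k S.:* (S.con 2ℚ S.:* m S.:+ t)) S.:= S.con 8ℚ S.:* (k S.:* m) S.:+ S.con 4ℚ S.:* (k S.:* t)) refl K (mass v) τ
        half : 4ℚ * (K * τ) ℚ.+ 4ℚ * (K * τ) ℚ.≤ 1ℚ
        half = begin
          4ℚ * (K * τ) ℚ.+ 4ℚ * (K * τ)   ≡⟨ S.solve 1 (λ x → S.con 4ℚ S.:* x S.:+ S.con 4ℚ S.:* x S.:= S.con 8ℚ S.:* x) refl (K * τ) ⟩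
          8ℚ * (K * τ)                        ≤⟨ *-monoˡ 8ℚ (ℚ.<⇒≤ (0<+ 0<4 0<4)) (*-monoʳ τ 0≤τ K≤T) ⟩
          8ℚ * (T * τ)                        ≡⟨ 8Tτ≡1 ⟩
          1ℚ                                      ∎

module Exponent where

  open import Data.Nat.Base using (ℕ)
  open import Relation.Binary.PropositionalEquality using (_≡_; refl)

  abstract
    -- 4514 = 2 · 2257: `limit` multiplies the doubled self-distance of the graph by 2257, and that
    -- distance is at most 2 log s. Abstract, so that powers with this exponent stay unevaluated.
    exponent : ℕ
    exponent = 4514

    exponent-≡ : exponent ≡ 4514
    exponent-≡ = refl

-- A coset that captures much of a set of small doubling.

module Cosets (𝔾 : BooleanGroups.BooleanGroup) (elements : List (BooleanGroups.BooleanGroup.G 𝔾)) (once : BooleanGroups.Enumerates 𝔾 elements) where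

  open import Data.Rational.Base as ℚ using (ℚ; 0ℚ; 1ℚ; ½; _*_; _<_)
  open import Data.List.Base using ([]; _∷_; length; filter; map)
  open import Data.List.Membership.Propositional using (_∈_)
  open import Data.List.Membership.Propositional.Properties using (∈-map⁺)
  open import Data.List.Properties using (length-map)
  open import Data.List.Relation.Unary.All using ([]; _∷_)
  open import Data.Nat.Base as ℕ using (ℕ; suc)
  import Data.Rational.Properties as ℚ
  open import Function.Base using (id)
  open import Data.Product.Base using (∃-syntax; Σ-syntax; _×_; _,_; proj₁; proj₂)
  open import Data.Vec.Base using ([]; _∷_)
  open import Relation.Binary.PropositionalEquality as ≡ using (_≡_; refl; cong; subst; subst₂)
  open import Relation.Nullary using (Dec; yes; no; contradiction)
  open LinearInequalities
  open RationalLemmas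
  open Expectations
  open Entropy
  open Exponent
  open RuzsaDistance 𝔾
  open SmallDefect 𝔾
  open Iteration 𝔾
  open NearlyUniform 𝔾 elements once
  open RandomVariable

  module Concentration (X₀ : RandomVariable) {M size : ℚ} (0<M : 0ℚ < M) (0<size : 0ℚ < size)
    (H₀≤ : H (measure X₀) (value X₀) ≤ log size) (doubling : 2257 ⊗ d X₀ X₀ ≤ log M) where

    private
      T τ η θ : ℚ
      -- T dominates N, M and 2; then τ = 1 / (8 T), η = τ / T and θ = η⁴ / 4 satisfy the demands of
      -- `Structure`. The dependence on the group order N is absent from the conclusions, because
      -- `limit` holds for every b with the same displacement.
      T = N ℚ.+ M ℚ.+ 2ℚ
      τ = inv (8ℚ * T)
      η = τ * inv T
      θ = (½ * ½) * ((η * η) * (η * η))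

      0≤N : 0ℚ ℚ.≤ N
      0≤N = 0≤E counting (λ _ _ → 0≤1)
      2≤T : 2ℚ ℚ.≤ T
      2≤T = q≤p+q 2ℚ (0≤+ 0≤N (ℚ.<⇒≤ 0<M))
      N≤T : N ℚ.≤ T
      N≤T = ℚ.≤-trans (p≤p+q N (ℚ.<⇒≤ 0<M)) (p≤p+q (N ℚ.+ M) 0≤2)
      M≤T : M ℚ.≤ T
      M≤T = ℚ.≤-trans (q≤p+q (M) 0≤N) (p≤p+q (N ℚ.+ M) 0≤2)
      0<T : 0ℚ < T
      0<T = ℚ.<-≤-trans 0<2 2≤T
      0<8T : 0ℚ < 8ℚ * T
      0<8T = 0<* (ℚ.<-≤-trans 0<1 1≤8) 0<T
      0<τ : 0ℚ < τ
      0<τ = 0<inv 0<8T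
      0<η : 0ℚ < η
      0<η = 0<* 0<τ (0<inv 0<T)
      0≤η : 0ℚ ℚ.≤ η
      0≤η = ℚ.<⇒≤ 0<η
      8Tτ≡1 : 8ℚ * (T * τ) ≡ 1ℚ
      8Tτ≡1 = ≡.trans (≡.sym (ℚ.*-assoc 8ℚ T τ)) (*-inv (<⇒≢0 0<8T))
      Tη≡τ : T * η ≡ τ
      Tη≡τ = ≡.trans (S.solve 3 (λ t u i → t S.:* (u S.:* i) S.:= (t S.:* i) S.:* u) refl T τ (inv T))
        (≡.trans (cong (_* τ) (*-inv (<⇒≢0 0<T))) (ℚ.*-identityˡ τ))
      Nη≤τ : N * η ℚ.≤ τ
      Nη≤τ = subst (N * η ℚ.≤_) Tη≡τ (*-monoʳ η 0≤η N≤T)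
      2η≤τ : η ℚ.+ η ℚ.≤ τ
      2η≤τ = subst₂ ℚ._≤_ (S.solve 1 (λ e → S.con 2ℚ S.:* e S.:= e S.:+ e) refl η) Tη≡τ (*-monoʳ η 0≤η 2≤T)
      4θ≡ : 4ℚ * θ ≡ (η * η) * (η * η)
      4θ≡ = S.solve 1 (λ x → S.con 4ℚ S.:* ((S.con ½ S.:* S.con ½) S.:* x) S.:= x) refl ((η * η) * (η * η))
      τ≤1 : τ ℚ.≤ 1ℚ
      τ≤1 = begin
        τ                      ≡⟨ ℚ.*-identityˡ τ ⟨
        1ℚ * τ               ≤⟨ *-monoʳ τ (ℚ.<⇒≤ 0<τ) 1≤8T ⟩
        (8ℚ * T) * τ       ≡⟨ *-inv (<⇒≢0 0<8T) ⟩
        1ℚ                     ∎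
        where
        open ℚ.≤-Reasoning
        1≤8T : 1ℚ ℚ.≤ 8ℚ * T
        1≤8T = *-mono-≤ {1ℚ} {8ℚ} {1ℚ} {T} 0≤1 (ℚ.<⇒≤ 0<T) 1≤8 (ℚ.≤-trans (p≤p+q 1ℚ 0≤1) 2≤T)
      η≤1 : η ℚ.≤ 1ℚ
      η≤1 = ℚ.≤-trans (q≤p+q η 0≤η) (ℚ.≤-trans 2η≤τ τ≤1)
      0<η⁴ : 0ℚ < (η * η) * (η * η)
      0<η⁴ = 0<* (0<* 0<η 0<η) (0<* 0<η 0<η)
      η⁴≤1 : (η * η) * (η * η) ℚ.≤ 1ℚ
      η⁴≤1 = *-mono-≤ {η * η} {1ℚ} {η * η} {1ℚ} (0≤* 0≤η 0≤η) 0≤1 η²≤1 η²≤1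
        where
        η²≤1 : η * η ℚ.≤ 1ℚ
        η²≤1 = *-mono-≤ {η} {1ℚ} {η} {1ℚ} 0≤η 0≤1 η≤1 η≤1
      0<¼ : 0ℚ < ½ * ½
      0<¼ = 0<* 0<½ 0<½
      0<θ : 0ℚ < θ
      0<θ = 0<* 0<¼ 0<η⁴
      0<1-θ : 0ℚ < 1ℚ ℚ.- θ
      0<1-θ = ℚ.<-≤-trans 0<¼ (ℚL.linear (½ * ½ ∷ θ ∷ 1ℚ ∷ []) 0 (v₀ :≤ v₂ :- v₁) ((1 , v₁ :≤ v₀) ∷ (1 , v₀ :+ v₀ :≤ v₂) ∷ []) refl
        (ℚ.≤-trans (*-monoˡ (½ * ½) (ℚ.<⇒≤ 0<¼) η⁴≤1) (ℚ.≤-reflexive (ℚ.*-identityʳ (½ * ½)))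
        ∷ ℚ.≤-trans (p≤p+q (½ * ½ ℚ.+ ½ * ½) (0≤+ (ℚ.<⇒≤ 0<¼) (ℚ.<⇒≤ 0<¼))) (ℚ.≤-reflexive refl) ∷ []))
      1<b : 1ℚ < inv (1ℚ ℚ.- θ)
      1<b with 1ℚ ℚ.<? inv (1ℚ ℚ.- θ)
      ... | yes p = p
      ... | no ¬p = contradiction 0<θ (≤⇒≯ (ℚL.linear (θ ∷ 1ℚ ∷ []) 0 (v₀ :≤ :0) ((1 , v₁ :≤ v₁ :- v₀) ∷ []) refl (1≤1-θ ∷ [])))
        where
        open ℚ.≤-Reasoning
        1≤1-θ : 1ℚ ℚ.≤ 1ℚ ℚ.- θ
        1≤1-θ = begin
          1ℚ                                     ≡⟨ *-inv (<⇒≢0 0<1-θ) ⟨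
          (1ℚ ℚ.- θ) * inv (1ℚ ℚ.- θ)          ≤⟨ *-monoˡ (1ℚ ℚ.- θ) (ℚ.<⇒≤ 0<1-θ) (ℚ.≮⇒≥ ¬p) ⟩
          (1ℚ ℚ.- θ) * 1ℚ                      ≡⟨ ℚ.*-identityʳ (1ℚ ℚ.- θ) ⟩
          1ℚ ℚ.- θ                               ∎

      limiting : Σ[ X ∈ RandomVariable ] d X X ≤ log (inv (1ℚ ℚ.- θ)) + log (inv (1ℚ ℚ.- θ)) × d X₀ X ≤ 2257 ⊗ d X₀ X₀
      limiting = limit X₀ 1<b

      X : RandomVariable
      X = proj₁ limiting

      small-defect : H (measure X ⊗ᵐ measure X) (add (value X) (value X)) ≤ H (measure X) (value X) + log (inv (1ℚ ℚ.- θ))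
      small-defect = linear (H (measure X ⊗ᵐ measure X) (add (value X) (value X)) ∷ H (measure X) (value X) ∷ log (inv (1ℚ ℚ.- θ)) ∷ []) 1 (v₀ :≤ v₁ :+ v₂)
        ((1 , v₀ :+ v₀ :- v₁ :- v₁ :≤ v₂ :+ v₂) ∷ []) refl (proj₁ (proj₂ limiting) ∷ [])

      near : d X₀ X ≤ log (M)
      near = ≤-trans (proj₂ (proj₂ limiting)) doubling

      H-add-X : H (measure X₀ ⊗ᵐ measure X) (add (value X₀) (value X)) ≤ H (measure X) (value X) + log (M)
      H-add-X = linear (H (measure X₀ ⊗ᵐ measure X) (add (value X₀) (value X)) ∷ H (measure X) (value X) ∷ log (M) ∷ H (measure X₀) (value X₀) ∷ []) 0 (v₀ :≤ v₁ :+ v₂)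
        ((1 , v₀ :+ v₀ :- v₃ :- v₁ :≤ v₂) ∷ (1 , v₃ :≤ v₀) ∷ []) refl
        (near ∷ H≤add {measure X₀} {measure X} (isProbability X₀) (isProbability X) (value X₀) (value X) ∷ [])

      H-X : H (measure X) (value X) ≤ log size + log (M)
      H-X = linear (H (measure X₀ ⊗ᵐ measure X) (add (value X₀) (value X)) ∷ H (measure X) (value X) ∷ log (M) ∷ H (measure X₀) (value X₀) ∷ log size ∷ []) 0 (v₁ :≤ v₄ :+ v₂)
        ((1 , v₀ :+ v₀ :- v₃ :- v₁ :≤ v₂) ∷ (2 , v₁ :≤ v₀) ∷ (1 , v₃ :≤ v₄) ∷ []) refl
        (near ∷ H≤add′ {measure X₀} {measure X} (isProbability X₀) (isProbability X) (value X₀) (value X) ∷ H₀≤ ∷ [])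

      module C = Structure (measure X) (isProbability X) (value X) {T} {τ} {η} {θ} 0<η 2η≤τ Nη≤τ 2≤T N≤T 8Tτ≡1 0<1-θ 4θ≡ small-defect

    B : G → Set
    B = C.B

    B? : ∀ g → Dec (B g)
    B? = C.B?

    g₀ : G
    g₀ = C.g₀

    B-closed : ∀ {g h} → B g → B h → B (g₀ ⊕ (g ⊕ h))
    B-closed = C.B-closed

    n : ℚ
    n = Σᴳ (λ g → indicator (B? g))

    n-bound : n ℚ.≤ (size * M) * 2ℚ
    n-bound = log-cancel C.0<n (0<* (0<* 0<size 0<M) 0<2)
      (linear (log C.n ∷ H (measure X) (value X) ∷ log 2ℚ ∷ log size ∷ log M ∷ log (size * M) ∷ log ((size * M) * 2ℚ) ∷ []) 0 (v₀ :≤ v₆)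
        ((1 , v₀ :≤ v₁ :+ v₂) ∷ (1 , v₁ :≤ v₃ :+ v₄) ∷ (1 , v₅ :+ v₂ :≤ v₆) ∷ (1 , v₃ :+ v₄ :≤ v₅) ∷ []) refl
        (C.log-n≤H ∷ H-X ∷ ≈⇒≥ (log-* (0<* 0<size 0<M) 0<2) ∷ ≈⇒≥ (log-* 0<size 0<M) ∷ []))

    coset : ∃[ v ] 1ℚ ℚ.≤ 16ℚ * (M * E (measure X₀) (λ ω → indicator (B? (v ⊕ value X₀ ω))))
    coset = C.heavy-coset (measure X₀) (isProbability X₀) (value X₀) {M} 0<M M≤T H-add-X

  -- Gibbs' inequality against the counting measure of `xs`, where repetitions merely increase the
  -- mass.
  maximum-entropy : ∀ {A : Set} {{_ : DecEq A}} μ → IsProbability μ → (X : Ω μ → A) (xs : List A) →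
    (∀ ω → X ω ∈ xs) → H μ X ≤ log (nat (length xs))
  maximum-entropy {A} μ total≡1 X xs X∈ = ≤-trans
    (≈⇒≤ (𝔼ᴸ.E-cong μ (λ ω ω∈ → A.sym (log-inv (0<prob μ X ω∈)))))
    (≤-trans (proj₂ J) (log-mono (proj₁ J) (begin
      E μ (λ ω → inv (prob μ X (X ω)))
        ≤⟨ E-mono μ (λ ω _ → ℚ.≤-trans (ℚ.≤-reflexive (≡.sym (ℚ.*-identityˡ (inv (prob μ X (X ω))))))
             (*-monoʳ (inv (prob μ X (X ω))) (0≤inv (0≤prob μ X (X ω))) (weight≤prob ν id (X∈ ω)))) ⟩
      E μ (λ ω → prob ν id (X ω) * inv (prob μ X (X ω)))
        ≤⟨ density≤total μ X ν id ⟩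
      total ν
        ≡⟨ total-list xs ⟩
      nat (length xs) ∎)))
    where
    open ℚ.≤-Reasoning
    ν : Measure
    ν = record { Ω = A ; points = xs ; weight = λ _ → 1ℚ ; 0≤weight = λ _ → 0≤1 }
    J : 0ℚ < E μ (λ ω → inv (prob μ X (X ω))) × Eᴸ μ (λ ω → log (inv (prob μ X (X ω)))) ≤ log (E μ (λ ω → inv (prob μ X (X ω))))
    J = jensen μ total≡1 (λ ω → inv (prob μ X (X ω))) (λ ω ω∈ → 0<inv (0<prob μ X ω∈))
    total-list : ∀ (xs : List A) → 𝔼.sum xs (λ _ → 1ℚ * 1ℚ) ≡ nat (length xs)
    total-list []       = refl
    total-list (x ∷ xs) = cong (1ℚ ℚ.+_) (total-list xs)

  sum-indicator : ∀ {A : Set} {P : A → Set} (P? : ∀ a → Dec (P a)) xs → 𝔼.sum xs (λ a → indicator (P? a)) ≡ nat (length (filter P? xs))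
  sum-indicator P? [] = refl
  sum-indicator P? (x ∷ xs) with P? x
  ... | yes _ = cong (1ℚ ℚ.+_) (sum-indicator P? xs)
  ... | no  _ = ≡.trans (ℚ.+-identityˡ _) (sum-indicator P? xs)

  -- By `B-closed` the translate g₀ + B is closed under addition, and in a group of exponent 2 an
  -- inhabited set of this kind is a subgroup.
  record Coset {I : Set} (is : List I) (ξ : I → G) (M : ℕ) : Set₁ where
    field
      B        : G → Set
      B?       : ∀ g → Dec (B g)
      g₀       : G
      B-closed : ∀ {g h} → B g → B h → B (g₀ ⊕ (g ⊕ h))
      v        : G
      many     : length is ℕ.≤ 16 ℕ.* (M ℕ.* length (filter (λ i → B? (v ⊕ ξ i)) is))
      few      : length (filter B? elements) ℕ.≤ length is ℕ.* M ℕ.* 2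

  module Approximation {I : Set} {{_ : DecEq I}} (is : List I) (∈is : ∀ i → i ∈ is)
    (once-I : ∀ i → 𝔼.sum is (λ j → indicator (i ≟ j)) ≡ 1ℚ) (0<is : 0 ℕ.< length is)
    (ξ : I → G) (ξ-injective : ∀ {i j} → ξ i ≡ ξ j → i ≡ j)
    (sumset : List G) (∈sumset : ∀ i j → ξ i ⊕ ξ j ∈ sumset) (s : ℕ) (0<s : 0 ℕ.< s) (length-sumset : length sumset ≡ length is ℕ.* s) where

    private
      M : ℕ
      M = s ℕ.^ exponent

      0<nat′ : ∀ {k} → 0 ℕ.< k → 0ℚ < nat k
      0<nat′ {suc k} _ = 0<nat k

      0<s′ : 0ℚ < nat s
      0<s′ = 0<nat′ 0<s

      0<M : 0ℚ < nat M
      0<M = subst (0ℚ <_) (≡.sym (nat-^ s exponent)) (0<^ exponent 0<s′)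

      size : ℚ
      size = nat (length is)

      0<size : 0ℚ < size
      0<size = 0<nat′ 0<is

      sum-const : ∀ {A : Set} (xs : List A) c → 𝔼.sum xs (λ _ → c) ≡ nat (length xs) * c
      sum-const []       c = ≡.sym (ℚ.*-zeroˡ c)
      sum-const (x ∷ xs) c = ≡.trans (cong (c ℚ.+_) (sum-const xs c)) (S.solve 2 (λ c n → c S.:+ n S.:* c S.:= (S.con 1ℚ S.:+ n) S.:* c) refl c (nat (length xs)))

      uniform : Measure
      uniform = record { Ω = I ; points = is ; weight = λ _ → inv size ; 0≤weight = λ _ → 0≤inv (ℚ.<⇒≤ 0<size) }

      uniform-total : IsProbability uniform
      uniform-total = ≡.trans (𝔼.sum-cong is (λ _ _ → ℚ.*-identityʳ (inv size)))
        (≡.trans (sum-const is (inv size)) (*-inv (<⇒≢0 0<size)))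

      X₀ : RandomVariable
      X₀ = record { measure = uniform ; isProbability = uniform-total ; value = ξ }

      H₀ : 𝕃
      H₀ = H uniform ξ

      H₀≤ : H₀ ≤ log size
      H₀≤ = subst (λ k → H₀ ≤ log (nat k)) (length-map ξ is)
        (maximum-entropy uniform uniform-total ξ (map ξ is) (λ x → ∈-map⁺ ξ (∈is x)))

      H₀≥ : log size ≤ H₀
      H₀≥ = ≤-trans (≈⇒≥ (ScalarExpectation.E-const 𝕃-semimodule uniform uniform-total (log size)))
        (Eᴸ-mono uniform (λ x x∈ → ≤-trans (≈⇒≤ (A.trans (equal-sound v₀ (:- (:- v₀)) (log size ∷ []) refl) (A.⁻¹-cong (A.sym (log-inv 0<size)))))
          (linear (log (inv size) ∷ log (prob uniform ξ (ξ x)) ∷ []) 0 (:- v₀ :≤ :- v₁) ((1 , v₁ :≤ v₀) ∷ []) refl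
            (log-mono (0<prob uniform ξ x∈) (atom-bound x) ∷ []))))
        where
        open ℚ.≤-Reasoning
        atom-bound : ∀ x → prob uniform ξ (ξ x) ℚ.≤ inv size
        atom-bound x = begin
          E uniform (λ y → indicator (ξ y ≟ ξ x))
            ≤⟨ E-mono uniform (λ y _ → indicator-mono (ξ y ≟ ξ x) (x ≟ y) (λ eq → ≡.sym (ξ-injective eq))) ⟩
          E uniform (λ y → indicator (x ≟ y))
            ≡⟨ 𝔼.sum-· is {inv size} (0≤inv (ℚ.<⇒≤ 0<size)) (λ y → indicator (x ≟ y)) ⟩
          inv size * 𝔼.sum is (λ y → indicator (x ≟ y))
            ≡⟨ cong (inv size *_) (once-I x) ⟩
          inv size * 1ℚ
            ≡⟨ ℚ.*-identityʳ (inv size) ⟩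
          inv size ∎

      H-add : H (uniform ⊗ᵐ uniform) (add ξ ξ) ≤ log size + log (nat s)
      H-add = ≤-trans (maximum-entropy (uniform ⊗ᵐ uniform) (⊗-isProbability {uniform} {uniform} uniform-total uniform-total)
          (add ξ ξ) sumset (λ (i , j) → ∈sumset i j))
        (≈⇒≤ (A.trans (A.reflexive (cong log (≡.trans (cong nat length-sumset) (nat-* (length is) s)))) (log-* 0<size 0<s′)))

      -- The uniform variable has entropy log size and the sum at most log size + log s, so the
      -- doubled distance is at most 2 log s.
      2257d≤ : 2257 ⊗ d X₀ X₀ ≤ log (nat M)
      2257d≤ = ≤-trans
        (linear (d X₀ X₀ ∷ log (nat s) ∷ []) 0 (2257 :* v₀ :≤ 4514 :* v₁) ((2257 , v₀ :≤ v₁ :+ v₁) ∷ []) refl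
          (linear (H (uniform ⊗ᵐ uniform) (add ξ ξ) ∷ H₀ ∷ log size ∷ log (nat s) ∷ []) 0 (v₀ :+ v₀ :- v₁ :- v₁ :≤ v₃ :+ v₃)
            ((2 , v₀ :≤ v₂ :+ v₃) ∷ (2 , v₂ :≤ v₁) ∷ []) refl (H-add ∷ H₀≥ ∷ []) ∷ []))
        (≈⇒≤ (A.trans (A.reflexive (cong (_⊗ log (nat s)) (≡.sym exponent-≡)))
          (A.trans (A.sym (log-^ X₀ 0<s′ exponent)) (A.reflexive (cong log (≡.sym (nat-^ s exponent)))))))

      module C = Concentration X₀ {nat M} {size} 0<M 0<size H₀≤ 2257d≤

      v : G
      v = proj₁ C.coset

      𝒳 : List I
      𝒳 = filter (λ i → C.B? (v ⊕ ξ i)) is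

      𝒳-large : length is ℕ.≤ 16 ℕ.* (M ℕ.* length 𝒳)
      𝒳-large = nat-cancel (begin
        size
          ≡⟨ ℚ.*-identityʳ size ⟨
        size * 1ℚ
          ≤⟨ *-monoˡ size (ℚ.<⇒≤ 0<size) (proj₂ C.coset) ⟩
        size * (16ℚ * (nat M * E uniform (λ x → indicator (C.B? (v ⊕ ξ x)))))
          ≡⟨ cong (λ t → size * (16ℚ * (nat M * t))) mass ⟩
        size * (16ℚ * (nat M * (inv size * nat (length 𝒳))))
          ≡⟨ S.solve 4 (λ z m i x → z S.:* (S.con 16ℚ S.:* (m S.:* (i S.:* x)))
               S.:= (z S.:* i) S.:* (S.con 16ℚ S.:* (m S.:* x))) refl size (nat M) (inv size) (nat (length 𝒳)) ⟩
        (size * inv size) * (16ℚ * (nat M * nat (length 𝒳)))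
          ≡⟨ cong (_* (16ℚ * (nat M * nat (length 𝒳)))) (*-inv (<⇒≢0 0<size)) ⟩
        1ℚ * (16ℚ * (nat M * nat (length 𝒳)))
          ≡⟨ ℚ.*-identityˡ (16ℚ * (nat M * nat (length 𝒳))) ⟩
        16ℚ * (nat M * nat (length 𝒳))
          ≡⟨ cong (16ℚ *_) (nat-* M (length 𝒳)) ⟨
        nat 16 * nat (M ℕ.* length 𝒳)
          ≡⟨ nat-* 16 (M ℕ.* length 𝒳) ⟨
        nat (16 ℕ.* (M ℕ.* length 𝒳)) ∎)
        where
        open ℚ.≤-Reasoning
        mass : E uniform (λ x → indicator (C.B? (v ⊕ ξ x))) ≡ inv size * nat (length 𝒳)
        mass = ≡.trans (𝔼.sum-· is {inv size} (0≤inv (ℚ.<⇒≤ 0<size)) (λ x → indicator (C.B? (v ⊕ ξ x))))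
          (cong (inv size *_) (sum-indicator (λ x → C.B? (v ⊕ ξ x)) is))

      ℬ : List G
      ℬ = filter C.B? elements

      ℬ-small : length ℬ ℕ.≤ length is ℕ.* M ℕ.* 2
      ℬ-small = nat-cancel (subst₂ ℚ._≤_ n≡ (≡.sym (≡.trans (nat-* (length is ℕ.* M) 2) (cong (_* nat 2) (nat-* (length is) M))))
        C.n-bound)
        where
        n≡ : C.n ≡ nat (length ℬ)
        n≡ = ≡.trans (𝔼.sum-cong elements (λ g _ → ℚ.*-identityˡ (indicator (C.B? g)))) (sum-indicator C.B? elements)

    coset : Coset is ξ M
    coset = record { B = C.B ; B? = C.B? ; g₀ = C.g₀ ; B-closed = C.B-closed ; v = v ; many = 𝒳-large ; few = ℬ-small }

-- Vector spaces over the two-element field, linear sections and the double counting.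

module Cubes where

  open import Data.List.Base as List using (List; []; _∷_; _++_; length; cartesianProduct; filter; deduplicate)
  open import Data.List.Membership.Propositional using (_∈_)
  open import Data.List.Membership.Propositional.Properties
  open import Data.List.Properties using (length-++; length-map; length-++-sucʳ)
  open import Data.List.Relation.Unary.All as All using (All)
  open import Data.List.Relation.Unary.AllPairs using ([]; _∷_)
  open import Data.List.Relation.Unary.Any as Any using (Any; here; there)
  open import Data.List.Relation.Unary.Any.Properties using (++⁻; ++⁺ˡ; ++⁺ʳ)
  open import Data.List.Relation.Unary.Unique.Propositional using (Unique)
  import Data.List.Relation.Unary.Unique.Propositional.Properties as Unique
  import Data.List.Relation.Unary.Unique.DecPropositional.Properties as UniqueDec
  open import Data.Nat.Base as ℕ using (ℕ; zero; suc)
  open import Data.Parity.Base using (Parity; 0ℙ; 1ℙ)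
  import Data.Parity.Properties as ℙ
  open import Data.Product.Base using (∃-syntax; Σ-syntax; _×_; _,_; proj₁; proj₂)
  open import Data.Rational.Base as ℚ using (ℚ; 0ℚ; 1ℚ; _*_)
  import Data.Rational.Properties as ℚ
  open import Data.Sum.Base using (inj₁; inj₂)
  open import Data.Vec.Base using ([]; _∷_; replicate)
  open import Data.Vec.Properties using (≡-dec; zipWith-assoc; zipWith-comm; zipWith-identityˡ; ∷-injectiveˡ; ∷-injectiveʳ)
  open import Function.Base using (_∘_)
  open import Relation.Binary.PropositionalEquality as ≡ using (_≡_; _≢_; refl; cong; cong₂; subst; subst₂)
  open import Relation.Nullary using (Dec; yes; no; contradiction)
  open import Defs hiding (fromℕ)
  open BooleanGroups
  open Expectations using (module 𝔼)
  open Entropy using (DecEq; _≟_; indicator; indicator-cong; indicator-no; indicator-pair; ×-decEq)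

  instance
    vector-decEq : ∀ {n} → DecEq (F₂^ n)
    vector-decEq = record { _≟_ = ≡-dec ℙ._≟_ }

  𝟘 : ∀ {n} → F₂^ n
  𝟘 = replicate _ 0ℙ

  vectors : ℕ → BooleanGroup
  vectors n = record
    { G          = F₂^ n
    ; decEq      = vector-decEq
    ; _⊕_        = _+ᵛ_
    ; 𝟎          = 𝟘
    ; ⊕-assoc    = zipWith-assoc ℙ.+-assoc
    ; ⊕-comm     = zipWith-comm ℙ.+-comm
    ; ⊕-identity = zipWith-identityˡ ℙ.+-identityˡ
    ; ⊕-self     = self
    }
    where
    self : ∀ {n} (x : F₂^ n) → x +ᵛ x ≡ 𝟘
    self []      = refl
    self (b ∷ x) = cong₂ _∷_ (ℙ.p+p≡0ℙ b) (self x)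

  _×ᵍ_ : BooleanGroup → BooleanGroup → BooleanGroup
  𝔾 ×ᵍ ℍ = record
    { G          = G.G × H.G
    ; decEq      = ×-decEq {{G.decEq}} {{H.decEq}}
    ; _⊕_        = λ (a , b) (c , d) → a G.⊕ c , b H.⊕ d
    ; 𝟎          = G.𝟎 , H.𝟎
    ; ⊕-assoc    = λ (a , b) (c , d) (e , f) → cong₂ _,_ (G.⊕-assoc a c e) (H.⊕-assoc b d f)
    ; ⊕-comm     = λ (a , b) (c , d) → cong₂ _,_ (G.⊕-comm a c) (H.⊕-comm b d)
    ; ⊕-identity = λ (a , b) → cong₂ _,_ (G.⊕-identity a) (H.⊕-identity b)
    ; ⊕-self     = λ (a , b) → cong₂ _,_ (G.⊕-self a) (H.⊕-self b)
    }
    where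
    module G = BooleanGroup 𝔾
    module H = BooleanGroup ℍ

  enumerate : ∀ n → List (F₂^ n)
  enumerate zero    = [] ∷ []
  enumerate (suc n) = List.map (0ℙ ∷_) (enumerate n) ++ List.map (1ℙ ∷_) (enumerate n)

  ∈-enumerate : ∀ {n} (v : F₂^ n) → v ∈ enumerate n
  ∈-enumerate []       = here refl
  ∈-enumerate (0ℙ ∷ v) = ++⁺ˡ (∈-map⁺ (0ℙ ∷_) (∈-enumerate v))
  ∈-enumerate (1ℙ ∷ v) = ++⁺ʳ (List.map (0ℙ ∷_) (enumerate _)) (∈-map⁺ (1ℙ ∷_) (∈-enumerate v))

  unique-enumerate : ∀ n → Unique (enumerate n)
  unique-enumerate zero    = All.[] ∷ []
  unique-enumerate (suc n) = Unique.++⁺ (Unique.map⁺ ∷-injectiveʳ (unique-enumerate n)) (Unique.map⁺ ∷-injectiveʳ (unique-enumerate n))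
    (λ (p , q) → disjoint (∈-map⁻ (0ℙ ∷_) p) (∈-map⁻ (1ℙ ∷_) q))
    where
    disjoint : ∀ {v : F₂^ (suc n)} → (∃[ x ] x ∈ enumerate n × v ≡ 0ℙ ∷ x) → (∃[ x ] x ∈ enumerate n × v ≡ 1ℙ ∷ x) → _
    disjoint (_ , _ , refl) (_ , _ , ())

  enumerate-once : ∀ {n} (v : F₂^ n) → 𝔼.sum (enumerate n) (λ g → indicator (v ≟ g)) ≡ 1ℚ
  enumerate-once []      = refl
  enumerate-once {suc n} (b ∷ v) = ≡.trans (𝔼.sum-++ (List.map (0ℙ ∷_) (enumerate n)) (List.map (1ℙ ∷_) (enumerate n)) _)
    (≡.trans (cong₂ ℚ._+_ (𝔼.sum-map (0ℙ ∷_) (enumerate n) _) (𝔼.sum-map (1ℙ ∷_) (enumerate n) _)) (cases b))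
    where
    same : ∀ b → 𝔼.sum (enumerate n) (λ g → indicator ((b ∷ v) ≟ (b ∷ g))) ≡ 1ℚ
    same b = ≡.trans (𝔼.sum-cong (enumerate n) (λ g _ → indicator-cong ((b ∷ v) ≟ (b ∷ g)) (v ≟ g) ∷-injectiveʳ (cong (b ∷_)))) (enumerate-once v)
    different : ∀ b c → b ≢ c → 𝔼.sum (enumerate n) (λ g → indicator ((b ∷ v) ≟ (c ∷ g))) ≡ 0ℚ
    different b c b≢c = ≡.trans (𝔼.sum-cong (enumerate n) (λ g _ → indicator-no ((b ∷ v) ≟ (c ∷ g)) (b≢c ∘ ∷-injectiveˡ))) (𝔼.sum-zero (enumerate n))
    cases : ∀ b → 𝔼.sum (enumerate n) (λ g → indicator ((b ∷ v) ≟ (0ℙ ∷ g))) ℚ.+ 𝔼.sum (enumerate n) (λ g → indicator ((b ∷ v) ≟ (1ℙ ∷ g))) ≡ 1ℚ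
    cases 0ℙ = ≡.trans (cong₂ ℚ._+_ (same 0ℙ) (different 0ℙ 1ℙ λ ())) (ℚ.+-identityʳ 1ℚ)
    cases 1ℙ = ≡.trans (cong₂ ℚ._+_ (different 1ℙ 0ℙ λ ()) (same 1ℙ)) (ℚ.+-identityˡ 1ℚ)

  pairs : ∀ m n → List (F₂^ m × F₂^ n)
  pairs m n = cartesianProduct (enumerate m) (enumerate n)

  ∈-pairs : ∀ {m n} (g : F₂^ m × F₂^ n) → g ∈ pairs m n
  ∈-pairs (u , v) = ∈-cartesianProduct⁺ (∈-enumerate u) (∈-enumerate v)

  pairs-once : ∀ {m n} (g : F₂^ m × F₂^ n) → 𝔼.sum (pairs m n) (λ h → indicator (g ≟ h)) ≡ 1ℚ
  pairs-once {m} {n} (u , v) = begin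
    𝔼.sum (pairs m n) (λ h → indicator ((u , v) ≟ h))
      ≡⟨ 𝔼.sum-product (enumerate m) (enumerate n) _ ⟩
    𝔼.sum (enumerate m) (λ a → 𝔼.sum (enumerate n) (λ b → indicator ((u , v) ≟ (a , b))))
      ≡⟨ 𝔼.sum-cong (enumerate m) (λ a _ → ≡.trans (𝔼.sum-cong (enumerate n) (λ b _ → indicator-pair u a v b))
           (𝔼.sum-· (enumerate n) {indicator (u ≟ a)} (Entropy.0≤indicator (u ≟ a)) _)) ⟩
    𝔼.sum (enumerate m) (λ a → indicator (u ≟ a) * 𝔼.sum (enumerate n) (λ b → indicator (v ≟ b)))
      ≡⟨ 𝔼.sum-cong (enumerate m) (λ a _ → ≡.trans (cong (indicator (u ≟ a) *_) (enumerate-once v)) (ℚ.*-identityʳ (indicator (u ≟ a)))) ⟩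
    𝔼.sum (enumerate m) (λ a → indicator (u ≟ a))
      ≡⟨ enumerate-once u ⟩
    1ℚ ∎
    where open ≡.≡-Reasoning

  length-cartesianProduct : ∀ {A B : Set} (xs : List A) (ys : List B) → length (cartesianProduct xs ys) ≡ length xs ℕ.* length ys
  length-cartesianProduct []       ys = refl
  length-cartesianProduct (x ∷ xs) ys = ≡.trans (length-++ (List.map (x ,_) ys)) (cong₂ ℕ._+_ (length-map (x ,_) ys) (length-cartesianProduct xs ys))

  unique-⊆-length : ∀ {A : Set} {xs ys : List A} → Unique xs → (∀ {z} → z ∈ xs → z ∈ ys) → length xs ℕ.≤ length ys
  unique-⊆-length {xs = []} _ _ = ℕ.z≤n
  unique-⊆-length {xs = x ∷ xs} {ys} (x∉ ∷ u) ⊆ys with ∈-∃++ (⊆ys (here refl))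
  ... | as , bs , refl = subst (suc (length xs) ℕ.≤_) (≡.sym (length-++-sucʳ as x bs)) (ℕ.s≤s (unique-⊆-length u sub))
    where
    sub : ∀ {z} → z ∈ xs → z ∈ as ++ bs
    sub {z} z∈ with ++⁻ as (⊆ys (there z∈))
    ... | inj₁ p          = ++⁺ˡ p
    ... | inj₂ (here refl) = contradiction refl (All.lookup x∉ z∈)
    ... | inj₂ (there p)  = ++⁺ʳ as p

  injection-length : ∀ {A B : Set} {xs : List A} {ys : List B} (f : A → B) → Unique xs → (∀ {z} → z ∈ xs → f z ∈ ys) →
    (∀ {y z} → y ∈ xs → z ∈ xs → f y ≡ f z → y ≡ z) → length xs ℕ.≤ length ys
  injection-length {xs = xs} {ys} f u into inj = subst (ℕ._≤ length ys) (length-map f xs)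
    (unique-⊆-length (unique-map xs u inj) (λ w∈ → let z , z∈ , eq = ∈-map⁻ f w∈ in subst (_∈ ys) (≡.sym eq) (into z∈)))
    where
    unique-map : ∀ xs → Unique xs → (∀ {y z} → y ∈ xs → z ∈ xs → f y ≡ f z → y ≡ z) → Unique (List.map f xs)
    unique-map []       _        _   = []
    unique-map (x ∷ xs) (x∉ ∷ u) inj = All.tabulate (λ {w} w∈ eq → let z , z∈ , eq′ = ∈-map⁻ f w∈ in
      All.lookup x∉ z∈ (inj (here refl) (there z∈) (≡.trans eq eq′))) ∷ unique-map xs u (λ p q → inj (there p) (there q))

  Additive : ∀ {m n} → (F₂^ m → F₂^ n) → Set
  Additive g = ∀ x y → g (x +ᵛ y) ≡ g x +ᵛ g y

  scale : ∀ {n} → Parity → F₂^ n → F₂^ n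
  scale 0ℙ v = 𝟘
  scale 1ℙ v = v

  module V {n} = XorSolver (vectors n)

  scale-+ : ∀ {n} b c (v : F₂^ n) → scale (b F₂.+ c) v ≡ scale b v +ᵛ scale c v
  scale-+ 0ℙ c  v = ≡.sym (BooleanGroup.⊕-identity (vectors _) _)
  scale-+ 1ℙ 0ℙ v = ≡.sym (V.⊕-identityʳ v)
  scale-+ 1ℙ 1ℙ v = ≡.sym (BooleanGroup.⊕-self (vectors _) v)

  -- A linear choice of a point in each inhabited fibre of H. Elements with leading bit 0 are left
  -- to the recursion; one element (1 ∷ u₁ , y₁), if there is any, prescribes y₁ + g u₁ as the image
  -- of the first basis vector, and otherwise that vector is sent to 0.
  section : ∀ m {n} (H : F₂^ m × F₂^ n → Set) → (∀ g → Dec (H g)) →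
    (∀ {u v x y} → H (u , x) → H (v , y) → H (u +ᵛ v , x +ᵛ y)) →
    Σ[ g ∈ (F₂^ m → F₂^ n) ] Additive g × (∀ u y → H (u , y) → H (u , g u))
  section zero {n} H H? closed = (λ _ → 𝟘) , (λ _ _ → ≡.sym (BooleanGroup.⊕-self (vectors n) 𝟘)) ,
    λ { [] y h → subst (λ z → H ([] , z)) (BooleanGroup.⊕-self (vectors n) y) (closed h h) }
  section (suc m) {n} H H? closed with section m (λ (u , y) → H (0ℙ ∷ u , y)) (λ (u , y) → H? (0ℙ ∷ u , y)) closed
    | Any.any? (λ (u , y) → H? (1ℙ ∷ u , y)) (pairs m n)
  ... | g , additive , g∈ | no none = (λ { (_ ∷ u) → g u }) , (λ { (_ ∷ u) (_ ∷ v) → additive u v }) ,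
    λ { (0ℙ ∷ u) y h → g∈ u y h ; (1ℙ ∷ u) y h → contradiction (lose (∈-pairs (u , y)) h) none }
    where
    lose : ∀ {z zs} {P : F₂^ m × F₂^ n → Set} → z ∈ zs → P z → Any P zs
    lose z∈ p = Any.map (λ { refl → p }) z∈
  ... | g , additive , g∈ | yes some with Any.satisfied some
  ...   | (u₁ , y₁) , h₁ = g′ , additive′ , g′∈
    where
    c : F₂^ n
    c = y₁ +ᵛ g u₁
    g′ : F₂^ (suc m) → F₂^ n
    g′ (b ∷ u) = g u +ᵛ scale b c
    additive′ : Additive g′
    additive′ (b ∷ u) (d ∷ v) = ≡.trans (cong₂ _+ᵛ_ (additive u v) (scale-+ b d c))
      (V.xor-solve ((x₀ :⊕ x₁) :⊕ (x₂ :⊕ x₃)) ((x₀ :⊕ x₂) :⊕ (x₁ :⊕ x₃)) (g u ∷ g v ∷ scale b c ∷ scale d c ∷ []) refl)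
    g′∈ : ∀ u y → H (u , y) → H (u , g′ u)
    g′∈ (0ℙ ∷ u) y h = subst (λ z → H (0ℙ ∷ u , z)) (≡.sym (V.⊕-identityʳ (g u))) (g∈ u y h)
    -- Adding (1 ∷ u₁ , y₁) clears the leading bit; after the recursion it is added back.
    g′∈ (1ℙ ∷ u) y h = subst₂ (λ w z → H (1ℙ ∷ w , z))
      (V.xor-solve ((x₀ :⊕ x₁) :⊕ x₁) x₀ (u ∷ u₁ ∷ []) refl)
      (≡.trans (cong (_+ᵛ y₁) (additive u u₁)) (V.xor-solve ((x₀ :⊕ x₁) :⊕ x₂) (x₀ :⊕ (x₂ :⊕ x₁)) (g u ∷ g u₁ ∷ y₁ ∷ []) refl))
      (closed (g∈ (u +ᵛ u₁) (y +ᵛ y₁) (closed h h₁)) h₁)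

  -- With h = f + g and R the range of h, the map taking (z , x , x′) to
  -- (w , h u + h x + h w , (v + (x′ , f x′)) + (0 , h x + h x*)), where h u = z and
  -- w = u + x, is injective on R × X × X.
  module _ {m n : ℕ} (f : F₂^ m → F₂^ n) (S : List (F₂^ n)) (S∋ : ∀ x y → f x +ᵛ f y -ᵛ f (x +ᵛ y) ∈ S)
    (B : F₂^ m × F₂^ n → Set) (B? : ∀ g → Dec (B g)) (g₀ : F₂^ m × F₂^ n) (v : F₂^ m × F₂^ n) where

    private
      𝔾 = vectors m ×ᵍ vectors n
      open BooleanGroup 𝔾 using (_⊕_)
      open XorSolver 𝔾
      point : F₂^ m → F₂^ m × F₂^ n
      point x = v ⊕ (x , f x)

    X : List (F₂^ m)
    X = filter (λ x → B? (v ⊕ (x , f x))) (enumerate m)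

    module _ (B-closed : ∀ {a b} → B a → B b → B (g₀ ⊕ (a ⊕ b))) (x* : F₂^ m) (x*∈X : x* ∈ X) where

      private
        X-spec : ∀ {x} → x ∈ X → B (point x)
        X-spec x∈ = proj₂ (∈-filter⁻ (λ x → B? (v ⊕ (x , f x))) {xs = enumerate m} x∈)
        Subgroup : F₂^ m × F₂^ n → Set
        Subgroup a = B (g₀ ⊕ a)
        Subgroup-closed : ∀ {a b} → Subgroup a → Subgroup b → Subgroup (a ⊕ b)
        Subgroup-closed {a} {b} p q = subst (λ t → B (g₀ ⊕ t)) (xor-solve ((x₀ :⊕ x₁) :⊕ (x₀ :⊕ x₂)) (x₁ :⊕ x₂) (g₀ ∷ a ∷ b ∷ []) refl) (B-closed p q)
        B-translate : ∀ {a b} → B a → Subgroup b → B (a ⊕ b)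
        B-translate {a} {b} p q = subst B (xor-solve (x₀ :⊕ (x₁ :⊕ (x₀ :⊕ x₂))) (x₁ :⊕ x₂) (g₀ ∷ a ∷ b ∷ []) refl) (B-closed p q)
        sec = section m Subgroup (λ a → B? (g₀ ⊕ a)) Subgroup-closed

      g h : F₂^ m → F₂^ n
      g = proj₁ sec
      h x = f x +ᵛ g x

      additive : Additive g
      additive = proj₁ (proj₂ sec)

      range : List (F₂^ n)
      range = deduplicate _≟_ (List.map h (enumerate m))

      private
        -- Over x + x* the subgroup contains the difference of two points of the graph and also the
        -- point chosen by g; these two differ by (0 , h x + h x*).
        h-subgroup : ∀ {x} → x ∈ X → Subgroup (𝟘 , h x +ᵛ h x*)
        h-subgroup {x} x∈ = subst Subgroup (cong₂ _,_ (BooleanGroup.⊕-self (vectors m) (x +ᵛ x*))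
            (≡.trans (cong ((f x +ᵛ f x*) +ᵛ_) (additive x x*))
              (V.xor-solve ((x₀ :⊕ x₁) :⊕ (x₂ :⊕ x₃)) ((x₀ :⊕ x₂) :⊕ (x₁ :⊕ x₃)) (f x ∷ f x* ∷ g x ∷ g x* ∷ []) refl)))
          (Subgroup-closed difference (proj₂ (proj₂ sec) (x +ᵛ x*) (f x +ᵛ f x*) difference))
          where
          difference : Subgroup (x +ᵛ x* , f x +ᵛ f x*)
          difference = subst (λ t → B (g₀ ⊕ t)) (xor-solve ((x₀ :⊕ x₁) :⊕ (x₀ :⊕ x₂)) (x₁ :⊕ x₂) (v ∷ (x , f x) ∷ (x* , f x*) ∷ []) refl)
            (B-closed (X-spec x∈) (X-spec x*∈X))

        h-defect : ∀ x y → h x +ᵛ h y +ᵛ h (x +ᵛ y) ∈ S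
        h-defect x y = subst (_∈ S) (≡.sym (≡.trans (cong (λ t → h x +ᵛ h y +ᵛ (f (x +ᵛ y) +ᵛ t)) (additive x y))
          (V.xor-solve (((x₀ :⊕ x₁) :⊕ (x₂ :⊕ x₃)) :⊕ (x₄ :⊕ (x₁ :⊕ x₃))) ((x₀ :⊕ x₂) :⊕ x₄) (f x ∷ g x ∷ f y ∷ g y ∷ f (x +ᵛ y) ∷ []) refl)))
          (S∋ x y)

        preimage : (z : F₂^ n) → List (F₂^ m) → F₂^ m
        -- A default value, not reached for z in the range of h.
        preimage z []       = 𝟘
        preimage z (x ∷ xs) with h x ≟ z
        ... | yes _ = x
        ... | no  _ = preimage z xs

        h-preimage : ∀ z xs → z ∈ List.map h xs → h (preimage z xs) ≡ z
        h-preimage z (x ∷ xs) z∈ with h x ≟ z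
        ... | yes eq = eq
        h-preimage z (x ∷ xs) (here eq)  | no ≢ = contradiction (≡.sym eq) ≢
        h-preimage z (x ∷ xs) (there z∈) | no ≢ = h-preimage z xs z∈

        π : F₂^ n → F₂^ m
        π z = preimage z (enumerate m)

        hπ : ∀ {z} → z ∈ range → h (π z) ≡ z
        hπ {z} z∈ = h-preimage z (enumerate m) (∈-deduplicate⁻ _≟_ (List.map h (enumerate m)) z∈)

        encode : F₂^ n × (F₂^ m × F₂^ m) → F₂^ m × (F₂^ n × (F₂^ m × F₂^ n))
        encode (z , (x , x′)) = π z +ᵛ x , (h (π z) +ᵛ h x +ᵛ h (π z +ᵛ x) , point x′ ⊕ (𝟘 , h x +ᵛ h x*))

        source = cartesianProduct range (cartesianProduct X X)
        target = cartesianProduct (enumerate m) (cartesianProduct S (filter B? (pairs m n)))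

        unpack : ∀ {z x x′} → (z , (x , x′)) ∈ source → z ∈ range × x ∈ X × x′ ∈ X
        unpack p = let a , b = ∈-cartesianProduct⁻ range (cartesianProduct X X) p ; c , d = ∈-cartesianProduct⁻ X X b in a , c , d

        encode-∈ : ∀ {t} → t ∈ source → encode t ∈ target
        encode-∈ {z , (x , x′)} p = let z∈ , x∈ , x′∈ = unpack p in
          ∈-cartesianProduct⁺ (∈-enumerate (π z +ᵛ x)) (∈-cartesianProduct⁺ (h-defect (π z) x)
            (∈-filter⁺ B? (∈-pairs _) (B-translate (X-spec x′∈) (h-subgroup x∈))))

        -- The first half of the pair (a , b) reveals x′, and then the second half reveals h x. The
        -- defect s gives z from h x and h w, and finally x = w + π z.
        decode : F₂^ m × (F₂^ n × (F₂^ m × F₂^ n)) → F₂^ n × (F₂^ m × F₂^ m)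
        decode (w , (s , (a , b))) = z , (w +ᵛ π z , x′)
          where
          x′ = proj₁ v +ᵛ a
          hx = (proj₂ v +ᵛ f x′) +ᵛ (b +ᵛ h x*)
          z  = s +ᵛ (hx +ᵛ h w)

        decode-encode : ∀ {t} → t ∈ source → decode (encode t) ≡ t
        decode-encode {z , (x , x′)} p = cong₂ _,_ z≡ (cong₂ _,_ x≡ x′≡)
          where
          z∈ = proj₁ (unpack p)
          a = proj₁ (proj₂ (proj₂ (encode (z , (x , x′)))))
          b = proj₂ (proj₂ (proj₂ (encode (z , (x , x′)))))
          x′≡ : proj₁ v +ᵛ a ≡ x′
          x′≡ = V.xor-solve (x₀ :⊕ ((x₀ :⊕ x₁) :⊕ :𝟎)) x₁ (proj₁ v ∷ x′ ∷ []) refl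
          hx≡ : (proj₂ v +ᵛ f (proj₁ v +ᵛ a)) +ᵛ (b +ᵛ h x*) ≡ h x
          hx≡ = ≡.trans (cong (λ t → (proj₂ v +ᵛ f t) +ᵛ (b +ᵛ h x*)) x′≡)
            (V.xor-solve ((x₀ :⊕ x₁) :⊕ (((x₀ :⊕ x₁) :⊕ (x₂ :⊕ x₃)) :⊕ x₃)) x₂ (proj₂ v ∷ f x′ ∷ h x ∷ h x* ∷ []) refl)
          z≡ : proj₁ (decode (encode (z , (x , x′)))) ≡ z
          z≡ = ≡.trans (cong (λ t → (h (π z) +ᵛ h x +ᵛ h (π z +ᵛ x)) +ᵛ (t +ᵛ h (π z +ᵛ x))) hx≡)
            (≡.trans (V.xor-solve (((x₀ :⊕ x₁) :⊕ x₂) :⊕ (x₁ :⊕ x₂)) x₀ (h (π z) ∷ h x ∷ h (π z +ᵛ x) ∷ []) refl) (hπ z∈))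
          x≡ : (π z +ᵛ x) +ᵛ π (proj₁ (decode (encode (z , (x , x′))))) ≡ x
          x≡ = ≡.trans (cong (λ t → (π z +ᵛ x) +ᵛ π t) z≡) (V.xor-solve ((x₀ :⊕ x₁) :⊕ x₀) x₁ (π z ∷ x ∷ []) refl)

      range-bound : length range ℕ.* (length X ℕ.* length X) ℕ.≤ length (enumerate m) ℕ.* (length S ℕ.* length (filter B? (pairs m n)))
      range-bound = subst₂ ℕ._≤_
        (≡.trans (length-cartesianProduct range (cartesianProduct X X)) (cong (length range ℕ.*_) (length-cartesianProduct X X)))
        (≡.trans (length-cartesianProduct (enumerate m) _) (cong (length (enumerate m) ℕ.*_) (length-cartesianProduct S _)))
        (injection-length {ys = target} encode
          (Unique.cartesianProduct⁺ (UniqueDec.deduplicate-! _≟_ (List.map h (enumerate m)))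
            (Unique.cartesianProduct⁺ unique-X unique-X))
          encode-∈ (λ p q eq → ≡.trans (≡.sym (decode-encode p)) (≡.trans (cong decode eq) (decode-encode q))))
        where
        unique-X : Unique X
        unique-X = Unique.filter⁺ (λ x → B? (v ⊕ (x , f x))) (unique-enumerate m)

-- From a coset near the graph to a linear approximation.

module GraphApproximation where

  open import Data.List.Base using (List; []; _∷_; length; filter; cartesianProduct; map)
  open import Data.List.Membership.Propositional using (_∈_)
  open import Data.List.Membership.Propositional.Properties
  open import Data.List.Properties using (length-map)
  open import Data.List.Relation.Unary.Any using (here)
  open import Data.List.Relation.Unary.Unique.Propositional using (Unique)
  import Data.List.Relation.Unary.Unique.DecPropositional.Properties as UniqueDec
  open import Data.Nat.Base as ℕ using (ℕ; zero; suc)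
  import Data.Nat.Properties as ℕ
  import Data.Nat.Solver
  open import Data.Product.Base using (∃-syntax; Σ-syntax; _×_; _,_; proj₁; proj₂)
  open import Data.Vec.Base using ([]; _∷_)
  open import Function.Bundles using (_⇔_; mk⇔)
  open import Relation.Binary.PropositionalEquality as ≡ using (_≡_; refl; cong; subst)
  open import Relation.Nullary using (contradiction)
  open import Defs using (F₂^; _+ᵛ_; _-ᵛ_)
  open BooleanGroups
  open Entropy using (_≟_)
  open Cubes hiding (X; h; g; additive; range; range-bound)
  open Exponent
  open Cosets using (module Coset; Coset; module Approximation)

  module NS = Data.Nat.Solver.+-*-Solver

  ∈⇒0<length : ∀ {A : Set} {x : A} {xs} → x ∈ xs → 0 ℕ.< length xs
  ∈⇒0<length {xs = _ ∷ _} _ = ℕ.s≤s ℕ.z≤n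

  0<length⇒∈ : ∀ {A : Set} (xs : List A) → 0 ℕ.< length xs → ∃[ x ] x ∈ xs
  0<length⇒∈ (x ∷ xs) _ = x , here refl

  module _ {m n : ℕ} (f : F₂^ m → F₂^ n) (S : List (F₂^ n)) (S∋ : ∀ x y → f x +ᵛ f y -ᵛ f (x +ᵛ y) ∈ S) where

    record LinearApproximation (bound : ℕ) : Set where
      field
        linear-part    : F₂^ m → F₂^ n
        additive       : Additive linear-part
        range          : List (F₂^ n)
        range-unique   : Unique range
        ∈range         : ∀ z → z ∈ range ⇔ (Σ[ x ∈ F₂^ m ] z ≡ f x +ᵛ linear-part x)
        range-bound    : length range ℕ.≤ bound

    module _ {M : ℕ} (C : Coset (vectors m ×ᵍ vectors n) (pairs m n) pairs-once (enumerate m) (λ x → x , f x) M) where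
      open Coset C

      private
        s : ℕ
        s = length S

        𝒳 : List (F₂^ m)
        𝒳 = Cubes.X f S S∋ B B? g₀ v

        0<𝒳 : 0 ℕ.< length 𝒳
        0<𝒳 = helper (length 𝒳) many
          where
          helper : ∀ l → length (enumerate m) ℕ.≤ 16 ℕ.* (M ℕ.* l) → 0 ℕ.< l
          helper (suc l) _ = ℕ.s≤s ℕ.z≤n
          helper zero    h = contradiction (ℕ.<-≤-trans (∈⇒0<length (∈-enumerate (𝟘 {m})))
            (ℕ.≤-trans h (ℕ.≤-reflexive (≡.trans (cong (16 ℕ.*_) (ℕ.*-zeroʳ M)) (ℕ.*-zeroʳ 16))))) λ ()

        x* = 0<length⇒∈ 𝒳 0<𝒳

        h : F₂^ m → F₂^ n
        h = Cubes.h f S S∋ B B? g₀ v B-closed (proj₁ x*) (proj₂ x*)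

        -- 512 = 16 · 16 · 2: bounding b brings in a second q, and both are at most 16 M x, so that
        -- x² cancels.
        arithmetic : ∀ r x q b → 0 ℕ.< x → r ℕ.* (x ℕ.* x) ℕ.≤ q ℕ.* (s ℕ.* b) → q ℕ.≤ 16 ℕ.* (M ℕ.* x) → b ℕ.≤ q ℕ.* M ℕ.* 2 →
          r ℕ.≤ 512 ℕ.* (s ℕ.* (M ℕ.* (M ℕ.* M)))
        arithmetic r x@(suc _) q b _ h₁ h₂ h₃ = ℕ.*-cancelʳ-≤ r (512 ℕ.* (s ℕ.* (M ℕ.* (M ℕ.* M)))) (x ℕ.* x) (begin
          r ℕ.* (x ℕ.* x)
            ≤⟨ h₁ ⟩
          q ℕ.* (s ℕ.* b)
            ≤⟨ ℕ.*-monoʳ-≤ q (ℕ.*-monoʳ-≤ s h₃) ⟩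
          q ℕ.* (s ℕ.* (q ℕ.* M ℕ.* 2))
            ≤⟨ ℕ.*-mono-≤ h₂ (ℕ.*-monoʳ-≤ s (ℕ.*-monoˡ-≤ 2 (ℕ.*-monoˡ-≤ M h₂))) ⟩
          16 ℕ.* (M ℕ.* x) ℕ.* (s ℕ.* (16 ℕ.* (M ℕ.* x) ℕ.* M ℕ.* 2))
            ≡⟨ NS.solve 3 (λ M x s → NS.con 16 NS.:* (M NS.:* x) NS.:* (s NS.:* (NS.con 16 NS.:* (M NS.:* x) NS.:* M NS.:* NS.con 2))
                 NS.:= (NS.con 512 NS.:* (s NS.:* (M NS.:* (M NS.:* M)))) NS.:* (x NS.:* x)) refl M x s ⟩
          512 ℕ.* (s ℕ.* (M ℕ.* (M ℕ.* M))) ℕ.* (x ℕ.* x) ∎)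
          where open ℕ.≤-Reasoning

      approximation : LinearApproximation (512 ℕ.* (length S ℕ.* (M ℕ.* (M ℕ.* M))))
      approximation = record
        { linear-part  = Cubes.g f S S∋ B B? g₀ v B-closed (proj₁ x*) (proj₂ x*)
        ; additive     = Cubes.additive f S S∋ B B? g₀ v B-closed (proj₁ x*) (proj₂ x*)
        ; range        = Cubes.range f S S∋ B B? g₀ v B-closed (proj₁ x*) (proj₂ x*)
        ; range-unique = UniqueDec.deduplicate-! _≟_ (map h (enumerate m))
        ; ∈range       = λ z → mk⇔
            (λ z∈ → let x , _ , eq = ∈-map⁻ h (∈-deduplicate⁻ _≟_ (map h (enumerate m)) z∈) in x , eq)
            (λ { (x , refl) → ∈-deduplicate⁺ _≟_ (∈-map⁺ h (∈-enumerate x)) })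
        ; range-bound  = arithmetic _ (length 𝒳) (length (enumerate m)) (length (filter B? (pairs m n))) 0<𝒳
            (Cubes.range-bound f S S∋ B B? g₀ v B-closed (proj₁ x*) (proj₂ x*)) many few
        }

    -- Sums of two points of the graph lie over z = x + y, at height f z plus a defect in S.
    sumset : List (F₂^ m × F₂^ n)
    sumset = map (λ (z , t) → z , t +ᵛ f z) (cartesianProduct (enumerate m) S)

    ∈-sumset : ∀ x y → (x +ᵛ y , f x +ᵛ f y) ∈ sumset
    ∈-sumset x y = subst (_∈ sumset)
      (cong (x +ᵛ y ,_) (V.xor-solve (((x₀ :⊕ x₁) :⊕ x₂) :⊕ x₂) (x₀ :⊕ x₁) (f x ∷ f y ∷ f (x +ᵛ y) ∷ []) refl))
      (∈-map⁺ (λ (z , t) → z , t +ᵛ f z) (∈-cartesianProduct⁺ (∈-enumerate (x +ᵛ y)) (S∋ x y)))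

    length-sumset : length sumset ≡ length (enumerate m) ℕ.* length S
    length-sumset = ≡.trans (length-map _ (cartesianProduct (enumerate m) S)) (length-cartesianProduct (enumerate m) S)

    graph-coset : Coset (vectors m ×ᵍ vectors n) (pairs m n) pairs-once (enumerate m) (λ x → x , f x) (length S ℕ.^ exponent)
    graph-coset = Approximation.coset (vectors m ×ᵍ vectors n) (pairs m n) pairs-once
      (enumerate m) ∈-enumerate enumerate-once (∈⇒0<length (∈-enumerate (𝟘 {m}))) (λ x → x , f x) (cong proj₁)
      sumset ∈-sumset (length S) (∈⇒0<length (S∋ 𝟘 𝟘)) length-sumset

-- Transfer of the bound to real powers.

module RealBounds where

  import Data.Integer.Base as ℤ
  open import Data.Nat.Base as ℕ using (ℕ; suc)
  import Data.Nat.Properties as ℕ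
  open import Data.Product.Base using (_,_)
  open import Data.Rational.Base as ℚ using (ℚ; 0ℚ; 1ℚ; ½; _*_; _<_)
  import Data.Rational.Properties as ℚ
  import Data.Rational.Unnormalised.Properties as ℚᵘ
  open import Data.Rational.Unnormalised.Base using (mkℚᵘ)
  import Data.Rational.Solver as ℚ
  open import Data.Sum.Base using (inj₂)
  open import Relation.Binary.PropositionalEquality as ≡ using (_≡_; refl; cong; subst; subst₂)
  open import Defs
  open RationalLemmas
  open LogarithmModel using (toℚᵘ-nat)

  module QS = ℚ.+-*-Solver

  fraction≡nat : ∀ n → (ℤ.+ n) ℚ./ 1 ≡ nat n
  fraction≡nat n = ℚ.toℚᵘ-injective (ℚᵘ.≃-trans (ℚ.toℚᵘ-fromℚᵘ (mkℚᵘ (ℤ.+ n) 0)) (ℚᵘ.≃-sym (toℚᵘ-nat n)))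

  fraction-< : ∀ n → (ℤ.+ n) ℚ./ 1 < (ℤ.+ suc n) ℚ./ 1
  fraction-< n = subst₂ _<_ (≡.sym (fraction≡nat n)) (≡.sym (fraction≡nat (suc n)))
    (subst (_< 1ℚ ℚ.+ nat n) (ℚ.+-identityˡ (nat n)) (ℚ.+-monoˡ-< (nat n) 0<1))

  fromℕ-positive : ∀ n → Positive (fromℕ (suc n))
  fromℕ-positive n = subst (0ℚ <_) (≡.sym (fraction≡nat (suc n))) (0<nat n)

  -- Below s = fromℕ s ≤ K the point k = s / 2 witnesses the lower bound
  -- s ^ c / 2 ^ (c + 1) of K ^ (c + 1), whether k ≤ 1 or not.
  module _ (c A : ℕ) (K : ℝ) (s N : ℕ) (0<s : 0 ℕ.< s) (s≤K : fromℕ s ≤ᴿ K) (N≤ : N ℕ.≤ A ℕ.* s ℕ.^ c) where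

    private
      σ k t a b : ℚ
      σ = nat s
      k = σ * ½
      t = σ ^ c * ½ ^ suc c
      b = t * ½
      factor : ℕ
      -- The power of 2 undoes the c + 1 halvings in t and the further one in b.
      factor = A ℕ.* 2 ℕ.^ suc (suc c)
      a = nat factor

      1≤σ : 1ℚ ℚ.≤ σ
      1≤σ = subst (ℚ._≤ σ) (ℚ.+-identityʳ 1ℚ) (nat-mono 0<s)
      0<σ : 0ℚ < σ
      0<σ = ℚ.<-≤-trans 0<1 1≤σ
      0<½ : 0ℚ < ½
      0<½ = ℚ.positive⁻¹ ½
      ½<1 : ½ < 1ℚ
      ½<1 = ℚ.*<* (ℤ.+<+ (ℕ.s≤s (ℕ.s≤s ℕ.z≤n)))
      halve : ∀ {x} → 0ℚ < x → x * ½ < x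
      halve {x} 0<x = subst (x * ½ <_) (ℚ.*-identityʳ x) (ℚ.*-monoʳ-<-pos x {{ℚ.positive 0<x}} ½<1)
      0<k : 0ℚ < k
      0<k = 0<* 0<σ 0<½
      0<t : 0ℚ < t
      0<t = 0<* (0<^ c 0<σ) (0<^ (suc c) 0<½)
      0<b : 0ℚ < b
      0<b = 0<* 0<t 0<½

      k<K : k <ᴿ K
      k<K = s≤K k (subst (k <_) (≡.sym (fraction≡nat s)) (halve 0<σ))

      t≤k^c : t ^ 1 ℚ.≤ k ^ c
      t≤k^c = begin
        t ^ 1                        ≡⟨ ℚ.*-identityʳ t ⟩
        σ ^ c * (½ * ½ ^ c)      ≤⟨ *-monoˡ (σ ^ c) (0≤^ c (ℚ.<⇒≤ 0<σ)) (*-monoʳ (½ ^ c) (0≤^ c (ℚ.<⇒≤ 0<½)) (ℚ.<⇒≤ ½<1)) ⟩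
        σ ^ c * (1ℚ * ½ ^ c)     ≡⟨ cong (σ ^ c *_) (ℚ.*-identityˡ (½ ^ c)) ⟩
        σ ^ c * ½ ^ c              ≡⟨ ^-distrib-* σ ½ c ⟨
        k ^ c                        ∎
        where open ℚ.≤-Reasoning

      t≤k^sc : t ^ 1 ℚ.≤ k ^ suc c
      t≤k^sc = begin
        t ^ 1                        ≡⟨ ℚ.*-identityʳ t ⟩
        σ ^ c * ½ ^ suc c          ≡⟨ cong (_* ½ ^ suc c) (ℚ.*-identityˡ (σ ^ c)) ⟨
        (1ℚ * σ ^ c) * ½ ^ suc c ≤⟨ *-monoʳ (½ ^ suc c) (0≤^ (suc c) (ℚ.<⇒≤ 0<½)) (*-monoʳ (σ ^ c) (0≤^ c (ℚ.<⇒≤ 0<σ)) 1≤σ) ⟩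
        σ ^ suc c * ½ ^ suc c      ≡⟨ ^-distrib-* σ ½ (suc c) ⟨
        k ^ suc c                    ∎
        where open ℚ.≤-Reasoning

      b<K^c : b <ᴿ (K ^ᴿ fromℕ (suc c))
      -- The common denominator is 1. The lower exponent c has to lie strictly below the real
      -- exponent, which is why the latter is c + 1; the upper one may equal it.
      b<K^c = inj₂ (t , halve 0<t , k , 0<k , k<K , ℚ.<⇒≤ 0<t , 0 , c , suc c , fraction-< c , ℚ.<-irrefl refl , t≤k^c , t≤k^sc)

      ½^*2^ : ∀ n → ½ ^ n * nat (2 ℕ.^ n) ≡ 1ℚ
      ½^*2^ n = ≡.trans (cong (½ ^ n *_) (nat-^ 2 n)) (≡.trans (≡.sym (^-distrib-* ½ (nat 2) n)) (1^ n))

      N≤ab : nat N ℚ.≤ a * b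
      N≤ab = begin
        nat N
          ≤⟨ nat-mono N≤ ⟩
        nat (A ℕ.* s ℕ.^ c)
          ≡⟨ ≡.trans (nat-* A (s ℕ.^ c)) (cong (nat A *_) (nat-^ s c)) ⟩
        nat A * σ ^ c
          ≡⟨ ℚ.*-identityʳ (nat A * σ ^ c) ⟨
        nat A * σ ^ c * 1ℚ
          ≡⟨ cong (nat A * σ ^ c *_) (½^*2^ (suc (suc c))) ⟨
        nat A * σ ^ c * ((½ * ½ ^ suc c) * nat (2 ℕ.^ suc (suc c)))
          ≡⟨ QS.solve 4 (λ x y z w → x QS.:* y QS.:* ((QS.con ½ QS.:* z) QS.:* w) QS.:= (x QS.:* w) QS.:* ((y QS.:* z) QS.:* QS.con ½)) refl
               (nat A) (σ ^ c) (½ ^ suc c) (nat (2 ℕ.^ suc (suc c))) ⟩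
        (nat A * nat (2 ℕ.^ suc (suc c))) * b
          ≡⟨ cong (_* b) (nat-* A (2 ℕ.^ suc (suc c))) ⟨
        a * b ∎
        where open ℚ.≤-Reasoning

    power-bound : 0 ℕ.< A → fromℕ N ≤ᴿ (fromℕ (suc (A ℕ.* 2 ℕ.^ suc (suc c))) *ᴿ K ^ᴿ fromℕ (suc c))
    -- The constant is `suc factor`, since a = `factor` must lie strictly below it.
    power-bound 0<A q q<N = inj₂ (a , b , subst (_< (ℤ.+ suc factor) ℚ./ 1) (fraction≡nat factor) (fraction-< factor) , b<K^c , 0<a , 0<b ,
      ℚ.<-≤-trans (subst (q <_) (fraction≡nat N) q<N) N≤ab)
      where
      0<a : 0ℚ < a
      0<a = ℚ.<-≤-trans 0<1 (subst (ℚ._≤ a) (ℚ.+-identityʳ 1ℚ) (nat-mono (ℕ.*-mono-≤ 0<A (ℕ.m^n>0 2 (suc (suc c))))))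

-- Linearity of additive maps and the final constants.

open import Defs
open import Data.Nat.Base using (ℕ; NonZero)
open import Data.Product.Base using (∃-syntax; Σ-syntax; _×_)
open import Relation.Binary.PropositionalEquality using (_≡_)
import Data.List.Base as List
open import Data.List.Membership.Propositional using (_∈_)
open import Data.Nat.Base using (suc; _+_; _*_; _^_; _≤_; s≤s; z≤n)
open import Data.Nat.Properties using (^-distribˡ-+-*)
import Data.Parity.Base as ℙ
open import Data.Product.Base using (_,_)
open import Data.Vec.Base using (_∷_; []; map)
open import Data.Vec.Properties using (map-id; map-const)
open import Function.Bundles using (module Equivalence)
open import Relation.Binary.PropositionalEquality using (refl; sym; trans; cong; subst)
open Cubes using (Additive; 𝟘; vectors)
open Exponent using (exponent)
open BooleanGroups using (module BooleanGroup)
open GraphApproximation using (module LinearApproximation; LinearApproximation; approximation; graph-coset; ∈⇒0<length)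
open RealBounds using (fromℕ-positive; power-bound)

-- The only scalars are 0 and 1, and negation is the identity.
additive⇒linear : ∀ {m n} {g : F₂^ m → F₂^ n} → Additive g → IsLinear g
additive⇒linear {m} {n} {g} additive = record
  { +ᴹ-isGroupHomomorphism = record
    { isMonoidHomomorphism = record
      { isMagmaHomomorphism = record { isRelHomomorphism = record { cong = cong g } ; homo = additive }
      ; ε-homo = g-zero }
    ; ⁻¹-homo = λ x → trans (cong g (map-id x)) (sym (map-id (g x))) }
  ; *ₗ-homo = scalar }
  where
  g-zero : g 𝟘 ≡ 𝟘
  g-zero = trans (cong g (sym (BooleanGroup.⊕-self (vectors m) 𝟘))) (trans (additive 𝟘 𝟘) (BooleanGroup.⊕-self (vectors n) (g 𝟘)))
  scalar : ∀ a x → g (map (a F₂.*_) x) ≡ map (a F₂.*_) (g x)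
  scalar ℙ.0ℙ x = trans (cong g (map-const x ℙ.0ℙ)) (trans g-zero (sym (map-const (g x) ℙ.0ℙ)))
  scalar ℙ.1ℙ x = trans (cong g (map-id x)) (sym (map-id (g x)))

-- The bound of `approximation` is 512 s M³ with M = s ^ `exponent`; this is its degree in s.
degree : ℕ
degree = suc (exponent + (exponent + exponent))

power-degree : ∀ s → s * (s ^ exponent * (s ^ exponent * s ^ exponent)) ≡ s ^ degree
power-degree s = cong (s *_) (sym (trans (^-distribˡ-+-* s exponent (exponent + exponent))
  (cong (s ^ exponent *_) (^-distribˡ-+-* s exponent exponent))))

corollary1p4 : ∃[ C₃ ] ∃[ C ] Positive C₃ × Positive C ×
    ((m n : ℕ) .{{_ : NonZero m}} .{{_ : NonZero n}} (K : ℝ) (f : F₂^ m → F₂^ n) →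
    Card (λ (z : F₂^ n) → Σ[ x ∈ F₂^ m ] Σ[ y ∈ F₂^ m ] z ≡ f x +ᵛ f y -ᵛ f (x +ᵛ y)) ≤ᴿ K →
    Σ[ g ∈ (F₂^ m → F₂^ n) ] Σ[ h ∈ (F₂^ m → F₂^ n) ]
    IsLinear g ×
    (∀ x → f x ≡ g x +ᵛ h x) ×
    Card (λ (z : F₂^ n) → Σ[ x ∈ F₂^ m ] z ≡ h x) ≤ᴿ (C *ᴿ K ^ᴿ C₃))
corollary1p4 = fromℕ (suc degree) , fromℕ (suc (512 * 2 ^ suc (suc degree))) ,
  fromℕ-positive degree , fromℕ-positive (512 * 2 ^ suc (suc degree)) ,
  λ { m n K f (_ , (S , _ , ∈S⇔ , refl) , S≤K) → decompose m n K f S (λ x y → Equivalence.from (∈S⇔ _) (x , y , refl)) S≤K }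
  where
  decompose : ∀ m n K (f : F₂^ m → F₂^ n) S → (∀ x y → f x +ᵛ f y -ᵛ f (x +ᵛ y) ∈ S) → fromℕ (List.length S) ≤ᴿ K →
    Σ[ g ∈ (F₂^ m → F₂^ n) ] Σ[ h ∈ (F₂^ m → F₂^ n) ] IsLinear g × (∀ x → f x ≡ g x +ᵛ h x) ×
    Card (λ z → Σ[ x ∈ F₂^ m ] z ≡ h x) ≤ᴿ (fromℕ (suc (512 * 2 ^ suc (suc degree))) *ᴿ K ^ᴿ fromℕ (suc degree))
  decompose m n K f S S∋ S≤K = linear-part , (λ x → f x +ᵛ linear-part x) , additive⇒linear additive , split ,
    (List.length range , (range , range-unique , ∈range , refl) ,
      power-bound degree 512 K (List.length S) (List.length range) (∈⇒0<length (S∋ 𝟘 𝟘)) S≤K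
        (subst (λ t → List.length range ≤ 512 * t) (power-degree (List.length S)) range-bound) (s≤s z≤n))
    where
    open LinearApproximation (approximation f S S∋ (graph-coset f S S∋))
    open BooleanGroups.XorSolver (vectors n) using (xor-solve)
    split : ∀ x → f x ≡ linear-part x +ᵛ (f x +ᵛ linear-part x)
    split x = xor-solve BooleanGroups.x₀ (BooleanGroups.x₁ BooleanGroups.:⊕ (BooleanGroups.x₀ BooleanGroups.:⊕ BooleanGroups.x₁)) (f x ∷ linear-part x ∷ []) refl
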